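{- Let $\chi$ be a primitive nonprincipal odd Dirichlet character with conductor $q$. Let $\Phi_q=\{j\mid 1\le j\le \frac{q-1}{2},\ \gcd(j,q)=1\}=\{j_1,\ldots,j_\ell\}$, where $\ell=|\Phi_q|=\frac12\varphi(q)$. Then for all integers $n\ge1$, $$L_n(\chi)=\frac{i^{\,n-\ell}}{\epsilon(q)\,n!}\left(\frac{\pi}{q}\right)^n\sum_{\delta}P(\delta)\,e^{i\pi j(\delta)/q}\left(\delta_1\chi(j_1)+\dots+\delta_\ell\chi(j_\ell)\right)^n,$$ where the sum is over all $2^\ell$ vectors $\delta=(\delta_1,\ldots,\delta_\ell)$ with each $\delta_\lambda=\pm1$, $P(\delta):=\delta_1\cdots\delta_\ell$, and $j(\delta):=\delta_1j_1+\dots+\delta_\ell j_\ell$.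
   Context: $L_n(\chi):=\sum_{1\le k_1<\dots<k_n}\frac{\chi(k_1)}{k_1}\cdots\frac{\chi(k_n)}{k_n}$, understood as the limit as $N\to\infty$ of the sums over $1\le k_1<\dots<k_n\le N$. $\varphi$ is Euler's totient function. $\epsilon(q)=\sqrt p$ if $q$ is a power of a prime $p$, and $\epsilon(q)=1$ otherwise. Odd means $\chi(-1)=-1$. -}

module Defs where

open import Data.Fin.Base using (Fin; toℕ; fromℕ<)
open import Data.Fin.Properties using (any?; toℕ-fromℕ<)
open import Data.Integer.Base as ℤ using (ℤ; +_; -[1+_])
open import Data.Integer.Coprimality using (Coprime)
open import Data.Integer.Divisibility using (_∣_)
import Data.Integer.Properties as ℤₚ
open import Data.List.Base using (List; []; _∷_; _++_; map; filter; foldr; length; upTo; zipWith)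
open import Data.Nat.Base as ℕ using (ℕ; zero; suc; _!)
open import Data.Nat.Coprimality using (coprime?)
import Data.Nat.Divisibility as ℕ
import Data.Nat.DivMod as ℕ
open import Data.Nat.Primality using (Prime; prime?; prime⇒nonZero; prime⇒nonTrivial)
import Data.Nat.Properties as ℕₚ
open import Data.Nat.Properties using (_!≢0)
open import Data.Product using (∃; _×_; _,_; proj₁; proj₂)
open import Data.Rational.Base as ℚ
  using (ℚ; mkℚ; 0ℚ; 1ℚ; ½; _+_; _*_; -_; _-_; ∣_∣; _≤_; _<_; _/_; 1/_; fromℚᵘ)
import Data.Rational.Properties as ℚₚ
open import Data.Rational.Solver using (module +-*-Solver)
import Data.Rational.Unnormalised.Base as ℚᵘ
import Data.Rational.Unnormalised.Properties as ℚᵘₚ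
open import Data.Sign.Base as Sign using (Sign)
open import Data.Sum using (_⊎_; inj₁; inj₂)
open import Data.Vec.Base as Vec using (Vec; []; _∷_)
open import Relation.Binary.PropositionalEquality
open import Relation.Nullary using (¬_; Dec; yes; no; contradiction)
open import Relation.Nullary.Decidable using (map′; _×-dec_)

open +-*-Solver using (solve; _:=_; _:+_; _:*_; :-_; _:-_; con)
module ℚ≤ = ℚₚ.≤-Reasoning

half+half : ∀ ε → ε * ½ + ε * ½ ≡ ε
half+half = solve 1 (λ e → e :* con ½ :+ e :* con ½ := e) refl

0<½* : ∀ {ε} → 0ℚ < ε → 0ℚ < ε * ½
0<½* {ε} 0<ε = subst (_< ε * ½) (ℚₚ.*-zeroˡ ½) (ℚₚ.*-monoˡ-<-pos ½ 0<ε)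

triangle : ∀ a b c → ∣ a - c ∣ ≤ ∣ a - b ∣ + ∣ b - c ∣
triangle a b c = subst (λ d → ∣ d ∣ ≤ ∣ a - b ∣ + ∣ b - c ∣)
  (solve 3 (λ a b c → (a :- b) :+ (b :- c) := a :- c) refl a b c)
  (ℚₚ.∣p+q∣≤∣p∣+∣q∣ (a - b) (b - c))

∣-∣-comm : ∀ a b → ∣ a - b ∣ ≡ ∣ b - a ∣
∣-∣-comm a b = trans (sym (ℚₚ.∣-p∣≡∣p∣ (a - b)))
  (cong ∣_∣ (solve 2 (λ a b → :- (a :- b) := b :- a) refl a b))

p≤∣p∣ : ∀ p → p ≤ ∣ p ∣
p≤∣p∣ p with ℚₚ.≤-total 0ℚ p
... | inj₁ 0≤p = ℚₚ.≤-reflexive (sym (ℚₚ.0≤p⇒∣p∣≡p 0≤p))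
... | inj₂ p≤0 = ℚₚ.≤-trans p≤0 (ℚₚ.0≤∣p∣ p)

∣∣-lub : ∀ {p e} → p ≤ e → - p ≤ e → ∣ p ∣ ≤ e
∣∣-lub {p} {e} p≤e -p≤e with ℚₚ.∣p∣≡p∨∣p∣≡-p p
... | inj₁ eq = subst (_≤ e) (sym eq) p≤e
... | inj₂ eq = subst (_≤ e) (sym eq) -p≤e

*-mono-≤ : ∀ {a b c d} → 0ℚ ≤ b → 0ℚ ≤ c → a ≤ b → c ≤ d → a * c ≤ b * d
*-mono-≤ {a} {b} {c} {d} 0≤b 0≤c a≤b c≤d = ℚₚ.≤-trans
  (ℚₚ.*-monoʳ-≤-nonNeg c {{ℚ.nonNegative 0≤c}} a≤b)
  (ℚₚ.*-monoˡ-≤-nonNeg b {{ℚ.nonNegative 0≤b}} c≤d)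

0≤* : ∀ {a b} → 0ℚ ≤ a → 0ℚ ≤ b → 0ℚ ≤ a * b
0≤* {a} {b} 0≤a 0≤b = subst (_≤ a * b) (ℚₚ.*-zeroʳ a)
  (ℚₚ.*-monoˡ-≤-nonNeg a {{ℚ.nonNegative 0≤a}} 0≤b)

0<* : ∀ {a b} → 0ℚ < a → 0ℚ < b → 0ℚ < a * b
0<* {a} {b} 0<a 0<b = subst (_< a * b) (ℚₚ.*-zeroʳ a)
  (ℚₚ.*-monoʳ-<-pos a {{ℚ.positive 0<a}} 0<b)

/-mono : ∀ a b m n → a ℤ.* + suc n ℤ.≤ b ℤ.* + suc m → a / suc m ≤ b / suc n
/-mono a b m n le = ℚₚ.toℚᵘ-cancel-≤
  (ℚᵘₚ.≤-trans (ℚᵘₚ.≤-reflexive (ℚₚ.toℚᵘ-fromℚᵘ (ℚᵘ.mkℚᵘ a m)))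
  (ℚᵘₚ.≤-trans (ℚᵘ.*≤* le)
    (ℚᵘₚ.≤-reflexive (ℚᵘₚ.≃-sym (ℚₚ.toℚᵘ-fromℚᵘ (ℚᵘ.mkℚᵘ b n))))))

archimedean : ∀ ε → 0ℚ < ε → ∃ λ N → + 1 / suc N ≤ ε
archimedean (mkℚ (+ zero) d c) (ℚ.*<* (ℤ.+<+ ()))
archimedean (mkℚ -[1+ _ ] d c) (ℚ.*<* ())
archimedean ε@(mkℚ (+ suc a) d c) _ = d , subst (+ 1 / suc d ≤_) (ℚₚ.fromℚᵘ-toℚᵘ ε)
  (/-mono (+ 1) (+ suc a) d d (ℤₚ.*-monoʳ-≤-nonNeg (+ suc d) {+ 1} {+ suc a} (ℤ.+≤+ (ℕ.s≤s ℕ.z≤n))))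

below-ℕ : ∀ p → ∃ λ K → p ≤ + K / 1
below-ℕ p@(mkℚ n d c) = ℤ.∣ n ∣ , subst (_≤ + ℤ.∣ n ∣ / 1) (ℚₚ.fromℚᵘ-toℚᵘ p)
  (/-mono n (+ ℤ.∣ n ∣) d 0 (begin
    n ℤ.* + 1            ≡⟨ ℤₚ.*-identityʳ n ⟩
    n                    ≤⟨ i≤+∣i∣ n ⟩
    + ℤ.∣ n ∣            ≤⟨ ℤ.+≤+ (ℕₚ.m≤m*n ℤ.∣ n ∣ (suc d)) ⟩
    + (ℤ.∣ n ∣ ℕ.* suc d) ≡⟨ ℤₚ.pos-* ℤ.∣ n ∣ (suc d) ⟩
    + ℤ.∣ n ∣ ℤ.* + suc d ∎))
  where
  open ℤₚ.≤-Reasoning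
  i≤+∣i∣ : ∀ i → i ℤ.≤ + ℤ.∣ i ∣
  i≤+∣i∣ (+ n)    = ℤₚ.≤-refl
  i≤+∣i∣ -[1+ n ] = ℤ.-≤+

0<1/ : ∀ n → 0ℚ < + 1 / suc n
0<1/ n = ℚₚ.positive⁻¹ (+ 1 / suc n) {{ℚₚ.normalize-pos 1 (suc n)}}

1/-antimono : ∀ {m n} → m ℕ.≤ n → + 1 / suc n ≤ + 1 / suc m
1/-antimono {m} {n} m≤n = /-mono (+ 1) (+ 1) n m
  (ℤₚ.*-monoˡ-≤-nonNeg (+ 1) (ℤ.+≤+ (ℕ.s≤s m≤n)))

fromℚᵘ-homo-+ : ∀ u v → fromℚᵘ (u ℚᵘ.+ v) ≡ fromℚᵘ u + fromℚᵘ v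
fromℚᵘ-homo-+ u v = ℚₚ.toℚᵘ-injective
  (ℚᵘₚ.≃-trans (ℚₚ.toℚᵘ-fromℚᵘ (u ℚᵘ.+ v))
  (ℚᵘₚ.≃-trans (ℚᵘₚ.+-cong (ℚᵘₚ.≃-sym (ℚₚ.toℚᵘ-fromℚᵘ u)) (ℚᵘₚ.≃-sym (ℚₚ.toℚᵘ-fromℚᵘ v)))
    (ℚᵘₚ.≃-sym (ℚₚ.toℚᵘ-homo-+ (fromℚᵘ u) (fromℚᵘ v)))))

fromℚᵘ-homo-* : ∀ u v → fromℚᵘ (u ℚᵘ.* v) ≡ fromℚᵘ u * fromℚᵘ v
fromℚᵘ-homo-* u v = ℚₚ.toℚᵘ-injective
  (ℚᵘₚ.≃-trans (ℚₚ.toℚᵘ-fromℚᵘ (u ℚᵘ.* v))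
  (ℚᵘₚ.≃-trans (ℚᵘₚ.*-cong (ℚᵘₚ.≃-sym (ℚₚ.toℚᵘ-fromℚᵘ u)) (ℚᵘₚ.≃-sym (ℚₚ.toℚᵘ-fromℚᵘ v)))
    (ℚᵘₚ.≃-sym (ℚₚ.toℚᵘ-homo-* (fromℚᵘ u) (fromℚᵘ v)))))

1/-* : ∀ m n .{{_ : ℕ.NonZero m}} .{{_ : ℕ.NonZero n}} →
       (+ 1 / (m ℕ.* n)) {{ℕₚ.m*n≢0 m n}} ≡ + 1 / m * (+ 1 / n)
1/-* (suc m) (suc n) = fromℚᵘ-homo-* (ℚᵘ.mkℚᵘ (+ 1) m) (ℚᵘ.mkℚᵘ (+ 1) n)

/-suc : ∀ a n → + suc a / suc n ≡ + a / suc n + + 1 / suc n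
/-suc a n = trans
  (ℚₚ.fromℚᵘ-cong {ℚᵘ.mkℚᵘ (+ suc a) n} {ℚᵘ.mkℚᵘ (+ a) n ℚᵘ.+ ℚᵘ.mkℚᵘ (+ 1) n} (ℚᵘ.*≡* (begin
    + suc a ℤ.* + (suc n ℕ.* suc n)             ≡⟨ cong (+ suc a ℤ.*_) (ℤₚ.pos-* (suc n) (suc n)) ⟩
    + suc a ℤ.* (+ suc n ℤ.* + suc n)           ≡⟨ ℤₚ.*-assoc (+ suc a) (+ suc n) (+ suc n) ⟨
    + suc a ℤ.* + suc n ℤ.* + suc n             ≡⟨ cong (λ i → i ℤ.* + suc n ℤ.* + suc n) (ℤₚ.+-comm (+ 1) (+ a)) ⟩
    (+ a ℤ.+ + 1) ℤ.* + suc n ℤ.* + suc n       ≡⟨ cong (ℤ._* + suc n) (ℤₚ.*-distribʳ-+ (+ suc n) (+ a) (+ 1)) ⟩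
    (+ a ℤ.* + suc n ℤ.+ + 1 ℤ.* + suc n) ℤ.* + suc n ∎)))
  (fromℚᵘ-homo-+ (ℚᵘ.mkℚᵘ (+ a) n) (ℚᵘ.mkℚᵘ (+ 1) n))
  where open ≡-Reasoning

Cauchy : (ℕ → ℚ) → Set
Cauchy s = ∀ ε → 0ℚ < ε → ∃ λ N → ∀ m n → N ℕ.≤ m → N ℕ.≤ n → ∣ s m - s n ∣ ≤ ε

record ℝ : Set where
  constructor mkℝ
  field
    seq    : ℕ → ℚ
    cauchy : Cauchy seq

open ℝ public

infix 4 _≈ʳ_ _<ʳ_

_≈ʳ_ : ℝ → ℝ → Set
x ≈ʳ y = ∀ ε → 0ℚ < ε → ∃ λ N → ∀ n → N ℕ.≤ n → ∣ seq x n - seq y n ∣ ≤ ε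

_<ʳ_ : ℝ → ℝ → Set
x <ʳ y = ∃ λ ε → 0ℚ < ε × ∃ λ N → ∀ n → N ℕ.≤ n → seq x n + ε ≤ seq y n

opaque
  const-cauchy : ∀ p → Cauchy (λ _ → p)
  const-cauchy p = λ ε 0<ε → 0 , λ _ _ _ _ →
    subst (_≤ ε) (sym (cong ∣_∣ (ℚₚ.+-inverseʳ p))) (ℚₚ.<⇒≤ 0<ε)

fromℚ : ℚ → ℝ
fromℚ p = mkℝ (λ _ → p) (const-cauchy p)

0ʳ 1ʳ : ℝ
0ʳ = fromℚ 0ℚ
1ʳ = fromℚ 1ℚ

infixl 6 _+ʳ_ _-ʳ_
infixl 7 _*ʳ_
infix  8 -ʳ_

opaque
  +-cauchy : ∀ x y → Cauchy (λ n → seq x n + seq y n)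
  +-cauchy x y = λ ε 0<ε →
    let (M , p) = cauchy x (ε * ½) (0<½* 0<ε)
        (N , q) = cauchy y (ε * ½) (0<½* 0<ε)
    in M ℕ.⊔ N , λ m n M⊔N≤m M⊔N≤n → begin
      ∣ (seq x m + seq y m) - (seq x n + seq y n) ∣
        ≡⟨ cong ∣_∣ (solve 4 (λ a b c d → (a :+ b) :- (c :+ d) := (a :- c) :+ (b :- d)) refl
             (seq x m) (seq y m) (seq x n) (seq y n)) ⟩
      ∣ (seq x m - seq x n) + (seq y m - seq y n) ∣
        ≤⟨ ℚₚ.∣p+q∣≤∣p∣+∣q∣ (seq x m - seq x n) (seq y m - seq y n) ⟩
      ∣ seq x m - seq x n ∣ + ∣ seq y m - seq y n ∣
        ≤⟨ ℚₚ.+-mono-≤ (p m n (ℕₚ.m⊔n≤o⇒m≤o M N M⊔N≤m) (ℕₚ.m⊔n≤o⇒m≤o M N M⊔N≤n))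
                       (q m n (ℕₚ.m⊔n≤o⇒n≤o M N M⊔N≤m) (ℕₚ.m⊔n≤o⇒n≤o M N M⊔N≤n)) ⟩
      ε * ½ + ε * ½ ≡⟨ half+half ε ⟩
      ε ∎
    where open ℚ≤

_+ʳ_ : ℝ → ℝ → ℝ
x +ʳ y = mkℝ (λ n → seq x n + seq y n) (+-cauchy x y)

opaque
  neg-cauchy : ∀ x → Cauchy (λ n → - seq x n)
  neg-cauchy x = λ ε 0<ε →
    let (N , p) = cauchy x ε 0<ε
    in N , λ m n N≤m N≤n → subst (_≤ ε)
      (trans (sym (ℚₚ.∣-p∣≡∣p∣ (seq x m - seq x n)))
             (cong ∣_∣ (ℚₚ.neg-distrib-+ (seq x m) (- seq x n))))
      (p m n N≤m N≤n)

-ʳ_ : ℝ → ℝ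
-ʳ x = mkℝ (λ n → - seq x n) (neg-cauchy x)

_-ʳ_ : ℝ → ℝ → ℝ
x -ʳ y = x +ʳ -ʳ y

eventuallyBounded : ∀ x → ∃ λ B → 0ℚ < B × ∃ λ N → ∀ n → N ℕ.≤ n → ∣ seq x n ∣ ≤ B
eventuallyBounded x =
  let (N , p) = cauchy x 1ℚ (ℚₚ.positive⁻¹ 1ℚ)
      b = ∣ seq x N ∣
  in b + 1ℚ , ℚₚ.+-mono-≤-< (ℚₚ.0≤∣p∣ (seq x N)) (ℚₚ.positive⁻¹ 1ℚ) , N , λ n N≤n → begin
    ∣ seq x n ∣
      ≡⟨ cong ∣_∣ (solve 2 (λ a b → a := b :+ (a :- b)) refl (seq x n) (seq x N)) ⟩
    ∣ seq x N + (seq x n - seq x N) ∣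
      ≤⟨ ℚₚ.∣p+q∣≤∣p∣+∣q∣ (seq x N) (seq x n - seq x N) ⟩
    b + ∣ seq x n - seq x N ∣
      ≤⟨ ℚₚ.+-monoʳ-≤ b (p n N N≤n ℕₚ.≤-refl) ⟩
    b + 1ℚ ∎
  where open ℚ≤

opaque
  *-cauchy : ∀ x y → Cauchy (λ n → seq x n * seq y n)
  *-cauchy x y = λ ε 0<ε →
    let (A , 0<A , K , ∣x∣≤A) = eventuallyBounded x
        (B , 0<B , L , ∣y∣≤B) = eventuallyBounded y
        0<A+B = ℚₚ.+-mono-< 0<A 0<B
        instance
          pos : ℚ.Positive (A + B)
          pos = ℚ.positive 0<A+B
          nz : ℚ.NonZero (A + B)
          nz = ℚₚ.pos⇒nonZero (A + B)
        δ = ε * 1/ (A + B)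
        0<δ = 0<* 0<ε (ℚₚ.positive⁻¹ (1/ (A + B)) {{ℚₚ.1/pos⇒pos (A + B)}})
        (M , p) = cauchy x δ 0<δ
        (N , q) = cauchy y δ 0<δ
    in (K ℕ.⊔ L) ℕ.⊔ (M ℕ.⊔ N) , λ m n le₁ le₂ →
      let KL≤m = ℕₚ.m⊔n≤o⇒m≤o (K ℕ.⊔ L) (M ℕ.⊔ N) le₁
          KL≤n = ℕₚ.m⊔n≤o⇒m≤o (K ℕ.⊔ L) (M ℕ.⊔ N) le₂
          MN≤m = ℕₚ.m⊔n≤o⇒n≤o (K ℕ.⊔ L) (M ℕ.⊔ N) le₁
          MN≤n = ℕₚ.m⊔n≤o⇒n≤o (K ℕ.⊔ L) (M ℕ.⊔ N) le₂
          a = seq x m ; b = seq y m ; c = seq x n ; d = seq y n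
      in begin
      ∣ a * b - c * d ∣
        ≡⟨ cong ∣_∣ (solve 4 (λ a b c d → a :* b :- c :* d := a :* (b :- d) :+ (a :- c) :* d)
             refl a b c d) ⟩
      ∣ a * (b - d) + (a - c) * d ∣
        ≤⟨ ℚₚ.∣p+q∣≤∣p∣+∣q∣ (a * (b - d)) ((a - c) * d) ⟩
      ∣ a * (b - d) ∣ + ∣ (a - c) * d ∣
        ≡⟨ cong₂ _+_ (ℚₚ.∣p*q∣≡∣p∣*∣q∣ a (b - d)) (ℚₚ.∣p*q∣≡∣p∣*∣q∣ (a - c) d) ⟩
      ∣ a ∣ * ∣ b - d ∣ + ∣ a - c ∣ * ∣ d ∣
        ≤⟨ ℚₚ.+-mono-≤
             (*-mono-≤ (ℚₚ.<⇒≤ 0<A) (ℚₚ.0≤∣p∣ (b - d)) (∣x∣≤A m (ℕₚ.m⊔n≤o⇒m≤o K L KL≤m))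
               (q m n (ℕₚ.m⊔n≤o⇒n≤o M N MN≤m) (ℕₚ.m⊔n≤o⇒n≤o M N MN≤n)))
             (*-mono-≤ (ℚₚ.<⇒≤ 0<δ) (ℚₚ.0≤∣p∣ d)
               (p m n (ℕₚ.m⊔n≤o⇒m≤o M N MN≤m) (ℕₚ.m⊔n≤o⇒m≤o M N MN≤n))
               (∣y∣≤B n (ℕₚ.m⊔n≤o⇒n≤o K L KL≤n))) ⟩
      A * δ + δ * B
        ≡⟨ solve 4 (λ A B e i → A :* (e :* i) :+ e :* i :* B := e :* ((A :+ B) :* i)) refl
             A B ε (1/ (A + B)) ⟩
      ε * ((A + B) * 1/ (A + B))
        ≡⟨ cong (ε *_) (ℚₚ.*-inverseʳ (A + B)) ⟩
      ε * 1ℚ ≡⟨ ℚₚ.*-identityʳ ε ⟩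
      ε ∎
    where open ℚ≤

_*ʳ_ : ℝ → ℝ → ℝ
x *ʳ y = mkℝ (λ n → seq x n * seq y n) (*-cauchy x y)

opaque
  abs-cauchy : ∀ x → Cauchy (λ n → ∣ seq x n ∣)
  abs-cauchy x = λ ε 0<ε →
    let (N , p) = cauchy x ε 0<ε
    in N , λ m n N≤m N≤n → ℚₚ.≤-trans (∣∣-lub (half (seq x m) (seq x n)) (half′ (seq x m) (seq x n)))
                             (p m n N≤m N≤n)
    where
    half : ∀ a b → ∣ a ∣ - ∣ b ∣ ≤ ∣ a - b ∣
    half a b = begin
      ∣ a ∣ - ∣ b ∣
        ≡⟨ cong (λ t → ∣ t ∣ - ∣ b ∣) (solve 2 (λ a b → a := (a :- b) :+ b) refl a b) ⟩
      ∣ (a - b) + b ∣ - ∣ b ∣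
        ≤⟨ ℚₚ.+-monoˡ-≤ (- ∣ b ∣) (ℚₚ.∣p+q∣≤∣p∣+∣q∣ (a - b) b) ⟩
      (∣ a - b ∣ + ∣ b ∣) - ∣ b ∣
        ≡⟨ solve 2 (λ s t → (s :+ t) :- t := s) refl ∣ a - b ∣ ∣ b ∣ ⟩
      ∣ a - b ∣ ∎
      where open ℚ≤
    half′ : ∀ a b → - (∣ a ∣ - ∣ b ∣) ≤ ∣ a - b ∣
    half′ a b = begin
      - (∣ a ∣ - ∣ b ∣) ≡⟨ solve 2 (λ s t → :- (s :- t) := t :- s) refl ∣ a ∣ ∣ b ∣ ⟩
      ∣ b ∣ - ∣ a ∣     ≤⟨ half b a ⟩
      ∣ b - a ∣         ≡⟨ ∣-∣-comm b a ⟩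
      ∣ a - b ∣         ∎
      where open ℚ≤

∣_∣ʳ : ℝ → ℝ
∣ x ∣ʳ = mkℝ (λ n → ∣ seq x n ∣) (abs-cauchy x)

-- inv 0 = 0; only finitely many terms of a positive real can be ≤ 0.
inv : ℚ → ℚ
inv p with p ℚₚ.≟ 0ℚ
... | yes _  = 0ℚ
... | no p≢0 = (1/ p) {{ℚ.≢-nonZero p≢0}}

*-inv : ∀ p → 0ℚ < p → p * inv p ≡ 1ℚ
*-inv p 0<p with p ℚₚ.≟ 0ℚ
... | yes p≡0 = contradiction (sym p≡0) (ℚₚ.<⇒≢ 0<p)
... | no p≢0  = ℚₚ.*-inverseʳ p {{ℚ.≢-nonZero p≢0}}

0<inv : ∀ p → 0ℚ < p → 0ℚ < inv p
0<inv p 0<p with p ℚₚ.≟ 0ℚ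
... | yes p≡0 = contradiction (sym p≡0) (ℚₚ.<⇒≢ 0<p)
... | no p≢0  = ℚₚ.positive⁻¹ _ {{ℚₚ.1/pos⇒pos p {{ℚ.positive 0<p}}}}

inv-antimono : ∀ {p q} → 0ℚ < p → p ≤ q → inv q ≤ inv p
inv-antimono {p} {q} 0<p p≤q = begin
  inv q                   ≡⟨ ℚₚ.*-identityˡ (inv q) ⟨
  1ℚ * inv q              ≡⟨ cong (_* inv q) (*-inv p 0<p) ⟨
  p * inv p * inv q       ≤⟨ ℚₚ.*-monoʳ-≤-nonNeg (inv q) {{ℚ.nonNegative (ℚₚ.<⇒≤ (0<inv q 0<q))}}
                               (ℚₚ.*-monoʳ-≤-nonNeg (inv p) {{ℚ.nonNegative (ℚₚ.<⇒≤ (0<inv p 0<p))}} p≤q) ⟩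
  q * inv p * inv q       ≡⟨ solve 3 (λ q i j → q :* i :* j := i :* (q :* j)) refl q (inv p) (inv q) ⟩
  inv p * (q * inv q)     ≡⟨ cong (inv p *_) (*-inv q 0<q) ⟩
  inv p * 1ℚ              ≡⟨ ℚₚ.*-identityʳ (inv p) ⟩
  inv p                   ∎
  where
  open ℚ≤
  0<q = ℚₚ.<-≤-trans 0<p p≤q

opaque
  recip-cauchy : ∀ x → 0ʳ <ʳ x → Cauchy (λ n → inv (seq x n))
  recip-cauchy x (d , 0<d , K , 0+d≤x) = λ ε 0<ε →
    let (N , p) = cauchy x (ε * (d * d)) (0<* 0<ε (0<* 0<d 0<d))
    in K ℕ.⊔ N , λ m n le₁ le₂ →
      let a = seq x m ; b = seq x n ; i = inv a ; j = inv b
          d≤a = d≤x m (ℕₚ.m⊔n≤o⇒m≤o K N le₁)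
          d≤b = d≤x n (ℕₚ.m⊔n≤o⇒m≤o K N le₂)
          0<a = ℚₚ.<-≤-trans 0<d d≤a
          0<b = ℚₚ.<-≤-trans 0<d d≤b
          0≤i = ℚₚ.<⇒≤ (0<inv a 0<a)
          0≤j = ℚₚ.<⇒≤ (0<inv b 0<b)
          0≤w = ℚₚ.<⇒≤ (0<inv d 0<d)
          w = inv d
      in begin
      ∣ i - j ∣
        ≡⟨ cong ∣_∣ (cong₂ _-_ (sym (ℚₚ.*-identityʳ i)) (sym (ℚₚ.*-identityʳ j))) ⟩
      ∣ i * 1ℚ - j * 1ℚ ∣
        ≡⟨ cong ∣_∣ (cong₂ (λ s t → i * s - j * t) (sym (*-inv b 0<b)) (sym (*-inv a 0<a))) ⟩
      ∣ i * (b * j) - j * (a * i) ∣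
        ≡⟨ cong ∣_∣ (solve 4 (λ a b i j → i :* (b :* j) :- j :* (a :* i) := (b :- a) :* (i :* j))
             refl a b i j) ⟩
      ∣ (b - a) * (i * j) ∣
        ≡⟨ ℚₚ.∣p*q∣≡∣p∣*∣q∣ (b - a) (i * j) ⟩
      ∣ b - a ∣ * ∣ i * j ∣
        ≡⟨ cong₂ _*_ (∣-∣-comm b a) (ℚₚ.0≤p⇒∣p∣≡p (0≤* 0≤i 0≤j)) ⟩
      ∣ a - b ∣ * (i * j)
        ≤⟨ *-mono-≤ (ℚₚ.<⇒≤ (0<* 0<ε (0<* 0<d 0<d))) (0≤* 0≤i 0≤j)
             (p m n (ℕₚ.m⊔n≤o⇒n≤o K N le₁) (ℕₚ.m⊔n≤o⇒n≤o K N le₂))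
             (*-mono-≤ 0≤w 0≤j (inv-antimono 0<d d≤a) (inv-antimono 0<d d≤b)) ⟩
      ε * (d * d) * (w * w)
        ≡⟨ solve 3 (λ e d w → e :* (d :* d) :* (w :* w) := e :* ((d :* w) :* (d :* w))) refl ε d w ⟩
      ε * ((d * w) * (d * w))
        ≡⟨ cong (λ t → ε * (t * t)) (*-inv d 0<d) ⟩
      ε * (1ℚ * 1ℚ)
        ≡⟨ ℚₚ.*-identityʳ ε ⟩
      ε ∎
    where
    open ℚ≤
    d≤x : ∀ n → K ℕ.≤ n → d ≤ seq x n
    d≤x n K≤n = subst (_≤ seq x n) (ℚₚ.+-identityˡ d) (0+d≤x n K≤n)

recip : (x : ℝ) → 0ʳ <ʳ x → ℝ
recip x 0<x = mkℝ (λ n → inv (seq x n)) (recip-cauchy x 0<x)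

infix 4 _⟶ʳ_

_⟶ʳ_ : (ℕ → ℝ) → ℝ → Set
s ⟶ʳ l = ∀ ε → 0ℚ < ε → ∃ λ N → ∀ n → N ℕ.≤ n → ∣ s n -ʳ l ∣ʳ <ʳ fromℚ ε

IsCauchy : (ℕ → ℝ) → Set
IsCauchy s = ∀ ε → 0ℚ < ε →
  ∃ λ N → ∀ m n → N ℕ.≤ m → N ℕ.≤ n → ∣ s m -ʳ s n ∣ʳ <ʳ fromℚ ε

-- The diagonal sequence through approximations of s n to within 1/(n+1)
module Limit (s : ℕ → ℝ) (s-cauchy : IsCauchy s) where

  modulus : ℕ → ℕ
  modulus n = proj₁ (cauchy (s n) (+ 1 / suc n) (0<1/ n))

  diagonal : ℕ → ℚ
  diagonal n = seq (s n) (modulus n)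

  diagonal-close : ∀ n k → modulus n ℕ.≤ k → ∣ diagonal n - seq (s n) k ∣ ≤ + 1 / suc n
  diagonal-close n k = proj₂ (cauchy (s n) (+ 1 / suc n) (0<1/ n)) (modulus n) k ℕₚ.≤-refl

  -- Beyond some N, diagonal m is close to seq (s n) k, provided k is large (depending on n).
  nearby : ∀ ε → 0ℚ < ε → ∃ λ N → ∀ m n → N ℕ.≤ m → N ℕ.≤ n →
           ∀ k → modulus n ℕ.≤ k → ∣ diagonal m - seq (s n) k ∣ ≤ ε
  nearby ε 0<ε =
    let 0<ε/2 = 0<½* 0<ε
        0<ε/4 = 0<½* 0<ε/2
        (M , 1/M≤) = archimedean (ε * ½ * ½) 0<ε/4
        (N , close) = s-cauchy (ε * ½ * ½) 0<ε/4
    in M ℕ.⊔ N , λ m n le₁ le₂ k k≥ →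
      let (d , 0<d , K , near) = close m n (ℕₚ.m⊔n≤o⇒n≤o M N le₁) (ℕₚ.m⊔n≤o⇒n≤o M N le₂)
          j = K ℕ.⊔ (modulus m ℕ.⊔ modulus n)
          j≥ = ℕₚ.m≤n⊔m K (modulus m ℕ.⊔ modulus n)
          j≥m = ℕₚ.≤-trans (ℕₚ.m≤m⊔n (modulus m) (modulus n)) j≥
          j≥n = ℕₚ.≤-trans (ℕₚ.m≤n⊔m (modulus m) (modulus n)) j≥
          M≤m = ℕₚ.m⊔n≤o⇒m≤o M N le₁
          M≤n = ℕₚ.m⊔n≤o⇒m≤o M N le₂
          a = diagonal m ; b = seq (s m) j ; c = seq (s n) j ; e = diagonal n ; f = seq (s n) k
          q = ε * ½ * ½
          small = λ {i} M≤i → ℚₚ.≤-trans (1/-antimono {M} {i} M≤i) 1/M≤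
      in begin
      ∣ a - f ∣                                   ≤⟨ triangle a b f ⟩
      ∣ a - b ∣ + ∣ b - f ∣                         ≤⟨ ℚₚ.+-monoʳ-≤ ∣ a - b ∣ (triangle b c f) ⟩
      ∣ a - b ∣ + (∣ b - c ∣ + ∣ c - f ∣)
        ≤⟨ ℚₚ.+-monoʳ-≤ ∣ a - b ∣ (ℚₚ.+-monoʳ-≤ ∣ b - c ∣ (triangle c e f)) ⟩
      ∣ a - b ∣ + (∣ b - c ∣ + (∣ c - e ∣ + ∣ e - f ∣))
        ≤⟨ ℚₚ.+-mono-≤ (ℚₚ.≤-trans (diagonal-close m j j≥m) (small M≤m))
          (ℚₚ.+-mono-≤ (begin
              ∣ b - c ∣     ≡⟨ ℚₚ.+-identityʳ ∣ b - c ∣ ⟨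
              ∣ b - c ∣ + 0ℚ ≤⟨ ℚₚ.+-monoʳ-≤ ∣ b - c ∣ (ℚₚ.<⇒≤ 0<d) ⟩
              ∣ b - c ∣ + d ≤⟨ near j (ℕₚ.m≤m⊔n K _) ⟩
              q ∎)
          (ℚₚ.+-mono-≤
            (subst (_≤ q) (∣-∣-comm e c) (ℚₚ.≤-trans (diagonal-close n j j≥n) (small M≤n)))
            (ℚₚ.≤-trans (diagonal-close n k k≥) (small M≤n)))) ⟩
      q + (q + (q + q))
        ≡⟨ solve 1 (λ e → let q = e :* con ½ :* con ½ in q :+ (q :+ (q :+ q)) := e) refl ε ⟩
      ε ∎
    where open ℚ≤

  opaque
    diagonal-cauchy : Cauchy diagonal
    diagonal-cauchy ε 0<ε =
      let (N , near) = nearby ε 0<ε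
      in N , λ m n N≤m N≤n → near m n N≤m N≤n (modulus n) ℕₚ.≤-refl

  lim : ℝ
  lim = mkℝ diagonal diagonal-cauchy

  lim-⟶ : s ⟶ʳ lim
  lim-⟶ ε 0<ε =
    let (N , near) = nearby (ε * ½) (0<½* 0<ε)
    in N , λ n N≤n → ε * ½ , 0<½* 0<ε , N ℕ.⊔ modulus n , λ k le → begin
      ∣ seq (s n) k - diagonal k ∣ + ε * ½
        ≡⟨ cong (_+ ε * ½) (∣-∣-comm (seq (s n) k) (diagonal k)) ⟩
      ∣ diagonal k - seq (s n) k ∣ + ε * ½
        ≤⟨ ℚₚ.+-monoˡ-≤ (ε * ½) (near k n (ℕₚ.m⊔n≤o⇒m≤o N _ le) N≤n k (ℕₚ.m⊔n≤o⇒n≤o N _ le)) ⟩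
      ε * ½ + ε * ½ ≡⟨ half+half ε ⟩
      ε ∎
    where open ℚ≤

open Limit public using (lim; lim-⟶)

⌊√_⌋ : ℕ → ℕ
⌊√ zero ⌋  = 0
⌊√ suc n ⌋ with suc ⌊√ n ⌋ ℕ.* suc ⌊√ n ⌋ ℕₚ.≤? suc n
... | yes _ = suc ⌊√ n ⌋
... | no  _ = ⌊√ n ⌋

⌊√⌋²≤ : ∀ n → ⌊√ n ⌋ ℕ.* ⌊√ n ⌋ ℕ.≤ n
⌊√⌋²≤ zero = ℕ.z≤n
⌊√⌋²≤ (suc n) with suc ⌊√ n ⌋ ℕ.* suc ⌊√ n ⌋ ℕₚ.≤? suc n
... | yes le = le
... | no  _  = ℕₚ.m≤n⇒m≤1+n (⌊√⌋²≤ n)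

<[1+⌊√⌋]² : ∀ n → n ℕ.< suc ⌊√ n ⌋ ℕ.* suc ⌊√ n ⌋
<[1+⌊√⌋]² zero = ℕ.s≤s ℕ.z≤n
<[1+⌊√⌋]² (suc n) with suc ⌊√ n ⌋ ℕ.* suc ⌊√ n ⌋ ℕₚ.≤? suc n
... | yes _  = ℕₚ.<-≤-trans (ℕ.s≤s (<[1+⌊√⌋]² n)) (ℕₚ.*-mono-< (ℕₚ.n<1+n (suc ⌊√ n ⌋)) (ℕₚ.n<1+n (suc ⌊√ n ⌋)))
... | no ¬le = ℕₚ.≰⇒> ¬le

²-cancel-< : ∀ a b → a ℕ.* a ℕ.< b ℕ.* b → a ℕ.< b
²-cancel-< a b a²<b² with a ℕₚ.<? b
... | yes a<b = a<b
... | no  a≮b = contradiction (ℕₚ.*-mono-≤ (ℕₚ.≮⇒≥ a≮b) (ℕₚ.≮⇒≥ a≮b)) (ℕₚ.<⇒≱ a²<b²)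

module Sqrt (p : ℕ) where

  root : ℕ → ℕ
  root n = ⌊√ p ℕ.* (suc n ℕ.* suc n) ⌋

  approx : ℕ → ℚ
  approx n = + root n / suc n

  [mn]² : ∀ m n → (m ℕ.* n) ℕ.* (m ℕ.* n) ≡ (m ℕ.* m) ℕ.* (n ℕ.* n)
  [mn]² m n = ℕₚ.[m*n]*[o*p]≡[m*o]*[n*p] m n m n

  cross : ∀ m n → root m ℕ.* suc n ℕ.< suc (root n) ℕ.* suc m
  cross m n = ²-cancel-< _ _ (begin-strict
    (root m ℕ.* suc n) ℕ.* (root m ℕ.* suc n)
      ≡⟨ [mn]² (root m) (suc n) ⟩
    (root m ℕ.* root m) ℕ.* (suc n ℕ.* suc n)
      ≤⟨ ℕₚ.*-monoˡ-≤ (suc n ℕ.* suc n) (⌊√⌋²≤ (p ℕ.* (suc m ℕ.* suc m))) ⟩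
    p ℕ.* (suc m ℕ.* suc m) ℕ.* (suc n ℕ.* suc n)
      ≡⟨ trans (ℕₚ.*-assoc p _ _) (trans (cong (p ℕ.*_) (ℕₚ.*-comm (suc m ℕ.* suc m) (suc n ℕ.* suc n))) (sym (ℕₚ.*-assoc p _ _))) ⟩
    p ℕ.* (suc n ℕ.* suc n) ℕ.* (suc m ℕ.* suc m)
      <⟨ ℕₚ.*-monoˡ-< (suc m ℕ.* suc m) (<[1+⌊√⌋]² (p ℕ.* (suc n ℕ.* suc n))) ⟩
    (suc (root n) ℕ.* suc (root n)) ℕ.* (suc m ℕ.* suc m)
      ≡⟨ [mn]² (suc (root n)) (suc m) ⟨
    (suc (root n) ℕ.* suc m) ℕ.* (suc (root n) ℕ.* suc m) ∎)
    where open ℕₚ.≤-Reasoning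

  approx-≤ : ∀ m n → approx m ≤ approx n + + 1 / suc n
  approx-≤ m n = subst (approx m ≤_) (/-suc (root n) n) (/-mono (+ root m) (+ suc (root n)) m n
    (subst₂ ℤ._≤_ (ℤₚ.pos-* (root m) (suc n)) (ℤₚ.pos-* (suc (root n)) (suc m))
      (ℤ.+≤+ (ℕₚ.<⇒≤ (cross m n)))))

  opaque
    approx-cauchy : Cauchy approx
    approx-cauchy ε 0<ε =
      let (N , 1/N≤ε) = archimedean ε 0<ε
          bound = λ {n} (N≤n : N ℕ.≤ n) → ℚₚ.≤-trans (1/-antimono N≤n) 1/N≤ε
          onesided = λ m n (N≤n : N ℕ.≤ n) → begin
            approx m - approx n
              ≤⟨ ℚₚ.+-monoˡ-≤ (- approx n) (ℚₚ.≤-trans (approx-≤ m n) (ℚₚ.+-monoʳ-≤ (approx n) (bound N≤n))) ⟩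
            (approx n + ε) - approx n
              ≡⟨ solve 2 (λ a e → (a :+ e) :- a := e) refl (approx n) ε ⟩
            ε ∎
      in N , λ m n N≤m N≤n → ∣∣-lub (onesided m n N≤n)
        (subst (_≤ ε) (solve 2 (λ a b → a :- b := :- (b :- a)) refl (approx n) (approx m))
          (onesided n m N≤m))
      where open ℚ≤

  √ : ℝ
  √ = mkℝ approx approx-cauchy

  √-positive : 0 ℕ.< p → 0ʳ <ʳ √
  √-positive 0<p = 1ℚ , ℚₚ.positive⁻¹ 1ℚ , 0 , λ n _ → /-mono (+ 1) (+ root n) 0 n
    (subst₂ ℤ._≤_ (sym (ℤₚ.*-identityˡ (+ suc n))) (sym (ℤₚ.*-identityʳ (+ root n)))
      (ℤ.+≤+ (ℕₚ.≤-pred (²-cancel-< (suc n) (suc (root n)) (ℕₚ.≤-<-trans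
        (ℕₚ.m≤n*m (suc n ℕ.* suc n) p {{ℕ.>-nonZero 0<p}})
        (<[1+⌊√⌋]² (p ℕ.* (suc n ℕ.* suc n))))))))

open Sqrt public using (√; √-positive)

record ℂ : Set where
  constructor _+𝕚_
  field
    re im : ℝ

open ℂ public

infix  4 _≈ᶜ_ _⟶ᶜ_
infixl 6 _+ᶜ_
infixl 7 _*ᶜ_
infix  8 -ᶜ_
infixr 8 _^ᶜ_

_≈ᶜ_ : ℂ → ℂ → Set
z ≈ᶜ w = re z ≈ʳ re w × im z ≈ʳ im w

_⟶ᶜ_ : (ℕ → ℂ) → ℂ → Set
s ⟶ᶜ l = ((λ n → re (s n)) ⟶ʳ re l) × ((λ n → im (s n)) ⟶ʳ im l)

fromℝ : ℝ → ℂ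
fromℝ x = x +𝕚 0ʳ

fromℚᶜ : ℚ → ℂ
fromℚᶜ p = fromℝ (fromℚ p)

0ᶜ 1ᶜ 𝕚 : ℂ
0ᶜ = fromℝ 0ʳ
1ᶜ = fromℝ 1ʳ
𝕚  = 0ʳ +𝕚 1ʳ

_+ᶜ_ _*ᶜ_ : ℂ → ℂ → ℂ
z +ᶜ w = (re z +ʳ re w) +𝕚 (im z +ʳ im w)
z *ᶜ w = (re z *ʳ re w -ʳ im z *ʳ im w) +𝕚 (re z *ʳ im w +ʳ im z *ʳ re w)

-ᶜ_ : ℂ → ℂ
-ᶜ z = (-ʳ re z) +𝕚 (-ʳ im z)

_^ᶜ_ : ℂ → ℕ → ℂ
z ^ᶜ zero  = 1ᶜ
z ^ᶜ suc n = z *ᶜ z ^ᶜ n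

invFact : ℕ → ℚ
invFact n = (+ 1 / (n !)) {{n !≢0}}

expTerm : ℂ → ℕ → ℂ
expTerm z k = fromℚᶜ (invFact k) *ᶜ z ^ᶜ k

expSum : ℂ → ℕ → ℂ
expSum z zero    = 0ᶜ
expSum z (suc n) = expSum z n +ᶜ expTerm z n

module ExpCauchy where
  open ℚ≤

  -- Rational approximations to complex numbers, with the norm ∣x∣ + ∣y∣, which
  -- unlike the modulus stays rational.
  record ℚ[i] : Set where
    constructor _,,_
    field x y : ℚ
  open ℚ[i]

  infixl 6 _⊕_ _⊖_
  infixl 7 _⊗_
  _⊕_ _⊖_ _⊗_ : ℚ[i] → ℚ[i] → ℚ[i]
  g ⊕ h = (x g + x h) ,, (y g + y h)
  g ⊖ h = (x g - x h) ,, (y g - y h)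
  g ⊗ h = (x g * x h - y g * y h) ,, (x g * y h + y g * x h)

  pow : ℚ[i] → ℕ → ℚ[i]
  pow g zero    = 1ℚ ,, 0ℚ
  pow g (suc n) = g ⊗ pow g n

  term : ℚ[i] → ℕ → ℚ[i]
  term g k = (invFact k ,, 0ℚ) ⊗ pow g k

  sum : ℚ[i] → ℕ → ℚ[i]
  sum g zero    = 0ℚ ,, 0ℚ
  sum g (suc n) = sum g n ⊕ term g n

  at : ℂ → ℕ → ℚ[i]
  at z k = seq (re z) k ,, seq (im z) k

  at-pow : ∀ z n k → at (z ^ᶜ n) k ≡ pow (at z k) n
  at-pow z zero    k = refl
  at-pow z (suc n) k = cong (at z k ⊗_) (at-pow z n k)

  at-sum : ∀ z n k → at (expSum z n) k ≡ sum (at z k) n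
  at-sum z zero    k = refl
  at-sum z (suc n) k = cong₂ _⊕_ (at-sum z n k) (cong ((invFact n ,, 0ℚ) ⊗_) (at-pow z n k))

  ‖_‖ : ℚ[i] → ℚ
  ‖ g ‖ = ∣ x g ∣ + ∣ y g ∣

  0≤‖‖ : ∀ g → 0ℚ ≤ ‖ g ‖
  0≤‖‖ g = ℚₚ.+-mono-≤ (ℚₚ.0≤∣p∣ (x g)) (ℚₚ.0≤∣p∣ (y g))

  ‖⊕‖ : ∀ g h → ‖ g ⊕ h ‖ ≤ ‖ g ‖ + ‖ h ‖
  ‖⊕‖ (a ,, b) (c ,, d) = begin
    ∣ a + c ∣ + ∣ b + d ∣
      ≤⟨ ℚₚ.+-mono-≤ (ℚₚ.∣p+q∣≤∣p∣+∣q∣ a c) (ℚₚ.∣p+q∣≤∣p∣+∣q∣ b d) ⟩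
    (∣ a ∣ + ∣ c ∣) + (∣ b ∣ + ∣ d ∣)
      ≡⟨ solve 4 (λ a b c d → (a :+ c) :+ (b :+ d) := (a :+ b) :+ (c :+ d)) refl (∣ a ∣) (∣ b ∣) (∣ c ∣) (∣ d ∣) ⟩
    (∣ a ∣ + ∣ b ∣) + (∣ c ∣ + ∣ d ∣) ∎

  ‖⊗‖ : ∀ g h → ‖ g ⊗ h ‖ ≤ ‖ g ‖ * ‖ h ‖
  ‖⊗‖ (a ,, b) (c ,, d) = begin
    ∣ a * c - b * d ∣ + ∣ a * d + b * c ∣
      ≤⟨ ℚₚ.+-mono-≤ (ℚₚ.∣p-q∣≤∣p∣+∣q∣ (a * c) (b * d)) (ℚₚ.∣p+q∣≤∣p∣+∣q∣ (a * d) (b * c)) ⟩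
    (∣ a * c ∣ + ∣ b * d ∣) + (∣ a * d ∣ + ∣ b * c ∣)
      ≡⟨ cong₂ _+_ (cong₂ _+_ (ℚₚ.∣p*q∣≡∣p∣*∣q∣ a c) (ℚₚ.∣p*q∣≡∣p∣*∣q∣ b d))
                   (cong₂ _+_ (ℚₚ.∣p*q∣≡∣p∣*∣q∣ a d) (ℚₚ.∣p*q∣≡∣p∣*∣q∣ b c)) ⟩
    (∣ a ∣ * ∣ c ∣ + ∣ b ∣ * ∣ d ∣) + (∣ a ∣ * ∣ d ∣ + ∣ b ∣ * ∣ c ∣)
      ≡⟨ solve 4 (λ a b c d → (a :* c :+ b :* d) :+ (a :* d :+ b :* c) := (a :+ b) :* (c :+ d))
           refl (∣ a ∣) (∣ b ∣) (∣ c ∣) (∣ d ∣) ⟩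
    (∣ a ∣ + ∣ b ∣) * (∣ c ∣ + ∣ d ∣) ∎

  ‖⊖‖-comm : ∀ g h → ‖ g ⊖ h ‖ ≡ ‖ h ⊖ g ‖
  ‖⊖‖-comm g h = cong₂ _+_ (∣-∣-comm (x g) (x h)) (∣-∣-comm (y g) (y h))

  ∣x∣≤‖‖ : ∀ g → ∣ x g ∣ ≤ ‖ g ‖
  ∣x∣≤‖‖ g = subst (_≤ ‖ g ‖) (ℚₚ.+-identityʳ ∣ x g ∣) (ℚₚ.+-monoʳ-≤ ∣ x g ∣ (ℚₚ.0≤∣p∣ (y g)))

  ∣y∣≤‖‖ : ∀ g → ∣ y g ∣ ≤ ‖ g ‖
  ∣y∣≤‖‖ g = subst (_≤ ‖ g ‖) (ℚₚ.+-identityˡ ∣ y g ∣) (ℚₚ.+-monoˡ-≤ ∣ y g ∣ (ℚₚ.0≤∣p∣ (x g)))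

  module _ (B : ℚ) (0<B : 0ℚ < B) where

    -- b k = Bᵏ / k!
    b : ℕ → ℚ
    b zero    = 1ℚ
    b (suc k) = B * (+ 1 / suc k) * b k

    0<b : ∀ k → 0ℚ < b k
    0<b zero    = ℚₚ.positive⁻¹ 1ℚ
    0<b (suc k) = 0<* (0<* 0<B (0<1/ k)) (0<b k)

    invFact-suc : ∀ k → invFact (suc k) ≡ + 1 / suc k * invFact k
    invFact-suc k = 1/-* (suc k) (k !) {{_}} {{k !≢0}}

    0<invFact : ∀ k → 0ℚ < invFact k
    0<invFact zero    = ℚₚ.positive⁻¹ 1ℚ
    0<invFact (suc k) = subst (0ℚ <_) (sym (invFact-suc k)) (0<* (0<1/ k) (0<invFact k))

    pow-bound : ∀ g → ‖ g ‖ ≤ B → ∀ k → invFact k * ‖ pow g k ‖ ≤ b k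
    pow-bound g g≤B zero    = ℚₚ.≤-refl
    pow-bound g g≤B (suc k) = begin
      invFact (suc k) * ‖ g ⊗ pow g k ‖
        ≤⟨ ℚₚ.*-monoˡ-≤-nonNeg (invFact (suc k)) {{ℚ.nonNegative (ℚₚ.<⇒≤ (0<invFact (suc k)))}} (‖⊗‖ g (pow g k)) ⟩
      invFact (suc k) * (‖ g ‖ * ‖ pow g k ‖)
        ≡⟨ cong (_* (‖ g ‖ * ‖ pow g k ‖)) (invFact-suc k) ⟩
      + 1 / suc k * invFact k * (‖ g ‖ * ‖ pow g k ‖)
        ≡⟨ solve 4 (λ s f g p → s :* f :* (g :* p) := g :* s :* (f :* p)) refl
             (+ 1 / suc k) (invFact k) (‖ g ‖) (‖ pow g k ‖) ⟩
      ‖ g ‖ * (+ 1 / suc k) * (invFact k * ‖ pow g k ‖)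
        ≤⟨ *-mono-≤ (ℚₚ.<⇒≤ (0<* 0<B (0<1/ k)))
             (0≤* (ℚₚ.<⇒≤ (0<invFact k)) (0≤‖‖ (pow g k)))
             (ℚₚ.*-monoʳ-≤-nonNeg (+ 1 / suc k) {{ℚ.nonNegative (ℚₚ.<⇒≤ (0<1/ k))}} g≤B)
             (pow-bound g g≤B k) ⟩
      B * (+ 1 / suc k) * b k ∎

    term-bound : ∀ g → ‖ g ‖ ≤ B → ∀ k → ‖ term g k ‖ ≤ b k
    term-bound g g≤B k = begin
      ‖ (invFact k ,, 0ℚ) ⊗ pow g k ‖        ≤⟨ ‖⊗‖ (invFact k ,, 0ℚ) (pow g k) ⟩
      (∣ invFact k ∣ + 0ℚ) * ‖ pow g k ‖
        ≡⟨ cong (_* ‖ pow g k ‖) (trans (ℚₚ.+-identityʳ _) (ℚₚ.0≤p⇒∣p∣≡p (ℚₚ.<⇒≤ (0<invFact k)))) ⟩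
      invFact k * ‖ pow g k ‖                ≤⟨ pow-bound g g≤B k ⟩
      b k                                 ∎

    K : ℕ
    K = proj₁ (below-ℕ (B + B))

    ratio≤½ : ∀ k → K ℕ.≤ k → B * (+ 1 / suc k) ≤ ½
    ratio≤½ k K≤k = begin
      B * s
        ≡⟨ solve 2 (λ B s → B :* s := (B :+ B) :* s :* con ½) refl B s ⟩
      (B + B) * s * ½
        ≤⟨ ℚₚ.*-monoʳ-≤-nonNeg ½ (ℚₚ.*-monoʳ-≤-nonNeg s {{ℚ.nonNegative (ℚₚ.<⇒≤ (0<1/ k))}} (proj₂ (below-ℕ (B + B)))) ⟩
      + K / 1 * s * ½
        ≡⟨ cong (_* ½) (fromℚᵘ-homo-* (ℚᵘ.mkℚᵘ (+ K) 0) (ℚᵘ.mkℚᵘ (+ 1) k)) ⟨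
      (+ K ℤ.* + 1) / (1 ℕ.* suc k) * ½
        ≤⟨ ℚₚ.*-monoʳ-≤-nonNeg ½ (/-mono (+ K ℤ.* + 1) (+ 1) (k ℕ.+ 0) 0 K≤) ⟩
      1ℚ * ½ ≡⟨ ℚₚ.*-identityˡ ½ ⟩
      ½ ∎
      where
      s = + 1 / suc k
      K≤ : + K ℤ.* + 1 ℤ.* + 1 ℤ.≤ + 1 ℤ.* + suc (k ℕ.+ 0)
      K≤ = subst₂ ℤ._≤_
        (sym (trans (ℤₚ.*-identityʳ (+ K ℤ.* + 1)) (ℤₚ.*-identityʳ (+ K))))
        (sym (ℤₚ.*-identityˡ (+ suc (k ℕ.+ 0))))
        (ℤ.+≤+ (ℕₚ.≤-trans K≤k (ℕₚ.m≤n⇒m≤1+n (ℕₚ.m≤m+n k 0))))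

    b-halves : ∀ k → K ℕ.≤ k → b (suc k) ≤ b k * ½
    b-halves k K≤k = begin
      B * (+ 1 / suc k) * b k ≤⟨ ℚₚ.*-monoʳ-≤-nonNeg (b k) {{ℚ.nonNegative (ℚₚ.<⇒≤ (0<b k))}} (ratio≤½ k K≤k) ⟩
      ½ * b k                 ≡⟨ ℚₚ.*-comm ½ (b k) ⟩
      b k * ½                 ∎

    b-decay : ∀ i → b (i ℕ.+ K) ≤ b K * (+ 1 / suc i)
    b-decay zero    = ℚₚ.≤-reflexive (sym (ℚₚ.*-identityʳ (b K)))
    b-decay (suc i) = begin
      b (suc (i ℕ.+ K))          ≤⟨ b-halves (i ℕ.+ K) (ℕₚ.m≤n+m K i) ⟩
      b (i ℕ.+ K) * ½            ≤⟨ ℚₚ.*-monoʳ-≤-nonNeg ½ (b-decay i) ⟩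
      b K * (+ 1 / suc i) * ½    ≡⟨ ℚₚ.*-assoc (b K) (+ 1 / suc i) ½ ⟩
      b K * (+ 1 / suc i * ½)    ≡⟨ cong (b K *_) (1/-* (suc i) 2) ⟨
      b K * (+ 1 / (suc i ℕ.* 2))
        ≤⟨ ℚₚ.*-monoˡ-≤-nonNeg (b K) {{ℚ.nonNegative (ℚₚ.<⇒≤ (0<b K))}}
             (1/-antimono {suc i} {suc (i ℕ.* 2)} (ℕ.s≤s (ℕₚ.m≤m*n i 2))) ⟩
      b K * (+ 1 / suc (suc i))  ∎

    tail : ∀ g → ‖ g ‖ ≤ B → ∀ n → K ℕ.≤ n → ∀ j →
           ‖ sum g (j ℕ.+ n) ⊖ sum g n ‖ + (b (j ℕ.+ n) + b (j ℕ.+ n)) ≤ b n + b n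
    tail g g≤B n K≤n zero = ℚₚ.≤-reflexive
      (trans (cong (_+ (b n + b n)) (cong₂ (λ p q → ∣ p ∣ + ∣ q ∣)
                 (ℚₚ.+-inverseʳ (x (sum g n))) (ℚₚ.+-inverseʳ (y (sum g n)))))
             (ℚₚ.+-identityˡ (b n + b n)))
    tail g g≤B n K≤n (suc j) = begin
      ‖ (sum g m ⊕ term g m) ⊖ sum g n ‖ + (b (suc m) + b (suc m))
        ≡⟨ cong (λ h → ‖ h ‖ + (b (suc m) + b (suc m))) (cong₂ _,,_
             (rearrange (x (sum g m)) (x (term g m)) (x (sum g n)))
             (rearrange (y (sum g m)) (y (term g m)) (y (sum g n)))) ⟩
      ‖ (sum g m ⊖ sum g n) ⊕ term g m ‖ + (b (suc m) + b (suc m))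
        ≤⟨ ℚₚ.+-mono-≤
             (ℚₚ.≤-trans (‖⊕‖ (sum g m ⊖ sum g n) (term g m))
               (ℚₚ.+-monoʳ-≤ ‖ sum g m ⊖ sum g n ‖ (term-bound g g≤B m)))
             (ℚₚ.+-mono-≤ halves halves) ⟩
      ‖ sum g m ⊖ sum g n ‖ + b m + (b m * ½ + b m * ½)
        ≡⟨ solve 2 (λ s b → s :+ b :+ (b :* con ½ :+ b :* con ½) := s :+ (b :+ b)) refl
             (‖ sum g m ⊖ sum g n ‖) (b m) ⟩
      ‖ sum g m ⊖ sum g n ‖ + (b m + b m)
        ≤⟨ tail g g≤B n K≤n j ⟩
      b n + b n ∎
      where
      m = j ℕ.+ n
      halves = b-halves m (ℕₚ.≤-trans K≤n (ℕₚ.m≤n+m n j))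
      rearrange : ∀ s t u → s + t - u ≡ s - u + t
      rearrange = solve 3 (λ s t u → s :+ t :- u := s :- u :+ t) refl

    -- The partial sums are uniformly Cauchy on the disc of radius B.
    uniform : ∀ ε → 0ℚ < ε → ∃ λ N → ∀ g → ‖ g ‖ ≤ B →
              ∀ m n → N ℕ.≤ m → N ℕ.≤ n → ‖ sum g m ⊖ sum g n ‖ ≤ ε
    uniform ε 0<ε = i ℕ.+ K , λ g g≤B m n N≤m N≤n → ordered g g≤B m n N≤m N≤n (ℕₚ.≤-total n m)
      where
      c = b K + b K
      0<c = ℚₚ.+-mono-< (0<b K) (0<b K)
      arch = archimedean (ε * inv c) (0<* 0<ε (0<inv c 0<c))
      i = proj₁ arch

      small : ∀ n → i ℕ.+ K ℕ.≤ n → b n + b n ≤ ε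
      small n N≤n = begin
        b n + b n
          ≡⟨ cong (λ k → b k + b k) (ℕₚ.m∸n+n≡m K≤n) ⟨
        b (j ℕ.+ K) + b (j ℕ.+ K)
          ≤⟨ ℚₚ.+-mono-≤ (b-decay j) (b-decay j) ⟩
        b K * (+ 1 / suc j) + b K * (+ 1 / suc j)
          ≡⟨ ℚₚ.*-distribʳ-+ (+ 1 / suc j) (b K) (b K) ⟨
        c * (+ 1 / suc j)
          ≤⟨ ℚₚ.*-monoˡ-≤-nonNeg c {{ℚ.nonNegative (ℚₚ.<⇒≤ 0<c)}}
               (ℚₚ.≤-trans (1/-antimono {i} {j} i≤j) (proj₂ arch)) ⟩
        c * (ε * inv c)
          ≡⟨ solve 3 (λ c e w → c :* (e :* w) := e :* (c :* w)) refl c ε (inv c) ⟩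
        ε * (c * inv c)
          ≡⟨ cong (ε *_) (*-inv c 0<c) ⟩
        ε * 1ℚ
          ≡⟨ ℚₚ.*-identityʳ ε ⟩
        ε ∎
        where
        K≤n = ℕₚ.m+n≤o⇒n≤o i N≤n
        j = n ℕ.∸ K
        i≤j = ℕₚ.m+n≤o⇒m≤o∸n i N≤n

      later : ∀ g → ‖ g ‖ ≤ B → ∀ m n → i ℕ.+ K ℕ.≤ n → n ℕ.≤ m → ‖ sum g m ⊖ sum g n ‖ ≤ ε
      later g g≤B m n N≤n n≤m = begin
        ‖ sum g m ⊖ sum g n ‖
          ≡⟨ cong (λ k → ‖ sum g k ⊖ sum g n ‖) (ℕₚ.m∸n+n≡m n≤m) ⟨
        ‖ sum g (j ℕ.+ n) ⊖ sum g n ‖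
          ≡⟨ ℚₚ.+-identityʳ _ ⟨
        ‖ sum g (j ℕ.+ n) ⊖ sum g n ‖ + 0ℚ
          ≤⟨ ℚₚ.+-monoʳ-≤ ‖ sum g (j ℕ.+ n) ⊖ sum g n ‖
               (ℚₚ.<⇒≤ (ℚₚ.+-mono-< (0<b (j ℕ.+ n)) (0<b (j ℕ.+ n)))) ⟩
        ‖ sum g (j ℕ.+ n) ⊖ sum g n ‖ + (b (j ℕ.+ n) + b (j ℕ.+ n))
          ≤⟨ tail g g≤B n (ℕₚ.m+n≤o⇒n≤o i N≤n) j ⟩
        b n + b n
          ≤⟨ small n N≤n ⟩
        ε ∎
        where j = m ℕ.∸ n

      ordered : ∀ g → ‖ g ‖ ≤ B → ∀ m n → i ℕ.+ K ℕ.≤ m → i ℕ.+ K ℕ.≤ n →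
                n ℕ.≤ m ⊎ m ℕ.≤ n → ‖ sum g m ⊖ sum g n ‖ ≤ ε
      ordered g g≤B m n N≤m N≤n (inj₁ n≤m) = later g g≤B m n N≤n n≤m
      ordered g g≤B m n N≤m N≤n (inj₂ m≤n) =
        subst (_≤ ε) (‖⊖‖-comm (sum g n) (sum g m)) (later g g≤B n m N≤m m≤n)

  bounded : ∀ z → ∃ λ B → 0ℚ < B × ∃ λ K → ∀ k → K ℕ.≤ k → ‖ at z k ‖ ≤ B
  bounded z =
    let (A , 0<A , M , ≤A) = eventuallyBounded (re z)
        (B , 0<B , N , ≤B) = eventuallyBounded (im z)
    in A + B , ℚₚ.+-mono-< 0<A 0<B , M ℕ.⊔ N , λ k le →
      ℚₚ.+-mono-≤ (≤A k (ℕₚ.m⊔n≤o⇒m≤o M N le)) (≤B k (ℕₚ.m⊔n≤o⇒n≤o M N le))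

  expSum-close : ∀ z ε → 0ℚ < ε → ∃ λ N → ∀ m n → N ℕ.≤ m → N ℕ.≤ n →
                 ∃ λ K → ∀ k → K ℕ.≤ k → ‖ at (expSum z m) k ⊖ at (expSum z n) k ‖ ≤ ε
  expSum-close z ε 0<ε =
    let (B , 0<B , K , z≤B) = bounded z
        (N , close) = uniform B 0<B ε 0<ε
    in N , λ m n N≤m N≤n → K , λ k K≤k →
      subst₂ (λ s t → ‖ s ⊖ t ‖ ≤ ε) (sym (at-sum z m k)) (sym (at-sum z n k))
        (close (at z k) (z≤B k K≤k) m n N≤m N≤n)

  component : (p : ℂ → ℝ) →
              (∀ z w k → ∣ seq (p z) k - seq (p w) k ∣ ≤ ‖ at z k ⊖ at w k ‖) →
              ∀ z → IsCauchy (λ n → p (expSum z n))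
  component p p≤ z ε 0<ε =
    let (N , close) = expSum-close z (ε * ½) (0<½* 0<ε)
    in N , λ m n N≤m N≤n →
      let (K , near) = close m n N≤m N≤n
      in ε * ½ , 0<½* 0<ε , K , λ k K≤k → begin
        ∣ seq (p (expSum z m)) k - seq (p (expSum z n)) k ∣ + ε * ½
          ≤⟨ ℚₚ.+-monoˡ-≤ (ε * ½) (ℚₚ.≤-trans (p≤ (expSum z m) (expSum z n) k) (near k K≤k)) ⟩
        ε * ½ + ε * ½ ≡⟨ half+half ε ⟩
        ε ∎

  re-cauchy : ∀ z → IsCauchy (λ n → re (expSum z n))
  re-cauchy = component re λ z w k → ∣x∣≤‖‖ (at z k ⊖ at w k)

  im-cauchy : ∀ z → IsCauchy (λ n → im (expSum z n))
  im-cauchy = component im λ z w k → ∣y∣≤‖‖ (at z k ⊖ at w k)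

-- exp z is opaque for performance; expSum-⟶ determines it up to ≈ᶜ.
opaque
  exp : ℂ → ℂ
  exp z = lim (λ n → re (expSum z n)) (ExpCauchy.re-cauchy z)
       +𝕚 lim (λ n → im (expSum z n)) (ExpCauchy.im-cauchy z)

  expSum-⟶ : ∀ z → expSum z ⟶ᶜ exp z
  expSum-⟶ z = lim-⟶ (λ n → re (expSum z n)) (ExpCauchy.re-cauchy z)
             , lim-⟶ (λ n → im (expSum z n)) (ExpCauchy.im-cauchy z)

IsPrimePower : ℕ → Set
IsPrimePower q = ∃ λ p → ∃ λ k → Prime p × 1 ℕ.≤ k × q ≡ p ℕ.^ k

k<p^k : ∀ {p} → 2 ℕ.≤ p → ∀ k → k ℕ.< p ℕ.^ k
k<p^k 2≤p zero    = ℕ.s≤s ℕ.z≤n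
k<p^k {p} 2≤p (suc k) = begin-strict
  suc k                         <⟨ ℕ.s≤s (k<p^k 2≤p k) ⟩
  1 ℕ.+ p ℕ.^ k                 ≤⟨ ℕₚ.+-monoˡ-≤ (p ℕ.^ k) (ℕₚ.≤-trans (ℕ.s≤s ℕ.z≤n) (k<p^k 2≤p k)) ⟩
  p ℕ.^ k ℕ.+ p ℕ.^ k           ≡⟨ cong (p ℕ.^ k ℕ.+_) (ℕₚ.+-identityʳ (p ℕ.^ k)) ⟨
  2 ℕ.* p ℕ.^ k                 ≤⟨ ℕₚ.*-monoˡ-≤ (p ℕ.^ k) 2≤p ⟩
  p ℕ.* p ℕ.^ k                 ∎
  where open ℕₚ.≤-Reasoning

primePower? : ∀ q → Dec (IsPrimePower q)
primePower? q = map′ forget bound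
  (any? λ i → any? λ j → prime? (toℕ i) ×-dec 1 ℕₚ.≤? toℕ j ×-dec q ℕₚ.≟ toℕ i ℕ.^ toℕ j)
  where
  Bounded : Set
  Bounded = ∃ λ (i : Fin (suc q)) → ∃ λ (j : Fin (suc q)) →
            Prime (toℕ i) × 1 ℕ.≤ toℕ j × q ≡ toℕ i ℕ.^ toℕ j

  forget : Bounded → IsPrimePower q
  forget (i , j , is) = toℕ i , toℕ j , is

  bound : IsPrimePower q → Bounded
  bound (p , k , p-prime , 1≤k , q≡p^k) = i , j ,
    subst Prime (sym i≡p) p-prime , subst (1 ℕ.≤_) (sym j≡k) 1≤k ,
    trans q≡p^k (sym (cong₂ ℕ._^_ i≡p j≡k))
    where
    instance
      p≢0 : ℕ.NonZero p
      p≢0 = prime⇒nonZero p-prime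
    2≤p = ℕ.nonTrivial⇒n>1 p {{prime⇒nonTrivial p-prime}}
    p≤q : p ℕ.≤ q
    p≤q = subst₂ ℕ._≤_ (ℕₚ.*-identityʳ p) (sym q≡p^k) (ℕₚ.^-monoʳ-≤ p 1≤k)
    k≤q : k ℕ.≤ q
    k≤q = subst (k ℕ.≤_) (sym q≡p^k) (ℕₚ.<⇒≤ (k<p^k 2≤p k))
    i j : Fin (suc q)
    i = fromℕ< (ℕ.s≤s p≤q)
    j = fromℕ< (ℕ.s≤s k≤q)
    i≡p = toℕ-fromℕ< (ℕ.s≤s p≤q)
    j≡k = toℕ-fromℕ< (ℕ.s≤s k≤q)

-- The exponent in IsPrimePower is at least 1, so ϵ 1 is 1.
ϵ : ℕ → ℝ
ϵ q with primePower? q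
... | yes (p , _) = √ p
... | no _        = 1ʳ

0<ϵ : ∀ q → 0ʳ <ʳ ϵ q
0<ϵ q with primePower? q
... | yes (p , _ , p-prime , _) =
  √-positive p (ℕ.>-nonZero⁻¹ p {{prime⇒nonZero p-prime}})
... | no _ = 1ℚ , ℚₚ.positive⁻¹ 1ℚ , 0 , λ _ _ → ℚₚ.≤-refl

1/ϵ : ℕ → ℝ
1/ϵ q = recip (ϵ q) (0<ϵ q)

sin : ℝ → ℝ
sin x = im (exp (𝕚 *ᶜ fromℝ x))

-- π is the least positive zero of sin. Least is stated as positivity of sin
-- before π, the constructive form of "no zeros" for a function positive near 0⁺.
record IsPi (π : ℝ) : Set where
  field
    0<π     : 0ʳ <ʳ π
    sin[π]≈0 : sin π ≈ʳ 0ʳ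
    0<sin   : ∀ x → 0ʳ <ʳ x → x <ʳ π → 0ʳ <ʳ sin x

-- Values at a coprime to q are automatically invertible: such an a has an
-- inverse b modulo q, and χ a · χ b ≈ χ 1 ≈ 1.
record DirichletCharacter (q : ℕ) : Set where
  field
    χ         : ℤ → ℂ
    periodic  : ∀ a b → + q ∣ a ℤ.- b → χ a ≈ᶜ χ b
    χ[1]≈1    : χ (+ 1) ≈ᶜ 1ᶜ
    homo-*    : ∀ a b → χ (a ℤ.* b) ≈ᶜ χ a *ᶜ χ b
    χ≈0       : ∀ a → ¬ Coprime a (+ q) → χ a ≈ᶜ 0ᶜ

module _ {q : ℕ} (X : DirichletCharacter q) where
  open DirichletCharacter X

  Odd : Set
  Odd = χ (ℤ.- + 1) ≈ᶜ -ᶜ 1ᶜ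

  Principal : Set
  Principal = ∀ a → Coprime a (+ q) → χ a ≈ᶜ 1ᶜ

  -- χ factors through the units modulo d
  IsInducedModulus : ℕ → Set
  IsInducedModulus d =
    d ℕ.∣ q × (∀ a → Coprime a (+ q) → + d ∣ a ℤ.- + 1 → χ a ≈ᶜ 1ᶜ)

  HasConductor : ℕ → Set
  HasConductor f = IsInducedModulus f × (∀ d → IsInducedModulus d → f ℕ.≤ d)

  Primitive : Set
  Primitive = HasConductor q

sumᶜ prodᶜ : List ℂ → ℂ
sumᶜ  = foldr _+ᶜ_ 0ᶜ
prodᶜ = foldr _*ᶜ_ 1ᶜ

-- increasing n-tuples from a list, as subsequences
sublists : {A : Set} (n : ℕ) → List A → List (Vec A n)
sublists zero    xs       = [] ∷ []
sublists (suc n) []       = []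
sublists (suc n) (x ∷ xs) = map (x ∷_) (sublists n xs) ++ sublists (suc n) xs

-- The sum over 1 ≤ k₁ < … < kₙ ≤ N; an index i in upTo N stands for k = i + 1.
L-partial : ∀ {q} → DirichletCharacter q → ℕ → ℕ → ℂ
L-partial X n N = sumᶜ (map (λ is → prodᶜ (map summand (Vec.toList is))) (sublists n (upTo N)))
  where
  open DirichletCharacter X
  summand : ℕ → ℂ
  summand i = χ (+ suc i) *ᶜ fromℚᶜ (+ 1 / suc i)

φ : ℕ → ℕ
φ q = length (filter (λ a → coprime? a q) (map suc (upTo q)))

Φ : ℕ → List ℕ
Φ q = filter (λ j → coprime? j q) (map suc (upTo ((q ℕ.∸ 1) ℕ./ 2)))

ℓ : ℕ → ℕ
ℓ q = length (Φ q)

signVectors : ∀ n → List (Vec Sign n)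
signVectors zero    = [] ∷ []
signVectors (suc n) = map (Sign.+ ∷_) (signVectors n) ++ map (Sign.- ∷_) (signVectors n)

signᶜ : Sign → ℂ
signᶜ Sign.+ = 1ᶜ
signᶜ Sign.- = -ᶜ 1ᶜ

P : ∀ {n} → Vec Sign n → ℂ
P δ = prodᶜ (map signᶜ (Vec.toList δ))

j[_] : ∀ {q} → Vec Sign (ℓ q) → ℤ
j[_] {q} δ = foldr ℤ._+_ (+ 0) (zipWith ℤ._◃_ (Vec.toList δ) (Φ q))

signedSum : ∀ {q} → DirichletCharacter q → Vec Sign (ℓ q) → ℂ
signedSum {q} X δ = sumᶜ (zipWith (λ s j → signᶜ s *ᶜ χ (+ j)) (Vec.toList δ) (Φ q))
  where open DirichletCharacter X

-- Integer powers of 𝕚, using 𝕚⁻¹ = -𝕚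
𝕚^_ : ℤ → ℂ
𝕚^ (+ n)    = 𝕚 ^ᶜ n
𝕚^ -[1+ n ] = (-ᶜ 𝕚) ^ᶜ suc n

{-# OPTIONS --safe #-}
-- The numbers L_n(χ) are the coefficients of ∏ (1 + χ(k) z / k). Since χ is odd, the factors
-- with k ≡ ± j (mod q) combine to ∏ (1 + a z / (x + m)) over all integers m, where x = j / q and
-- a = χ(j) / q; this is sin (π (x + a z)) / sin (π x). The product of the denominators 2 sin (π j / q)
-- over 1 ≤ j < q / 2 is ε(q), because its square is the value at 1 of the q-th cyclotomic polynomial,
-- and expanding the product of the numerators into exponentials gives the sum over δ.
--
-- The product formula for the sine is read off from its finite analogue: for N = 2 M + 1 the
-- factorisation of Xᴺ - Yᴺ shows that
--   ∏ (1 + (π z / N) cot (π (x + m) / N)),  ∣m∣ ≤ M,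
-- is a multiple of e^{2πix} (1 + iπz/N)ᴺ - (1 - iπz/N)ᴺ, whose coefficients converge. Coefficients
-- are compared through logarithmic derivatives, that is, through power sums; there dominated
-- convergence applies once the terms for m and - m are paired.
module Submission where

open import Algebra.Bundles using (CommutativeRing; CommutativeMonoid; RawRing)
import Algebra.Properties.CommutativeSemigroup as SemigroupProperties
import Algebra.Properties.CommutativeSemiring.Exp as Exponentiation
import Algebra.Properties.Ring as RingProperties
import Algebra.Properties.Semiring.Mult.TCOptimised as Multiplication
import Algebra.Solver.Ring
open import Algebra.Solver.Ring.AlmostCommutativeRing using (fromCommutativeRing; _-Raw-AlmostCommutative⟶_)
open import Data.Empty using (⊥-elim)
open import Data.Integer.Base as ℤ using (ℤ; +_; -[1+_])
open import Data.Integer.Coprimality as ℤ using ()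
open import Data.Integer.Divisibility as ℤ using ()
import Data.Integer.Properties as ℤₚ
open import Data.Integer.Solver using () renaming (module +-*-Solver to ℤ-Solver)
open import Data.List.Base using (List; []; _∷_; map; filter; upTo; applyUpTo; length; _++_; foldr; zipWith)
open import Data.List.Relation.Unary.All as All using (All; []; _∷_)
import Data.List.Relation.Unary.All.Properties as All
open import Data.Maybe.Base using (Maybe; just; nothing)
open import Data.Nat.Base as ℕ using (ℕ; zero; suc; _!; NonZero)
open import Data.Nat.Coprimality as Coprimality using (Coprime; coprime?)
import Data.Nat.DivMod as ℕ
import Data.Nat.Divisibility as ℕ
open import Data.Nat.Divisibility using (_∣_; _∣?_; m∣m*n; n∣m*n; ∣-trans; ∣m⇒∣m*n; _∣0)
open import Data.Nat.Primality using (Prime; prime⇒nonZero; prime⇒nonTrivial)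
import Data.Nat.Properties as ℕₚ
open import Data.Product using (_×_; _,_; proj₁; proj₂; ∃)
open import Data.Rational.Base as ℚ using (ℚ; 0ℚ; 1ℚ; ½; _/_)
import Data.Rational.Properties as ℚₚ
open import Data.Rational.Solver using () renaming (module +-*-Solver to ℚ-Solver)
import Data.Rational.Unnormalised.Base as ℚᵘ
open import Data.Sign.Base as Sign using (Sign)
open import Data.Sum.Base using (_⊎_; inj₁; inj₂)
open import Data.Vec.Base as Vec using (Vec; []; _∷_)
open import Defs using (inv; invFact; 1/-*; IsPrimePower; Φ; ℓ; signVectors; sublists; ℝ; 0ʳ; 1ʳ; _+ʳ_; _*ʳ_; _<ʳ_; _≈ʳ_; fromℚ; recip; j[_]; fromℚᵘ-homo-+; fromℚᵘ-homo-*)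
open import Function.Base using (_∘_; id)
open import Level using (0ℓ)
open import Relation.Binary.PropositionalEquality as ≡ using (_≡_; subst)
import Relation.Binary.Reasoning.Setoid as SetoidReasoning
open import Relation.Nullary using (yes; no; Dec; ¬_; contradiction)
open import Relation.Nullary.Decidable using (_×-dec_; ¬?)
open import Relation.Unary using (Pred; Decidable)

-- Reals are Cauchy sequences, so equality is undecidable and an inverse exists only where a bound
-- away from 0 is proved. That is why norms occur only as rational upper bounds, why x and all
-- angles are rational, and why inverses are constructed together with bounds. Nothing about π is
-- given except positivity of the sine before it and the zero there. From these E t = exp (π i t) is
-- shown to satisfy E 1 = -1, and |E s - 1| is bounded below for 1/2 < s ≤ 1; a geometric sum
-- carries the bound over to smaller s, some multiple of which lies in that interval.
--
-- The obstacle in the limit is the first power sum, the sum of 1 / (x + m), which converges only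
-- conditionally, whereas L is cut off at an arbitrary N and not symmetrically. With M = ⌊N / q⌋ the
-- two ranges differ by fewer than q terms and one term for each j, all tending to 0.
--
-- Knowing the square of the product of the 2 sin (π j / q) leaves its sign open. Both it and ε(q)
-- are positive, so their sum is invertible and equal squares give equality.

-- A ring solver with integer coefficients.

module IntegerSolver {c ℓ} (R : CommutativeRing c ℓ) where
  open CommutativeRing R
  open RingProperties ring
  open Multiplication semiring using (1+×; ×-homo-+; ×1-homo-*) renaming (_×_ to _·_)
  open SetoidReasoning setoid

  -- Integer coefficients have decidable equality, which the carrier need not have. Multiples are
  -- taken with the optimised `_·_`, for which 1 and 2 evaluate to `1#` and `1# + 1#` judgementally,
  -- so that constants such as `con (+ 2)` match sums written out in the ring.
  ⟦_⟧ℤ : ℤ → Carrier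
  ⟦ + n ⟧ℤ      = n · 1#
  ⟦ -[1+ n ] ⟧ℤ = - (suc n · 1#)

  private
    cancel : ∀ a b c → (c + a) - (c + b) ≈ a - b
    cancel a b c = begin
      (c + a) + - (c + b)     ≈⟨ +-cong (+-comm c a) (trans (-‿cong (+-comm c b)) (sym (-‿+-comm b c))) ⟩
      (a + c) + (- b + - c)   ≈⟨ +-congˡ (+-comm (- b) (- c)) ⟩
      (a + c) + (- c + - b)   ≈⟨ +-assoc a c _ ⟩
      a + (c + (- c + - b))   ≈⟨ +-congˡ (trans (sym (+-assoc c _ _)) (trans (+-congʳ (-‿inverseʳ c)) (+-identityˡ _))) ⟩
      a - b ∎

    ⊖-homo : ∀ m n → ⟦ m ℤ.⊖ n ⟧ℤ ≈ m · 1# - n · 1#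
    ⊖-homo zero    zero    = sym (-‿inverseʳ 0#)
    ⊖-homo zero    (suc n) = sym (+-identityˡ _)
    ⊖-homo (suc m) zero    = sym (trans (+-congˡ -0#≈0#) (+-identityʳ _))
    ⊖-homo (suc m) (suc n) = begin
      ⟦ suc m ℤ.⊖ suc n ⟧ℤ           ≡⟨ ≡.cong ⟦_⟧ℤ (ℤₚ.[1+m]⊖[1+n]≡m⊖n m n) ⟩
      ⟦ m ℤ.⊖ n ⟧ℤ                   ≈⟨ ⊖-homo m n ⟩
      m · 1# - n · 1#                ≈⟨ cancel _ _ 1# ⟨
      (1# + m · 1#) - (1# + n · 1#)  ≈⟨ +-cong (1+× m 1#) (-‿cong (1+× n 1#)) ⟨
      suc m · 1# - suc n · 1#        ∎

    neg-homo : ∀ i → ⟦ ℤ.- i ⟧ℤ ≈ - ⟦ i ⟧ℤ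
    neg-homo (+ zero)  = sym -0#≈0#
    neg-homo (+ suc n) = refl
    neg-homo -[1+ n ]  = sym (-‿involutive _)

    +-homo : ∀ i j → ⟦ i ℤ.+ j ⟧ℤ ≈ ⟦ i ⟧ℤ + ⟦ j ⟧ℤ
    +-homo (+ m)    (+ n)    = ×-homo-+ 1# m n
    +-homo (+ m)    -[1+ n ] = ⊖-homo m (suc n)
    +-homo -[1+ m ] (+ n)    = trans (⊖-homo n (suc m)) (+-comm _ _)
    +-homo -[1+ m ] -[1+ n ] = begin
      - (suc (suc (m ℕ.+ n)) · 1#)       ≡⟨ ≡.cong (λ k → - (suc k · 1#)) (≡.sym (ℕₚ.+-suc m n)) ⟩
      - ((suc m ℕ.+ suc n) · 1#)         ≈⟨ -‿cong (×-homo-+ 1# (suc m) (suc n)) ⟩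
      - (suc m · 1# + suc n · 1#)        ≈⟨ -‿+-comm _ _ ⟨
      - (suc m · 1#) + - (suc n · 1#)    ∎

    *-homo⁺ : ∀ m n → ⟦ + m ℤ.* + n ⟧ℤ ≈ m · 1# * n · 1#
    *-homo⁺ m n = trans (reflexive (≡.cong ⟦_⟧ℤ (≡.sym (ℤₚ.pos-* m n)))) (×1-homo-* m n)

    *-homo : ∀ i j → ⟦ i ℤ.* j ⟧ℤ ≈ ⟦ i ⟧ℤ * ⟦ j ⟧ℤ
    *-homo (+ m)    (+ n)    = *-homo⁺ m n
    *-homo (+ m)    -[1+ n ] = begin
      ⟦ + m ℤ.* -[1+ n ] ⟧ℤ        ≡⟨ ≡.cong ⟦_⟧ℤ (≡.sym (ℤₚ.neg-distribʳ-* (+ m) (+ suc n))) ⟩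
      ⟦ ℤ.- (+ m ℤ.* + suc n) ⟧ℤ   ≈⟨ neg-homo (+ m ℤ.* + suc n) ⟩
      - ⟦ + m ℤ.* + suc n ⟧ℤ       ≈⟨ -‿cong (*-homo⁺ m (suc n)) ⟩
      - (m · 1# * suc n · 1#)      ≈⟨ -‿distribʳ-* _ _ ⟩
      m · 1# * - (suc n · 1#)      ∎
    *-homo -[1+ m ] (+ n)    = begin
      ⟦ -[1+ m ] ℤ.* + n ⟧ℤ        ≡⟨ ≡.cong ⟦_⟧ℤ (≡.sym (ℤₚ.neg-distribˡ-* (+ suc m) (+ n))) ⟩
      ⟦ ℤ.- (+ suc m ℤ.* + n) ⟧ℤ   ≈⟨ neg-homo (+ suc m ℤ.* + n) ⟩
      - ⟦ + suc m ℤ.* + n ⟧ℤ       ≈⟨ -‿cong (*-homo⁺ (suc m) n) ⟩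
      - (suc m · 1# * n · 1#)      ≈⟨ -‿distribˡ-* _ _ ⟩
      - (suc m · 1#) * n · 1#      ∎
    *-homo -[1+ m ] -[1+ n ] = begin
      ⟦ + suc m ℤ.* + suc n ⟧ℤ             ≈⟨ *-homo⁺ (suc m) (suc n) ⟩
      suc m · 1# * suc n · 1#              ≈⟨ -‿involutive _ ⟨
      - - (suc m · 1# * suc n · 1#)        ≈⟨ -‿cong (-‿distribʳ-* _ _) ⟩
      - (suc m · 1# * - (suc n · 1#))      ≈⟨ -‿distribˡ-* _ _ ⟩
      - (suc m · 1#) * - (suc n · 1#)      ∎

    ℤ-rawRing : RawRing _ _
    ℤ-rawRing = CommutativeRing.rawRing ℤₚ.+-*-commutativeRing

    morphism : ℤ-rawRing -Raw-AlmostCommutative⟶ fromCommutativeRing R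
    morphism = record
      { ⟦_⟧    = ⟦_⟧ℤ
      ; +-homo = +-homo
      ; *-homo = *-homo
      ; -‿homo = neg-homo
      ; 0-homo = refl
      ; 1-homo = refl
      }

    _coeff≟_ : ∀ i j → Maybe (⟦ i ⟧ℤ ≈ ⟦ j ⟧ℤ)
    i coeff≟ j with i ℤₚ.≟ j
    ... | yes i≡j = just (reflexive (≡.cong ⟦_⟧ℤ i≡j))
    ... | no  _   = nothing

  open Algebra.Solver.Ring ℤ-rawRing (fromCommutativeRing R) morphism _coeff≟_ public
    using (solve; _:=_; _:+_; _:*_; _:-_; :-_; con)

-- Finite folds in a commutative monoid.

module Fold {c ℓ} (M : CommutativeMonoid c ℓ) where
  open CommutativeMonoid M
  open SetoidReasoning setoid
  open SemigroupProperties commutativeSemigroup using (interchange)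

  ⨁ : ℕ → (ℕ → Carrier) → Carrier
  ⨁ zero    f = ε
  ⨁ (suc n) f = ⨁ n f ∙ f n

  ⨁-cong : ∀ n {f g} → (∀ i → i ℕ.< n → f i ≈ g i) → ⨁ n f ≈ ⨁ n g
  ⨁-cong zero    f≈g = refl
  ⨁-cong (suc n) f≈g = ∙-cong (⨁-cong n (λ i i<n → f≈g i (ℕₚ.m<n⇒m<1+n i<n))) (f≈g n ℕₚ.≤-refl)

  ⨁-≡ : ∀ {m n} f → m ≡ n → ⨁ m f ≈ ⨁ n f
  ⨁-≡ f ≡.refl = refl

  ⨁-ε : ∀ n → ⨁ n (λ _ → ε) ≈ ε
  ⨁-ε zero    = refl
  ⨁-ε (suc n) = trans (identityʳ _) (⨁-ε n)

  ⨁-∙ : ∀ n f g → ⨁ n (λ i → f i ∙ g i) ≈ ⨁ n f ∙ ⨁ n g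
  ⨁-∙ zero    f g = sym (identityˡ ε)
  ⨁-∙ (suc n) f g = trans (∙-congʳ (⨁-∙ n f g)) (interchange _ _ _ _)

  ⨁-head : ∀ n f → ⨁ (suc n) f ≈ f 0 ∙ ⨁ n (f ∘ suc)
  ⨁-head zero    f = comm _ _
  ⨁-head (suc n) f = trans (∙-congʳ (⨁-head n f)) (assoc _ _ _)

  ⨁-split : ∀ m n f → ⨁ (m ℕ.+ n) f ≈ ⨁ m f ∙ ⨁ n (λ i → f (m ℕ.+ i))
  ⨁-split m zero    f = trans (⨁-≡ f (ℕₚ.+-identityʳ m)) (sym (identityʳ _))
  ⨁-split m (suc n) f = begin
    ⨁ (m ℕ.+ suc n) f                                          ≈⟨ ⨁-≡ f (ℕₚ.+-suc m n) ⟩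
    ⨁ (m ℕ.+ n) f ∙ f (m ℕ.+ n)                                ≈⟨ ∙-congʳ (⨁-split m n f) ⟩
    ⨁ m f ∙ ⨁ n (λ i → f (m ℕ.+ i)) ∙ f (m ℕ.+ n)              ≈⟨ assoc _ _ _ ⟩
    ⨁ m f ∙ (⨁ n (λ i → f (m ℕ.+ i)) ∙ f (m ℕ.+ n))            ∎

  ⨁-blocks : ∀ m n f → ⨁ (m ℕ.* n) f ≈ ⨁ m (λ b → ⨁ n (λ i → f (b ℕ.* n ℕ.+ i)))
  ⨁-blocks zero    n f = refl
  ⨁-blocks (suc m) n f = begin
    ⨁ (n ℕ.+ m ℕ.* n) f                                ≈⟨ ⨁-≡ f (ℕₚ.+-comm n (m ℕ.* n)) ⟩
    ⨁ (m ℕ.* n ℕ.+ n) f                                ≈⟨ ⨁-split (m ℕ.* n) n f ⟩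
    ⨁ (m ℕ.* n) f ∙ ⨁ n (λ i → f (m ℕ.* n ℕ.+ i))      ≈⟨ ∙-congʳ (⨁-blocks m n f) ⟩
    _ ∎

  ⨁-swap : ∀ m n (f : ℕ → ℕ → Carrier) →
           ⨁ m (λ i → ⨁ n (f i)) ≈ ⨁ n (λ j → ⨁ m (λ i → f i j))
  ⨁-swap zero    n f = sym (⨁-ε n)
  ⨁-swap (suc m) n f = trans (∙-congʳ (⨁-swap m n f)) (sym (⨁-∙ n _ _))

  ⨁-reverse : ∀ n f → ⨁ n (λ i → f (n ℕ.∸ suc i)) ≈ ⨁ n f
  ⨁-reverse zero    f = refl
  ⨁-reverse (suc n) f = begin
    ⨁ (suc n) (λ i → f (n ℕ.∸ i))           ≈⟨ ⨁-head n _ ⟩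
    f n ∙ ⨁ n (λ i → f (n ℕ.∸ suc i))       ≈⟨ ∙-congˡ (⨁-reverse n f) ⟩
    f n ∙ ⨁ n f                             ≈⟨ comm _ _ ⟩
    ⨁ n f ∙ f n                             ∎

  ⨁ᴸ : ∀ {a} {A : Set a} → (A → Carrier) → List A → Carrier
  ⨁ᴸ f []       = ε
  ⨁ᴸ f (x ∷ xs) = f x ∙ ⨁ᴸ f xs

  ⨁ᴸ-cong : ∀ {a} {A : Set a} {f g : A → Carrier} → (∀ x → f x ≈ g x) → ∀ xs → ⨁ᴸ f xs ≈ ⨁ᴸ g xs
  ⨁ᴸ-cong f≈g []       = refl
  ⨁ᴸ-cong f≈g (x ∷ xs) = ∙-cong (f≈g x) (⨁ᴸ-cong f≈g xs)

  ⨁ᴸ-∙ : ∀ {a} {A : Set a} (f g : A → Carrier) xs → ⨁ᴸ (λ x → f x ∙ g x) xs ≈ ⨁ᴸ f xs ∙ ⨁ᴸ g xs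
  ⨁ᴸ-∙ f g []       = sym (identityˡ ε)
  ⨁ᴸ-∙ f g (x ∷ xs) = trans (∙-congˡ (⨁ᴸ-∙ f g xs)) (interchange _ _ _ _)

  ⨁ᴸ-ε : ∀ {a} {A : Set a} (xs : List A) → ⨁ᴸ (λ _ → ε) xs ≈ ε
  ⨁ᴸ-ε []       = refl
  ⨁ᴸ-ε (x ∷ xs) = trans (identityˡ _) (⨁ᴸ-ε xs)

  ⨁-⨁ᴸ-swap : ∀ {a} {A : Set a} n (f : ℕ → A → Carrier) xs →
              ⨁ n (λ i → ⨁ᴸ (f i) xs) ≈ ⨁ᴸ (λ x → ⨁ n (λ i → f i x)) xs
  ⨁-⨁ᴸ-swap zero    f xs = sym (⨁ᴸ-ε xs)
  ⨁-⨁ᴸ-swap (suc n) f xs = trans (∙-congʳ (⨁-⨁ᴸ-swap n f xs)) (sym (⨁ᴸ-∙ _ _ xs))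

  -- Sums and products over coprime residues are kept over full ranges, with `ε` at the excluded
  -- places, so that splitting into blocks, reversal and interchange apply without any reasoning
  -- about filtered lists.
  when : ∀ {p} {P : Set p} → Dec P → Carrier → Carrier
  when (yes _) x = x
  when (no  _) x = ε

  when-yes : ∀ {p} {P : Set p} (d : Dec P) {x} → P → when d x ≈ x
  when-yes (yes _) _ = refl
  when-yes (no ¬p) p = contradiction p ¬p

  when-no : ∀ {p} {P : Set p} (d : Dec P) {x} → ¬ P → when d x ≈ ε
  when-no (yes p) ¬p = contradiction p ¬p
  when-no (no _)  _  = refl

  when-cong : ∀ {p q} {P : Set p} {Q : Set q} (d : Dec P) (e : Dec Q) {x y} →
              (P → Q) → (Q → P) → (P → x ≈ y) → when d x ≈ when e y
  when-cong (yes p) e p⇒q q⇒p eq = trans (eq p) (sym (when-yes e (p⇒q p)))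
  when-cong (no ¬p) e p⇒q q⇒p eq = sym (when-no e (¬p ∘ q⇒p))

  ⨁ᴸ-applyUpTo : ∀ {a} {A : Set a} (f : A → Carrier) h n → ⨁ᴸ f (applyUpTo h n) ≈ ⨁ n (f ∘ h)
  ⨁ᴸ-applyUpTo f h zero    = refl
  ⨁ᴸ-applyUpTo f h (suc n) = trans (∙-congˡ (⨁ᴸ-applyUpTo f (h ∘ suc) n)) (sym (⨁-head n (f ∘ h)))

  ⨁ᴸ-filter : ∀ {p} {P : Pred ℕ p} (P? : Decidable P) f xs →
              ⨁ᴸ f (filter P? xs) ≈ ⨁ᴸ (λ x → when (P? x) (f x)) xs
  ⨁ᴸ-filter P? f []       = refl
  ⨁ᴸ-filter P? f (x ∷ xs) with P? x
  ... | yes _ = ∙-congˡ (⨁ᴸ-filter P? f xs)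
  ... | no  _ = trans (⨁ᴸ-filter P? f xs) (sym (identityˡ _))

  ⨁ᴸ-map : ∀ {a b} {A : Set a} {B : Set b} (f : B → Carrier) (g : A → B) xs →
           ⨁ᴸ f (map g xs) ≈ ⨁ᴸ (f ∘ g) xs
  ⨁ᴸ-map f g []       = refl
  ⨁ᴸ-map f g (x ∷ xs) = ∙-congˡ (⨁ᴸ-map f g xs)

  ⨁ᴸ-filter-range : ∀ {p} {P : Pred ℕ p} (P? : Decidable P) f n →
                    ⨁ᴸ f (filter P? (map suc (upTo n))) ≈ ⨁ n (λ i → when (P? (suc i)) (f (suc i)))
  ⨁ᴸ-filter-range P? f n = begin
    ⨁ᴸ f (filter P? (map suc (upTo n)))                   ≈⟨ ⨁ᴸ-filter P? f (map suc (upTo n)) ⟩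
    ⨁ᴸ (λ x → when (P? x) (f x)) (map suc (upTo n))       ≈⟨ ⨁ᴸ-map _ suc (upTo n) ⟩
    ⨁ᴸ (λ i → when (P? (suc i)) (f (suc i))) (upTo n)     ≈⟨ ⨁ᴸ-applyUpTo _ id n ⟩
    _ ∎

-- Formal power series and products of linear factors.

module PowerSeries {c ℓ} (R : CommutativeRing c ℓ) where
  open CommutativeRing R
  open IntegerSolver R using (solve; _:=_; _:+_; _:*_; _:-_; :-_; con)
  open Exponentiation commutativeSemiring using (_^_; ^-congˡ; ^-distrib-*)
  open SetoidReasoning setoid

  Series : Set c
  Series = ℕ → Carrier

  infix 4 _≋_
  infixl 7 _⊛_
  infixl 6 _⊞_

  _≋_ : Series → Series → Set ℓ
  f ≋ g = ∀ n → f n ≈ g n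

  tail : Series → Series
  tail f n = f (suc n)

  -- `_⊛_` is the Cauchy product, unrolled as f g = f 0 g + z (tail f) g; this makes its laws
  -- inductions on the degree that generalise over `f`.
  _⊞_ _⊛_ : Series → Series → Series
  (f ⊞ g) n = f n + g n
  (f ⊛ g) zero    = f 0 * g 0
  (f ⊛ g) (suc n) = f 0 * g (suc n) + (tail f ⊛ g) n

  constant : Carrier → Series
  constant a zero    = a
  constant a (suc n) = 0#

  ⊛-cong : ∀ {f f′ g g′} → f ≋ f′ → g ≋ g′ → f ⊛ g ≋ f′ ⊛ g′
  ⊛-cong f≋ g≋ zero    = *-cong (f≋ 0) (g≋ 0)
  ⊛-cong f≋ g≋ (suc n) = +-cong (*-cong (f≋ 0) (g≋ (suc n))) (⊛-cong (f≋ ∘ suc) g≋ n)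

  ⊛-zeroˡ : ∀ g n → ((λ _ → 0#) ⊛ g) n ≈ 0#
  ⊛-zeroˡ g zero    = zeroˡ _
  ⊛-zeroˡ g (suc n) = trans (+-cong (zeroˡ _) (⊛-zeroˡ g n)) (+-identityˡ _)

  constant-⊛ : ∀ a g n → (constant a ⊛ g) n ≈ a * g n
  constant-⊛ a g zero    = refl
  constant-⊛ a g (suc n) = trans (+-congˡ (⊛-zeroˡ g n)) (+-identityʳ _)

  ⊛-distribʳ : ∀ f g h → (f ⊞ g) ⊛ h ≋ f ⊛ h ⊞ g ⊛ h
  ⊛-distribʳ f g h zero    = distribʳ _ _ _
  ⊛-distribʳ f g h (suc n) = trans (+-congˡ (⊛-distribʳ (tail f) (tail g) h n))
    (solve 5 (λ a b c x y → (a :+ b) :* c :+ (x :+ y) := (a :* c :+ x) :+ (b :* c :+ y)) refl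
      (f 0) (g 0) (h (suc n)) _ _)

  *-⊛ : ∀ a f g n → ((λ k → a * f k) ⊛ g) n ≈ a * (f ⊛ g) n
  *-⊛ a f g zero    = *-assoc _ _ _
  *-⊛ a f g (suc n) = trans (+-cong (*-assoc _ _ _) (*-⊛ a (tail f) g n)) (sym (distribˡ _ _ _))

  ⊛-tailʳ : ∀ f g n → (f ⊛ g) (suc n) ≈ (f ⊛ tail g) n + f (suc n) * g 0
  ⊛-tailʳ f g zero    = refl
  ⊛-tailʳ f g (suc n) = trans (+-congˡ (⊛-tailʳ (tail f) g n)) (sym (+-assoc _ _ _))

  ⊛-comm : ∀ f g → f ⊛ g ≋ g ⊛ f
  ⊛-comm f g zero    = *-comm _ _
  ⊛-comm f g (suc n) = begin
    f 0 * g (suc n) + (tail f ⊛ g) n   ≈⟨ +-cong (*-comm _ _) (⊛-comm (tail f) g n) ⟩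
    g (suc n) * f 0 + (g ⊛ tail f) n   ≈⟨ +-comm _ _ ⟩
    (g ⊛ tail f) n + g (suc n) * f 0   ≈⟨ ⊛-tailʳ g f n ⟨
    (g ⊛ f) (suc n)                    ∎

  ⊛-assoc : ∀ f g h → (f ⊛ g) ⊛ h ≋ f ⊛ (g ⊛ h)
  ⊛-assoc f g h zero    = *-assoc _ _ _
  ⊛-assoc f g h (suc n) = begin
    f 0 * g 0 * h (suc n) + (((λ k → f 0 * g (suc k)) ⊞ (tail f ⊛ g)) ⊛ h) n
      ≈⟨ +-congˡ (⊛-distribʳ _ (tail f ⊛ g) h n) ⟩
    f 0 * g 0 * h (suc n) + (((λ k → f 0 * g (suc k)) ⊛ h) n + ((tail f ⊛ g) ⊛ h) n)
      ≈⟨ +-congˡ (+-cong (*-⊛ (f 0) (tail g) h n) (⊛-assoc (tail f) g h n)) ⟩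
    f 0 * g 0 * h (suc n) + (f 0 * (tail g ⊛ h) n + (tail f ⊛ (g ⊛ h)) n)
      ≈⟨ solve 5 (λ a b c x y → a :* b :* c :+ (a :* x :+ y) := a :* (b :* c :+ x) :+ y) refl
           (f 0) (g 0) (h (suc n)) _ _ ⟩
    f 0 * (g ⊛ h) (suc n) + (tail f ⊛ (g ⊛ h)) n ∎

  seriesRing : CommutativeRing c ℓ
  seriesRing = record
    { Carrier = Series ; _≈_ = _≋_ ; _+_ = _⊞_ ; _*_ = _⊛_
    ; -_ = λ f n → - f n ; 0# = λ _ → 0# ; 1# = constant 1#
    ; isCommutativeRing = record
      { isRing = record
        { +-isAbelianGroup = record
          { isGroup = record
            { isMonoid = record
              { isSemigroup = record
                { isMagma = record
                  { isEquivalence = record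
                    { refl = λ _ → refl ; sym = λ p n → sym (p n) ; trans = λ p q n → trans (p n) (q n) }
                  ; ∙-cong = λ p q n → +-cong (p n) (q n) }
                ; assoc = λ f g h n → +-assoc (f n) (g n) (h n) }
              ; identity = (λ f n → +-identityˡ (f n)) , (λ f n → +-identityʳ (f n)) }
            ; inverse = (λ f n → -‿inverseˡ (f n)) , (λ f n → -‿inverseʳ (f n))
            ; ⁻¹-cong = λ p n → -‿cong (p n) }
          ; comm = λ f g n → +-comm (f n) (g n) }
        ; *-cong = ⊛-cong
        ; *-assoc = ⊛-assoc
        ; *-identity = 1⊛ , (λ f n → trans (⊛-comm f (constant 1#) n) (1⊛ f n))
        ; distrib = (λ f g h n → trans (⊛-comm f (g ⊞ h) n) (trans (⊛-distribʳ g h f n)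
                                    (+-cong (⊛-comm g f n) (⊛-comm h f n))))
                  , (λ f g h → ⊛-distribʳ g h f) }
      ; *-comm = ⊛-comm } }
    where
    1⊛ : ∀ f n → (constant 1# ⊛ f) n ≈ f n
    1⊛ f n = trans (constant-⊛ 1# f n) (*-identityˡ _)

  module 𝕊 = CommutativeRing seriesRing
  module Σ = Fold +-commutativeMonoid
  module Π = Fold *-commutativeMonoid
  module ΣS = Fold 𝕊.+-commutativeMonoid
  module ΠS = Fold 𝕊.*-commutativeMonoid
  open Σ public using () renaming (⨁ to ∑; ⨁ᴸ to ∑ᴸ)
  open Π public using () renaming (⨁ to ∏; ⨁ᴸ to ∏ᴸ)

  ∑-* : ∀ a n f → a * ∑ n f ≈ ∑ n (λ i → a * f i)
  ∑-* a zero    f = zeroʳ a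
  ∑-* a (suc n) f = trans (distribˡ _ _ _) (+-congʳ (∑-* a n f))

  ∑ᴸ-* : ∀ {x} {X : Set x} a (f : X → Carrier) xs → a * ∑ᴸ f xs ≈ ∑ᴸ (λ i → a * f i) xs
  ∑ᴸ-* a f []       = zeroʳ a
  ∑ᴸ-* a f (x ∷ xs) = trans (distribˡ _ _ _) (+-congˡ (∑ᴸ-* a f xs))

  ∑-neg : ∀ n f → ∑ n (λ i → - f i) ≈ - ∑ n f
  ∑-neg zero    f = solve 0 (con (+ 0) := :- con (+ 0)) refl
  ∑-neg (suc n) f = trans (+-congʳ (∑-neg n f))
    (solve 2 (λ a b → :- a :+ :- b := :- (a :+ b)) refl _ _)

  ∑S : ∀ m (f : ℕ → Series) n → ΣS.⨁ m f n ≈ ∑ m (λ i → f i n)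
  ∑S zero    f n = refl
  ∑S (suc m) f n = +-congʳ (∑S m f n)

  ∑ᴸS : ∀ {a} {A : Set a} (f : A → Series) xs n → ΣS.⨁ᴸ f xs n ≈ ∑ᴸ (λ x → f x n) xs
  ∑ᴸS f []       n = refl
  ∑ᴸS f (x ∷ xs) n = +-congˡ (∑ᴸS f xs n)

  linear : Carrier → Series
  linear x zero          = 1#
  linear x (suc zero)    = x
  linear x (suc (suc _)) = 0#

  linear-⊛ : ∀ x g n → (linear x ⊛ g) (suc n) ≈ g (suc n) + x * g n
  linear-⊛ x g zero    = +-congʳ (*-identityˡ _)
  linear-⊛ x g (suc n) = +-cong (*-identityˡ _)
    (trans (+-congˡ (⊛-zeroˡ g n)) (+-identityʳ _))

  -- As 1 + x z has constant term 1, the coefficients can be compared from the bottom up.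
  linear-cancel : ∀ x {f g} → f 0 ≈ g 0 → linear x ⊛ f ≋ linear x ⊛ g → f ≋ g
  linear-cancel x {f} {g} f0≈g0 eq zero    = f0≈g0
  linear-cancel x {f} {g} f0≈g0 eq (suc n) = begin
    f (suc n)                          ≈⟨ solve 2 (λ a b → a := (a :+ b) :- b) refl _ (x * f n) ⟩
    (f (suc n) + x * f n) - x * f n    ≈⟨ +-cong (trans (sym (linear-⊛ x f n)) (trans (eq (suc n)) (linear-⊛ x g n)))
                                                 (-‿cong (*-congˡ (linear-cancel x f0≈g0 eq n))) ⟩
    (g (suc n) + x * g n) - x * g n    ≈⟨ solve 2 (λ a b → a := (a :+ b) :- b) refl _ (x * g n) ⟨
    g (suc n)                          ∎

  linear-cong : ∀ {x y} → x ≈ y → linear x ≋ linear y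
  linear-cong x≈y zero          = refl
  linear-cong x≈y (suc zero)    = x≈y
  linear-cong x≈y (suc (suc _)) = refl

  -- The substitution of `a z` for the variable.
  scale : Carrier → Series → Series
  scale a f n = a ^ n * f n

  scale-⊛ : ∀ a f g → scale a (f ⊛ g) ≋ scale a f ⊛ scale a g
  scale-⊛ a f g zero    = solve 2 (λ x y → con (+ 1) :* (x :* y) := con (+ 1) :* x :* (con (+ 1) :* y)) refl _ _
  scale-⊛ a f g (suc n) = begin
    a * a ^ n * (f 0 * g (suc n) + (tail f ⊛ g) n)
      ≈⟨ solve 5 (λ a p x y z → a :* p :* (x :* y :+ z) := con (+ 1) :* x :* (a :* p :* y) :+ a :* (p :* z)) refl
           a (a ^ n) _ _ _ ⟩
    1# * f 0 * (a * a ^ n * g (suc n)) + a * scale a (tail f ⊛ g) n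
      ≈⟨ +-congˡ (trans (*-congˡ (scale-⊛ a (tail f) g n)) (sym (*-⊛ a _ _ n))) ⟩
    1# * f 0 * (a * a ^ n * g (suc n)) + ((λ k → a * scale a (tail f) k) ⊛ scale a g) n
      ≈⟨ +-congˡ (⊛-cong (λ k → sym (*-assoc _ _ _)) (λ _ → refl) n) ⟩
    _ ∎

  scale-linear : ∀ a x → scale a (linear x) ≋ linear (a * x)
  scale-linear a x zero          = *-identityʳ _
  scale-linear a x (suc zero)    = *-congʳ (*-identityʳ a)
  scale-linear a x (suc (suc n)) = zeroʳ _

  scale-constant : ∀ a b → scale a (constant b) ≋ constant b
  scale-constant a b zero    = *-identityˡ _
  scale-constant a b (suc n) = zeroʳ _

  ∏-linear-degree : ∀ N x n → N ℕ.< n → ΠS.⨁ N (linear ∘ x) n ≈ 0#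
  ∏-linear-degree zero    x (suc n) N<n = refl
  ∏-linear-degree (suc N) x (suc n) (ℕ.s≤s N<n) = begin
    (ΠS.⨁ N (linear ∘ x) ⊛ linear (x N)) (suc n)             ≈⟨ ⊛-comm _ (linear (x N)) (suc n) ⟩
    (linear (x N) ⊛ ΠS.⨁ N (linear ∘ x)) (suc n)             ≈⟨ linear-⊛ (x N) _ n ⟩
    ΠS.⨁ N (linear ∘ x) (suc n) + x N * ΠS.⨁ N (linear ∘ x) n
      ≈⟨ +-cong (∏-linear-degree N x (suc n) (ℕₚ.m<n⇒m<1+n N<n)) (*-congˡ (∏-linear-degree N x n N<n)) ⟩
    0# + x N * 0#                                            ≈⟨ solve 1 (λ x → con (+ 0) :+ x :* con (+ 0) := con (+ 0)) refl _ ⟩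
    0#                                                       ∎

  ∏-linear-head : ∀ N x → ΠS.⨁ N (linear ∘ x) 0 ≈ 1#
  ∏-linear-head zero    x = refl
  ∏-linear-head (suc N) x = trans (*-identityʳ _) (∏-linear-head N x)

  scale-∏-linear : ∀ a N x → scale a (ΠS.⨁ N (linear ∘ x)) ≋ ΠS.⨁ N (λ k → linear (a * x k))
  scale-∏-linear a zero    x   = scale-constant a 1#
  scale-∏-linear a (suc N) x n = trans (scale-⊛ a _ (linear (x N)) n)
    (⊛-cong (scale-∏-linear a N x) (scale-linear a (x N)) n)

  constant-cong : ∀ {a b} → a ≈ b → constant a ≋ constant b
  constant-cong a≈b zero    = a≈b
  constant-cong a≈b (suc n) = refl

  constant-* : ∀ a b → constant a ⊛ constant b ≋ constant (a * b)
  constant-* a b n = trans (constant-⊛ a (constant b) n) (coefficient n)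
    where
    coefficient : ∀ n → a * constant b n ≈ constant (a * b) n
    coefficient zero    = refl
    coefficient (suc n) = zeroʳ a

  open Exponentiation 𝕊.commutativeSemiring using () renaming (_^_ to _^S_)

  constant-^ : ∀ a n → constant a ^S n ≋ constant (a ^ n)
  constant-^ a zero      = 𝕊.refl
  constant-^ a (suc n) k = trans (⊛-cong {constant a} 𝕊.refl (constant-^ a n) k) (constant-* a (a ^ n) k)

  constant-∏ : ∀ N f → ΠS.⨁ N (constant ∘ f) ≋ constant (∏ N f)
  constant-∏ zero    f   = 𝕊.refl
  constant-∏ (suc N) f n = trans (⊛-cong (constant-∏ N f) 𝕊.refl n) (constant-* (∏ N f) (f N) n)

  module _ (A B : Carrier) where

    -- The sum of e i Aⁱ Bᴺ⁻ⁱ over i ≤ N.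
    homogeneous : ℕ → Series → Carrier
    homogeneous zero    e = e 0
    homogeneous (suc N) e = B * homogeneous N e + e (suc N) * A ^ suc N

    homogeneous-cong : ∀ N {e e′} → e ≋ e′ → homogeneous N e ≈ homogeneous N e′
    homogeneous-cong zero    eq = eq 0
    homogeneous-cong (suc N) eq = +-cong (*-congˡ (homogeneous-cong N eq)) (*-congʳ (eq (suc N)))

    private
      linear-0 : ∀ x e → (linear x ⊛ e) 0 ≈ e 0
      linear-0 x e = *-identityˡ _

      -- Multiplication by 1 + x z multiplies the form by B + x A, except that the coefficient of
      -- `e` in degree `suc N`, which `homogeneous N` ignores, comes to light. It vanishes when `e`
      -- is a product of N linear factors.
      step : ∀ N x e → homogeneous (suc N) (linear x ⊛ e) ≈
             (B + x * A) * homogeneous N e + B * 0# + e (suc N) * A ^ suc N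
      step zero    x e = trans (+-cong (*-congˡ (linear-0 x e)) (*-congʳ (linear-⊛ x e 0)))
        (solve 5 (λ A B x e e₁ → B :* e :+ (e₁ :+ x :* e) :* (A :* con (+ 1))
                   := (B :+ x :* A) :* e :+ B :* con (+ 0) :+ e₁ :* (A :* con (+ 1))) refl A B x (e 0) (e 1))
      step (suc N) x e = trans (+-cong (*-congˡ (step N x e)) (*-congʳ (linear-⊛ x e (suc N))))
        (solve 7 (λ A B x e₁ e₂ h p →
            B :* ((B :+ x :* A) :* h :+ B :* con (+ 0) :+ e₁ :* p) :+ (e₂ :+ x :* e₁) :* (A :* p)
            := (B :+ x :* A) :* (B :* h :+ e₁ :* p) :+ B :* con (+ 0) :+ e₂ :* (A :* p)) refl
          A B x (e (suc N)) (e (suc (suc N))) (homogeneous N e) (A ^ suc N))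

    ∏-homogeneous : ∀ N x → ∏ N (λ k → B + x k * A) ≈ homogeneous N (ΠS.⨁ N (linear ∘ x))
    ∏-homogeneous zero    x = refl
    ∏-homogeneous (suc N) x = begin
      ∏ N (λ k → B + x k * A) * (B + x N * A)
        ≈⟨ *-congʳ (∏-homogeneous N x) ⟩
      homogeneous N F * (B + x N * A)
        ≈⟨ solve 4 (λ h b B p → h :* b := b :* h :+ B :* con (+ 0) :+ con (+ 0) :* p) refl
             (homogeneous N F) (B + x N * A) B (A ^ suc N) ⟩
      (B + x N * A) * homogeneous N F + B * 0# + 0# * A ^ suc N
        ≈⟨ +-congˡ (*-congʳ (∏-linear-degree N x (suc N) ℕₚ.≤-refl)) ⟨
      (B + x N * A) * homogeneous N F + B * 0# + F (suc N) * A ^ suc N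
        ≈⟨ step N (x N) F ⟨
      homogeneous (suc N) (linear (x N) ⊛ F)
        ≈⟨ homogeneous-cong (suc N) (⊛-comm (linear (x N)) F) ⟩
      homogeneous (suc N) (F ⊛ linear (x N)) ∎
      where F = ΠS.⨁ N (linear ∘ x)

    homogeneous-sparse : ∀ N e → (∀ i → 0 ℕ.< i → i ℕ.≤ N → e i ≈ 0#) → homogeneous N e ≈ B ^ N * e 0
    homogeneous-sparse zero    e e≈0 = sym (*-identityˡ _)
    homogeneous-sparse (suc N) e e≈0 = begin
      B * homogeneous N e + e (suc N) * A ^ suc N
        ≈⟨ +-cong (*-congˡ (homogeneous-sparse N e (λ i 0<i i≤N → e≈0 i 0<i (ℕₚ.m≤n⇒m≤1+n i≤N))))
                  (*-congʳ (e≈0 (suc N) (ℕ.s≤s ℕ.z≤n) ℕₚ.≤-refl)) ⟩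
      B * (B ^ N * e 0) + 0# * A ^ suc N
        ≈⟨ solve 4 (λ B b e p → B :* (b :* e) :+ con (+ 0) :* p := B :* b :* e) refl B (B ^ N) (e 0) (A ^ suc N) ⟩
      B * B ^ N * e 0 ∎

  -- Replacing the variable z by ω z only permutes the factors of ∏ (1 - ωᵏ z), so
  -- its coefficients between degrees 0 and N vanish.
  module RootsOfUnity (ω : Carrier) (N-1 : ℕ) (ω^N≈1 : ω ^ suc N-1 ≈ 1#)
    (ω^k-fixed : ∀ k → 0 ℕ.< k → k ℕ.< suc N-1 → ∀ x → ω ^ k * x ≈ x → x ≈ 0#) where

    private
      N : ℕ
      N = suc N-1

      root : ℕ → Carrier
      root k = - (ω ^ k)

      F : ℕ → Series
      F n = ΠS.⨁ n (linear ∘ root)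

      scale-F : ∀ n → scale ω (F n) ≋ ΠS.⨁ n (linear ∘ root ∘ suc)
      scale-F zero      = scale-constant ω 1#
      scale-F (suc n) k = begin
        scale ω (F n ⊛ linear (root n)) k             ≈⟨ scale-⊛ ω (F n) (linear (root n)) k ⟩
        (scale ω (F n) ⊛ scale ω (linear (root n))) k
          ≈⟨ ⊛-cong (scale-F n) (λ i → trans (scale-linear ω (root n) i)
               (linear-cong (solve 2 (λ w p → w :* (:- p) := :- (w :* p)) refl ω (ω ^ n)) i)) k ⟩
        _ ∎

      -- Scaling moves the factor with index k to k + 1. Hence (1 - z) F (ω z) = F (z) (1 - ωᴺ z) =
      -- (1 - z) F (z), and 1 - z is cancelled.
      F-invariant : scale ω (F N) ≋ F N
      F-invariant = linear-cancel (root 0) (*-identityˡ _) λ n → begin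
        (linear (root 0) ⊛ scale ω (F N)) n               ≈⟨ ⊛-cong {linear (root 0)} (λ _ → refl) (scale-F N) n ⟩
        (linear (root 0) ⊛ ΠS.⨁ N (linear ∘ root ∘ suc)) n ≈⟨ ΠS.⨁-head N (linear ∘ root) n ⟨
        (F N ⊛ linear (root N)) n                         ≈⟨ ⊛-comm (F N) _ n ⟩
        (linear (root N) ⊛ F N) n                         ≈⟨ ⊛-cong (linear-cong (-‿cong ω^N≈1)) (λ _ → refl) n ⟩
        (linear (root 0) ⊛ F N) n                         ∎

    middle : ∀ i → 0 ℕ.< i → i ℕ.< N → F N i ≈ 0#
    middle i 0<i i<N = ω^k-fixed i 0<i i<N (F N i) (F-invariant i)

    private
      two-terms : ∀ A B → ∏ N (λ k → B + root k * A) ≈ B ^ N + F N N * A ^ N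
      two-terms A B = begin
        ∏ N (λ k → B + root k * A)                  ≈⟨ ∏-homogeneous A B N root ⟩
        B * homogeneous A B N-1 (F N) + F N N * A ^ N
          ≈⟨ +-congʳ (*-congˡ (homogeneous-sparse A B N-1 (F N) (λ i 0<i i≤ → middle i 0<i (ℕ.s≤s i≤)))) ⟩
        B * (B ^ N-1 * F N 0) + F N N * A ^ N
          ≈⟨ +-congʳ (trans (sym (*-assoc _ _ _)) (trans (*-congˡ (∏-linear-head N root)) (*-identityʳ _))) ⟩
        B ^ N + F N N * A ^ N ∎

      1^n : ∀ n → 1# ^ n ≈ 1#
      1^n zero    = refl
      1^n (suc n) = trans (*-identityˡ _) (1^n n)

    -- Evaluation at A = B = 1, where the factor with k = 0 is zero.
    top : F N N ≈ - 1#
    top = begin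
      F N N                                       ≈⟨ solve 1 (λ f → f := (con (+ 1) :+ f :* con (+ 1)) :- con (+ 1)) refl (F N N) ⟩
      (1# + F N N * 1#) - 1#                      ≈⟨ +-congʳ (+-cong (1^n N) (*-congˡ (1^n N))) ⟨
      (1# ^ N + F N N * 1# ^ N) - 1#              ≈⟨ +-congʳ (two-terms 1# 1#) ⟨
      ∏ N (λ k → 1# + root k * 1#) - 1#           ≈⟨ +-congʳ (Π.⨁-head N-1 _) ⟩
      (1# + root 0 * 1#) * ∏ N-1 _ - 1#
        ≈⟨ solve 1 (λ p → (con (+ 1) :+ (:- con (+ 1)) :* con (+ 1)) :* p :- con (+ 1) := :- con (+ 1)) refl _ ⟩
      - 1#                                        ∎

    ∏-factors : ∀ A B → ∏ N (λ k → B - ω ^ k * A) ≈ B ^ N - A ^ N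
    ∏-factors A B = begin
      ∏ N (λ k → B - ω ^ k * A)       ≈⟨ Π.⨁-cong N (λ k _ → +-congˡ (solve 2 (λ p a → :- (p :* a) := :- p :* a) refl (ω ^ k) A)) ⟩
      ∏ N (λ k → B + root k * A)      ≈⟨ two-terms A B ⟩
      B ^ N + F N N * A ^ N           ≈⟨ +-congˡ (*-congʳ top) ⟩
      B ^ N + - 1# * A ^ N            ≈⟨ +-congˡ (solve 1 (λ a → :- con (+ 1) :* a := :- a) refl _) ⟩
      B ^ N - A ^ N                   ∎

    -- The product of 1 - ωᵏ over 0 < k < N, read off from the coefficients of
    -- the quotient of 1 - zᴺ by 1 - z.
    ∏-nontrivial : ∏ N-1 (λ k → 1# - ω ^ suc k) ≈ ∑ N (λ _ → 1#)
    ∏-nontrivial = begin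
      ∏ N-1 (λ k → 1# - ω ^ suc k)             ≈⟨ Π.⨁-cong N-1 (λ k _ → +-congˡ (sym (*-identityʳ _))) ⟩
      ∏ N-1 (λ k → 1# + root (suc k) * 1#)     ≈⟨ ∏-homogeneous 1# 1# N-1 (root ∘ suc) ⟩
      homogeneous 1# 1# N-1 G                  ≈⟨ count N-1 ℕₚ.≤-refl ⟩
      ∑ N (λ _ → 1#)                           ∎
      where
      G = ΠS.⨁ N-1 (linear ∘ root ∘ suc)

      -- (1 - z) G is `F N`, whose coefficients strictly between degrees 0 and N vanish, so
      -- consecutive coefficients of `G` agree.
      G-coefficient : ∀ i → i ℕ.≤ N-1 → G i ≈ 1#
      G-coefficient zero    _   = ∏-linear-head N-1 (root ∘ suc)
      G-coefficient (suc i) i<N = begin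
        G (suc i)                          ≈⟨ solve 2 (λ g h → g := (g :+ :- con (+ 1) :* h) :+ h) refl (G (suc i)) (G i) ⟩
        (G (suc i) + root 0 * G i) + G i   ≈⟨ +-congʳ (linear-⊛ (root 0) G i) ⟨
        (linear (root 0) ⊛ G) (suc i) + G i ≈⟨ +-cong (ΠS.⨁-head N-1 (linear ∘ root) (suc i)) refl ⟨
        F N (suc i) + G i                  ≈⟨ +-cong (middle (suc i) (ℕ.s≤s ℕ.z≤n) (ℕ.s≤s i<N)) (G-coefficient i (ℕₚ.<⇒≤ i<N)) ⟩
        0# + 1#                            ≈⟨ +-identityˡ _ ⟩
        1#                                 ∎

      count : ∀ n → n ℕ.≤ N-1 → homogeneous 1# 1# n G ≈ ∑ (suc n) (λ _ → 1#)
      count zero    n≤ = trans (G-coefficient 0 n≤) (sym (+-identityˡ _))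
      count (suc n) n≤ = +-cong (trans (*-identityˡ _) (count n (ℕₚ.<⇒≤ n≤)))
        (trans (*-cong (G-coefficient (suc n) n≤) (1^n (suc n))) (*-identityˡ _))

-- Logarithmic derivatives of power series.

module LogarithmicDerivative {c ℓ} (R : CommutativeRing c ℓ) where
  open CommutativeRing R
  open IntegerSolver R using (solve; _:=_; _:+_; _:*_; _:-_; :-_; con)
  open Exponentiation commutativeSemiring using (_^_)
  open SetoidReasoning setoid
  open PowerSeries R public

  natural : ℕ → Carrier
  natural zero    = 0#
  natural (suc n) = 1# + natural n

  private
    -- The operator z d/dz. It preserves degrees, so its product rule is proved without an index
    -- shift; the derivative is its tail.
    euler : Series → Series
    euler f n = natural n * f n

    euler-tail : ∀ f n → tail (euler f) n ≈ euler (tail f) n + tail f n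
    euler-tail f n = solve 2 (λ k x → (con (+ 1) :+ k) :* x := k :* x :+ x) refl _ _

    euler-⊛ : ∀ f g n → euler (f ⊛ g) n ≈ (euler f ⊛ g) n + (f ⊛ euler g) n
    euler-⊛ f g zero    = solve 2 (λ x y → con (+ 0) :* (x :* y)
      := con (+ 0) :* x :* y :+ x :* (con (+ 0) :* y)) refl _ _
    euler-⊛ f g (suc n) = begin
      natural (suc n) * (f 0 * g (suc n) + (tail f ⊛ g) n)
        ≈⟨ solve 4 (λ k a b x → (con (+ 1) :+ k) :* (a :* b :+ x)
             := a :* ((con (+ 1) :+ k) :* b) :+ (k :* x :+ x)) refl (natural n) (f 0) (g (suc n)) _ ⟩
      f 0 * euler g (suc n) + (euler (tail f ⊛ g) n + (tail f ⊛ g) n)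
        ≈⟨ +-congˡ (+-congʳ (euler-⊛ (tail f) g n)) ⟩
      f 0 * euler g (suc n) + ((euler (tail f) ⊛ g) n + (tail f ⊛ euler g) n + (tail f ⊛ g) n)
        ≈⟨ solve 6 (λ a u v w f₀ g₁ → a :+ (u :+ v :+ w) := con (+ 0) :* f₀ :* g₁ :+ (u :+ w) :+ (a :+ v)) refl
             _ _ _ _ (f 0) (g (suc n)) ⟩
      euler f 0 * g (suc n) + ((euler (tail f) ⊛ g) n + (tail f ⊛ g) n) + (f ⊛ euler g) (suc n)
        ≈⟨ +-congʳ (+-congˡ (trans (⊛-cong (euler-tail f) (λ _ → refl) n) (⊛-distribʳ (euler (tail f)) (tail f) g n))) ⟨
      (euler f ⊛ g) (suc n) + (f ⊛ euler g) (suc n) ∎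

  derivative : Series → Series
  derivative f = tail (euler f)

  derivative-⊛ : ∀ f g n → derivative (f ⊛ g) n ≈ (derivative f ⊛ g) n + (f ⊛ derivative g) n
  derivative-⊛ f g n = begin
    euler (f ⊛ g) (suc n)                               ≈⟨ euler-⊛ f g (suc n) ⟩
    (euler f ⊛ g) (suc n) + (f ⊛ euler g) (suc n)       ≈⟨ +-congˡ (⊛-tailʳ f (euler g) n) ⟩
    0# * f 0 * g (suc n) + (derivative f ⊛ g) n + ((f ⊛ derivative g) n + f (suc n) * (0# * g 0))
      ≈⟨ solve 6 (λ a b x y u v → con (+ 0) :* a :* b :+ x :+ (y :+ u :* (con (+ 0) :* v)) := x :+ y) refl _ _ _ _ _ _ ⟩
    (derivative f ⊛ g) n + (f ⊛ derivative g) n         ∎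

  -- f′ = f p expresses p = f′ / f without a division. Products of series become sums of their `p`,
  -- and for a linear factor `p` is geometric, so that the `p` of a product of linear factors
  -- collects signed power sums.
  LogDerivative : Series → Series → Set ℓ
  LogDerivative f p = derivative f ≋ f ⊛ p

  LogDerivative-⊛ : ∀ {f g p r} → LogDerivative f p → LogDerivative g r → LogDerivative (f ⊛ g) (p ⊞ r)
  LogDerivative-⊛ {f} {g} {p} {r} f′ g′ n = begin
    derivative (f ⊛ g) n                          ≈⟨ derivative-⊛ f g n ⟩
    (derivative f ⊛ g) n + (f ⊛ derivative g) n   ≈⟨ +-cong (⊛-cong f′ 𝕊.refl n) (⊛-cong {f} 𝕊.refl g′ n) ⟩
    (f ⊛ p ⊛ g) n + (f ⊛ (g ⊛ r)) n               ≈⟨ rearrange n ⟩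
    (f ⊛ g ⊛ (p ⊞ r)) n                           ∎
    where
    open IntegerSolver seriesRing using () renaming (solve to solveS; _:=_ to _≔_; _:+_ to _⊕_; _:*_ to _⊗_)
    rearrange : (f ⊛ p ⊛ g) ⊞ (f ⊛ (g ⊛ r)) ≋ f ⊛ g ⊛ (p ⊞ r)
    rearrange = solveS 4 (λ f g p r → (f ⊗ p ⊗ g) ⊕ (f ⊗ (g ⊗ r)) ≔ f ⊗ g ⊗ (p ⊕ r)) 𝕊.refl f g p r

  LogDerivative-cong : ∀ {f g p r} → f ≋ g → p ≋ r → LogDerivative f p → LogDerivative g r
  LogDerivative-cong f≋g p≋r f′ n = trans (*-congˡ (sym (f≋g (suc n)))) (trans (f′ n) (⊛-cong f≋g p≋r n))

  LogDerivative-1 : LogDerivative 𝕊.1# 𝕊.0#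
  LogDerivative-1 n = trans (zeroʳ _) (sym (trans (constant-⊛ 1# 𝕊.0# n) (zeroʳ _)))

  LogDerivative-∏ : ∀ m (f p : ℕ → Series) → (∀ i → i ℕ.< m → LogDerivative (f i) (p i)) →
                    LogDerivative (ΠS.⨁ m f) (ΣS.⨁ m p)
  LogDerivative-∏ zero    f p f′ = LogDerivative-1
  LogDerivative-∏ (suc m) f p f′ =
    LogDerivative-⊛ (LogDerivative-∏ m f p (λ i i<m → f′ i (ℕₚ.m<n⇒m<1+n i<m))) (f′ m ℕₚ.≤-refl)

  LogDerivative-∏ᴸ : ∀ {a} {A : Set a} (f p : A → Series) → (∀ x → LogDerivative (f x) (p x)) →
                     ∀ xs → LogDerivative (ΠS.⨁ᴸ f xs) (ΣS.⨁ᴸ p xs)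
  LogDerivative-∏ᴸ f p f′ []       = LogDerivative-1
  LogDerivative-∏ᴸ f p f′ (x ∷ xs) = LogDerivative-⊛ (f′ x) (LogDerivative-∏ᴸ f p f′ xs)

  open Exponentiation 𝕊.commutativeSemiring using () renaming (_^_ to _^S_)

  LogDerivative-^ : ∀ {f p} n → LogDerivative f p → LogDerivative (f ^S n) (λ k → natural n * p k)
  LogDerivative-^ {f} {p} zero    f′ = LogDerivative-cong {𝕊.1#} 𝕊.refl (λ k → sym (zeroˡ (p k))) LogDerivative-1
  LogDerivative-^ {f} {p} (suc n) f′ = LogDerivative-cong {f ⊛ f ^S n} 𝕊.refl
    (λ k → solve 2 (λ n p → p :+ n :* p := (con (+ 1) :+ n) :* p) refl (natural n) (p k))
    (LogDerivative-⊛ f′ (LogDerivative-^ n f′))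

  -- The expansion of x / (1 + x z).
  geometric : Carrier → Series
  geometric x n = x * (- x) ^ n

  linear-geometric : ∀ x → LogDerivative (linear x) (geometric x)
  linear-geometric x zero    = solve 1 (λ x → (con (+ 1) :+ con (+ 0)) :* x := con (+ 1) :* (x :* con (+ 1))) refl x
  linear-geometric x (suc n) = trans (zeroʳ _) (sym (trans (linear-⊛ x (geometric x) n)
    (solve 2 (λ x p → x :* (:- x :* p) :+ x :* (x :* p) := con (+ 0)) refl x ((- x) ^ n))))

  geometric-scale : ∀ a x n → geometric (a * x) n ≈ a ^ suc n * geometric x n
  geometric-scale a x zero    = solve 2 (λ a x → a :* x :* con (+ 1) := a :* con (+ 1) :* (x :* con (+ 1))) refl a x
  geometric-scale a x (suc n) = begin
    a * x * (- (a * x) * (- (a * x)) ^ n)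
      ≈⟨ solve 3 (λ a x p → a :* x :* (:- (a :* x) :* p) := a :* (:- x :* (a :* x :* p))) refl a x ((- (a * x)) ^ n) ⟩
    a * (- x * geometric (a * x) n)
      ≈⟨ *-congˡ (*-congˡ (geometric-scale a x n)) ⟩
    a * (- x * (a ^ suc n * geometric x n))
      ≈⟨ solve 4 (λ a x p q → a :* (:- x :* (p :* (x :* q))) := a :* p :* (x :* (:- x :* q))) refl a x (a ^ suc n) ((- x) ^ n) ⟩
    a ^ suc (suc n) * geometric x (suc n) ∎

  module Exponential (inverse : ℕ → Carrier) (inverse-natural : ∀ n → inverse n * natural (suc n) ≈ 1#) where

    -- f′ = f p determines the coefficient of degree n + 1 from those up to n, because n + 1 is
    -- invertible.
    LogDerivative-unique : ∀ {f g p} → f 0 ≈ g 0 → LogDerivative f p → LogDerivative g p → f ≋ g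
    LogDerivative-unique {f} {g} {p} f₀≈g₀ f′ g′ n = initially n n ℕₚ.≤-refl
      where
      divide : ∀ n {x y} → natural (suc n) * x ≈ natural (suc n) * y → x ≈ y
      divide n {x} {y} eq = begin
        x                                   ≈⟨ *-identityˡ x ⟨
        1# * x                              ≈⟨ *-congʳ (inverse-natural n) ⟨
        inverse n * natural (suc n) * x     ≈⟨ trans (*-assoc _ _ _) (trans (*-congˡ eq) (sym (*-assoc _ _ _))) ⟩
        inverse n * natural (suc n) * y     ≈⟨ *-congʳ (inverse-natural n) ⟩
        1# * y                              ≈⟨ *-identityˡ y ⟩
        y                                   ∎

      agree : ∀ {f g} p n → (∀ i → i ℕ.≤ n → f i ≈ g i) → (f ⊛ p) n ≈ (g ⊛ p) n
      agree p zero    eq = *-congʳ (eq 0 ℕ.z≤n)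
      agree p (suc n) eq = +-cong (*-congʳ (eq 0 ℕ.z≤n)) (agree p n (λ i i≤n → eq (suc i) (ℕ.s≤s i≤n)))

      initially : ∀ n i → i ℕ.≤ n → f i ≈ g i
      initially n       zero    _          = f₀≈g₀
      initially (suc n) (suc i) (ℕ.s≤s i≤n) = divide i (trans (f′ i) (trans
        (agree p i (λ j j≤i → initially n j (ℕₚ.≤-trans j≤i i≤n))) (sym (g′ i))))

    private
      dot : ∀ {n} → Vec Carrier n → Series → Carrier
      dot []       p = 0#
      dot (x ∷ xs) p = x * p 0 + dot xs (tail p)

      -- Course-of-values recursion made structural: all coefficients up to degree n are carried
      -- along, the latest first, and `dot` is then a convolution.
      history : Series → ∀ n → Vec Carrier (suc n)
      history p zero    = 1# ∷ []
      history p (suc n) = inverse n * dot (history p n) p ∷ history p n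

    -- The series with constant term 1 and logarithmic derivative p.
    antilog : Series → Series
    antilog p n = Vec.head (history p n)

    private
      dot-history : ∀ p r n → dot (history p n) r ≈ (antilog p ⊛ r) n
      dot-history p r zero    = +-identityʳ _
      dot-history p r (suc n) = begin
        antilog p (suc n) * r 0 + dot (history p n) (tail r)  ≈⟨ +-congˡ (dot-history p (tail r) n) ⟩
        antilog p (suc n) * r 0 + (antilog p ⊛ tail r) n      ≈⟨ +-comm _ _ ⟩
        (antilog p ⊛ tail r) n + antilog p (suc n) * r 0      ≈⟨ ⊛-tailʳ (antilog p) r n ⟨
        (antilog p ⊛ r) (suc n)                               ∎

    antilog-suc : ∀ p n → antilog p (suc n) ≈ inverse n * (antilog p ⊛ p) n
    antilog-suc p n = *-congˡ (dot-history p p n)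

    antilog-LogDerivative : ∀ p → LogDerivative (antilog p) p
    antilog-LogDerivative p n = begin
      natural (suc n) * antilog p (suc n)                   ≈⟨ *-congˡ (antilog-suc p n) ⟩
      natural (suc n) * (inverse n * (antilog p ⊛ p) n)     ≈⟨ trans (sym (*-assoc _ _ _)) (*-congʳ (trans (*-comm _ _) (inverse-natural n))) ⟩
      1# * (antilog p ⊛ p) n                                ≈⟨ *-identityˡ _ ⟩
      (antilog p ⊛ p) n                                     ∎

    -- This replaces the quotient f / g. When p - r tends to 0 the extra factor tends to 1, which is
    -- how limits of products are compared through power sums.
    LogDerivative-perturb : ∀ {f g p r} → f 0 ≈ 1# → g 0 ≈ 1# → LogDerivative f p → LogDerivative g r →
                            f ≋ g ⊛ antilog (p 𝕊.- r)
    LogDerivative-perturb {f} {g} {p} {r} f₀ g₀ f′ g′ = LogDerivative-unique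
      (trans f₀ (sym (trans (*-identityʳ _) g₀))) f′
      (LogDerivative-cong {g ⊛ antilog (p 𝕊.- r)} 𝕊.refl
        (λ n → solve 2 (λ p r → r :+ (p :- r) := p) refl (p n) (r n))
        (LogDerivative-⊛ g′ (antilog-LogDerivative (p 𝕊.- r))))

    expSeries : Carrier → Series
    expSeries a zero    = 1#
    expSeries a (suc n) = inverse n * (a * expSeries a n)

    expSeries-LogDerivative : ∀ a → LogDerivative (expSeries a) (constant a)
    expSeries-LogDerivative a n = begin
      natural (suc n) * (inverse n * (a * expSeries a n))
        ≈⟨ trans (sym (*-assoc _ _ _)) (*-congʳ (trans (*-comm _ _) (inverse-natural n))) ⟩
      1# * (a * expSeries a n)         ≈⟨ *-identityˡ _ ⟩
      a * expSeries a n                ≈⟨ constant-⊛ a (expSeries a) n ⟨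
      (constant a ⊛ expSeries a) n     ≈⟨ ⊛-comm (constant a) (expSeries a) n ⟩
      (expSeries a ⊛ constant a) n     ∎

    -- Both sides have constant term 1 and the constant logarithmic derivative a + b; no binomial
    -- theorem is involved.
    expSeries-+ : ∀ a b → expSeries a ⊛ expSeries b ≋ expSeries (a + b)
    expSeries-+ a b = LogDerivative-unique (*-identityˡ _)
      (LogDerivative-cong {expSeries a ⊛ expSeries b} 𝕊.refl
        (λ { zero → refl ; (suc n) → +-identityˡ _ })
        (LogDerivative-⊛ (expSeries-LogDerivative a) (expSeries-LogDerivative b)))
      (expSeries-LogDerivative (a + b))

    expSeries-cong : ∀ {a b} → a ≈ b → expSeries a ≋ expSeries b
    expSeries-cong a≈b zero    = refl
    expSeries-cong a≈b (suc n) = *-congˡ (*-cong a≈b (expSeries-cong a≈b n))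

    expSeries-* : ∀ a b n → expSeries (a * b) n ≈ a ^ n * expSeries b n
    expSeries-* a b zero    = sym (*-identityˡ _)
    expSeries-* a b (suc n) = trans (*-congˡ (*-congˡ (expSeries-* a b n)))
      (solve 5 (λ i a b p e → i :* (a :* b :* (p :* e)) := a :* p :* (i :* (b :* e))) refl _ a b _ _)

-- Rational arithmetic and inequalities.

module RationalArithmetic where
  open import Algebra.Bundles using (CommutativeRing)
  open import Algebra.Structures using (IsCommutativeRing)
  open import Data.Integer.Base as ℤ using (ℤ; +_; -[1+_])
  open import Data.Nat.Base as ℕ using (ℕ; zero; suc)
  import Data.Nat.Properties as ℕₚ
  open import Data.Product using (∃; _×_; _,_; proj₁; proj₂)
  open import Data.Rational.Base as ℚ using (ℚ; 0ℚ; 1ℚ; ½; _≤_; _<_; _/_)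
  import Data.Rational.Properties as ℚₚ
  import Data.Rational.Unnormalised.Base as ℚᵘ
  open import Data.Sum.Base using (_⊎_; inj₁; inj₂)
  open import Defs using (fromℚᵘ-homo-*; /-suc; inv; 1/-*)
  open import Function.Base using (_∘_)
  open import Level using (0ℓ)
  open import Relation.Binary.PropositionalEquality
  open import Relation.Nullary using (¬_)

  -- Rational arithmetic behind opaque operations, so that unification treats them as
  -- injective and never normalises fractions.
  module Q where
    open ℚₚ public using (≤-refl; ≤-trans; ≤-reflexive; <⇒≤; <-≤-trans; ≤-<-trans; ≤-antisym; <-irrefl; ≤-total; _<?_; _≤?_; ≮⇒≥; module ≤-Reasoning)

    infixl 6 _+_ _-_
    infixl 7 _*_
    infix  8 -_

    opaque
      _+_ _*_ : ℚ → ℚ → ℚ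
      _+_ = ℚ._+_
      _*_ = ℚ._*_

      -_ ∣_∣ : ℚ → ℚ
      -_   = ℚ.-_
      ∣_∣ = ℚ.∣_∣

    _-_ : ℚ → ℚ → ℚ
    p - q = p + - q

    opaque
      unfolding _+_ _*_ -_ ∣_∣

      neg-≡ : ∀ p → - p ≡ ℚ.- p
      neg-≡ p = refl

      isCommutativeRing : IsCommutativeRing _≡_ _+_ _*_ -_ 0ℚ 1ℚ
      isCommutativeRing = ℚₚ.+-*-isCommutativeRing

      +-mono-≤ : ∀ {p q r s} → p ≤ q → r ≤ s → p + r ≤ q + s
      +-mono-≤ = ℚₚ.+-mono-≤
      +-mono-<-≤ : ∀ {p q r s} → p < q → r ≤ s → p + r < q + s
      +-mono-<-≤ = ℚₚ.+-mono-<-≤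
      +-monoˡ-≤ : ∀ r {p q} → p ≤ q → p + r ≤ q + r
      +-monoˡ-≤ = ℚₚ.+-monoˡ-≤
      +-monoʳ-≤ : ∀ r {p q} → p ≤ q → r + p ≤ r + q
      +-monoʳ-≤ = ℚₚ.+-monoʳ-≤
      +-monoʳ-< : ∀ r {p q} → p < q → r + p < r + q
      +-monoʳ-< = ℚₚ.+-monoʳ-<
      neg-antimono-≤ : ∀ {p q} → p ≤ q → - q ≤ - p
      neg-antimono-≤ = ℚₚ.neg-antimono-≤
      *-monoˡ : ∀ {a b c} → 0ℚ ≤ c → a ≤ b → c * a ≤ c * b
      *-monoˡ {c = c} 0≤c = ℚₚ.*-monoˡ-≤-nonNeg c {{ℚ.nonNegative 0≤c}}
      *-monoʳ : ∀ {a b c} → 0ℚ ≤ c → a ≤ b → a * c ≤ b * c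
      *-monoʳ {c = c} 0≤c = ℚₚ.*-monoʳ-≤-nonNeg c {{ℚ.nonNegative 0≤c}}
      *-cancelʳ : ∀ {a b c} → 0ℚ < c → a * c ≤ b * c → a ≤ b
      *-cancelʳ {c = c} 0<c = ℚₚ.*-cancelʳ-≤-pos c {{ℚ.positive 0<c}}
      *-cancelʳ-< : ∀ {a b c} → 0ℚ < c → a * c < b * c → a < b
      *-cancelʳ-< {a} {b} {c} 0<c = ℚₚ.*-cancelʳ-<-nonNeg c {{ℚ.nonNegative (ℚₚ.<⇒≤ 0<c)}} {a} {b}
      0≤p⇒∣p∣≡p : ∀ {p} → 0ℚ ≤ p → ∣ p ∣ ≡ p
      0≤p⇒∣p∣≡p = ℚₚ.0≤p⇒∣p∣≡p
      0≤∣p∣ : ∀ p → 0ℚ ≤ ∣ p ∣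
      0≤∣p∣ = ℚₚ.0≤∣p∣
      ∣-p∣≡∣p∣ : ∀ p → ∣ - p ∣ ≡ ∣ p ∣
      ∣-p∣≡∣p∣ = ℚₚ.∣-p∣≡∣p∣
      ∣p∣≡p∨∣p∣≡-p : ∀ p → ∣ p ∣ ≡ p ⊎ ∣ p ∣ ≡ - p
      ∣p∣≡p∨∣p∣≡-p = ℚₚ.∣p∣≡p∨∣p∣≡-p
      ∣p*q∣≡∣p∣*∣q∣ : ∀ p q → ∣ p * q ∣ ≡ ∣ p ∣ * ∣ q ∣
      ∣p*q∣≡∣p∣*∣q∣ = ℚₚ.∣p*q∣≡∣p∣*∣q∣
      *-monoʳ-< : ∀ {a b c} → 0ℚ < c → a < b → a * c < b * c
      *-monoʳ-< {c = c} 0<c = ℚₚ.*-monoˡ-<-pos c {{ℚ.positive 0<c}}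
      p<q⇒0<q-p : ∀ {p q} → p < q → 0ℚ < q + - p
      p<q⇒0<q-p {p} {q} p<q = subst (_< q ℚ.- p) (ℚₚ.+-inverseʳ p) (ℚₚ.+-monoˡ-< (ℚ.- p) p<q)
      0<* : ∀ {a b} → 0ℚ < a → 0ℚ < b → 0ℚ < a * b
      0<* = Defs.0<*
      0≤* : ∀ {a b} → 0ℚ ≤ a → 0ℚ ≤ b → 0ℚ ≤ a * b
      0≤* = Defs.0≤*
      0≤+ : ∀ {a b} → 0ℚ ≤ a → 0ℚ ≤ b → 0ℚ ≤ a + b
      0≤+ = ℚₚ.+-mono-≤
      0<+ : ∀ {a b} → 0ℚ < a → 0ℚ ≤ b → 0ℚ < a + b
      0<+ = ℚₚ.+-mono-<-≤
      minus-≤ : ∀ {a b} → 0ℚ ≤ b → a + - b ≤ a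
      minus-≤ {a} {b} 0≤b = subst (a ℚ.- b ≤_) (ℚₚ.+-identityʳ a) (ℚₚ.+-monoʳ-≤ a (ℚₚ.neg-antimono-≤ 0≤b))
      half+half : ∀ ε → ε * ½ + ε * ½ ≡ ε
      half+half = Defs.half+half
      0<½* : ∀ {ε} → 0ℚ < ε → 0ℚ < ε * ½
      0<½* = Defs.0<½*
      *-inv : ∀ p → 0ℚ < p → p * inv p ≡ 1ℚ
      *-inv = Defs.*-inv

    commutativeRing : CommutativeRing 0ℓ 0ℓ
    commutativeRing = record { isCommutativeRing = isCommutativeRing }

    open CommutativeRing commutativeRing public using (+-comm; +-assoc; +-identityˡ; +-identityʳ; *-comm; *-assoc; *-identityˡ; *-identityʳ)
      renaming (zeroˡ to *-zeroˡ; zeroʳ to *-zeroʳ; -‿inverseʳ to +-inverseʳ; -‿inverseˡ to +-inverseˡ)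

    0<inv : ∀ p → 0ℚ < p → 0ℚ < inv p
    0<inv = Defs.0<inv

  module ℚS = IntegerSolver Q.commutativeRing

  module Rationals where
    open Q using (_+_; _*_; -_; _-_; ∣_∣)
    open Q public using (*-monoˡ; *-monoʳ; *-cancelʳ; 0<*; 0≤*; 0≤+; 0<+; minus-≤; half+half; 0<½*; *-inv; 0<inv)

    open Q.≤-Reasoning

    opaque
      unfolding Q._+_ Q._*_ Q.-_ Q.∣_∣

      1/[1+_] : ℕ → ℚ
      1/[1+ n ] = + 1 / suc n

      ν : ℕ → ℚ
      ν n = + n / 1

      1/[1+]-≡ : ∀ n → 1/[1+ n ] ≡ + 1 / suc n
      1/[1+]-≡ n = refl

      ν-0 : ν 0 ≡ 0ℚ
      ν-0 = refl

      ν-suc : ∀ n → ν (suc n) ≡ 1ℚ + ν n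
      ν-suc n = trans (/-suc n 0) (Q.+-comm (+ n / 1) 1ℚ)

      1/[1+n]*ν : ∀ n → 1/[1+ n ] * ν (suc n) ≡ 1ℚ
      1/[1+n]*ν n = trans (sym (fromℚᵘ-homo-* (ℚᵘ.mkℚᵘ (+ 1) n) (ℚᵘ.mkℚᵘ (+ suc n) 0)))
        (ℚₚ.fromℚᵘ-cong {ℚᵘ.mkℚᵘ (+ 1) n ℚᵘ.* ℚᵘ.mkℚᵘ (+ suc n) 0} {ℚᵘ.mkℚᵘ (+ 1) 0}
          (ℚᵘ.*≡* (cong (λ k → + suc k) (trans (ℕₚ.*-identityʳ _) (cong (ℕ._+ 0) (sym (ℕₚ.*-identityʳ n)))))))

      0<1/ : ∀ n → 0ℚ < 1/[1+ n ]
      0<1/ = Defs.0<1/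

      1/-antimono : ∀ {m n} → m ℕ.≤ n → 1/[1+ n ] ≤ 1/[1+ m ]
      1/-antimono {m} {n} = Defs.1/-antimono {m} {n}

      archimedean : ∀ ε → 0ℚ < ε → ∃ λ N → 1/[1+ N ] ≤ ε
      archimedean = Defs.archimedean

      1/≤1 : ∀ n → 1/[1+ n ] ≤ 1ℚ
      1/≤1 n = 1/-antimono {0} {n} ℕ.z≤n

      1/[1+0]≡1 : 1/[1+ 0 ] ≡ 1ℚ
      1/[1+0]≡1 = refl

      1/-halve : ∀ n → 1/[1+ n ] * ½ ≤ 1/[1+ suc n ]
      1/-halve n = begin
        + 1 / suc n ℚ.* ½        ≡⟨ 1/-* (suc n) 2 ⟨
        + 1 / (suc n ℕ.* 2)      ≤⟨ 1/-antimono {suc n} {suc (n ℕ.* 2)} (ℕ.s≤s (ℕₚ.m≤m*n n 2)) ⟩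
        1/[1+ suc n ]            ∎

    2ℚ 4ℚ : ℚ
    2ℚ = 1ℚ + 1ℚ
    4ℚ = 2ℚ + 2ℚ

    opaque
      unfolding Q._+_ Q._*_

      4*½*½ : 4ℚ * (½ * ½) ≡ 1ℚ
      4*½*½ = refl

      ½+½ : ½ + ½ ≡ 1ℚ
      ½+½ = refl

      ½*2 : ½ * 2ℚ ≡ 1ℚ
      ½*2 = refl

    0<1 : 0ℚ < 1ℚ
    0<1 = ℚₚ.positive⁻¹ 1ℚ

    0≤ν : ∀ n → 0ℚ ≤ ν n
    0≤ν zero    = Q.≤-reflexive (sym ν-0)
    0≤ν (suc n) = subst (0ℚ ≤_) (sym (ν-suc n)) (0≤+ (Q.<⇒≤ (ℚₚ.positive⁻¹ 1ℚ)) (0≤ν n))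

    0<ν[1+_] : ∀ n → 0ℚ < ν (suc n)
    0<ν[1+ n ] = subst (0ℚ <_) (sym (ν-suc n)) (0<+ (ℚₚ.positive⁻¹ 1ℚ) (0≤ν n))

    1≤ν[1+_] : ∀ n → 1ℚ ≤ ν (suc n)
    1≤ν[1+ n ] = subst₂ _≤_ (Q.+-identityʳ 1ℚ) (sym (ν-suc n)) (Q.+-monoʳ-≤ 1ℚ (0≤ν n))

    ν-<-suc : ∀ n → ν n < ν (suc n)
    ν-<-suc n = subst₂ _<_ (Q.+-identityʳ (ν n)) (trans (Q.+-comm (ν n) 1ℚ) (sym (ν-suc n))) (Q.+-monoʳ-< (ν n) 0<1)

    ν-mono : ∀ {m n} → m ℕ.≤ n → ν m ≤ ν n
    ν-mono {n = n} ℕ.z≤n = subst (_≤ ν n) (sym ν-0) (0≤ν n)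
    ν-mono (ℕ.s≤s {m} {n} m≤n) = subst₂ _≤_ (sym (ν-suc m)) (sym (ν-suc n)) (Q.+-monoʳ-≤ 1ℚ (ν-mono m≤n))

    ν-+ : ∀ m n → ν (m ℕ.+ n) ≡ ν m + ν n
    ν-+ zero    n = sym (trans (cong (_+ ν n) ν-0) (Q.+-identityˡ (ν n)))
    ν-+ (suc m) n = trans (ν-suc (m ℕ.+ n)) (trans (cong (λ t → 1ℚ + t) (ν-+ m n))
      (trans (sym (Q.+-assoc 1ℚ (ν m) (ν n))) (cong (_+ ν n) (sym (ν-suc m)))))

    ν-* : ∀ m n → ν (m ℕ.* n) ≡ ν m * ν n
    ν-* zero    n = trans ν-0 (sym (trans (cong (_* ν n) ν-0) (Q.*-zeroˡ (ν n))))
    ν-* (suc m) n = trans (ν-+ n (m ℕ.* n)) (trans (cong (λ t → ν n + t) (ν-* m n))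
      (trans (ℚS.solve 2 (λ a b → b :+ a :* b := (con (+ 1) :+ a) :* b) refl (ν m) (ν n)) (cong (_* ν n) (sym (ν-suc m)))))
      where open ℚS

    0≤1/ : ∀ n → 0ℚ ≤ 1/[1+ n ]
    0≤1/ n = Q.<⇒≤ (0<1/ n)

    <⇒≱ : ∀ {a b} → a < b → ¬ b ≤ a
    <⇒≱ a<b b≤a = Q.<-irrefl refl (Q.<-≤-trans a<b b≤a)

    *-cancelʳ-≡ : ∀ {a b c} → 0ℚ < c → a * c ≡ b * c → a ≡ b
    *-cancelʳ-≡ 0<c eq = Q.≤-antisym (*-cancelʳ 0<c (Q.≤-reflexive eq)) (*-cancelʳ 0<c (Q.≤-reflexive (sym eq)))

    0≤1 : 0ℚ ≤ 1ℚ
    0≤1 = Q.<⇒≤ (ℚₚ.positive⁻¹ 1ℚ)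

    ≤-steps : ∀ {a b c} → 0ℚ ≤ c → a ≤ b → a ≤ b + c
    ≤-steps {a} {b} 0≤c a≤b = subst (_≤ b + _) (Q.+-identityʳ a) (Q.+-mono-≤ a≤b 0≤c)

    ½≤1 : ½ ≤ 1ℚ
    ½≤1 = Q.≤-trans (≤-steps (Q.<⇒≤ (ℚₚ.positive⁻¹ ½)) Q.≤-refl) (Q.≤-reflexive ½+½)

    0≤2 : 0ℚ ≤ 2ℚ
    0≤2 = 0≤+ 0≤1 0≤1

    0≤4 : 0ℚ ≤ 4ℚ
    0≤4 = 0≤+ 0≤2 0≤2

    0<2 : 0ℚ < 2ℚ
    0<2 = 0<+ 0<1 0≤1

    0≤1+ : ∀ {a} → 0ℚ ≤ a → 0ℚ < 1ℚ + a
    0≤1+ 0≤a = 0<+ 0<1 0≤a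

    -- δ = ε / (1 + A); the summand 1 keeps the denominator positive when A = 0.
    shrink : ∀ A → 0ℚ ≤ A → ∀ ε → 0ℚ < ε → ∃ λ δ → 0ℚ < δ × A * δ ≤ ε
    shrink A 0≤A ε 0<ε = ε * i , 0<* 0<ε (0<inv _ 0<1+A) , (begin
      A * (ε * i)          ≤⟨ *-monoʳ (Q.<⇒≤ (0<* 0<ε (0<inv _ 0<1+A))) A≤1+A ⟩
      (1ℚ + A) * (ε * i)   ≡⟨ ℚS.solve 3 (λ a e i → a ℚS.:* (e ℚS.:* i) ℚS.:= e ℚS.:* (a ℚS.:* i)) refl (1ℚ + A) ε i ⟩
      ε * ((1ℚ + A) * i)   ≡⟨ cong (ε *_) (*-inv _ 0<1+A) ⟩
      ε * 1ℚ               ≡⟨ Q.*-identityʳ ε ⟩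
      ε ∎)
      where
      0<1+A = 0≤1+ 0≤A
      i = inv (1ℚ + A)
      A≤1+A : A ≤ 1ℚ + A
      A≤1+A = subst (_≤ 1ℚ + A) (Q.+-identityˡ A) (Q.+-monoˡ-≤ A 0≤1)

    1/-small : ∀ A → 0ℚ ≤ A → ∀ ε → 0ℚ < ε → ∃ λ N → ∀ n → N ℕ.≤ n → A * 1/[1+ n ] ≤ ε
    1/-small A 0≤A ε 0<ε =
      let (δ , 0<δ , Aδ≤ε) = shrink A 0≤A ε 0<ε
          (N , 1/N≤δ) = archimedean δ 0<δ
      in N , λ n N≤n → Q.≤-trans (*-monoˡ 0≤A (Q.≤-trans (1/-antimono N≤n) 1/N≤δ)) Aδ≤ε

    -- 1 / (n + 2)² is at most 1 / ((n + 1) (n + 2)), whose partial fractions telescope. It bounds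
    -- tails of the sum of inverse squares.
    1/-telescope : ∀ n → 1/[1+ suc n ] * 1/[1+ suc n ] ≤ 1/[1+ n ] - 1/[1+ suc n ]
    1/-telescope n = begin
      b * b   ≤⟨ *-monoʳ (0≤1/ (suc n)) (1/-antimono {n} (ℕₚ.n≤1+n n)) ⟩
      a * b   ≡⟨ solve 3 (λ a b v → a :* b := a :* (b :* (con (+ 1) :+ v)) :- b :* (a :* v)) refl a b v ⟩
      a * (b * (1ℚ + v)) - b * (a * v)
              ≡⟨ cong₂ (λ s t → a * s - b * t) (trans (cong (b *_) (sym (ν-suc (suc n)))) (1/[1+n]*ν (suc n))) (1/[1+n]*ν n) ⟩
      a * 1ℚ - b * 1ℚ ≡⟨ cong₂ _-_ (Q.*-identityʳ a) (Q.*-identityʳ b) ⟩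
      a - b ∎
      where
      open ℚS
      a = 1/[1+ n ] ; b = 1/[1+ suc n ] ; v = ν (suc n)

    ½^_ : ℕ → ℚ
    ½^ zero  = 1ℚ
    ½^ suc n = ½ * ½^ n

    0<½^ : ∀ n → 0ℚ < ½^ n
    0<½^ zero    = 0<1
    0<½^ (suc n) = 0<* (ℚₚ.positive⁻¹ ½) (0<½^ n)

    ½^-+ : ∀ m n → ½^ (m ℕ.+ n) ≡ ½^ m * ½^ n
    ½^-+ zero    n = sym (Q.*-identityˡ (½^ n))
    ½^-+ (suc m) n = trans (cong (½ *_) (½^-+ m n)) (sym (Q.*-assoc ½ (½^ m) (½^ n)))

    ½^≤1/ : ∀ n → ½^ n ≤ 1/[1+ n ]
    ½^≤1/ zero    = Q.≤-reflexive (sym 1/[1+0]≡1)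
    ½^≤1/ (suc n) = begin
      ½ * ½^ n                 ≤⟨ *-monoˡ (Q.<⇒≤ (ℚₚ.positive⁻¹ ½)) (½^≤1/ n) ⟩
      ½ * 1/[1+ n ]            ≡⟨ Q.*-comm ½ 1/[1+ n ] ⟩
      1/[1+ n ] * ½            ≤⟨ 1/-halve n ⟩
      1/[1+ suc n ]            ∎

    eventually-decreasing-bounded : ∀ K (v : ℕ → ℚ) → (∀ k → 0ℚ ≤ v k) → (∀ k → K ℕ.≤ k → v (suc k) ≤ v k) →
                                    ∃ λ C → 0ℚ ≤ C × (∀ k → v k ≤ C)
    eventually-decreasing-bounded zero    v 0≤v dec = v 0 , 0≤v 0 , bound
      where
      bound : ∀ k → v k ≤ v 0
      bound zero    = Q.≤-refl
      bound (suc k) = Q.≤-trans (dec k ℕ.z≤n) (bound k)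
    eventually-decreasing-bounded (suc K) v 0≤v dec
      with C , 0≤C , ≤C ← eventually-decreasing-bounded K (v ∘ suc) (0≤v ∘ suc) (λ k K≤k → dec (suc k) (ℕ.s≤s K≤k))
      = v 0 + C , 0≤+ (0≤v 0) 0≤C , λ
        { zero    → ≤-steps 0≤C Q.≤-refl
        ; (suc k) → subst (v (suc k) ≤_) (Q.+-comm C (v 0)) (≤-steps (0≤v 0) (≤C k)) }

    -- Bᵏ / k! = O(4⁻ᵏ).
    factorial-beats-quarter : ∀ B → 0ℚ ≤ B → (b : ℕ → ℚ) → (∀ k → 0ℚ ≤ b k) → (∀ k → b (suc k) ≡ B * 1/[1+ k ] * b k) →
                              ∃ λ C → 0ℚ ≤ C × (∀ k → b k ≤ C * (½^ k * ½^ k))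
    factorial-beats-quarter B 0≤B b 0≤b b-suc =
      -- From `N` on, 4 B / (k + 1) ≤ 1, so 4ᵏ b k no longer increases.
      let (N , small) = 1/-small (4ℚ * B) (0≤* 0≤4 0≤B) 1ℚ 0<1
          (C , 0≤C , v≤C) = eventually-decreasing-bounded N v 0≤v λ k N≤k → begin
            v (suc k)                          ≡⟨ v-suc k ⟩
            4ℚ * B * 1/[1+ k ] * v k          ≤⟨ *-monoʳ (0≤v k) (small k N≤k) ⟩
            1ℚ * v k                           ≡⟨ Q.*-identityˡ (v k) ⟩
            v k                                ∎
      in C , 0≤C , λ k → begin
        b k                                    ≡⟨ 2^½^ k ⟨
        v k * (½^ k * ½^ k)                    ≤⟨ *-monoʳ (0≤* (Q.<⇒≤ (0<½^ k)) (Q.<⇒≤ (0<½^ k))) (v≤C k) ⟩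
        C * (½^ k * ½^ k)                      ∎
      where
      open ℚS
      4^_ : ℕ → ℚ
      4^ zero = 1ℚ
      4^ suc k = 4ℚ * 4^ k
      v : ℕ → ℚ
      v k = 4^ k * b k
      0≤4^ : ∀ k → 0ℚ ≤ 4^ k
      0≤4^ zero = 0≤1
      0≤4^ (suc k) = 0≤* 0≤4 (0≤4^ k)
      0≤v : ∀ k → 0ℚ ≤ v k
      0≤v k = 0≤* (0≤4^ k) (0≤b k)
      v-suc : ∀ k → v (suc k) ≡ 4ℚ * B * 1/[1+ k ] * v k
      v-suc k = trans (cong (4ℚ * 4^ k *_) (b-suc k))
        (solve 5 (λ f p B r b → f :* p :* (B :* r :* b) := f :* B :* r :* (p :* b)) refl (4ℚ) (4^ k) B 1/[1+ k ] (b k))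
      4^½^ : ∀ k → 4^ k * (½^ k * ½^ k) ≡ 1ℚ
      4^½^ zero = trans (Q.*-identityˡ (1ℚ * 1ℚ)) (Q.*-identityˡ 1ℚ)
      4^½^ (suc k) = trans (solve 4 (λ f g p h → f :* p :* (g :* h :* (g :* h)) := f :* (g :* g) :* (p :* (h :* h))) refl 4ℚ ½ (4^ k) (½^ k))
        (trans (cong₂ _*_ 4*½*½ (4^½^ k)) (Q.*-identityˡ 1ℚ))
      2^½^ : ∀ k → v k * (½^ k * ½^ k) ≡ b k
      2^½^ k = trans (solve 3 (λ p b w → p :* b :* w := b :* (p :* w)) refl (4^ k) (b k) (½^ k * ½^ k))
        (trans (cong (b k *_) (4^½^ k)) (Q.*-identityʳ (b k)))

  open Rationals public

open RationalArithmetic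

-- Normed algebras over the rationals.

infix 4 _≤ℚ_ _<ℚ_
infixl 7 _*ℚ_
infixl 6 _+ℚ_
_≤ℚ_ _<ℚ_ : ℚ → ℚ → Set
_≤ℚ_ = ℚ._≤_
_<ℚ_ = ℚ._<_
_*ℚ_ _+ℚ_ : ℚ → ℚ → ℚ
_*ℚ_ = Q._*_
_+ℚ_ = Q._+_

-- The norm is present only through its rational upper bounds: x ≲ r reads ‖x‖ ≤ r.
record NormedAlgebra : Set₁ where
  infix 4 _≲_
  field
    commutativeRing : CommutativeRing 0ℓ 0ℓ
  open CommutativeRing commutativeRing public
  field
    _≲_    : Carrier → ℚ → Set
    ≲-resp : ∀ {x y r} → x ≈ y → x ≲ r → y ≲ r
    ≲-mono : ∀ {x r s} → r ≤ℚ s → x ≲ r → x ≲ s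
    ≲-+    : ∀ {x y r s} → x ≲ r → y ≲ s → x + y ≲ r +ℚ s
    ≲-neg  : ∀ {x r} → x ≲ r → - x ≲ r
    ≲-*    : ∀ {x y r s} → 0ℚ ≤ℚ r → 0ℚ ≤ℚ s → x ≲ r → y ≲ s → x * y ≲ r *ℚ s
    ≲-0    : ∀ {x} → (∀ ε → 0ℚ <ℚ ε → x ≲ ε) → x ≈ 0#
    ≲-closed : ∀ {x r} → (∀ ε → 0ℚ <ℚ ε → x ≲ r +ℚ ε) → x ≲ r
    bound  : ∀ x → ∃ λ B → 0ℚ ≤ℚ B × x ≲ B
    ι      : ℚ → Carrier
    ι-+    : ∀ p q → ι (p +ℚ q) ≈ ι p + ι q
    ι-*    : ∀ p q → ι (p *ℚ q) ≈ ι p * ι q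
    ι-1    : ι 1ℚ ≈ 1#
    ι-0    : ι 0ℚ ≈ 0#
    ι-≲    : ∀ p → ι p ≲ Q.∣ p ∣

-- Limits of sequences and series, and dominated convergence.

module Limits (V : NormedAlgebra) where
  open NormedAlgebra V public
  open IntegerSolver commutativeRing public using (solve; _:=_; _:+_; _:*_; _:-_; :-_; con)
  open Exponentiation commutativeSemiring public using (_^_; ^-congˡ; ^-distrib-*)
  open SetoidReasoning setoid
  open LogarithmicDerivative commutativeRing public

  ι-neg : ∀ p → ι (Q.- p) ≈ - ι p
  ι-neg p = begin
    ι (Q.- p)                      ≈⟨ solve 2 (λ a b → a := (a :+ b) :- b) refl (ι (Q.- p)) (ι p) ⟩
    (ι (Q.- p) + ι p) - ι p        ≈⟨ +-congʳ (trans (sym (ι-+ (Q.- p) p)) (trans (reflexive (≡.cong ι (Q.+-inverseˡ p))) ι-0)) ⟩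
    0# - ι p                       ≈⟨ +-identityˡ _ ⟩
    - ι p                          ∎

  ι-≥ : ∀ {p} → 0ℚ ≤ℚ p → ι p ≲ p
  ι-≥ {p} 0≤p = subst (ι p ≲_) (Q.0≤p⇒∣p∣≡p 0≤p) (ι-≲ p)

  ι-ν : ∀ n → ι (ν n) ≈ natural n
  ι-ν zero    = trans (reflexive (≡.cong ι ν-0)) ι-0
  ι-ν (suc n) = trans (reflexive (≡.cong ι (ν-suc n))) (trans (ι-+ 1ℚ (ν n)) (+-cong ι-1 (ι-ν n)))

  ι-inverse : ∀ {p q} → p *ℚ q ≡ 1ℚ → ι p * ι q ≈ 1#
  ι-inverse {p} {q} eq = trans (sym (ι-* p q)) (trans (reflexive (≡.cong ι eq)) ι-1)

  inverse : ℕ → Carrier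
  inverse n = ι 1/[1+ n ]

  inverse-natural : ∀ n → inverse n * natural (suc n) ≈ 1#
  inverse-natural n = trans (*-congˡ (sym (ι-ν (suc n)))) (ι-inverse (1/[1+n]*ν n))

  open Exponential inverse inverse-natural public

  ≲-≡ : ∀ {x r s} → r ≡ s → x ≲ r → x ≲ s
  ≲-≡ ≡.refl x≲ = x≲

  0≲ : ∀ {r} → 0ℚ ≤ℚ r → 0# ≲ r
  0≲ 0≤r = ≲-mono 0≤r (≲-resp ι-0 (ι-≥ Q.≤-refl))

  1≲ : 1# ≲ 1ℚ
  1≲ = ≲-resp ι-1 (ι-≥ 0≤1)

  ≲-- : ∀ {x y r s} → x ≲ r → y ≲ s → x - y ≲ r +ℚ s
  ≲-- x≲ y≲ = ≲-+ x≲ (≲-neg y≲)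

  infix 4 _⟶_

  Null : (ℕ → Carrier) → Set
  Null s = ∀ ε → 0ℚ <ℚ ε → ∃ λ N → ∀ n → N ℕ.≤ n → s n ≲ ε

  _⟶_ : (ℕ → Carrier) → Carrier → Set
  s ⟶ l = Null (λ n → s n - l)

  Bounded : (ℕ → Carrier) → Set
  Bounded s = ∃ λ B → 0ℚ ≤ℚ B × ∃ λ N → ∀ n → N ℕ.≤ n → s n ≲ B

  Null-cong : ∀ {s t} → (∀ n → s n ≈ t n) → Null s → Null t
  Null-cong s≈t s→0 ε 0<ε = let (N , s≲) = s→0 ε 0<ε in N , λ n N≤n → ≲-resp (s≈t n) (s≲ n N≤n)

  Null-0 : Null (λ _ → 0#)
  Null-0 ε 0<ε = 0 , λ _ _ → 0≲ (Q.<⇒≤ 0<ε)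

  Null-+ : ∀ {s t} → Null s → Null t → Null (λ n → s n + t n)
  Null-+ {s} {t} s→0 t→0 ε 0<ε =
    let (M , s≲) = s→0 (ε *ℚ ½) (0<½* 0<ε)
        (N , t≲) = t→0 (ε *ℚ ½) (0<½* 0<ε)
    in M ℕ.⊔ N , λ n le → ≲-≡ (half+half ε)
      (≲-+ (s≲ n (ℕₚ.m⊔n≤o⇒m≤o M N le)) (t≲ n (ℕₚ.m⊔n≤o⇒n≤o M N le)))

  Null-neg : ∀ {s} → Null s → Null (λ n → - s n)
  Null-neg s→0 ε 0<ε = let (N , s≲) = s→0 ε 0<ε in N , λ n N≤n → ≲-neg (s≲ n N≤n)

  Null-* : ∀ {s t} → Bounded s → Null t → Null (λ n → s n * t n)
  Null-* {s} {t} (B , 0≤B , M , s≲B) t→0 ε 0<ε =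
    let (δ , 0<δ , Bδ≤ε) = shrink B 0≤B ε 0<ε
        (N , t≲) = t→0 δ 0<δ
    in M ℕ.⊔ N , λ n le → ≲-mono Bδ≤ε
      (≲-* 0≤B (Q.<⇒≤ 0<δ) (s≲B n (ℕₚ.m⊔n≤o⇒m≤o M N le)) (t≲ n (ℕₚ.m⊔n≤o⇒n≤o M N le)))

  Bounded-constant : ∀ x → Bounded (λ _ → x)
  Bounded-constant x = let (B , 0≤B , x≲B) = bound x in B , 0≤B , 0 , λ _ _ → x≲B

  Null⇒Bounded : ∀ {s} → Null s → Bounded s
  Null⇒Bounded s→0 = 1ℚ , 0≤1 , s→0 1ℚ 0<1

  Bounded-+ : ∀ {s t} → Bounded s → Bounded t → Bounded (λ n → s n + t n)
  Bounded-+ (A , 0≤A , M , s≲) (B , 0≤B , N , t≲) = A +ℚ B , 0≤+ 0≤A 0≤B , M ℕ.⊔ N , λ n le →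
    ≲-+ (s≲ n (ℕₚ.m⊔n≤o⇒m≤o M N le)) (t≲ n (ℕₚ.m⊔n≤o⇒n≤o M N le))

  Bounded-cong : ∀ {s t} → (∀ n → s n ≈ t n) → Bounded s → Bounded t
  Bounded-cong s≈t (B , 0≤B , N , s≲) = B , 0≤B , N , λ n N≤n → ≲-resp (s≈t n) (s≲ n N≤n)

  Null-squeeze : ∀ {s} A → 0ℚ ≤ℚ A → (∀ n → s n ≲ A *ℚ 1/[1+ n ]) → Null s
  Null-squeeze A 0≤A s≲ ε 0<ε = let (N , small) = 1/-small A 0≤A ε 0<ε in N , λ n N≤n → ≲-mono (small n N≤n) (s≲ n)

  Null-compose : ∀ {s} (m : ℕ → ℕ) → (∀ K → ∃ λ N → ∀ n → N ℕ.≤ n → K ℕ.≤ m n) → Null s → Null (s ∘ m)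
  Null-compose m m→∞ s→0 ε 0<ε =
    let (K , s≲) = s→0 ε 0<ε ; (N , K≤) = m→∞ K in N , λ n N≤n → s≲ (m n) (K≤ n N≤n)

  Null-constant : ∀ {x} → Null (λ _ → x) → x ≈ 0#
  Null-constant x→0 = ≲-0 λ ε 0<ε → let (N , x≲) = x→0 ε 0<ε in x≲ N ℕₚ.≤-refl

  ⟶-cong : ∀ {s t l m} → (∀ n → s n ≈ t n) → l ≈ m → s ⟶ l → t ⟶ m
  ⟶-cong s≈t l≈m = Null-cong λ n → +-cong (s≈t n) (-‿cong l≈m)

  ⟶-constant : ∀ x → (λ _ → x) ⟶ x
  ⟶-constant x = Null-cong (λ _ → sym (-‿inverseʳ x)) Null-0

  ⟶-+ : ∀ {s t l m} → s ⟶ l → t ⟶ m → (λ n → s n + t n) ⟶ l + m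
  ⟶-+ s→l t→m = Null-cong (λ n → solve 4 (λ s t l m → (s :- l) :+ (t :- m) := (s :+ t) :- (l :+ m)) refl _ _ _ _)
    (Null-+ s→l t→m)

  ⟶⇒Bounded : ∀ {s l} → s ⟶ l → Bounded s
  ⟶⇒Bounded {l = l} s→l = Bounded-cong (λ n → solve 2 (λ s l → (s :- l) :+ l := s) refl _ _)
    (Bounded-+ (Null⇒Bounded s→l) (Bounded-constant l))

  ⟶-* : ∀ {s t l m} → s ⟶ l → t ⟶ m → (λ n → s n * t n) ⟶ l * m
  ⟶-* {s} {t} {l} {m} s→l t→m =
    Null-cong (λ n → solve 4 (λ s t l m → s :* (t :- m) :+ m :* (s :- l) := s :* t :- l :* m) refl (s n) (t n) l m)
      (Null-+ (Null-* (⟶⇒Bounded {l = l} s→l) t→m) (Null-* (Bounded-constant m) s→l))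

  ⟶-unique : ∀ {s l m} → s ⟶ l → s ⟶ m → l ≈ m
  ⟶-unique {s} {l} {m} s→l s→m = begin
    l              ≈⟨ solve 2 (λ l m → l := m :+ (l :- m)) refl l m ⟩
    m + (l - m)    ≈⟨ +-congˡ (Null-constant (Null-cong
      (λ n → solve 3 (λ s l m → (s :- m) :- (s :- l) := l :- m) refl (s n) l m) (Null-+ s→m (Null-neg s→l)))) ⟩
    m + 0#         ≈⟨ +-identityʳ m ⟩
    m              ∎

  ⟶-⊛ : ∀ {f g : ℕ → Series} {h k} n → (∀ i → i ℕ.≤ n → (λ N → f N i) ⟶ h i) →
         (∀ i → i ℕ.≤ n → (λ N → g N i) ⟶ k i) → (λ N → (f N ⊛ g N) n) ⟶ (h ⊛ k) n
  ⟶-⊛ {h = h} {k} zero f→h g→k = ⟶-* {l = h 0} {k 0} (f→h 0 ℕ.z≤n) (g→k 0 ℕ.z≤n)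
  ⟶-⊛ {f} {g} {h} {k} (suc n) f→h g→k = ⟶-+ {l = h 0 * k (suc n)} {m = (tail h ⊛ k) n}
    (⟶-* {l = h 0} {k (suc n)} (f→h 0 ℕ.z≤n) (g→k (suc n) ℕₚ.≤-refl))
    (⟶-⊛ {λ N → tail (f N)} {g} {tail h} {k} n (λ i i≤n → f→h (suc i) (ℕ.s≤s i≤n)) (λ i i≤n → g→k i (ℕₚ.m≤n⇒m≤1+n i≤n)))

  _⟶S_ : (ℕ → Series) → Series → Set
  f ⟶S h = ∀ n → (λ N → f N n) ⟶ h n

  ⟶S-⊛ : ∀ {f g : ℕ → Series} {h k} → f ⟶S h → g ⟶S k → (λ N → f N ⊛ g N) ⟶S (h ⊛ k)
  ⟶S-⊛ {f} {g} {h} {k} f→h g→k n = ⟶-⊛ {f} {g} {h} {k} n (λ i _ → f→h i) (λ i _ → g→k i)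

  ⟶S-∏ᴸ : ∀ {A : Set} {f : A → ℕ → Series} {h : A → Series} → (∀ x → f x ⟶S h x) → ∀ xs →
          (λ N → ΠS.⨁ᴸ (λ x → f x N) xs) ⟶S ΠS.⨁ᴸ h xs
  ⟶S-∏ᴸ f→h []       n = ⟶-constant _
  ⟶S-∏ᴸ {f = f} {h} f→h (x ∷ xs) = ⟶S-⊛ {f x} {λ N → ΠS.⨁ᴸ (λ y → f y N) xs} {h x} (f→h x) (⟶S-∏ᴸ f→h xs)

  Null-∑ᴸ : ∀ {A : Set} {f : A → ℕ → Carrier} → (∀ x → Null (f x)) → ∀ xs → Null (λ N → ∑ᴸ (λ x → f x N) xs)
  Null-∑ᴸ f→0 []       = Null-0
  Null-∑ᴸ f→0 (x ∷ xs) = Null-+ (f→0 x) (Null-∑ᴸ f→0 xs)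

  -- By `antilog-suc`, a coefficient of positive degree is a convolution of earlier coefficients,
  -- which converge, with those of `p N`, which tend to 0.
  antilog-⟶ : (p : ℕ → Series) → (∀ n → Null (λ N → p N n)) → (λ N → antilog (p N)) ⟶S constant 1#
  antilog-⟶ p p→0 n = initially n n ℕₚ.≤-refl
    where
    initially : ∀ n i → i ℕ.≤ n → (λ N → antilog (p N) i) ⟶ constant 1# i
    initially n       zero    _           = ⟶-constant 1#
    initially (suc n) (suc i) (ℕ.s≤s i≤n) = ⟶-cong (λ N → sym (antilog-suc (p N) i))
      (trans (*-congˡ (trans (⊛-comm (constant 1#) _ i) (⊛-zeroˡ _ i))) (zeroʳ _))
      (⟶-* {l = inverse i} {m = (constant 1# ⊛ (λ _ → 0#)) i} (⟶-constant (inverse i))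
        (⟶-⊛ {λ N → antilog (p N)} {p} {constant 1#} i (λ j j≤i → initially n j (ℕₚ.≤-trans j≤i i≤n))
          (λ j _ → Null-cong (λ N → solve 1 (λ x → x := x :- con (+ 0)) refl _) (p→0 j))))

  -- By `LogDerivative-perturb`, `f N` is `g N` times an antilogarithm that tends to 1. It serves
  -- twice: to compare the powers (1 + a z / m)ᵐ with the exponential series, and the partial
  -- products that define L with products of cotangent factors.
  LogDerivative-⟶ : ∀ {f g p r : ℕ → Series} {h} → (∀ N → f N 0 ≈ 1#) → (∀ N → g N 0 ≈ 1#) →
                    (∀ N → LogDerivative (f N) (p N)) → (∀ N → LogDerivative (g N) (r N)) →
                    (∀ n → Null (λ N → p N n - r N n)) → g ⟶S h → f ⟶S h
  LogDerivative-⟶ {f} {g} {p} {r} {h} f₀ g₀ f′ g′ p-r→0 g→h n = ⟶-cong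
    (λ N → sym (LogDerivative-perturb (f₀ N) (g₀ N) (f′ N) (g′ N) n))
    (𝕊.*-identityʳ h n)
    (⟶S-⊛ {g} {λ N → antilog (p N 𝕊.- r N)} {h} {constant 1#} g→h (antilog-⟶ (λ N → p N 𝕊.- r N) p-r→0) n)

  Null-inverse : Null inverse
  Null-inverse = Null-squeeze 1ℚ 0≤1 λ n → ≲-≡ (≡.sym (Q.*-identityˡ _)) (ι-≥ (0≤1/ n))

  Bounded-* : ∀ {s t} → Bounded s → Bounded t → Bounded (λ n → s n * t n)
  Bounded-* (A , 0≤A , M , s≲) (B , 0≤B , N , t≲) = A *ℚ B , 0≤* 0≤A 0≤B , M ℕ.⊔ N , λ n le →
    ≲-* 0≤A 0≤B (s≲ n (ℕₚ.m⊔n≤o⇒m≤o M N le)) (t≲ n (ℕₚ.m⊔n≤o⇒n≤o M N le))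

  Bounded-^ : ∀ {s} → Bounded s → ∀ k → Bounded (λ n → s n ^ k)
  Bounded-^ s-bounded zero    = Bounded-constant 1#
  Bounded-^ s-bounded (suc k) = Bounded-* s-bounded (Bounded-^ s-bounded k)

  open Exponentiation 𝕊.commutativeSemiring public using () renaming (_^_ to _^S_)

  ^S-head : ∀ {f} n → f 0 ≈ 1# → (f ^S n) 0 ≈ 1#
  ^S-head zero    f₀ = refl
  ^S-head (suc n) f₀ = trans (*-cong f₀ (^S-head n f₀)) (*-identityˡ 1#)

  -- The logarithmic derivative of (1 + a z / (m + 1)) to the power m + 1 has coefficients a (-a /
  -- (m + 1))ⁿ, which tend to a for n = 0 and to 0 otherwise.
  euler-limit : ∀ a → (λ m → linear (a * inverse m) ^S suc m) ⟶S expSeries a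
  euler-limit a = LogDerivative-⟶ {g = λ _ → expSeries a} {h = expSeries a}
    (λ m → ^S-head {linear (a * inverse m)} (suc m) refl) (λ _ → refl)
    (λ m → LogDerivative-^ (suc m) (linear-geometric (a * inverse m))) (λ _ → expSeries-LogDerivative a)
    difference (λ n → ⟶-constant (expSeries a n))
    where
    x : ℕ → Carrier
    x m = a * inverse m

    expand : ∀ m n → natural (suc m) * geometric (x m) n ≈ a * (- x m) ^ n
    expand m n = begin
      natural (suc m) * (a * inverse m * (- x m) ^ n)
        ≈⟨ solve 4 (λ n a i p → n :* (a :* i :* p) := i :* n :* (a :* p)) refl (natural (suc m)) a (inverse m) ((- x m) ^ n) ⟩
      inverse m * natural (suc m) * (a * (- x m) ^ n)
        ≈⟨ trans (*-congʳ (inverse-natural m)) (*-identityˡ _) ⟩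
      a * (- x m) ^ n ∎

    x→0 : Null x
    x→0 = Null-* (Bounded-constant a) Null-inverse

    difference : ∀ n → Null (λ m → natural (suc m) * geometric (x m) n - constant a n)
    difference zero    = Null-cong (λ m → sym (trans (+-congʳ (expand m 0)) (solve 1 (λ a → a :* con (+ 1) :- a := con (+ 0)) refl a))) Null-0
    difference (suc n) = Null-cong
      (λ m → sym (trans (+-congʳ (expand m (suc n))) (solve 3 (λ a x p → a :* (:- x :* p) :- con (+ 0) := a :* p :* (:- x)) refl a (x m) _)))
      (Null-* (Bounded-* (Bounded-constant a) (Bounded-^ (Null⇒Bounded (Null-neg x→0)) n)) (Null-neg x→0))

  ∑-≲ : ∀ n {f} {A : ℕ → ℚ} → (∀ i → i ℕ.< n → f i ≲ A i) →
        ∀ {B} → 0ℚ ≤ℚ B → (∀ i → i ℕ.< n → A i ≤ℚ B) → ∑ n f ≲ ν n *ℚ B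
  ∑-≲ zero    f≲ {B} 0≤B A≤B = 0≲ (Q.≤-reflexive (≡.sym (≡.trans (≡.cong (_*ℚ B) ν-0) (Q.*-zeroˡ B))))
  ∑-≲ (suc n) {f} f≲ {B} 0≤B A≤B = ≲-≡
    (≡.trans (ℚS.solve 2 (λ b v → v ℚS.:* b ℚS.:+ b ℚS.:= (ℚS.con (+ 1) ℚS.:+ v) ℚS.:* b) ≡.refl B (ν n)) (≡.cong (_*ℚ B) (≡.sym (ν-suc n))))
    (≲-+ (∑-≲ n (λ i i<n → f≲ i (ℕₚ.m<n⇒m<1+n i<n)) 0≤B (λ i i<n → A≤B i (ℕₚ.m<n⇒m<1+n i<n)))
         (≲-mono (A≤B n ℕₚ.≤-refl) (f≲ n ℕₚ.≤-refl)))

  ∑-≲-telescope : ∀ n {f} (T : ℕ → ℚ) → (∀ i → i ℕ.< n → f i ≲ T i Q.- T (suc i)) → ∑ n f ≲ T 0 Q.- T n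
  ∑-≲-telescope zero    T f≲ = 0≲ (Q.≤-reflexive (≡.sym (Q.+-inverseʳ (T 0))))
  ∑-≲-telescope (suc n) {f} T f≲ = ≲-≡
    (ℚS.solve 3 (λ a b c → (a ℚS.:- b) ℚS.:+ (b ℚS.:- c) ℚS.:= a ℚS.:- c) ≡.refl (T 0) (T n) (T (suc n)))
    (≲-+ (∑-≲-telescope n T (λ i i<n → f≲ i (ℕₚ.m<n⇒m<1+n i<n))) (f≲ n ℕₚ.≤-refl))

  -- The index l stands for M - 1 - k.
  tannery : ∀ (u : ℕ → ℕ → Carrier) A → 0ℚ ≤ℚ A → (∀ k l → u k l ≲ A *ℚ (1/[1+ k ] *ℚ 1/[1+ k ])) →
            (∀ k l → u k l ≲ A *ℚ 1/[1+ k ℕ.+ l ]) → Null (λ M → ∑ M (λ k → u k (M ℕ.∸ suc k)))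
  tannery u A 0≤A u≲₁ u≲₂ ε 0<ε = suc (K ℕ.+ L) , estimate
    where
    -- The inverse squares from `K` on telescope to at most A / K ≤ ε / 2. Each of the `K` terms
    -- before is at most A / M, so for large M they add up to at most ε / 2 as well.
    cutoff = 1/-small A 0≤A (ε *ℚ ½) (0<½* 0<ε)
    K′ = proj₁ cutoff
    K = suc K′
    rate = 1/-small (ν K *ℚ A) (0≤* (0≤ν K) 0≤A) (ε *ℚ ½) (0<½* 0<ε)
    L = proj₁ rate

    index : ∀ K m k → k ℕ.< suc m → k ℕ.+ (suc m ℕ.∸ suc k) ≡ m
    index K m k (ℕ.s≤s k≤m) = ℕₚ.m+[n∸m]≡n k≤m

    estimate : ∀ M → suc (K ℕ.+ L) ℕ.≤ M → ∑ M (λ k → u k (M ℕ.∸ suc k)) ≲ ε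
    estimate (suc m) (ℕ.s≤s K+L≤m) = ≲-resp (trans (sym (Σ.⨁-split K (suc m ℕ.∸ K) _)) (Σ.⨁-≡ _ (ℕₚ.m+[n∸m]≡n K≤M)))
      (≲-≡ (half+half ε) (≲-+ initial final))
      where
      K≤m = ℕₚ.m+n≤o⇒m≤o K K+L≤m
      K≤M : K ℕ.≤ suc m
      K≤M = ℕₚ.m≤n⇒m≤1+n K≤m
      initial : ∑ K (λ k → u k (suc m ℕ.∸ suc k)) ≲ ε *ℚ ½
      initial = ≲-mono (Q.≤-trans (Q.≤-reflexive (≡.sym (Q.*-assoc (ν K) A 1/[1+ m ])))
                         (proj₂ rate m (ℕₚ.m+n≤o⇒n≤o K K+L≤m)))
        (∑-≲ K {A = λ _ → A *ℚ 1/[1+ m ]}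
          (λ k k<K → subst (λ j → u k (suc m ℕ.∸ suc k) ≲ A *ℚ 1/[1+ j ]) (index K m k (ℕₚ.<-≤-trans k<K K≤M)) (u≲₂ k _))
          (0≤* 0≤A (0≤1/ m)) (λ _ _ → Q.≤-refl))
      T : ℕ → ℚ
      T k = A *ℚ 1/[1+ K′ ℕ.+ k ]
      final : ∑ (suc m ℕ.∸ K) (λ k → u (K ℕ.+ k) (suc m ℕ.∸ suc (K ℕ.+ k))) ≲ ε *ℚ ½
      final = ≲-mono (Q.≤-trans (minus-≤ (0≤* 0≤A (0≤1/ _))) (proj₂ cutoff (K′ ℕ.+ 0) (ℕₚ.m≤m+n K′ 0)))
        (∑-≲-telescope (suc m ℕ.∸ K) T λ k _ → ≲-mono (step k) (u≲₁ (K ℕ.+ k) _))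
        where
        step : ∀ k → A *ℚ (1/[1+ K ℕ.+ k ] *ℚ 1/[1+ K ℕ.+ k ]) ≤ℚ T k Q.- T (suc k)
        step k = Q.≤-trans (*-monoˡ 0≤A (1/-telescope (K′ ℕ.+ k)))
          (Q.≤-reflexive (≡.trans
            (ℚS.solve 3 (λ a x y → a ℚS.:* (x ℚS.:- y) ℚS.:= a ℚS.:* x ℚS.:- a ℚS.:* y) ≡.refl A 1/[1+ K′ ℕ.+ k ] 1/[1+ suc (K′ ℕ.+ k) ])
            (≡.cong (λ j → T k Q.- A *ℚ 1/[1+ j ]) (≡.sym (ℕₚ.+-suc K′ k)))))

  ∑-⊛ : ∀ N f g → ∑ N (f ⊛ g) ≈ ∑ N (λ i → f i * ∑ (N ℕ.∸ i) g)
  ∑-⊛ zero    f g = refl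
  ∑-⊛ (suc N) f g = begin
    ∑ (suc N) (f ⊛ g)
      ≈⟨ Σ.⨁-head N _ ⟩
    f 0 * g 0 + ∑ N (λ n → f 0 * g (suc n) + (tail f ⊛ g) n)
      ≈⟨ +-congˡ (trans (Σ.⨁-∙ N _ _) (+-congʳ (sym (∑-* (f 0) N (tail g))))) ⟩
    f 0 * g 0 + (f 0 * ∑ N (tail g) + ∑ N (tail f ⊛ g))
      ≈⟨ solve 4 (λ f g h x → f :* g :+ (f :* h :+ x) := f :* (g :+ h) :+ x) refl (f 0) (g 0) _ _ ⟩
    f 0 * (g 0 + ∑ N (tail g)) + ∑ N (tail f ⊛ g)
      ≈⟨ +-cong (*-congˡ (sym (Σ.⨁-head N g))) (∑-⊛ N (tail f) g) ⟩
    f 0 * ∑ (suc N) g + ∑ N (λ i → f (suc i) * ∑ (N ℕ.∸ i) g)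
      ≈⟨ Σ.⨁-head N (λ i → f i * ∑ (suc N ℕ.∸ i) g) ⟨
    ∑ (suc N) (λ i → f i * ∑ (suc N ℕ.∸ i) g) ∎

  -- 4⁻ⁿ, kept as a product of two powers of 1/2: in a Cauchy product one of them absorbs the number
  -- N of terms and the other still tends to 0.
  quarter^ : ℕ → ℚ
  quarter^ n = ½^ n *ℚ ½^ n

  quarter^-0 : quarter^ 0 ≡ 1ℚ
  quarter^-0 = Q.*-identityˡ 1ℚ

  0≤quarter^ : ∀ n → 0ℚ ≤ℚ quarter^ n
  0≤quarter^ n = 0≤* (Q.<⇒≤ (0<½^ n)) (Q.<⇒≤ (0<½^ n))

  quarter^-+ : ∀ m n → quarter^ (m ℕ.+ n) ≡ quarter^ m *ℚ quarter^ n
  quarter^-+ m n = ≡.trans (≡.cong (λ t → t *ℚ t) (½^-+ m n))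
    (ℚS.solve 2 (λ a b → a ℚS.:* b ℚS.:* (a ℚS.:* b) ℚS.:= a ℚS.:* a ℚS.:* (b ℚS.:* b)) ≡.refl (½^ m) (½^ n))

  -- Decay like 4⁻ⁿ is much more than summability, but exponential series have it for every
  -- argument, and it makes the remainder of a Cauchy product explicit.
  Summable : Series → Set
  Summable f = ∃ λ C → 0ℚ ≤ℚ C × (∀ n → f n ≲ C *ℚ quarter^ n)

  quarter^≤½^ : ∀ n → quarter^ n ≤ℚ ½^ n
  quarter^≤½^ n = subst (quarter^ n ≤ℚ_) (Q.*-identityˡ (½^ n))
    (*-monoʳ (Q.<⇒≤ (0<½^ n)) (Q.≤-trans (½^≤1/ n) (1/≤1 n)))

  ∑-tail-≲ : ∀ {f : Series} {C} → 0ℚ ≤ℚ C → (∀ n → f n ≲ C *ℚ quarter^ n) → ∀ m i → ∑ i (λ k → f (m ℕ.+ k)) ≲ 2ℚ *ℚ C *ℚ quarter^ m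
  ∑-tail-≲ {f} {C} 0≤C f≲ m i = ≲-mono (Q.≤-trans (minus-≤ (0≤T i)) (Q.≤-reflexive (Q.*-identityʳ _)))
    (∑-≲-telescope i T λ k _ → ≲-mono (step k) (f≲ (m ℕ.+ k)))
    where
    D = 2ℚ *ℚ C *ℚ quarter^ m
    0≤D : 0ℚ ≤ℚ D
    0≤D = 0≤* (0≤* 0≤2 0≤C) (0≤quarter^ m)
    T : ℕ → ℚ
    T k = D *ℚ ½^ k
    0≤T : ∀ k → 0ℚ ≤ℚ T k
    0≤T k = 0≤* 0≤D (Q.<⇒≤ (0<½^ k))
    step : ∀ k → C *ℚ quarter^ (m ℕ.+ k) ≤ℚ T k Q.- T (suc k)
    step k = Q.≤-trans (*-monoˡ 0≤C (Q.≤-trans (Q.≤-reflexive (quarter^-+ m k)) (*-monoˡ (0≤quarter^ m) (quarter^≤½^ k))))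
      (Q.≤-reflexive (≡.trans (≡.sym (≡.trans (≡.cong (_*ℚ (C *ℚ (quarter^ m *ℚ ½^ k))) ½*2) (Q.*-identityˡ _)))
        (≡.trans (ℚS.solve 4 (λ h c w v → h ℚS.:* ℚS.con (+ 2) ℚS.:* (c ℚS.:* (w ℚS.:* v)) ℚS.:=
            ℚS.con (+ 2) ℚS.:* c ℚS.:* w ℚS.:* v ℚS.:* (h ℚS.:* ℚS.con (+ 2)) ℚS.:- ℚS.con (+ 2) ℚS.:* c ℚS.:* w ℚS.:* (h ℚS.:* v)) ≡.refl ½ C (quarter^ m) (½^ k))
          (≡.cong (λ t → t Q.- T (suc k)) (≡.trans (≡.cong (D *ℚ ½^ k *ℚ_) ½*2) (Q.*-identityʳ _))))))

  -- The difference is the sum of f i g j over i, j < N with i + j ≥ N. For fixed i these j form a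
  -- tail starting at N - i, so each i contributes O(4⁻ᴺ), and there are N of them.
  cauchy-product : ∀ {f g} → Summable f → Summable g → Null (λ N → ∑ N f * ∑ N g - ∑ N (f ⊛ g))
  cauchy-product {f} {g} (A , 0≤A , f≲) (C , 0≤C , g≲) = Null-squeeze D 0≤D λ N → ≲-resp (sym (difference N))
    (≲-mono (final N) (∑-≲ N {A = λ _ → D *ℚ quarter^ N} (term N) (0≤* 0≤D (0≤quarter^ N)) (λ _ _ → Q.≤-refl)))
    where
    D = A *ℚ (2ℚ *ℚ C)
    0≤2C = 0≤* 0≤2 0≤C
    0≤D : 0ℚ ≤ℚ D
    0≤D = 0≤* 0≤A 0≤2C
    difference : ∀ N → ∑ N f * ∑ N g - ∑ N (f ⊛ g) ≈ ∑ N (λ i → f i * (∑ N g - ∑ (N ℕ.∸ i) g))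
    difference N = begin
      ∑ N f * ∑ N g - ∑ N (f ⊛ g)
        ≈⟨ +-cong (trans (*-comm _ _) (trans (∑-* _ N f) (Σ.⨁-cong N (λ i _ → *-comm _ _)))) (-‿cong (∑-⊛ N f g)) ⟩
      ∑ N (λ i → f i * ∑ N g) - ∑ N (λ i → f i * ∑ (N ℕ.∸ i) g)
        ≈⟨ +-congˡ (sym (∑-neg N _)) ⟩
      ∑ N (λ i → f i * ∑ N g) + ∑ N (λ i → - (f i * ∑ (N ℕ.∸ i) g))
        ≈⟨ Σ.⨁-∙ N _ _ ⟨
      ∑ N (λ i → f i * ∑ N g + - (f i * ∑ (N ℕ.∸ i) g))
        ≈⟨ Σ.⨁-cong N (λ i _ → solve 3 (λ f a b → f :* a :+ :- (f :* b) := f :* (a :- b)) refl (f i) _ _) ⟩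
      ∑ N (λ i → f i * (∑ N g - ∑ (N ℕ.∸ i) g)) ∎
    term : ∀ N i → i ℕ.< N → f i * (∑ N g - ∑ (N ℕ.∸ i) g) ≲ D *ℚ quarter^ N
    term N i i<N = ≲-≡ weight (≲-* (0≤* 0≤A (0≤quarter^ i)) (0≤* 0≤2C (0≤quarter^ m)) (f≲ i)
      (≲-resp (begin
        ∑ i (λ k → g (m ℕ.+ k))          ≈⟨ solve 2 (λ a b → b := (a :+ b) :- a) refl (∑ m g) _ ⟩
        (∑ m g + ∑ i (λ k → g (m ℕ.+ k))) - ∑ m g  ≈⟨ +-congʳ (sym (Σ.⨁-split m i g)) ⟩
        ∑ (m ℕ.+ i) g - ∑ m g            ≈⟨ +-congʳ (Σ.⨁-≡ g m+i≡N) ⟩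
        ∑ N g - ∑ m g                    ∎)
        (∑-tail-≲ {g} 0≤C g≲ m i)))
      where
      m = N ℕ.∸ i
      m+i≡N : m ℕ.+ i ≡ N
      m+i≡N = ℕₚ.m∸n+n≡m (ℕₚ.<⇒≤ i<N)
      weight : (A *ℚ quarter^ i) *ℚ (2ℚ *ℚ C *ℚ quarter^ m) ≡ D *ℚ quarter^ N
      weight = ≡.trans (ℚS.solve 4 (λ a c w v → a ℚS.:* w ℚS.:* (c ℚS.:* v) ℚS.:= a ℚS.:* c ℚS.:* (v ℚS.:* w)) ≡.refl A (2ℚ *ℚ C) (quarter^ i) (quarter^ m))
        (≡.cong (D *ℚ_) (≡.trans (≡.sym (quarter^-+ m i)) (≡.cong quarter^ m+i≡N)))
    final : ∀ N → ν N *ℚ (D *ℚ quarter^ N) ≤ℚ D *ℚ 1/[1+ N ]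
    final N = Q.≤-trans (Q.≤-reflexive (ℚS.solve 3 (λ v d h → v ℚS.:* (d ℚS.:* (h ℚS.:* h)) ℚS.:= d ℚS.:* (v ℚS.:* h ℚS.:* h)) ≡.refl (ν N) D (½^ N)))
      (*-monoˡ 0≤D (Q.≤-trans (*-monoʳ (Q.<⇒≤ (0<½^ N)) ν½^≤1)
        (Q.≤-trans (Q.≤-reflexive (Q.*-identityˡ _)) (½^≤1/ N))))
      where
      ν½^≤1 : ν N *ℚ ½^ N ≤ℚ 1ℚ
      ν½^≤1 = Q.≤-trans (*-monoˡ (0≤ν N) (½^≤1/ N)) (Q.≤-trans (*-monoʳ (0≤1/ N) (ν-mono (ℕₚ.n≤1+n N)))
        (Q.≤-reflexive (≡.trans (Q.*-comm (ν (suc N)) 1/[1+ N ]) (1/[1+n]*ν N))))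

-- The exponential series.

opaque
  unfolding Q._*_ 1/[1+_]

  invFact-suc : ∀ n → invFact (suc n) ≡ 1/[1+ n ] *ℚ invFact n
  invFact-suc n = 1/-* (suc n) (n !) {{_}} {{n ℕₚ.!≢0}}

module Exponentials (V : NormedAlgebra) where
  open Limits V
  open SetoidReasoning setoid

  expSeries-closed : ∀ z n → expSeries z n ≈ ι (invFact n) * z ^ n
  expSeries-closed z zero    = sym (trans (*-identityʳ _) ι-1)
  expSeries-closed z (suc n) = begin
    inverse n * (z * expSeries z n)
      ≈⟨ *-congˡ (*-congˡ (expSeries-closed z n)) ⟩
    inverse n * (z * (ι (invFact n) * z ^ n))
      ≈⟨ solve 4 (λ i z f p → i :* (z :* (f :* p)) := i :* f :* (z :* p)) refl (inverse n) z (ι (invFact n)) (z ^ n) ⟩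
    inverse n * ι (invFact n) * (z * z ^ n)
      ≈⟨ *-congʳ (trans (reflexive (≡.cong ι (invFact-suc n))) (ι-* _ _)) ⟨
    ι (invFact (suc n)) * (z * z ^ n) ∎

  expSeries-summable : ∀ a → Summable (expSeries a)
  expSeries-summable a =
    let (B , 0≤B , a≲B) = bound a
        b : ℕ → ℚ
        b = λ n → majorant B n
        (C , 0≤C , b≤) = factorial-beats-quarter B 0≤B b (0≤majorant 0≤B) (λ _ → ≡.refl)
    in C , 0≤C , λ n → ≲-mono (b≤ n) (expSeries-≲ 0≤B a≲B n)
    where
    majorant : ℚ → ℕ → ℚ
    majorant B zero    = 1ℚ
    majorant B (suc n) = B *ℚ 1/[1+ n ] *ℚ majorant B n
    0≤majorant : ∀ {B} → 0ℚ ≤ℚ B → ∀ n → 0ℚ ≤ℚ majorant B n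
    0≤majorant 0≤B zero    = 0≤1
    0≤majorant 0≤B (suc n) = 0≤* (0≤* 0≤B (0≤1/ n)) (0≤majorant 0≤B n)
    expSeries-≲ : ∀ {B} → 0ℚ ≤ℚ B → a ≲ B → ∀ n → expSeries a n ≲ majorant B n
    expSeries-≲ 0≤B a≲B zero    = 1≲
    expSeries-≲ {B} 0≤B a≲B (suc n) = ≲-≡ (ℚS.solve 3 (λ i B m → i ℚS.:* (B ℚS.:* m) ℚS.:= B ℚS.:* i ℚS.:* m) ≡.refl _ B _)
      (≲-* (0≤1/ n) (0≤* 0≤B (0≤majorant 0≤B n)) (ι-≥ (0≤1/ n))
        (≲-* 0≤B (0≤majorant 0≤B n) a≲B (expSeries-≲ 0≤B a≲B n)))

  -- The product of the partial sums and the partial sum of the product series differ by a null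
  -- sequence, and the product series is the exponential series of a + b. Values enter as limits, so
  -- no exponential function has to be fixed.
  expSeries-+-limit : ∀ {a b x y z} → ((λ N → ∑ N (expSeries a)) ⟶ x) → ((λ N → ∑ N (expSeries b)) ⟶ y) →
                      ((λ N → ∑ N (expSeries (a + b))) ⟶ z) → z ≈ x * y
  expSeries-+-limit {a} {b} {x} {y} {z} →x →y →z = ⟶-unique {l = z} {m = x * y} →z
    (Null-cong (λ N → trans (solve 3 (λ p q r → (p :- q) :- (p :- r) := r :- q) refl _ _ _)
                        (+-congʳ (Σ.⨁-cong N (λ n _ → expSeries-+ a b n))))
      (Null-+ (⟶-* {l = x} {y} →x →y)
        (Null-neg (cauchy-product (expSeries-summable a) (expSeries-summable b)))))

  ^-≲1 : ∀ {x} n → x ≲ 1ℚ → x ^ n ≲ 1ℚ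
  ^-≲1 zero    x≲1 = 1≲
  ^-≲1 (suc n) x≲1 = ≲-≡ (Q.*-identityˡ 1ℚ) (≲-* 0≤1 0≤1 x≲1 (^-≲1 n x≲1))

  ⟶-≲ : ∀ {s l r} → s ⟶ l → (∀ n → s n ≲ r) → l ≲ r
  ⟶-≲ {s} {l} {r} s→l s≲r = ≲-closed λ ε 0<ε → let (N , near) = s→l ε 0<ε in
    ≲-resp (solve 2 (λ s l → s :- (s :- l) := l) refl (s N) l) (≲-- (s≲r N) (near N ℕₚ.≤-refl))

  module LinearApproximation (a : Carrier) (C : ℚ) (0≤C : 0ℚ ≤ℚ C) (e≲ : ∀ n → expSeries a n ≲ C *ℚ quarter^ n) where

    -- What the partial sum has beyond degree 1, with t² taken out.
    rest : ℚ → ℕ → Carrier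
    rest t M = ι t * ι t * ∑ M (λ i → ι t ^ i * expSeries a (2 ℕ.+ i))

    expand : ∀ t M → ∑ (2 ℕ.+ M) (expSeries (ι t * a)) ≈ 1# + ι t * a + rest t M
    expand t M = begin
      ∑ (2 ℕ.+ M) (expSeries (ι t * a))
        ≈⟨ Σ.⨁-cong (2 ℕ.+ M) (λ n _ → expSeries-* (ι t) a n) ⟩
      ∑ (2 ℕ.+ M) (λ n → ι t ^ n * expSeries a n)
        ≈⟨ Σ.⨁-split 2 M _ ⟩
      (0# + 1# * 1# + ι t * 1# * (inverse 0 * (a * 1#))) + ∑ M (λ i → ι t * (ι t * ι t ^ i) * expSeries a (2 ℕ.+ i))
        ≈⟨ +-cong (trans (+-congˡ (*-congˡ (*-congʳ inverse-0))) (solve 2 (λ t a → con (+ 0) :+ con (+ 1) :* con (+ 1) :+ t :* con (+ 1) :* (con (+ 1) :* (a :* con (+ 1)))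
             := con (+ 1) :+ t :* a) refl (ι t) a))
             (trans (Σ.⨁-cong M (λ i _ → solve 3 (λ t p e → t :* (t :* p) :* e := t :* t :* (p :* e)) refl (ι t) _ _))
               (sym (∑-* (ι t * ι t) M _))) ⟩
      1# + ι t * a + rest t M ∎
      where
      inverse-0 : inverse 0 ≈ 1#
      inverse-0 = trans (reflexive (≡.cong ι 1/[1+0]≡1)) ι-1

    shifted : ∀ t x → ((λ N → ∑ N (expSeries (ι t * a))) ⟶ x) → rest t ⟶ x - 1# - ι t * a
    shifted t x →x = Null-cong (λ M → trans (+-congʳ (expand t M))
        (solve 3 (λ r b x → con (+ 1) :+ b :+ r :- x := r :- (x :- con (+ 1) :- b)) refl (rest t M) (ι t * a) x))
      (Null-compose (2 ℕ.+_) (λ K → K , λ n K≤n → ℕₚ.m≤n⇒m≤o+n 2 K≤n) →x)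

    remainder : ∀ t → Q.∣ t ∣ ≤ℚ 1ℚ → ∀ M → rest t M ≲ 2ℚ *ℚ C *ℚ (Q.∣ t ∣ *ℚ Q.∣ t ∣)
    remainder t ∣t∣≤1 M = ≲-≡ (Q.*-comm (Q.∣ t ∣ *ℚ Q.∣ t ∣) (2ℚ *ℚ C))
      (≲-* {r = Q.∣ t ∣ *ℚ Q.∣ t ∣} {s = 2ℚ *ℚ C} 0≤t² (0≤* 0≤2 0≤C) (≲-* (Q.0≤∣p∣ t) (Q.0≤∣p∣ t) (ι-≲ t) (ι-≲ t))
        (≲-≡ (≡.trans (≡.cong (2ℚ *ℚ C *ℚ_) quarter^-0) (Q.*-identityʳ (2ℚ *ℚ C))) (∑-tail-≲ {λ i → ι t ^ i * expSeries a (2 ℕ.+ i)} 0≤C term 0 M)))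
      where
      0≤t² = 0≤* (Q.0≤∣p∣ t) (Q.0≤∣p∣ t)
      term : ∀ i → ι t ^ i * expSeries a (2 ℕ.+ i) ≲ C *ℚ quarter^ i
      term i = ≲-≡ (Q.*-identityˡ (C *ℚ quarter^ i)) (≲-* {r = 1ℚ} {s = C *ℚ quarter^ i} 0≤1 (0≤* 0≤C (0≤quarter^ i)) (^-≲1 i (≲-mono ∣t∣≤1 (ι-≲ t)))
        (≲-mono (*-monoˡ 0≤C (quarter^-decreasing i)) (e≲ (2 ℕ.+ i))))
        where
        quarter^-decreasing : ∀ i → quarter^ (2 ℕ.+ i) ≤ℚ quarter^ i
        quarter^-decreasing i = Q.≤-trans (Q.≤-reflexive (quarter^-+ 2 i)) (subst (quarter^ 2 *ℚ quarter^ i ≤ℚ_) (Q.*-identityˡ (quarter^ i))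
            (*-monoʳ (0≤quarter^ i) (Q.≤-trans (quarter^≤½^ 2) (Q.≤-trans (½^≤1/ 2) (1/≤1 2)))))

    estimate : ∀ t x → Q.∣ t ∣ ≤ℚ 1ℚ → ((λ N → ∑ N (expSeries (ι t * a))) ⟶ x) →
               x - 1# - ι t * a ≲ 2ℚ *ℚ C *ℚ (Q.∣ t ∣ *ℚ Q.∣ t ∣)
    estimate t x ∣t∣≤1 →x = ⟶-≲ (shifted t x →x) (remainder t ∣t∣≤1)

  -- For |t| ≤ 1 the powers of t left in the remainder are bounded by 1, so the constant, twice that
  -- of `expSeries-summable`, depends on `a` only. The estimates for cotangents rest on this
  -- uniformity in t.
  exp-linear-approximation : ∀ a → ∃ λ C → 0ℚ ≤ℚ C × (∀ t x → Q.∣ t ∣ ≤ℚ 1ℚ →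
    ((λ N → ∑ N (expSeries (ι t * a))) ⟶ x) → x - 1# - ι t * a ≲ C *ℚ (Q.∣ t ∣ *ℚ Q.∣ t ∣))
  exp-linear-approximation a =
    let (C , 0≤C , e≲) = expSeries-summable a
    in 2ℚ *ℚ C , 0≤* 0≤2 0≤C , LinearApproximation.estimate a C 0≤C e≲

-- Rotations: estimates and inverses.

-- E t stands for exp (π i t) and ϖ for π i.
record Rotations (V : NormedAlgebra) : Set where
  open Limits V
  field
    E      : ℚ → Carrier
    ϖ ϖ⁻¹  : Carrier
    ϖ⁻¹-ϖ  : ϖ⁻¹ * ϖ ≈ 1#
    E-+    : ∀ s t → E (s +ℚ t) ≈ E s * E t
    E-0    : E 0ℚ ≈ 1#
    E-2    : E 2ℚ ≈ 1#
    E-⟶    : ∀ t → (λ N → ∑ N (expSeries (ι t * ϖ))) ⟶ E t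
    -- On the left half of the circle `E s` stays away from 1. Only this range is demanded here;
    -- `unit` reaches every 0 < |s| ≤ 1 by passing to a multiple of the angle.
    E-left : ∃ λ C → 0ℚ ≤ℚ C × (∀ s → ½ <ℚ s → s ≤ℚ 1ℚ → ∃ λ w → (E s - 1#) * w ≈ 1# × w ≲ C)

multiple-below : ∀ s → 0ℚ <ℚ s → ∀ n → 1ℚ <ℚ ν n *ℚ s → ∃ λ m → ν m *ℚ s ≤ℚ 1ℚ × 1ℚ <ℚ ν (suc m) *ℚ s
multiple-below s 0<s zero 1<0 = contradiction 0≤1 (<⇒≱ (subst (1ℚ <ℚ_) (≡.trans (≡.cong (_*ℚ s) ν-0) (Q.*-zeroˡ s)) 1<0))
multiple-below s 0<s (suc n) 1<ns with Q.≤-total (ν n *ℚ s) 1ℚ | 1ℚ Q.<? (ν n *ℚ s)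
... | _        | yes 1<     = multiple-below s 0<s n 1<
... | _        | no  1≮     = n , Q.≮⇒≥ 1≮ , 1<ns

module RotationEstimates {V : NormedAlgebra} (Rot : Rotations V) where
  open Limits V public
  open Rotations Rot public
  open Exponentials V public
  open SetoidReasoning setoid

  E-≡ : ∀ {s t} → s ≡ t → E s ≈ E t
  E-≡ ≡.refl = refl

  E-neg : ∀ t → E (Q.- t) * E t ≈ 1#
  E-neg t = trans (sym (E-+ (Q.- t) t)) (trans (E-≡ (Q.+-inverseˡ t)) E-0)

  E-^ : ∀ t n → E t ^ n ≈ E (ν n *ℚ t)
  E-^ t zero    = sym (trans (E-≡ (≡.trans (≡.cong (_*ℚ t) ν-0) (Q.*-zeroˡ t))) E-0)
  E-^ t (suc n) = trans (*-congˡ (E-^ t n)) (trans (sym (E-+ t (ν n *ℚ t)))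
    (E-≡ (≡.trans (ℚS.solve 2 (λ t v → t ℚS.:+ v ℚS.:* t ℚS.:= (ℚS.con (+ 1) ℚS.:+ v) ℚS.:* t) ≡.refl t (ν n))
                  (≡.cong (_*ℚ t) (≡.sym (ν-suc n))))))

  1^ : ∀ n → 1# ^ n ≈ 1#
  1^ zero    = refl
  1^ (suc n) = trans (*-identityˡ _) (1^ n)

  E-even : ∀ n → E (ν n *ℚ 2ℚ) ≈ 1#
  E-even n = trans (sym (E-^ 2ℚ n)) (trans (^-congˡ n E-2) (1^ n))

  private
    approx = exp-linear-approximation ϖ

  ϖ-bound E₂-bound E₁-bound E-bound : ℚ
  ϖ-bound  = proj₁ (bound ϖ)
  E₂-bound = proj₁ approx
  E₁-bound = ϖ-bound +ℚ E₂-bound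
  E-bound  = E₁-bound +ℚ 1ℚ

  0≤ϖ : 0ℚ ≤ℚ ϖ-bound
  0≤ϖ = proj₁ (proj₂ (bound ϖ))
  0≤E₂ : 0ℚ ≤ℚ E₂-bound
  0≤E₂ = proj₁ (proj₂ approx)
  0≤E₁ : 0ℚ ≤ℚ E₁-bound
  0≤E₁ = 0≤+ 0≤ϖ 0≤E₂
  0≤E : 0ℚ ≤ℚ E-bound
  0≤E = 0≤+ 0≤E₁ 0≤1

  ϖ-≲ : ϖ ≲ ϖ-bound
  ϖ-≲ = proj₂ (proj₂ (bound ϖ))

  E₂-≲ : ∀ t → Q.∣ t ∣ ≤ℚ 1ℚ → E t - 1# - ι t * ϖ ≲ E₂-bound *ℚ (Q.∣ t ∣ *ℚ Q.∣ t ∣)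
  E₂-≲ t ∣t∣≤1 = proj₂ (proj₂ approx) t (E t) ∣t∣≤1 (E-⟶ t)

  E₁-≲ : ∀ t → Q.∣ t ∣ ≤ℚ 1ℚ → E t - 1# ≲ E₁-bound *ℚ Q.∣ t ∣
  E₁-≲ t ∣t∣≤1 = ≲-resp (solve 2 (λ e z → z :+ (e :- con (+ 1) :- z) := e :- con (+ 1)) refl (E t) (ι t * ϖ))
    (≲-mono (Q.≤-trans (Q.+-monoʳ-≤ _ (*-monoˡ 0≤E₂ (*-monoˡ (Q.0≤∣p∣ t) ∣t∣≤1)))
               (Q.≤-reflexive (ℚS.solve 3 (λ a b t → t ℚS.:* a ℚS.:+ b ℚS.:* (t ℚS.:* ℚS.con (+ 1)) ℚS.:= (a ℚS.:+ b) ℚS.:* t) ≡.refl ϖ-bound E₂-bound Q.∣ t ∣)))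
      (≲-+ (≲-* (Q.0≤∣p∣ t) 0≤ϖ (ι-≲ t) ϖ-≲) (E₂-≲ t ∣t∣≤1)))

  E-≲ : ∀ t → Q.∣ t ∣ ≤ℚ 1ℚ → E t ≲ E-bound
  E-≲ t ∣t∣≤1 = ≲-resp (solve 1 (λ e → e :- con (+ 1) :+ con (+ 1) := e) refl (E t))
    (≲-+ (≲-mono (Q.≤-trans (*-monoˡ 0≤E₁ ∣t∣≤1) (Q.≤-reflexive (Q.*-identityʳ _))) (E₁-≲ t ∣t∣≤1)) 1≲)

  geometric-sum : ∀ x m → (x - 1#) * ∑ m (x ^_) ≈ x ^ m - 1#
  geometric-sum x zero    = trans (zeroʳ _) (sym (-‿inverseʳ 1#))
  geometric-sum x (suc m) = trans (distribˡ _ _ _) (trans (+-congʳ (geometric-sum x m))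
    (solve 2 (λ x p → p :- con (+ 1) :+ (x :- con (+ 1)) :* p := x :* p :- con (+ 1)) refl x (x ^ m)))

  private
    left-bound = proj₁ E-left
    0≤left : 0ℚ ≤ℚ left-bound
    0≤left = proj₁ (proj₂ E-left)

  unit-bound : ℚ
  unit-bound = E-bound *ℚ (E-bound *ℚ left-bound)

  0≤unit : 0ℚ ≤ℚ unit-bound
  0≤unit = 0≤* 0≤E (0≤* 0≤E 0≤left)

  private
    -- If m s ∈ (1/2, 1], the sum of the powers E (k s), k < m, times the inverse of
    -- E (m s) - 1 is inverse to E s - 1.
    unit⁺ : ∀ s B → 0ℚ <ℚ s → s ≤ℚ 1ℚ → 1ℚ ≤ℚ B *ℚ s →
            ∃ λ w → (E s - 1#) * w ≈ 1# × w ≲ B *ℚ (E-bound *ℚ left-bound)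
    unit⁺ s B 0<s s≤1 1≤Bs =
      -- 1 / (N + 1) ≤ s / 2 gives (N + 1) s ≥ 2 > 1, a start for the downward search for the
      -- largest multiple of `s` not above 1.
      let (N , small) = 1/-small 1ℚ 0≤1 (s *ℚ ½) (0<* 0<s (ℚₚ.positive⁻¹ ½))
          (m , ms≤1 , 1<) = multiple-below s 0<s (suc N) (big N (small N ℕₚ.≤-refl))
          (w , inverse-w , w≲) = proj₂ (proj₂ E-left) (ν m *ℚ s) (half m ms≤1 1<) ms≤1
      in ∑ m (E s ^_) * w
       , trans (sym (*-assoc _ _ _)) (trans (*-congʳ (trans (geometric-sum (E s) m) (+-congʳ (E-^ s m)))) inverse-w)
       -- m ≤ B because m s ≤ 1 ≤ B s, and the geometric sum has m terms, each bounded by `E-bound`.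
       , ≲-mono (Q.≤-trans (Q.≤-reflexive (Q.*-assoc (ν m) E-bound left-bound))
                  (*-monoʳ (0≤* 0≤E 0≤left) (*-cancelʳ 0<s (Q.≤-trans ms≤1 1≤Bs))))
           (≲-* (0≤* (0≤ν m) 0≤E) 0≤left
             (∑-≲ m {A = λ _ → E-bound} (λ k k<m → ≲-resp (sym (E-^ s k)) (E-≲ (ν k *ℚ s)
               (∣∣≤1 (0≤* (0≤ν k) (Q.<⇒≤ 0<s)) (Q.≤-trans (*-monoʳ (Q.<⇒≤ 0<s) (ν-mono (ℕₚ.<⇒≤ k<m))) ms≤1))))
               0≤E (λ _ _ → Q.≤-refl)) w≲)
      where
      ∣∣≤1 : ∀ {p} → 0ℚ ≤ℚ p → p ≤ℚ 1ℚ → Q.∣ p ∣ ≤ℚ 1ℚ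
      ∣∣≤1 0≤p p≤1 = subst (_≤ℚ 1ℚ) (≡.sym (Q.0≤p⇒∣p∣≡p 0≤p)) p≤1
      1<2 : 1ℚ <ℚ 2ℚ
      1<2 = subst (_<ℚ 2ℚ) (Q.+-identityʳ 1ℚ) (Q.+-monoʳ-< 1ℚ 0<1)
      big : ∀ N → 1ℚ *ℚ 1/[1+ N ] ≤ℚ s *ℚ ½ → 1ℚ <ℚ ν (suc N) *ℚ s
      big N le = Q.<-≤-trans 1<2 (Q.≤-trans
        (Q.≤-reflexive (≡.sym (≡.trans (ℚS.solve 2 (λ v r → v ℚS.:* (ℚS.con (+ 1) ℚS.:* r) ℚS.:* ℚS.con (+ 2) ℚS.:= r ℚS.:* v ℚS.:* ℚS.con (+ 2)) ≡.refl (ν (suc N)) 1/[1+ N ])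
          (≡.trans (≡.cong (_*ℚ 2ℚ) (1/[1+n]*ν N)) (Q.*-identityˡ 2ℚ)))))
        (Q.≤-trans (*-monoʳ 0≤2 (*-monoˡ (0≤ν (suc N)) le))
          (Q.≤-reflexive (≡.trans (ℚS.solve 3 (λ v s h → v ℚS.:* (s ℚS.:* h) ℚS.:* ℚS.con (+ 2) ℚS.:= v ℚS.:* s ℚS.:* (h ℚS.:* ℚS.con (+ 2))) ≡.refl (ν (suc N)) s ½)
            (≡.trans (≡.cong (ν (suc N) *ℚ s *ℚ_) ½*2) (Q.*-identityʳ _))))))
      half : ∀ m → ν m *ℚ s ≤ℚ 1ℚ → 1ℚ <ℚ ν (suc m) *ℚ s → ½ <ℚ ν m *ℚ s
      half zero    _ 1<s = contradiction (Q.≤-trans (Q.≤-reflexive (≡.trans (≡.cong (_*ℚ s) (≡.trans (ν-suc 0) (≡.trans (≡.cong (1ℚ +ℚ_) ν-0) (Q.+-identityʳ 1ℚ)))) (Q.*-identityˡ s))) s≤1) (<⇒≱ 1<s)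
      half (suc m) _ 1<  = *-cancelʳ-<2 (Q.<-≤-trans 1< (Q.≤-trans
        (*-monoʳ (Q.<⇒≤ 0<s) (Q.≤-trans (Q.≤-reflexive (ν-suc (suc m))) (Q.+-monoˡ-≤ (ν (suc m)) 1≤ν[1+ m ])))
        (Q.≤-reflexive (ℚS.solve 2 (λ v s → (v ℚS.:+ v) ℚS.:* s ℚS.:= v ℚS.:* s ℚS.:* ℚS.con (+ 2)) ≡.refl (ν (suc m)) s))))
        where
        *-cancelʳ-<2 : ∀ {a} → 1ℚ <ℚ a *ℚ 2ℚ → ½ <ℚ a
        *-cancelʳ-<2 {a} lt = Q.*-cancelʳ-< 0<2 (subst (_<ℚ a *ℚ 2ℚ) (≡.sym ½*2) lt)

  -- `B` is any bound for 1 / |s|, so that callers need not divide. A negative s is reduced to u =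
  -- -s through E s E u = 1: the inverse of E s - 1 is -E u times that of E u - 1.
  unit : ∀ s B → 0ℚ <ℚ Q.∣ s ∣ → Q.∣ s ∣ ≤ℚ 1ℚ → 0ℚ ≤ℚ B → 1ℚ ≤ℚ B *ℚ Q.∣ s ∣ →
         ∃ λ w → (E s - 1#) * w ≈ 1# × w ≲ B *ℚ unit-bound
  unit s B 0<∣s∣ ∣s∣≤1 0≤B 1≤B∣s∣ = by-sign (unit⁺ Q.∣ s ∣ B 0<∣s∣ ∣s∣≤1 1≤B∣s∣) (Q.∣p∣≡p∨∣p∣≡-p s)
    where
    u = Q.∣ s ∣
    1≤E : 1ℚ ≤ℚ E-bound
    1≤E = subst (_≤ℚ E-bound) (Q.+-identityˡ 1ℚ) (Q.+-monoˡ-≤ 1ℚ 0≤E₁)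

    by-sign : (∃ λ w → (E u - 1#) * w ≈ 1# × w ≲ B *ℚ (E-bound *ℚ left-bound)) →
              u ≡ s ⊎ u ≡ Q.- s → ∃ λ w → (E s - 1#) * w ≈ 1# × w ≲ B *ℚ unit-bound
    by-sign (w , inverse-w , w≲) (inj₁ u≡s) = w , trans (*-congʳ (+-congʳ (E-≡ (≡.sym u≡s)))) inverse-w
      , ≲-mono (*-monoˡ 0≤B (subst (_≤ℚ unit-bound) (Q.*-identityˡ (E-bound *ℚ left-bound)) (*-monoʳ (0≤* 0≤E 0≤left) 1≤E))) w≲
    by-sign (w , inverse-w , w≲) (inj₂ u≡-s) = - (E u * w)
      , (begin
          (E s - 1#) * - (E u * w)
            ≈⟨ solve 3 (λ e f w → (e :- con (+ 1)) :* (:- (f :* w)) := f :* w :- e :* f :* w) refl (E s) (E u) w ⟩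
          E u * w - E s * E u * w
            ≈⟨ +-congˡ (-‿cong (*-congʳ (trans (*-congʳ (E-≡ s≡-u)) (E-neg u)))) ⟩
          E u * w - 1# * w
            ≈⟨ solve 2 (λ f w → f :* w :- con (+ 1) :* w := (f :- con (+ 1)) :* w) refl (E u) w ⟩
          (E u - 1#) * w
            ≈⟨ inverse-w ⟩
          1# ∎)
      , ≲-≡ (ℚS.solve 3 (λ b e l → e ℚS.:* (b ℚS.:* l) ℚS.:= b ℚS.:* (e ℚS.:* l)) ≡.refl B E-bound (E-bound *ℚ left-bound))
          (≲-neg (≲-* 0≤E (0≤* 0≤B (0≤* 0≤E 0≤left)) (E-≲ u (subst (_≤ℚ 1ℚ) (≡.sym (Q.0≤p⇒∣p∣≡p (Q.0≤∣p∣ s))) ∣s∣≤1)) w≲))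
      where
      s≡-u : s ≡ Q.- u
      s≡-u = ≡.sym (≡.trans (≡.cong Q.-_ u≡-s) (ℚS.solve 1 (λ s → ℚS.:- (ℚS.:- s) ℚS.:= s) ≡.refl s))

  private
    unit-at : ∀ s → 0ℚ <ℚ Q.∣ s ∣ → Q.∣ s ∣ ≤ℚ 1ℚ → ∃ λ w → (E s - 1#) * w ≈ 1# × w ≲ inv Q.∣ s ∣ *ℚ unit-bound
    unit-at s 0< ≤1 = unit s (inv Q.∣ s ∣) 0< ≤1 (Q.<⇒≤ (0<inv _ 0<))
      (Q.≤-reflexive (≡.sym (≡.trans (Q.*-comm (inv Q.∣ s ∣) Q.∣ s ∣) (*-inv _ 0<))))

    -- Both side conditions are decidable for rational `s`, which makes the inverse a total
    -- function; `choose-spec` recovers any property established for all proofs of the conditions.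
    choose : ∀ s → Dec (0ℚ <ℚ Q.∣ s ∣) → Dec (Q.∣ s ∣ ≤ℚ 1ℚ) → Carrier
    choose s (yes 0<) (yes ≤1) = proj₁ (unit-at s 0< ≤1)
    choose s (yes _)  (no _)   = 0#
    choose s (no _)   _        = 0#

    choose-spec : ∀ s (P : Carrier → Set) → (∀ 0< ≤1 → P (proj₁ (unit-at s 0< ≤1))) → ∀ d e →
                  0ℚ <ℚ Q.∣ s ∣ → Q.∣ s ∣ ≤ℚ 1ℚ → P (choose s d e)
    choose-spec s P p (yes 0<) (yes ≤1) _   _   = p 0< ≤1
    choose-spec s P p (yes _)  (no ≰1)  _   s≤1 = contradiction s≤1 ≰1
    choose-spec s P p (no 0≮)  _        0<s _   = contradiction 0<s 0≮

  opaque
    -- The inverse of E s - 1; the junk value 0 unless 0 < ∣s∣ ≤ 1.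
    E-1⁻¹ : ℚ → Carrier
    E-1⁻¹ s = choose s (0ℚ Q.<? Q.∣ s ∣) (Q.∣ s ∣ Q.≤? 1ℚ)

    E-1⁻¹-inverse : ∀ s → 0ℚ <ℚ Q.∣ s ∣ → Q.∣ s ∣ ≤ℚ 1ℚ → (E s - 1#) * E-1⁻¹ s ≈ 1#
    E-1⁻¹-inverse s = choose-spec s (λ w → (E s - 1#) * w ≈ 1#) (λ 0< ≤1 → proj₁ (proj₂ (unit-at s 0< ≤1)))
      (0ℚ Q.<? Q.∣ s ∣) (Q.∣ s ∣ Q.≤? 1ℚ)

    E-1⁻¹-≲ : ∀ s B → 0ℚ <ℚ Q.∣ s ∣ → Q.∣ s ∣ ≤ℚ 1ℚ → 1ℚ ≤ℚ B *ℚ Q.∣ s ∣ → E-1⁻¹ s ≲ B *ℚ unit-bound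
    E-1⁻¹-≲ s B 0<s s≤1 1≤Bs = choose-spec s (λ w → w ≲ B *ℚ unit-bound)
      (λ 0< ≤1 → ≲-mono (*-monoʳ 0≤unit (*-cancelʳ 0< (Q.≤-trans
        (Q.≤-reflexive (≡.trans (Q.*-comm (inv Q.∣ s ∣) Q.∣ s ∣) (*-inv _ 0<))) 1≤Bs))) (proj₂ (proj₂ (unit-at s 0< ≤1))))
      (0ℚ Q.<? Q.∣ s ∣) (Q.∣ s ∣ Q.≤? 1ℚ) 0<s s≤1

  -- `E-1⁻¹` serves |s| ≤ 1; for s ≥ 1 the period 2 replaces s by s - 2. In this form, the fact that
  -- E s - 1 is no zero divisor passes to power series coefficient by coefficient.
  E-fixed : ∀ s → 0ℚ <ℚ s → s <ℚ 2ℚ → ∀ z → E s * z ≈ z → z ≈ 0#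
  E-fixed s 0<s s<2 z Es*z≈z = by-cases (Q.≤-total s 1ℚ)
    where
    cancel : ∀ u → 0ℚ <ℚ Q.∣ u ∣ → Q.∣ u ∣ ≤ℚ 1ℚ → E u ≈ E s → z ≈ 0#
    cancel u 0<u u≤1 Eu≈Es = begin
      z                              ≈⟨ trans (*-congʳ (E-1⁻¹-inverse u 0<u u≤1)) (*-identityˡ z) ⟨
      (E u - 1#) * E-1⁻¹ u * z       ≈⟨ solve 3 (λ e w z → (e :- con (+ 1)) :* w :* z := w :* (e :* z :- z)) refl (E u) (E-1⁻¹ u) z ⟩
      E-1⁻¹ u * (E u * z - z)        ≈⟨ *-congˡ (trans (+-congʳ (trans (*-congʳ Eu≈Es) Es*z≈z)) (-‿inverseʳ z)) ⟩
      E-1⁻¹ u * 0#                   ≈⟨ zeroʳ _ ⟩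
      0#                             ∎

    by-cases : s ≤ℚ 1ℚ ⊎ 1ℚ ≤ℚ s → z ≈ 0#
    by-cases (inj₁ s≤1) = cancel s (subst (0ℚ <ℚ_) (≡.sym ∣s∣) 0<s) (subst (_≤ℚ 1ℚ) (≡.sym ∣s∣) s≤1) refl
      where ∣s∣ = Q.0≤p⇒∣p∣≡p (Q.<⇒≤ 0<s)
    by-cases (inj₂ 1≤s) = cancel (s Q.- 2ℚ) (subst (0ℚ <ℚ_) (≡.sym ∣u∣) 0<2-s) (subst (_≤ℚ 1ℚ) (≡.sym ∣u∣) 2-s≤1)
      (sym (begin
        E s                            ≈⟨ E-≡ (ℚS.solve 2 (λ s t → s ℚS.:= t ℚS.:+ (s ℚS.:- t)) ≡.refl s 2ℚ) ⟩
        E (2ℚ +ℚ (s Q.- 2ℚ))           ≈⟨ trans (E-+ _ _) (trans (*-congʳ E-2) (*-identityˡ _)) ⟩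
        E (s Q.- 2ℚ)                   ∎))
      where
      0<2-s = Q.p<q⇒0<q-p s<2
      ∣u∣ : Q.∣ s Q.- 2ℚ ∣ ≡ 2ℚ Q.- s
      ∣u∣ = ≡.trans (≡.cong Q.∣_∣ (ℚS.solve 2 (λ s t → s ℚS.:- t ℚS.:= ℚS.:- (t ℚS.:- s)) ≡.refl s 2ℚ))
        (≡.trans (Q.∣-p∣≡∣p∣ _) (Q.0≤p⇒∣p∣≡p (Q.<⇒≤ 0<2-s)))
      2-s≤1 : 2ℚ Q.- s ≤ℚ 1ℚ
      2-s≤1 = Q.≤-trans (Q.+-monoʳ-≤ 2ℚ (Q.neg-antimono-≤ 1≤s)) (Q.≤-reflexive (ℚS.solve 0 (ℚS.con (+ 2) ℚS.:- ℚS.con (+ 1) ℚS.:= ℚS.con (+ 1)) ≡.refl))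

  module PrimitiveRoot (N-1 : ℕ) where
    private
      h = 1/[1+ N-1 ]
      N = suc N-1

    ω^N≈1 : E (2ℚ *ℚ h) ^ N ≈ 1#
    ω^N≈1 = trans (E-^ _ N) (trans (E-≡ (≡.trans (ℚS.solve 3 (λ n t h → n ℚS.:* (t ℚS.:* h) ℚS.:= h ℚS.:* n ℚS.:* t) ≡.refl (ν N) 2ℚ h)
      (≡.trans (≡.cong (_*ℚ 2ℚ) (1/[1+n]*ν N-1)) (Q.*-identityˡ 2ℚ)))) E-2)

    ω^k-fixed : ∀ k → 0 ℕ.< k → k ℕ.< N → ∀ z → E (2ℚ *ℚ h) ^ k * z ≈ z → z ≈ 0#
    ω^k-fixed (suc k) _ k<N z fixed = E-fixed (ν (suc k) *ℚ (2ℚ *ℚ h)) (0<* 0<ν[1+ k ] (0<* 0<2 (0<1/ N-1)))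
      (Q.<-≤-trans (Q.*-monoʳ-< (0<* 0<2 (0<1/ N-1)) (Q.<-≤-trans (ν-<-suc (suc k)) (ν-mono k<N)))
        (Q.≤-reflexive (≡.trans (ℚS.solve 3 (λ n t h → n ℚS.:* (t ℚS.:* h) ℚS.:= h ℚS.:* n ℚS.:* t) ≡.refl (ν N) 2ℚ h)
          (≡.trans (≡.cong (_*ℚ 2ℚ) (1/[1+n]*ν N-1)) (Q.*-identityˡ 2ℚ)))))
      z (trans (*-congʳ (sym (E-^ _ (suc k)))) fixed)

-- Uniform bounds for double families, and symmetric sums.

module Domination (V : NormedAlgebra) where
  open Limits V

  infix 4 _≼_
  -- Landau's O with one constant for all `k` and `l`.
  _≼_ : (ℕ → ℕ → Carrier) → (ℕ → ℕ → ℚ) → Set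
  f ≼ g = ∃ λ A → 0ℚ ≤ℚ A × (∀ k l → f k l ≲ A *ℚ g k l)

  ≼-resp : ∀ {f f′ g} → (∀ k l → f k l ≈ f′ k l) → f ≼ g → f′ ≼ g
  ≼-resp f≈ (A , 0≤A , f≲) = A , 0≤A , λ k l → ≲-resp (f≈ k l) (f≲ k l)

  ≼-mono : ∀ {f g g′} → (∀ k l → g k l ≤ℚ g′ k l) → f ≼ g → f ≼ g′
  ≼-mono g≤ (A , 0≤A , f≲) = A , 0≤A , λ k l → ≲-mono (*-monoˡ 0≤A (g≤ k l)) (f≲ k l)

  ≼-+ : ∀ {f f′ g} → f ≼ g → f′ ≼ g → (λ k l → f k l + f′ k l) ≼ g
  ≼-+ {g = g} (A , 0≤A , f≲) (B , 0≤B , f′≲) = A +ℚ B , 0≤+ 0≤A 0≤B , λ k l →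
    ≲-≡ (ℚS.solve 3 (λ A B g → A ℚS.:* g ℚS.:+ B ℚS.:* g ℚS.:= (A ℚS.:+ B) ℚS.:* g) ≡.refl A B (g k l)) (≲-+ (f≲ k l) (f′≲ k l))

  ≼-neg : ∀ {f g} → f ≼ g → (λ k l → - f k l) ≼ g
  ≼-neg (A , 0≤A , f≲) = A , 0≤A , λ k l → ≲-neg (f≲ k l)

  ≼-* : ∀ {f f′ g g′} → (∀ k l → 0ℚ ≤ℚ g k l) → (∀ k l → 0ℚ ≤ℚ g′ k l) → f ≼ g → f′ ≼ g′ →
        (λ k l → f k l * f′ k l) ≼ (λ k l → g k l *ℚ g′ k l)
  ≼-* {g = g} {g′} 0≤g 0≤g′ (A , 0≤A , f≲) (B , 0≤B , f′≲) = A *ℚ B , 0≤* 0≤A 0≤B , λ k l →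
    ≲-≡ (ℚS.solve 4 (λ A B g h → A ℚS.:* g ℚS.:* (B ℚS.:* h) ℚS.:= A ℚS.:* B ℚS.:* (g ℚS.:* h)) ≡.refl A B (g k l) (g′ k l))
      (≲-* (0≤* 0≤A (0≤g k l)) (0≤* 0≤B (0≤g′ k l)) (f≲ k l) (f′≲ k l))

module _ {c ℓ} (M : CommutativeMonoid c ℓ) where
  open CommutativeMonoid M
  open Fold M
  open SetoidReasoning setoid

  -- Each induction step peels off the two outermost terms, at M + 1 and -(M + 1).
  ⨁-symmetric : ∀ (g : ℚ → Carrier) M → ⨁ (suc (M ℕ.+ M)) (λ i → g (ν i Q.- ν M)) ≈
                g 0ℚ ∙ ⨁ M (λ k → g (ν (suc k)) ∙ g (Q.- ν (suc k)))
  ⨁-symmetric g zero    = trans (identityˡ _) (trans (reflexive (≡.cong g (Q.+-inverseʳ (ν 0)))) (sym (identityʳ _)))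
  ⨁-symmetric g (suc M) = begin
    ⨁ (suc (suc M ℕ.+ suc M)) f
      ≈⟨ ⨁-≡ f (≡.cong (λ m → suc (suc m)) (ℕₚ.+-suc M M)) ⟩
    ⨁ (suc (suc (M ℕ.+ M))) f ∙ f (suc (suc (M ℕ.+ M)))
      ≈⟨ ∙-cong (⨁-head (suc (M ℕ.+ M)) f) (reflexive (≡.cong g last)) ⟩
    f 0 ∙ ⨁ (suc (M ℕ.+ M)) (f ∘ suc) ∙ g (ν (suc M))
      ≈⟨ ∙-congʳ (∙-cong (reflexive (≡.cong g first)) (⨁-cong (suc (M ℕ.+ M)) (λ i _ → reflexive (≡.cong g (shift i))))) ⟩
    g (Q.- ν (suc M)) ∙ ⨁ (suc (M ℕ.+ M)) (λ i → g (ν i Q.- ν M)) ∙ g (ν (suc M))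
      ≈⟨ ∙-congʳ (∙-congˡ (⨁-symmetric g M)) ⟩
    g (Q.- ν (suc M)) ∙ (g 0ℚ ∙ S) ∙ g (ν (suc M))
      ≈⟨ ∙-congʳ (comm _ _) ⟩
    g 0ℚ ∙ S ∙ g (Q.- ν (suc M)) ∙ g (ν (suc M))
      ≈⟨ assoc _ _ _ ⟩
    g 0ℚ ∙ S ∙ (g (Q.- ν (suc M)) ∙ g (ν (suc M)))
      ≈⟨ trans (∙-congˡ (comm _ _)) (assoc _ _ _) ⟩
    g 0ℚ ∙ (S ∙ (g (ν (suc M)) ∙ g (Q.- ν (suc M)))) ∎
    where
    f : ℕ → Carrier
    f i = g (ν i Q.- ν (suc M))
    S = ⨁ M (λ k → g (ν (suc k)) ∙ g (Q.- ν (suc k)))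
    first : ν 0 Q.- ν (suc M) ≡ Q.- ν (suc M)
    first = ≡.trans (≡.cong (λ t → t Q.- ν (suc M)) ν-0) (Q.+-identityˡ _)
    shift : ∀ i → ν (suc i) Q.- ν (suc M) ≡ ν i Q.- ν M
    shift i = ≡.trans (≡.cong₂ Q._-_ (ν-suc i) (ν-suc M))
      (ℚS.solve 2 (λ i m → (ℚS.con (+ 1) ℚS.:+ i) ℚS.:- (ℚS.con (+ 1) ℚS.:+ m) ℚS.:= i ℚS.:- m) ≡.refl (ν i) (ν M))
    last : ν (suc (suc (M ℕ.+ M))) Q.- ν (suc M) ≡ ν (suc M)
    last = ≡.trans (shift (suc (M ℕ.+ M))) (≡.trans (≡.cong (λ t → t Q.- ν M) (ν-+ (suc M) M))
      (ℚS.solve 2 (λ a b → a ℚS.:+ b ℚS.:- b ℚS.:= a) ≡.refl (ν (suc M)) (ν M)))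

-- Approximation of 1 / τ by finite cotangents.

-- cot M (x + k) is (π / N) cot (π (x + k) / N) with N = 2 M + 1.
module CotangentSums {V : NormedAlgebra} (Rot : Rotations V) where
  open RotationEstimates Rot
  open SetoidReasoning setoid

  step : ℕ → ℚ
  step M = 1/[1+ M ℕ.+ M ]

  size : ℕ → ℚ
  size M = ν (suc (M ℕ.+ M))

  angle : ℕ → ℚ → ℚ
  angle M τ = 2ℚ *ℚ τ *ℚ step M

  -- cot θ = i (exp (2 i θ) + 1) / (exp (2 i θ) - 1) with θ = π τ / N, where the i is part of `ϖ`.
  -- Like `E-1⁻¹` it is total, and meaningful for 0 < 2 |τ| ≤ N.
  cot : ℕ → ℚ → Carrier
  cot M τ = ϖ * inverse (M ℕ.+ M) * ((E (angle M τ) + 1#) * E-1⁻¹ (angle M τ))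

  step*size : ∀ M → step M *ℚ size M ≡ 1ℚ
  step*size M = 1/[1+n]*ν (M ℕ.+ M)

  3ℚ : ℚ
  3ℚ = 2ℚ +ℚ 1ℚ

  -- `Q` stands for 1 / |τ| up to a factor between 1 and 3, which leaves room for the single value 2
  -- / (k + 1) at both τ = x + (k + 1) and τ = x - (k + 1). The 3 covers the product of 2 / (k + 1)
  -- with x + (k + 1), at most 2 + 2 x. The condition on 2 |τ| puts the angle into the range where
  -- `E-1⁻¹` is an inverse.
  module Single (M : ℕ) (τ Q : ℚ) (0<T : 0ℚ <ℚ Q.∣ τ ∣) (2T≤N : 2ℚ *ℚ Q.∣ τ ∣ ≤ℚ size M)
    (0≤Q : 0ℚ ≤ℚ Q) (1≤QT : 1ℚ ≤ℚ Q *ℚ Q.∣ τ ∣) (QT≤3 : Q *ℚ Q.∣ τ ∣ ≤ℚ 3ℚ) where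

    T h n : ℚ
    T = Q.∣ τ ∣
    h = step M
    n = size M
    s : ℚ
    s = angle M τ

    0≤h : 0ℚ ≤ℚ h
    0≤h = 0≤1/ _
    0≤n : 0ℚ ≤ℚ n
    0≤n = 0≤ν _

    ∣s∣ : Q.∣ s ∣ ≡ 2ℚ *ℚ T *ℚ h
    ∣s∣ = ≡.trans (Q.∣p*q∣≡∣p∣*∣q∣ _ _) (≡.cong₂ _*ℚ_ (≡.trans (Q.∣p*q∣≡∣p∣*∣q∣ 2ℚ τ) (≡.cong (_*ℚ T) (Q.0≤p⇒∣p∣≡p 0≤2))) (Q.0≤p⇒∣p∣≡p 0≤h))

    0<∣s∣ : 0ℚ <ℚ Q.∣ s ∣
    0<∣s∣ = subst (0ℚ <ℚ_) (≡.sym ∣s∣) (0<* (0<* 0<2 0<T) (0<1/ _))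

    ∣s∣≤1 : Q.∣ s ∣ ≤ℚ 1ℚ
    ∣s∣≤1 = Q.≤-trans (Q.≤-reflexive ∣s∣) (Q.≤-trans (*-monoʳ 0≤h 2T≤N)
      (Q.≤-reflexive (≡.trans (Q.*-comm n h) (step*size M))))

    Q∣s∣ : Q *ℚ Q.∣ s ∣ ≤ℚ 2ℚ *ℚ 3ℚ *ℚ h
    Q∣s∣ = Q.≤-trans (Q.≤-reflexive (≡.trans (≡.cong (Q *ℚ_) ∣s∣)
      (ℚS.solve 3 (λ q t h → q ℚS.:* (ℚS.con (+ 2) ℚS.:* t ℚS.:* h) ℚS.:= ℚS.con (+ 2) ℚS.:* (q ℚS.:* t) ℚS.:* h) ≡.refl Q T h)))
      (*-monoʳ 0≤h (*-monoˡ 0≤2 QT≤3))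

    w : Carrier
    w = E-1⁻¹ s

    w-inverse : (E s - 1#) * w ≈ 1#
    w-inverse = E-1⁻¹-inverse s 0<∣s∣ ∣s∣≤1

    w-≲ : w ≲ Q *ℚ n *ℚ unit-bound
    w-≲ = E-1⁻¹-≲ s (Q *ℚ n) 0<∣s∣ ∣s∣≤1 (Q.≤-trans 1≤QT (Q.≤-trans
      (≤-steps (0≤* 0≤Q (Q.<⇒≤ 0<T)) Q.≤-refl)
      (Q.≤-reflexive (≡.sym (≡.trans (≡.cong (Q *ℚ n *ℚ_) ∣s∣)
        (≡.trans (ℚS.solve 4 (λ q n t h → q ℚS.:* n ℚS.:* (ℚS.con (+ 2) ℚS.:* t ℚS.:* h) ℚS.:= h ℚS.:* n ℚS.:* (q ℚS.:* t ℚS.:+ q ℚS.:* t)) ≡.refl Q n T h)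
          (≡.trans (≡.cong (_*ℚ (Q *ℚ T +ℚ Q *ℚ T)) (step*size M)) (Q.*-identityˡ _))))))))

    c : Carrier
    c = cot M τ

    cot-bound : ℚ
    cot-bound = ϖ-bound *ℚ ((E-bound +ℚ 1ℚ) *ℚ unit-bound)

    0≤cot : 0ℚ ≤ℚ cot-bound
    0≤cot = 0≤* 0≤ϖ (0≤* (0≤+ 0≤E 0≤1) 0≤unit)

    cot-≲ : c ≲ cot-bound *ℚ Q
    cot-≲ = ≲-≡ (≡.trans (ℚS.solve 6 (λ p h e q n u → p ℚS.:* h ℚS.:* (e ℚS.:* (q ℚS.:* n ℚS.:* u)) ℚS.:= h ℚS.:* n ℚS.:* (p ℚS.:* (e ℚS.:* u) ℚS.:* q)) ≡.refl
                    ϖ-bound h (E-bound +ℚ 1ℚ) Q n unit-bound)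
                  (≡.trans (≡.cong (_*ℚ (cot-bound *ℚ Q)) (step*size M)) (Q.*-identityˡ _)))
      (≲-* (0≤* 0≤ϖ 0≤h) (0≤* (0≤+ 0≤E 0≤1) (0≤* (0≤* 0≤Q 0≤n) 0≤unit))
        (≲-* 0≤ϖ 0≤h ϖ-≲ (ι-≥ 0≤h))
        (≲-* (0≤+ 0≤E 0≤1) (0≤* (0≤* 0≤Q 0≤n) 0≤unit) (≲-+ (E-≲ s ∣s∣≤1) 1≲) w-≲))

    cot-defining : c * (E s - 1#) ≈ ϖ * ι h * (E s + 1#)
    cot-defining = trans
      (solve 3 (λ r e w → r :* ((e :+ con (+ 1)) :* w) :* (e :- con (+ 1)) := r :* (e :+ con (+ 1)) :* ((e :- con (+ 1)) :* w)) refl (ϖ * ι h) (E s) w)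
      (trans (*-congˡ w-inverse) (*-identityʳ _))

    ϖ⁻¹-bound : ℚ
    ϖ⁻¹-bound = proj₁ (bound ϖ⁻¹)
    0≤ϖ⁻¹ : 0ℚ ≤ℚ ϖ⁻¹-bound
    0≤ϖ⁻¹ = proj₁ (proj₂ (bound ϖ⁻¹))

    difference-bound : ℚ
    difference-bound = E₁-bound *ℚ (2ℚ *ℚ 3ℚ) +ℚ ϖ⁻¹-bound *ℚ (cot-bound *ℚ E₂-bound) *ℚ (2ℚ *ℚ 3ℚ *ℚ (2ℚ *ℚ 3ℚ))

    0≤difference : 0ℚ ≤ℚ difference-bound
    0≤difference = 0≤+ (0≤* 0≤E₁ 0≤6) (0≤* (0≤* 0≤ϖ⁻¹ (0≤* 0≤cot 0≤E₂)) (0≤* 0≤6 0≤6))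
      where
      0≤6 : 0ℚ ≤ℚ 2ℚ *ℚ 3ℚ
      0≤6 = 0≤* 0≤2 (0≤+ 0≤2 0≤1)

    private
      -- With y - 1 = s ϖ + ρ, `cot-defining` becomes 2 τ c = (y + 1) - n c ρ / ϖ. So `X` is 2 (τ c
      -- - 1), written through quantities that are small with s: y - 1 is O(s) and ρ is O(s²).
      y ρ X : Carrier
      y = E s
      ρ = y - 1# - ι s * ϖ
      X = (y - 1#) - ϖ⁻¹ * (ι n * (c * ρ))

      ι-2 : ι 2ℚ ≈ 1# + 1#
      ι-2 = trans (ι-+ 1ℚ 1ℚ) (+-cong ι-1 ι-1)

      X-≈ : X ≈ (1# + 1#) * (ι τ * c - 1#)
      X-≈ = begin
        (y - 1#) - ϖ⁻¹ * (ι n * (c * (y - 1# - ι s * ϖ)))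
          ≈⟨ solve 6 (λ y v n c s p → (y :- con (+ 1)) :- v :* (n :* (c :* (y :- con (+ 1) :- s :* p)))
               := (y :- con (+ 1)) :- v :* (n :* (c :* (y :- con (+ 1)))) :+ v :* p :* (n :* (c :* s))) refl y ϖ⁻¹ (ι n) c (ι s) ϖ ⟩
        (y - 1#) - ϖ⁻¹ * (ι n * (c * (y - 1#))) + ϖ⁻¹ * ϖ * (ι n * (c * ι s))
          ≈⟨ +-cong (+-congˡ (-‿cong (*-congˡ (*-congˡ cot-defining)))) (*-congˡ (*-congˡ (*-congˡ
               (trans (ι-* (2ℚ *ℚ τ) h) (*-congʳ (trans (ι-* 2ℚ τ) (*-congʳ ι-2))))))) ⟩
        (y - 1#) - ϖ⁻¹ * (ι n * (ϖ * ι h * (y + 1#))) + ϖ⁻¹ * ϖ * (ι n * (c * ((1# + 1#) * ι τ * ι h)))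
          ≈⟨ solve 7 (λ y v n p h c t → (y :- con (+ 1)) :- v :* (n :* (p :* h :* (y :+ con (+ 1)))) :+ v :* p :* (n :* (c :* (con (+ 2) :* t :* h)))
               := (y :- con (+ 1)) :+ v :* p :* (h :* n) :* (con (+ 2) :* (t :* c) :- (y :+ con (+ 1)))) refl y ϖ⁻¹ (ι n) ϖ (ι h) c (ι τ) ⟩
        (y - 1#) + ϖ⁻¹ * ϖ * (ι h * ι n) * ((1# + 1#) * (ι τ * c) - (y + 1#))
          ≈⟨ +-congˡ (trans (*-congʳ (trans (*-cong ϖ⁻¹-ϖ (ι-inverse (step*size M))) (*-identityˡ _))) (*-identityˡ _)) ⟩
        (y - 1#) + ((1# + 1#) * (ι τ * c) - (y + 1#))
          ≈⟨ solve 2 (λ y z → (y :- con (+ 1)) :+ (con (+ 2) :* z :- (y :+ con (+ 1))) := con (+ 2) :* (z :- con (+ 1))) refl y (ι τ * c) ⟩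
        (1# + 1#) * (ι τ * c - 1#) ∎

    -- c - d = d (τ c - 1) is half of d times `X`. As d is O(Q) and Q |s| ≤ 6 / N, the two parts of
    -- `X` contribute Q |s| = O(1 / N) and n (Q |s|)² = O(1 / N), the latter because n = N. The
    -- constant is independent of τ.
    cot-difference : ∀ d → ι τ * d ≈ 1# → d ≲ Q → c - d ≲ difference-bound *ℚ h
    cot-difference d τd≈1 d≲Q = ≲-resp (sym formula) (≲-mono estimate
      (≲-* 0≤Q (0≤+ (0≤* 0≤E₁ 0≤σ) (0≤* 0≤ϖ⁻¹ (0≤* 0≤n (0≤* (0≤* 0≤cot 0≤Q) (0≤* 0≤E₂ (0≤* 0≤σ 0≤σ)))))) d≲Q
        (≲-≡ (Q.*-identityˡ _) (≲-* 0≤1 (0≤+ (0≤* 0≤E₁ 0≤σ) (0≤* 0≤ϖ⁻¹ (0≤* 0≤n (0≤* (0≤* 0≤cot 0≤Q) (0≤* 0≤E₂ (0≤* 0≤σ 0≤σ)))))) ½≲1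
          (≲-- (E₁-≲ s ∣s∣≤1) (≲-* 0≤ϖ⁻¹ (0≤* 0≤n (0≤* (0≤* 0≤cot 0≤Q) (0≤* 0≤E₂ (0≤* 0≤σ 0≤σ)))) (proj₂ (proj₂ (bound ϖ⁻¹)))
            (≲-* 0≤n (0≤* (0≤* 0≤cot 0≤Q) (0≤* 0≤E₂ (0≤* 0≤σ 0≤σ))) (ι-≥ 0≤n)
              (≲-* (0≤* 0≤cot 0≤Q) (0≤* 0≤E₂ (0≤* 0≤σ 0≤σ)) cot-≲ (E₂-≲ s ∣s∣≤1)))))))))
      where
      σ = Q.∣ s ∣
      0≤σ = Q.0≤∣p∣ s
      ½≲1 : ι ½ ≲ 1ℚ
      ½≲1 = ≲-mono ½≤1 (ι-≥ (Q.<⇒≤ (ℚₚ.positive⁻¹ ½)))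
      formula : c - d ≈ d * (ι ½ * X)
      formula = sym (begin
        d * (ι ½ * X)                                   ≈⟨ *-congˡ (*-congˡ X-≈) ⟩
        d * (ι ½ * ((1# + 1#) * (ι τ * c - 1#)))
          ≈⟨ solve 4 (λ d h t c → d :* (h :* (con (+ 2) :* (t :* c :- con (+ 1)))) := h :* con (+ 2) :* (t :* d :* c :- d)) refl d (ι ½) (ι τ) c ⟩
        ι ½ * (1# + 1#) * (ι τ * d * c - d)
          ≈⟨ *-cong (trans (*-congˡ (sym ι-2)) (ι-inverse ½*2)) (+-congʳ (trans (*-congʳ τd≈1) (*-identityˡ c))) ⟩
        1# * (c - d)                                    ≈⟨ *-identityˡ _ ⟩
        c - d                                           ∎)
      estimate : Q *ℚ (E₁-bound *ℚ σ +ℚ ϖ⁻¹-bound *ℚ (n *ℚ (cot-bound *ℚ Q *ℚ (E₂-bound *ℚ (σ *ℚ σ))))) ≤ℚ difference-bound *ℚ h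
      estimate = Q.≤-trans (Q.≤-reflexive (ℚS.solve 7 (λ q a s v n c b →
            q ℚS.:* (a ℚS.:* s ℚS.:+ v ℚS.:* (n ℚS.:* (c ℚS.:* q ℚS.:* (b ℚS.:* (s ℚS.:* s)))))
            ℚS.:= a ℚS.:* (q ℚS.:* s) ℚS.:+ v ℚS.:* (c ℚS.:* b) ℚS.:* n ℚS.:* (q ℚS.:* s ℚS.:* (q ℚS.:* s))) ≡.refl Q E₁-bound σ ϖ⁻¹-bound n cot-bound E₂-bound))
        (Q.≤-trans (Q.+-mono-≤ (*-monoˡ 0≤E₁ Q∣s∣)
            (*-monoˡ (0≤* (0≤* 0≤ϖ⁻¹ (0≤* 0≤cot 0≤E₂)) 0≤n)
              (Q.≤-trans (*-monoˡ (0≤* 0≤Q 0≤σ) Q∣s∣) (*-monoʳ (0≤* (0≤* 0≤2 (0≤+ 0≤2 0≤1)) 0≤h) Q∣s∣))))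
          (Q.≤-reflexive (≡.trans (ℚS.solve 5 (λ a k h v n → a ℚS.:* (k ℚS.:* h) ℚS.:+ v ℚS.:* n ℚS.:* (k ℚS.:* h ℚS.:* (k ℚS.:* h))
              ℚS.:= a ℚS.:* k ℚS.:* h ℚS.:+ v ℚS.:* (k ℚS.:* k) ℚS.:* (h ℚS.:* n) ℚS.:* h) ≡.refl E₁-bound (2ℚ *ℚ 3ℚ) h (ϖ⁻¹-bound *ℚ (cot-bound *ℚ E₂-bound)) n)
            (≡.trans (≡.cong (λ t → E₁-bound *ℚ (2ℚ *ℚ 3ℚ) *ℚ h +ℚ ϖ⁻¹-bound *ℚ (cot-bound *ℚ E₂-bound) *ℚ (2ℚ *ℚ 3ℚ *ℚ (2ℚ *ℚ 3ℚ)) *ℚ t *ℚ h) (step*size M))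
              (ℚS.solve 3 (λ a b h → a ℚS.:* h ℚS.:+ b ℚS.:* ℚS.con (+ 1) ℚS.:* h ℚS.:= (a ℚS.:+ b) ℚS.:* h) ≡.refl _ _ h)))))

-- The sine product as a limit of cotangent products.

module Cotangent {V : NormedAlgebra} (Rot : Rotations V) (x : ℚ) (0<x : 0ℚ <ℚ x) (x<½ : x <ℚ ½) where
  open RotationEstimates Rot
  open CotangentSums Rot
  open Domination V
  open SetoidReasoning setoid

  0≤x : 0ℚ ≤ℚ x
  0≤x = Q.<⇒≤ 0<x

  2x≤1 : 2ℚ *ℚ x ≤ℚ 1ℚ
  2x≤1 = Q.≤-trans (*-monoˡ 0≤2 (Q.<⇒≤ x<½)) (Q.≤-reflexive (≡.trans (Q.*-comm 2ℚ ½) ½*2))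

  ∣∣-nonneg : ∀ {p} → 0ℚ ≤ℚ p → Q.∣ p ∣ ≡ p
  ∣∣-nonneg = Q.0≤p⇒∣p∣≡p

  x<1 : x <ℚ 1ℚ
  x<1 = Q.<-≤-trans x<½ ½≤1

  above below : ℕ → ℚ
  above k = x +ℚ ν (suc k)
  below k = ν (suc k) Q.- x

  0<above : ∀ k → 0ℚ <ℚ above k
  0<above k = 0<+ 0<x (0≤ν _)

  0<below : ∀ k → 0ℚ <ℚ below k
  0<below k = Q.p<q⇒0<q-p (Q.<-≤-trans x<1 1≤ν[1+ k ])

  ∣above∣ : ∀ k → Q.∣ above k ∣ ≡ above k
  ∣above∣ k = ∣∣-nonneg (Q.<⇒≤ (0<above k))

  below-neg : ∀ k → x Q.- ν (suc k) ≡ Q.- below k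
  below-neg k = ℚS.solve 2 (λ x n → x ℚS.:- n ℚS.:= ℚS.:- (n ℚS.:- x)) ≡.refl x (ν (suc k))

  ∣below∣ : ∀ k → Q.∣ x Q.- ν (suc k) ∣ ≡ below k
  ∣below∣ k = ≡.trans (≡.cong Q.∣_∣ (below-neg k)) (≡.trans (Q.∣-p∣≡∣p∣ _) (∣∣-nonneg (Q.<⇒≤ (0<below k))))

  -- Here M = k + l + 1, so `β` is 1 / M in a form without the side condition k < M. `α` squared is
  -- the summable majorant and `β` the one that tends to 0 with M.
  α : ℕ → ℕ → ℚ
  α k l = 1/[1+ k ]
  β : ℕ → ℕ → ℚ
  β k l = 1/[1+ k ℕ.+ l ]

  -- An upper bound for 1 / |x ± (k + 1)|, valid for both signs because x < 1/2.
  scaled : ℕ → ℚ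
  scaled k = 2ℚ *ℚ 1/[1+ k ]

  0≤scaled : ∀ k → 0ℚ ≤ℚ scaled k
  0≤scaled k = 0≤* 0≤2 (0≤1/ k)

  scaled*ν : ∀ k → scaled k *ℚ ν (suc k) ≡ 2ℚ
  scaled*ν k = ≡.trans (Q.*-assoc 2ℚ _ _) (≡.trans (≡.cong (2ℚ *ℚ_) (1/[1+n]*ν k)) (Q.*-identityʳ 2ℚ))

  scaled*x : ∀ k → scaled k *ℚ x ≤ℚ 1ℚ
  scaled*x k = Q.≤-trans (Q.≤-reflexive (ℚS.solve 3 (λ a r x → a ℚS.:* r ℚS.:* x ℚS.:= r ℚS.:* (a ℚS.:* x)) ≡.refl 2ℚ 1/[1+ k ] x))
    (Q.≤-trans (*-monoˡ (0≤1/ k) 2x≤1) (Q.≤-trans (Q.≤-reflexive (Q.*-identityʳ _)) (1/≤1 k)))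

  2≤3 : 2ℚ ≤ℚ 3ℚ
  2≤3 = ≤-steps 0≤1 Q.≤-refl

  scaled-above : ∀ k → scaled k *ℚ above k ≡ scaled k *ℚ x +ℚ 2ℚ
  scaled-above k = ≡.trans (ℚS.solve 3 (λ s x n → s ℚS.:* (x ℚS.:+ n) ℚS.:= s ℚS.:* x ℚS.:+ s ℚS.:* n) ≡.refl (scaled k) x (ν (suc k)))
    (≡.cong (scaled k *ℚ x +ℚ_) (scaled*ν k))

  scaled-below : ∀ k → scaled k *ℚ below k ≡ 2ℚ Q.- scaled k *ℚ x
  scaled-below k = ≡.trans (ℚS.solve 3 (λ s x n → s ℚS.:* (n ℚS.:- x) ℚS.:= s ℚS.:* n ℚS.:- s ℚS.:* x) ≡.refl (scaled k) x (ν (suc k)))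
    (≡.cong (λ t → t Q.- scaled k *ℚ x) (scaled*ν k))

  1≤scaled-above : ∀ k → 1ℚ ≤ℚ scaled k *ℚ above k
  1≤scaled-above k = Q.≤-trans (≤-steps 0≤1 Q.≤-refl) (Q.≤-trans (≤-steps (0≤* (0≤scaled k) 0≤x) Q.≤-refl)
    (Q.≤-reflexive (≡.trans (Q.+-comm 2ℚ _) (≡.sym (scaled-above k)))))

  1≤scaled-below : ∀ k → 1ℚ ≤ℚ scaled k *ℚ below k
  1≤scaled-below k = Q.≤-trans (Q.≤-reflexive (ℚS.solve 0 (ℚS.con (+ 1) ℚS.:= ℚS.con (+ 2) ℚS.:- ℚS.con (+ 1)) ≡.refl))
    (Q.≤-trans (Q.+-monoʳ-≤ 2ℚ (Q.neg-antimono-≤ (scaled*x k))) (Q.≤-reflexive (≡.sym (scaled-below k))))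

  2*ν≤size : ∀ k M → suc k ℕ.≤ M → 2ℚ *ℚ ν (suc k) +ℚ 1ℚ ≤ℚ size M
  2*ν≤size k M k<M = Q.≤-trans (Q.+-monoˡ-≤ 1ℚ (*-monoˡ 0≤2 (ν-mono k<M))) (Q.≤-reflexive (≡.sym
    (≡.trans (ν-suc _) (≡.trans (≡.cong (1ℚ +ℚ_) (ν-+ M M))
      (ℚS.solve 1 (λ m → ℚS.con (+ 1) ℚS.:+ (m ℚS.:+ m) ℚS.:= ℚS.con (+ 2) ℚS.:* m ℚS.:+ ℚS.con (+ 1)) ≡.refl (ν M))))))

  module Above (M k : ℕ) (k<M : suc k ℕ.≤ M) = Single M (above k) (scaled k)
    (subst (0ℚ <ℚ_) (≡.sym (∣above∣ k)) (0<above k))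
    (Q.≤-trans (Q.≤-reflexive (≡.trans (≡.cong (2ℚ *ℚ_) (∣above∣ k))
      (ℚS.solve 2 (λ x n → ℚS.con (+ 2) ℚS.:* (x ℚS.:+ n) ℚS.:= ℚS.con (+ 2) ℚS.:* n ℚS.:+ ℚS.con (+ 2) ℚS.:* x) ≡.refl x (ν (suc k)))))
      (Q.≤-trans (Q.+-monoʳ-≤ _ 2x≤1) (2*ν≤size k M k<M)))
    (0≤scaled k)
    (subst (λ t → 1ℚ ≤ℚ scaled k *ℚ t) (≡.sym (∣above∣ k)) (1≤scaled-above k))
    (Q.≤-trans (Q.≤-reflexive (≡.trans (≡.cong (scaled k *ℚ_) (∣above∣ k)) (scaled-above k)))
      (Q.≤-trans (Q.+-monoˡ-≤ 2ℚ (scaled*x k)) (Q.≤-reflexive (Q.+-comm 1ℚ 2ℚ))))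

  module Below (M k : ℕ) (k<M : suc k ℕ.≤ M) = Single M (x Q.- ν (suc k)) (scaled k)
    (subst (0ℚ <ℚ_) (≡.sym (∣below∣ k)) (0<below k))
    (Q.≤-trans (Q.≤-reflexive (≡.trans (≡.cong (2ℚ *ℚ_) (∣below∣ k))
      (ℚS.solve 2 (λ x n → ℚS.con (+ 2) ℚS.:* (n ℚS.:- x) ℚS.:= ℚS.con (+ 2) ℚS.:* n ℚS.:- ℚS.con (+ 2) ℚS.:* x) ≡.refl x (ν (suc k)))))
      (Q.≤-trans (minus-≤ (0≤* 0≤2 0≤x)) (Q.≤-trans (≤-steps 0≤1 Q.≤-refl) (2*ν≤size k M k<M))))
    (0≤scaled k)
    (subst (λ t → 1ℚ ≤ℚ scaled k *ℚ t) (≡.sym (∣below∣ k)) (1≤scaled-below k))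
    (Q.≤-trans (Q.≤-reflexive (≡.trans (≡.cong (scaled k *ℚ_) (∣below∣ k)) (scaled-below k)))
      (Q.≤-trans (minus-≤ (0≤* (0≤scaled k) 0≤x)) 2≤3))

  inv-x : inv x *ℚ Q.∣ x ∣ ≡ 1ℚ
  inv-x = ≡.trans (≡.cong (inv x *ℚ_) (∣∣-nonneg 0≤x)) (≡.trans (Q.*-comm (inv x) x) (*-inv x 0<x))

  module Zeroth (M : ℕ) = Single M x (inv x)
    (subst (0ℚ <ℚ_) (≡.sym (∣∣-nonneg 0≤x)) 0<x)
    (Q.≤-trans (Q.≤-reflexive (≡.cong (2ℚ *ℚ_) (∣∣-nonneg 0≤x))) (Q.≤-trans 2x≤1 1≤ν[1+ _ ]))
    (Q.<⇒≤ (0<inv x 0<x))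
    (Q.≤-reflexive (≡.sym inv-x))
    (Q.≤-trans (Q.≤-reflexive inv-x) (Q.≤-trans (≤-steps 0≤1 Q.≤-refl) 2≤3))

  d⁺ d⁻ : ℕ → Carrier
  d⁺ k = ι (inv (above k))
  d⁻ k = - ι (inv (below k))

  d⁰ : Carrier
  d⁰ = ι (inv x)

  d⁺-inverse : ∀ k → ι (above k) * d⁺ k ≈ 1#
  d⁺-inverse k = ι-inverse (*-inv _ (0<above k))

  d⁻-inverse : ∀ k → ι (x Q.- ν (suc k)) * d⁻ k ≈ 1#
  d⁻-inverse k = trans (*-congʳ (trans (reflexive (≡.cong ι (below-neg k))) (ι-neg _)))
    (trans (solve 2 (λ a b → :- a :* :- b := a :* b) refl _ _) (ι-inverse (*-inv _ (0<below k))))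

  inv≤scaled : ∀ {a} k → 0ℚ <ℚ a → 1ℚ ≤ℚ scaled k *ℚ a → inv a ≤ℚ scaled k
  inv≤scaled {a} k 0<a 1≤ = *-cancelʳ 0<a (Q.≤-trans (Q.≤-reflexive (≡.trans (Q.*-comm (inv a) a) (*-inv a 0<a))) 1≤)

  d⁺-≲ : ∀ k → d⁺ k ≲ scaled k
  d⁺-≲ k = ≲-mono (inv≤scaled k (0<above k) (1≤scaled-above k)) (ι-≥ (Q.<⇒≤ (0<inv _ (0<above k))))

  d⁻-≲ : ∀ k → d⁻ k ≲ scaled k
  d⁻-≲ k = ≲-neg (≲-mono (inv≤scaled k (0<below k) (1≤scaled-below k)) (ι-≥ (Q.<⇒≤ (0<inv _ (0<below k)))))

  c⁺ c⁻ : ℕ → ℕ → Carrier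
  c⁺ k l = cot (suc (k ℕ.+ l)) (above k)
  c⁻ k l = cot (suc (k ℕ.+ l)) (x Q.- ν (suc k))

  private
    k<M : ∀ k l → suc k ℕ.≤ suc (k ℕ.+ l)
    k<M k l = ℕ.s≤s (ℕₚ.m≤m+n k l)

    step≤β : ∀ k l → step (suc (k ℕ.+ l)) ≤ℚ β k l
    step≤β k l = 1/-antimono (ℕₚ.≤-trans (ℕₚ.n≤1+n (k ℕ.+ l)) (ℕₚ.m≤m+n (suc (k ℕ.+ l)) (suc (k ℕ.+ l))))

    0≤α : ∀ k (l : ℕ) → 0ℚ ≤ℚ α k l
    0≤α k l = 0≤1/ k
    0≤β : ∀ k l → 0ℚ ≤ℚ β k l
    0≤β k l = 0≤1/ (k ℕ.+ l)

    α² : ℕ → ℕ → ℚ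
    α² k l = α k l *ℚ α k l

    α²≤α : ∀ k l → α² k l ≤ℚ α k l
    α²≤α k l = Q.≤-trans (*-monoˡ (0≤α k l) (1/≤1 k)) (Q.≤-reflexive (Q.*-identityʳ _))

    βα≤β : ∀ k l → β k l *ℚ α k l ≤ℚ β k l
    βα≤β k l = Q.≤-trans (*-monoˡ (0≤β k l) (1/≤1 k)) (Q.≤-reflexive (Q.*-identityʳ _))

    αβ≤β : ∀ k l → α k l *ℚ β k l ≤ℚ β k l
    αβ≤β k l = Q.≤-trans (Q.≤-reflexive (Q.*-comm _ _)) (βα≤β k l)

    scaled-≼ : ∀ {f A} → 0ℚ ≤ℚ A → (∀ k l → f k l ≲ A *ℚ scaled k) → f ≼ α
    scaled-≼ {A = A} 0≤A f≲ = A *ℚ 2ℚ , 0≤* 0≤A 0≤2 , λ k l → ≲-≡ (≡.sym (Q.*-assoc A 2ℚ _)) (f≲ k l)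

    c⁺-≼ : c⁺ ≼ α
    -- The constants in `Single` do not depend on its parameters, so those of the smallest instance
    -- M = 1, k = 0 serve for all k and l.
    c⁺-≼ = scaled-≼ (Above.0≤cot 1 0 ℕₚ.≤-refl) (λ k l → Above.cot-≲ _ k (k<M k l))
    c⁻-≼ : c⁻ ≼ α
    c⁻-≼ = scaled-≼ (Below.0≤cot 1 0 ℕₚ.≤-refl) (λ k l → Below.cot-≲ _ k (k<M k l))
    d⁺-≼ : (λ k l → d⁺ k) ≼ α
    d⁺-≼ = 2ℚ , 0≤2 , λ k l → d⁺-≲ k
    d⁻-≼ : (λ k l → d⁻ k) ≼ α
    d⁻-≼ = 2ℚ , 0≤2 , λ k l → d⁻-≲ k

    c-d⁺-≼ : (λ k l → c⁺ k l - d⁺ k) ≼ β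
    c-d⁺-≼ = Above.difference-bound 1 0 ℕₚ.≤-refl , Above.0≤difference 1 0 ℕₚ.≤-refl , λ k l →
      ≲-mono (*-monoˡ (Above.0≤difference 1 0 ℕₚ.≤-refl) (step≤β k l)) (Above.cot-difference _ k (k<M k l) (d⁺ k) (d⁺-inverse k) (d⁺-≲ k))
    c-d⁻-≼ : (λ k l → c⁻ k l - d⁻ k) ≼ β
    c-d⁻-≼ = Below.difference-bound 1 0 ℕₚ.≤-refl , Below.0≤difference 1 0 ℕₚ.≤-refl , λ k l →
      ≲-mono (*-monoˡ (Below.0≤difference 1 0 ℕₚ.≤-refl) (step≤β k l)) (Below.cot-difference _ k (k<M k l) (d⁻ k) (d⁻-inverse k) (d⁻-≲ k))

    -- 1 / (x + m) + 1 / (x - m) = 2 x / ((x + m) (x - m)) with m = k + 1.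
    d-sum-≼ : (λ k l → d⁺ k + d⁻ k) ≼ α²
    d-sum-≼ = 4ℚ , 0≤4 , λ k l → ≲-resp (sum k) (≲-≡ (ℚS.solve 1 (λ r → ℚS.con (+ 2) ℚS.:* r ℚS.:* (ℚS.con (+ 2) ℚS.:* r) ℚS.:* ℚS.con (+ 1)
          ℚS.:= (ℚS.con (+ 2) ℚS.:+ ℚS.con (+ 2)) ℚS.:* (r ℚS.:* r)) ≡.refl 1/[1+ k ])
        (≲-* (0≤* (0≤scaled k) (0≤scaled k)) 0≤1 (≲-* (0≤scaled k) (0≤scaled k) (d⁺-≲ k) (d⁻-≲ k)) (≲-mono 2x≤1 (ι-≥ (0≤* 0≤2 0≤x)))))
      where
      sum : ∀ k → d⁺ k * d⁻ k * ι (2ℚ *ℚ x) ≈ d⁺ k + d⁻ k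
      sum k = begin
        d⁺ k * d⁻ k * ι (2ℚ *ℚ x)
          ≈⟨ *-congˡ (trans (reflexive (≡.cong ι (ℚS.solve 2 (λ x n → ℚS.con (+ 2) ℚS.:* x ℚS.:= (x ℚS.:+ n) ℚS.:+ (x ℚS.:- n)) ≡.refl x (ν (suc k))))) (ι-+ _ _)) ⟩
        d⁺ k * d⁻ k * (ι (above k) + ι (x Q.- ν (suc k)))
          ≈⟨ solve 4 (λ d e a b → d :* e :* (a :+ b) := a :* d :* e :+ b :* e :* d) refl (d⁺ k) (d⁻ k) _ _ ⟩
        ι (above k) * d⁺ k * d⁻ k + ι (x Q.- ν (suc k)) * d⁻ k * d⁺ k
          ≈⟨ +-cong (trans (*-congʳ (d⁺-inverse k)) (*-identityˡ _)) (trans (*-congʳ (d⁻-inverse k)) (*-identityˡ _)) ⟩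
        d⁻ k + d⁺ k ≈⟨ +-comm _ _ ⟩
        d⁺ k + d⁻ k ∎

    module PairBound (k l : ℕ) where
      M = suc (k ℕ.+ l)
      module A = Above M k (k<M k l)
      module B = Below M k (k<M k l)
      h n σ : ℚ
      h = step M
      n = size M
      σ = 2ℚ *ℚ (2ℚ *ℚ x) *ℚ h
      r = ϖ * ι h

      0≤h : 0ℚ ≤ℚ h
      0≤h = 0≤1/ _

      σ≤2h : σ ≤ℚ 2ℚ *ℚ h
      σ≤2h = *-monoʳ 0≤h (Q.≤-trans (*-monoˡ 0≤2 2x≤1) (Q.≤-reflexive (Q.*-identityʳ 2ℚ)))

      0≤σ : 0ℚ ≤ℚ σ
      0≤σ = 0≤* (0≤* 0≤2 (0≤* 0≤2 0≤x)) 0≤h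

      σ≤1 : Q.∣ σ ∣ ≤ℚ 1ℚ
      σ≤1 = Q.≤-trans (Q.≤-reflexive (∣∣-nonneg 0≤σ)) (Q.≤-trans σ≤2h (Q.≤-trans (*-monoˡ 0≤2 (1/-antimono {1} {M ℕ.+ M} (ℕ.s≤s ℕ.z≤n)))
        (Q.≤-reflexive (≡.trans (Q.*-comm 2ℚ 1/[1+ 1 ]) (≡.trans (≡.cong (1/[1+ 1 ] *ℚ_) (≡.sym ν-2)) (1/[1+n]*ν 1))))))
        where
        ν-2 : ν 2 ≡ 2ℚ
        ν-2 = ≡.trans (ν-suc 1) (≡.cong (1ℚ +ℚ_) (≡.trans (ν-suc 0) (≡.trans (≡.cong (1ℚ +ℚ_) ν-0) (Q.+-identityʳ 1ℚ))))

      -- The analogue of cot u + cot v = sin (u + v) / (sin u sin v). In y z the shifts by k + 1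
      -- cancel, so E σ - 1 is O(1 / N); together with r = ϖ / N it compensates the two inverses of
      -- size N / (k + 1) and leaves the inverse square of k + 1.
      formula : c⁺ k l + c⁻ k l ≈ (1# + 1#) * (r * ((E σ - 1#) * (A.w * B.w)))
      formula = sym (begin
        (1# + 1#) * (r * ((E σ - 1#) * (A.w * B.w)))
          ≈⟨ *-congˡ (*-congˡ (*-congʳ (+-congʳ (trans (E-≡ angles) (E-+ _ _))))) ⟩
        (1# + 1#) * (r * ((y * z - 1#) * (A.w * B.w)))
          ≈⟨ solve 5 (λ r y z v w → con (+ 2) :* (r :* ((y :* z :- con (+ 1)) :* (v :* w)))
               := r :* ((y :+ con (+ 1)) :* v) :* ((z :- con (+ 1)) :* w) :+ r :* ((z :+ con (+ 1)) :* w) :* ((y :- con (+ 1)) :* v)) refl r y z A.w B.w ⟩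
        c⁺ k l * ((z - 1#) * B.w) + c⁻ k l * ((y - 1#) * A.w)
          ≈⟨ +-cong (trans (*-congˡ B.w-inverse) (*-identityʳ _)) (trans (*-congˡ A.w-inverse) (*-identityʳ _)) ⟩
        c⁺ k l + c⁻ k l ∎)
        where
        y = E (angle M (above k))
        z = E (angle M (x Q.- ν (suc k)))
        angles : σ ≡ angle M (above k) +ℚ angle M (x Q.- ν (suc k))
        angles = ℚS.solve 3 (λ x n h → ℚS.con (+ 2) ℚS.:* (ℚS.con (+ 2) ℚS.:* x) ℚS.:* h ℚS.:=
          ℚS.con (+ 2) ℚS.:* (x ℚS.:+ n) ℚS.:* h ℚS.:+ ℚS.con (+ 2) ℚS.:* (x ℚS.:- n) ℚS.:* h) ≡.refl x (ν (suc k)) h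

      pair-bound : ℚ
      pair-bound = 2ℚ *ℚ (ϖ-bound *ℚ (E₁-bound *ℚ 2ℚ *ℚ (2ℚ *ℚ unit-bound *ℚ (2ℚ *ℚ unit-bound))))

      pair-≲ : c⁺ k l + c⁻ k l ≲ pair-bound *ℚ α² k l
      pair-≲ = ≲-resp (sym formula) (≲-≡ weight
        (≲-* 0≤2 (0≤* (0≤* 0≤ϖ 0≤h) (0≤* (0≤* 0≤E₁ 0≤2h) 0≤ww)) (≲-+ 1≲ 1≲)
          (≲-* (0≤* 0≤ϖ 0≤h) (0≤* (0≤* 0≤E₁ 0≤2h) 0≤ww) (≲-* 0≤ϖ 0≤h ϖ-≲ (ι-≥ 0≤h))
            (≲-* (0≤* 0≤E₁ 0≤2h) 0≤ww
              (≲-mono (*-monoˡ 0≤E₁ (Q.≤-trans (Q.≤-reflexive (∣∣-nonneg 0≤σ)) σ≤2h)) (E₁-≲ σ σ≤1))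
              (≲-* 0≤w 0≤w A.w-≲ B.w-≲)))))
        where
        0≤2h = 0≤* 0≤2 0≤h
        0≤w = 0≤* (0≤* (0≤scaled k) (0≤ν (suc (M ℕ.+ M)))) 0≤unit
        0≤ww = 0≤* 0≤w 0≤w
        u = unit-bound
        weight : 2ℚ *ℚ (ϖ-bound *ℚ h *ℚ (E₁-bound *ℚ (2ℚ *ℚ h) *ℚ (scaled k *ℚ n *ℚ u *ℚ (scaled k *ℚ n *ℚ u)))) ≡ pair-bound *ℚ α² k l
        weight = ≡.trans (ℚS.solve 6 (λ p h e a n u → ℚS.con (+ 2) ℚS.:* (p ℚS.:* h ℚS.:* (e ℚS.:* (ℚS.con (+ 2) ℚS.:* h) ℚS.:* (ℚS.con (+ 2) ℚS.:* a ℚS.:* n ℚS.:* u ℚS.:* (ℚS.con (+ 2) ℚS.:* a ℚS.:* n ℚS.:* u))))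
            ℚS.:= h ℚS.:* n ℚS.:* (h ℚS.:* n) ℚS.:* (ℚS.con (+ 2) ℚS.:* (p ℚS.:* (e ℚS.:* ℚS.con (+ 2) ℚS.:* (ℚS.con (+ 2) ℚS.:* u ℚS.:* (ℚS.con (+ 2) ℚS.:* u)))) ℚS.:* (a ℚS.:* a)))
            ≡.refl ϖ-bound h E₁-bound 1/[1+ k ] n u)
          (≡.trans (≡.cong (_*ℚ (pair-bound *ℚ α² k l)) (≡.trans (≡.cong₂ _*ℚ_ (step*size M) (step*size M)) (Q.*-identityˡ 1ℚ))) (Q.*-identityˡ _))

    c-sum-≼ : (λ k l → c⁺ k l + c⁻ k l) ≼ α²
    c-sum-≼ = PairBound.pair-bound 0 0 , 0≤* 0≤2 (0≤* 0≤ϖ (0≤* (0≤* 0≤E₁ 0≤2) (0≤* (0≤* 0≤2 0≤unit) (0≤* 0≤2 0≤unit)))) , PairBound.pair-≲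

    geometric-suc : ∀ x n → geometric x (suc n) ≈ - (x * geometric x n)
    geometric-suc x n = solve 2 (λ x p → x :* (:- x :* p) := :- (x :* (x :* p))) refl x _

    geometric-≼ : ∀ {f} → f ≼ α → ∀ n → (λ k l → geometric (f k l) n) ≼ α
    geometric-≼² : ∀ {f} → f ≼ α → ∀ n → (λ k l → geometric (f k l) (suc n)) ≼ α²
    geometric-≼ f≼ zero    = ≼-resp (λ k l → sym (*-identityʳ _)) f≼
    geometric-≼ f≼ (suc n) = ≼-mono α²≤α (geometric-≼² f≼ n)
    geometric-≼² f≼ n = ≼-resp (λ k l → sym (geometric-suc _ n)) (≼-neg (≼-* 0≤α 0≤α f≼ (geometric-≼ f≼ n)))

    -- Inductively, f u - g v = f (u - v) + (f - g) v for the previous powers u and v, where in each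
    -- product one factor is O(β) and the other bounded.
    geometric-difference : ∀ {f g} → f ≼ α → g ≼ α → (λ k l → f k l - g k l) ≼ β →
                           ∀ n → (λ k l → geometric (f k l) n - geometric (g k l) n) ≼ β
    geometric-difference f≼ g≼ f-g zero = ≼-resp (λ k l → sym (+-cong (*-identityʳ _) (-‿cong (*-identityʳ _)))) f-g
    geometric-difference {f} {g} f≼ g≼ f-g (suc n) = ≼-resp
      (λ k l → trans (solve 4 (λ f g u v → :- (f :* (u :- v) :+ (f :- g) :* v) := :- (f :* u) :- :- (g :* v)) refl (f k l) (g k l) _ _)
        (sym (+-cong (geometric-suc _ n) (-‿cong (geometric-suc _ n)))))
      (≼-neg (≼-+ (≼-mono αβ≤β (≼-* 0≤α 0≤β f≼ (geometric-difference f≼ g≼ f-g n)))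
                  (≼-mono βα≤β (≼-* 0≤β 0≤α f-g (geometric-≼ g≼ n)))))

  pair : ℕ → ℕ → ℕ → Carrier
  pair n M k = (geometric (cot M (above k)) n + geometric (cot M (x Q.- ν (suc k))) n) -
               (geometric (d⁺ k) n + geometric (d⁻ k) n)

  private
    pair-β : ∀ n → (λ k l → pair n (suc (k ℕ.+ l)) k) ≼ β
    pair-β n = ≼-resp (λ k l → solve 4 (λ a b c d → (a :- c) :+ (b :- d) := (a :+ b) :- (c :+ d)) refl _ _ _ _)
      (≼-+ (geometric-difference c⁺-≼ d⁺-≼ c-d⁺-≼ n) (geometric-difference c⁻-≼ d⁻-≼ c-d⁻-≼ n))

    -- Only degree 0 uses the cancellation between k + 1 and -(k + 1); from the second power on,
    -- each term is summable by itself.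
    pair-α² : ∀ n → (λ k l → pair n (suc (k ℕ.+ l)) k) ≼ α²
    pair-α² zero    = ≼-resp (λ k l → sym (+-cong (+-cong (*-identityʳ _) (*-identityʳ _)) (-‿cong (+-cong (*-identityʳ _) (*-identityʳ _)))))
      (≼-+ c-sum-≼ (≼-neg d-sum-≼))
    pair-α² (suc n) = ≼-+ (≼-+ (geometric-≼² c⁺-≼ n) (geometric-≼² c⁻-≼ n)) (≼-neg (≼-+ (geometric-≼² d⁺-≼ n) (geometric-≼² d⁻-≼ n)))

  ∑-pair-Null : ∀ n → Null (λ M → ∑ M (pair n M))
  ∑-pair-Null n = Null-cong (λ M → Σ.⨁-cong M (λ k k<M → reflexive (≡.cong (λ m → pair n m k) (ℕₚ.m+[n∸m]≡n k<M))))
    (apply (pair-α² n) (pair-β n))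
    where
    apply : (λ k l → pair n (suc (k ℕ.+ l)) k) ≼ α² → (λ k l → pair n (suc (k ℕ.+ l)) k) ≼ β →
            Null (λ M → ∑ M (λ k → pair n (suc (k ℕ.+ (M ℕ.∸ suc k))) k))
    apply (A , 0≤A , u≲₁) (B , 0≤B , u≲₂) = tannery (λ k l → pair n (suc (k ℕ.+ l)) k) (A +ℚ B) (0≤+ 0≤A 0≤B)
      (λ k l → ≲-mono (*-monoʳ (0≤* (0≤α k l) (0≤α k l)) (≤-steps 0≤B Q.≤-refl)) (u≲₁ k l))
      (λ k l → ≲-mono (*-monoʳ (0≤β k l) (Q.≤-trans (≤-steps 0≤A Q.≤-refl) (Q.≤-reflexive (Q.+-comm B A)))) (u≲₂ k l))

  geometric-⟶ : ∀ {s l} → s ⟶ l → ∀ n → (λ M → geometric (s M) n) ⟶ geometric l n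
  geometric-⟶ {s} {l} s→l zero    = ⟶-cong (λ _ → sym (*-identityʳ _)) (sym (*-identityʳ _)) s→l
  geometric-⟶ {s} {l} s→l (suc n) = ⟶-cong
    (λ M → solve 2 (λ x p → con (ℤ.- + 1) :* (x :* (x :* p)) := x :* (:- x :* p)) refl (s M) _)
    (solve 2 (λ x p → con (ℤ.- + 1) :* (x :* (x :* p)) := x :* (:- x :* p)) refl l _)
    (⟶-* {l = - 1#} {m = l * geometric l n} (⟶-constant (- 1#)) (⟶-* {l = l} {m = geometric l n} s→l (geometric-⟶ s→l n)))

  cot-zeroth-⟶ : (λ M → cot M x) ⟶ d⁰
  cot-zeroth-⟶ = Null-squeeze (Zeroth.difference-bound 0) (Zeroth.0≤difference 0) λ M →
    ≲-mono (*-monoˡ (Zeroth.0≤difference 0) (1/-antimono (ℕₚ.m≤m+n M M)))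
      (Zeroth.cot-difference M d⁰ (ι-inverse (*-inv x 0<x)) (ι-≥ (Q.<⇒≤ (0<inv x 0<x))))

  factor : ℕ → ℕ → Carrier
  factor M i = cot M (x +ℚ (ν i Q.- ν M))

  -- The coefficient of degree n in the logarithmic derivative of ∏ (1 + a z / (x + m)) over |m| ≤
  -- M, with m and -m paired.
  limitSum : Carrier → ℕ → ℕ → Carrier
  limitSum a M n = geometric (a * d⁰) n + ∑ M (λ k → geometric (a * d⁺ k) n + geometric (a * d⁻ k) n)

  factor-sum : ∀ a n → Null (λ M → ∑ (suc (M ℕ.+ M)) (λ i → geometric (a * factor M i) n) - limitSum a M n)
  factor-sum a n = Null-cong (λ M → sym (identity M))
    (Null-* (Bounded-constant (a ^ suc n)) (Null-+ (geometric-⟶ {l = d⁰} cot-zeroth-⟶ n) (∑-pair-Null n)))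
    where
    g : ℕ → ℚ → Carrier
    g M τ = geometric (cot M (x +ℚ τ)) n
    identity : ∀ M → ∑ (suc (M ℕ.+ M)) (λ i → geometric (a * factor M i) n) - limitSum a M n ≈
               a ^ suc n * ((geometric (cot M x) n - geometric d⁰ n) + ∑ M (pair n M))
    identity M = begin
      ∑ (suc (M ℕ.+ M)) (λ i → geometric (a * factor M i) n) - limitSum a M n
        ≈⟨ +-cong (trans (Σ.⨁-cong (suc (M ℕ.+ M)) (λ i _ → geometric-scale a _ n)) (sym (∑-* p (suc (M ℕ.+ M)) (λ i → g M (ν i Q.- ν M)))))
             (-‿cong (+-cong (geometric-scale a _ n) (trans (Σ.⨁-cong M (λ k _ → trans (+-cong (geometric-scale a _ n) (geometric-scale a _ n)) (sym (distribˡ _ _ _)))) (sym (∑-* p M (λ k → geometric (d⁺ k) n + geometric (d⁻ k) n)))))) ⟩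
      p * ∑ (suc (M ℕ.+ M)) (λ i → g M (ν i Q.- ν M)) - (p * geometric d⁰ n + p * D)
        ≈⟨ +-congʳ (*-congˡ (trans (⨁-symmetric +-commutativeMonoid (g M) M) (+-congʳ (reflexive (≡.cong (λ t → geometric (cot M t) n) (Q.+-identityʳ x)))))) ⟩
      p * (geometric (cot M x) n + C) - (p * geometric d⁰ n + p * D)
        ≈⟨ solve 5 (λ p c C d D → p :* (c :+ C) :- (p :* d :+ p :* D) := p :* ((c :- d) :+ (C :+ :- D))) refl p _ C _ D ⟩
      p * ((geometric (cot M x) n - geometric d⁰ n) + (C + - D))
        ≈⟨ *-congˡ (+-congˡ (trans (+-congˡ (sym (∑-neg M _))) (sym (Σ.⨁-∙ M _ _)))) ⟩
      p * ((geometric (cot M x) n - geometric d⁰ n) + ∑ M (pair n M)) ∎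
      where
      p = a ^ suc n
      C = ∑ M (λ k → g M (ν (suc k)) + g M (Q.- ν (suc k)))
      D = ∑ M (λ k → geometric (d⁺ k) n + geometric (d⁻ k) n)

  private
    -- `Below`, `Zeroth` and `Above` cover i < M, i = M and i > M; the bound on i keeps the angle
    -- where `E-1⁻¹` is an inverse.
    factor-defining : ∀ M i → i ℕ.< suc (M ℕ.+ M) →
                      factor M i * (E (angle M (x +ℚ (ν i Q.- ν M))) - 1#) ≈ ϖ * inverse (M ℕ.+ M) * (E (angle M (x +ℚ (ν i Q.- ν M))) + 1#)
    factor-defining M i i<N with ℕ.compare i M
    ... | ℕ.less .i k    = subst (Defining (suc (i ℕ.+ k))) (≡.cong (x +ℚ_) eq) (Below.cot-defining (suc (i ℕ.+ k)) k (ℕ.s≤s (ℕₚ.m≤n+m k i)))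
      where
      Defining : ℕ → ℚ → Set
      Defining M τ = cot M τ * (E (angle M τ) - 1#) ≈ ϖ * inverse (M ℕ.+ M) * (E (angle M τ) + 1#)
      eq : Q.- ν (suc k) ≡ ν i Q.- ν (suc (i ℕ.+ k))
      eq = ≡.trans (ℚS.solve 2 (λ i k → ℚS.:- k ℚS.:= i ℚS.:- (i ℚS.:+ k)) ≡.refl (ν i) (ν (suc k)))
        (≡.cong (λ t → ν i Q.- t) (≡.trans (≡.sym (ν-+ i (suc k))) (≡.cong ν (ℕₚ.+-suc i k))))
    ... | ℕ.equal .i     = subst (Defining i) (≡.trans (≡.sym (Q.+-identityʳ x)) (≡.cong (x +ℚ_) (≡.sym (Q.+-inverseʳ (ν i))))) (Zeroth.cot-defining i)
      where
      Defining : ℕ → ℚ → Set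
      Defining M τ = cot M τ * (E (angle M τ) - 1#) ≈ ϖ * inverse (M ℕ.+ M) * (E (angle M τ) + 1#)
    ... | ℕ.greater .M k = subst (Defining M) (≡.cong (x +ℚ_) eq) (Above.cot-defining M k (ℕₚ.+-cancelˡ-≤ M _ _ (subst (ℕ._≤ M ℕ.+ M) (≡.sym (ℕₚ.+-suc M k)) (ℕₚ.≤-pred i<N))))
      where
      Defining : ℕ → ℚ → Set
      Defining M τ = cot M τ * (E (angle M τ) - 1#) ≈ ϖ * inverse (M ℕ.+ M) * (E (angle M τ) + 1#)
      eq : ν (suc k) ≡ ν (suc (M ℕ.+ k)) Q.- ν M
      eq = ≡.trans (ℚS.solve 2 (λ m k → k ℚS.:= m ℚS.:+ k ℚS.:- m) ≡.refl (ν M) (ν (suc k)))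
        (≡.cong (λ t → t Q.- ν M) (≡.trans (≡.sym (ν-+ M (suc k))) (≡.cong ν (ℕₚ.+-suc M k))))

  open Exponentiation 𝕊.commutativeSemiring using () renaming (^-distrib-* to ^S-distrib-⊛; ^-congˡ to ^S-congˡ)
  module 𝕊R = SetoidReasoning 𝕊.setoid

  module FiniteProduct (M : ℕ) where
    N = suc (M ℕ.+ M)
    h = step M
    r = ϖ * inverse (M ℕ.+ M)
    ω y₀ : Carrier
    ω = E (2ℚ *ℚ h)
    y₀ = E (angle M (x Q.- ν M))
    y : ℕ → Carrier
    y i = E (angle M (x +ℚ (ν i Q.- ν M)))
    A B : Series
    A = linear r
    B = linear (- r)

    y-≈ : ∀ i → y i ≈ ω ^ i * y₀
    y-≈ i = trans (E-≡ (ℚS.solve 5 (λ t x i m h → t ℚS.:* (x ℚS.:+ (i ℚS.:- m)) ℚS.:* h ℚS.:= i ℚS.:* (t ℚS.:* h) ℚS.:+ t ℚS.:* (x ℚS.:- m) ℚS.:* h) ≡.refl 2ℚ x (ν i) (ν M) h))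
      (trans (E-+ _ _) (*-congʳ (sym (E-^ _ i))))

    y₀^N : y₀ ^ N ≈ E (2ℚ *ℚ x)
    y₀^N = begin
      y₀ ^ N                                             ≈⟨ E-^ _ N ⟩
      E (size M *ℚ (2ℚ *ℚ (x Q.- ν M) *ℚ h))             ≈⟨ E-≡ (≡.trans (ℚS.solve 5 (λ n t x m h → n ℚS.:* (t ℚS.:* (x ℚS.:- m) ℚS.:* h) ℚS.:= h ℚS.:* n ℚS.:* (t ℚS.:* x ℚS.:- m ℚS.:* t)) ≡.refl (size M) 2ℚ x (ν M) h)
                                                              (≡.trans (≡.cong (_*ℚ (2ℚ *ℚ x Q.- ν M *ℚ 2ℚ)) (step*size M)) (Q.*-identityˡ _))) ⟩
      E (2ℚ *ℚ x +ℚ Q.- (ν M *ℚ 2ℚ))                     ≈⟨ E-+ _ _ ⟩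
      E (2ℚ *ℚ x) * E (Q.- (ν M *ℚ 2ℚ))                  ≈⟨ *-congˡ (trans (sym (*-identityʳ _)) (trans (*-congˡ (sym (E-even M))) (E-neg (ν M *ℚ 2ℚ)))) ⟩
      E (2ℚ *ℚ x) * 1#                                   ≈⟨ *-identityʳ _ ⟩
      E (2ℚ *ℚ x)                                        ∎

    open PrimitiveRoot (M ℕ.+ M) using (ω^N≈1; ω^k-fixed)

    -- By `factor-defining`, (1 - y) (1 + c z) = (1 - r z) - y (1 + r z), and the y of consecutive i
    -- differ by the factor ω. The factorisation of Bᴺ - (y₀ A)ᴺ is therefore used in the ring of
    -- series itself, with ω as a constant series. The same factorisation in the base ring evaluates
    -- ∏ (1 - y), and in y₀ᴺ = E (2 x) the shift by M disappears.
    factored : constant (1# - E (2ℚ *ℚ x)) ⊛ ΠS.⨁ N (linear ∘ factor M) ≋ (B ^S N) 𝕊.- constant (E (2ℚ *ℚ x)) ⊛ A ^S N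
    factored = 𝕊R.begin
      constant (1# - E (2ℚ *ℚ x)) ⊛ ΠS.⨁ N (linear ∘ factor M)
        𝕊R.≈⟨ ⊛-cong (𝕊.trans (constant-∏ N (λ i → 1# - y i)) (constant-cong ∏[1-y])) 𝕊.refl ⟨
      ΠS.⨁ N (λ i → constant (1# - y i)) ⊛ ΠS.⨁ N (linear ∘ factor M)
        𝕊R.≈⟨ ΠS.⨁-∙ N _ _ ⟨
      ΠS.⨁ N (λ i → constant (1# - y i) ⊛ linear (factor M i))
        𝕊R.≈⟨ ΠS.⨁-cong N single ⟩
      ΠS.⨁ N (λ i → B 𝕊.- (constant ω ^S i) ⊛ (constant y₀ ⊛ A))
        𝕊R.≈⟨ RootsS.∏-factors (constant y₀ ⊛ A) B ⟩
      (B ^S N) 𝕊.- (constant y₀ ⊛ A) ^S N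
        𝕊R.≈⟨ 𝕊.+-congˡ {B ^S N} (𝕊.-‿cong (𝕊.trans (^S-distrib-⊛ (constant y₀) A N) (⊛-cong (𝕊.trans (constant-^ y₀ N) (constant-cong y₀^N)) 𝕊.refl))) ⟩
      (B ^S N) 𝕊.- constant (E (2ℚ *ℚ x)) ⊛ A ^S N 𝕊R.∎
      where
      module Roots = RootsOfUnity ω (M ℕ.+ M) ω^N≈1 ω^k-fixed
      module RootsS = PowerSeries.RootsOfUnity seriesRing (constant ω) (M ℕ.+ M)
        (𝕊.trans (constant-^ ω N) (constant-cong ω^N≈1))
        (λ k 0<k k<N f ω^kf≋f n → ω^k-fixed k 0<k k<N (f n) (trans (sym (constant-⊛ _ f n))
          (trans (⊛-cong (𝕊.sym (constant-^ ω k)) 𝕊.refl n) (ω^kf≋f n))))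
      ∏[1-y] : ∏ N (λ i → 1# - y i) ≈ 1# - E (2ℚ *ℚ x)
      ∏[1-y] = trans (Π.⨁-cong N (λ i _ → +-congˡ (-‿cong (y-≈ i)))) (trans (Roots.∏-factors y₀ 1#) (+-cong (1^ N) (-‿cong y₀^N)))
      single : ∀ i → i ℕ.< N → constant (1# - y i) ⊛ linear (factor M i) ≋ B 𝕊.- (constant ω ^S i) ⊛ (constant y₀ ⊛ A)
      single i i<N n = trans (constant-⊛ _ _ n) (trans (coefficient n) (+-congˡ (-‿cong (sym (begin
        ((constant ω ^S i) ⊛ (constant y₀ ⊛ A)) n  ≈⟨ ⊛-cong (constant-^ ω i) 𝕊.refl n ⟩
        (constant (ω ^ i) ⊛ (constant y₀ ⊛ A)) n   ≈⟨ trans (constant-⊛ _ _ n) (*-congˡ (constant-⊛ _ _ n)) ⟩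
        ω ^ i * (y₀ * A n)                         ≈⟨ trans (sym (*-assoc _ _ _)) (*-congʳ (sym (y-≈ i))) ⟩
        y i * A n                                  ∎)))))
        where
        coefficient : ∀ n → (1# - y i) * linear (factor M i) n ≈ B n - y i * A n
        coefficient zero          = solve 1 (λ y → (con (+ 1) :- y) :* con (+ 1) := con (+ 1) :- y :* con (+ 1)) refl (y i)
        coefficient (suc zero)    = begin
          (1# - y i) * factor M i        ≈⟨ solve 2 (λ y c → (con (+ 1) :- y) :* c := :- (c :* (y :- con (+ 1)))) refl (y i) (factor M i) ⟩
          - (factor M i * (y i - 1#))    ≈⟨ -‿cong (factor-defining M i i<N) ⟩
          - (r * (y i + 1#))             ≈⟨ solve 2 (λ r y → :- (r :* (y :+ con (+ 1))) := :- r :- y :* r) refl r (y i) ⟩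
          - r - y i * r                  ∎
        coefficient (suc (suc n)) = solve 1 (λ y → (con (+ 1) :- y) :* con (+ 0) := con (+ 0) :- y :* con (+ 0)) refl (y i)

  private
    M+M→∞ : ∀ K → ∃ λ N → ∀ n → N ℕ.≤ n → K ℕ.≤ n ℕ.+ n
    M+M→∞ K = K , λ n K≤n → ℕₚ.≤-trans K≤n (ℕₚ.m≤m+n n n)

    power-limit : ∀ a n → (λ M → (linear (a * inverse (M ℕ.+ M)) ^S suc (M ℕ.+ M)) n) ⟶ expSeries a n
    power-limit a n = Null-compose (λ M → M ℕ.+ M) M+M→∞ (euler-limit a n)

    2x-unit : (1# - E (2ℚ *ℚ x)) * - E-1⁻¹ (2ℚ *ℚ x) ≈ 1#
    2x-unit = trans (solve 2 (λ e w → (con (+ 1) :- e) :* (:- w) := (e :- con (+ 1)) :* w) refl _ _)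
      (E-1⁻¹-inverse (2ℚ *ℚ x) (subst (0ℚ <ℚ_) (≡.sym (∣∣-nonneg 0≤2x)) (0<* 0<2 0<x)) (Q.≤-trans (Q.≤-reflexive (∣∣-nonneg 0≤2x)) 2x≤1))
      where 0≤2x = 0≤* 0≤2 0≤x

    w = - E-1⁻¹ (2ℚ *ℚ x)

  -- The expansion of sin (π (x + a z)) / sin (π x), with numerator and denominator multiplied by -2
  -- i exp (π i x); `w` is the inverse of 1 - exp (2 π i x).
  limitSeries : Carrier → Series
  limitSeries a n = a ^ n * (w * (expSeries (- ϖ) n - E (2ℚ *ℚ x) * expSeries ϖ n))

  limitSeries-≈ : ∀ a n → (1# - E (2ℚ *ℚ x)) * limitSeries a n ≈ expSeries (- (a * ϖ)) n - E (2ℚ *ℚ x) * expSeries (a * ϖ) n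
  limitSeries-≈ a n = begin
    (1# - e) * (p * (w * (expSeries (- ϖ) n - e * expSeries ϖ n)))
      ≈⟨ solve 6 (λ d p w f e g → d :* (p :* (w :* (f :- e :* g))) := d :* w :* (p :* f :- e :* (p :* g))) refl (1# - e) p w _ e _ ⟩
    (1# - e) * w * (p * expSeries (- ϖ) n - e * (p * expSeries ϖ n))
      ≈⟨ trans (*-congʳ 2x-unit) (*-identityˡ _) ⟩
    p * expSeries (- ϖ) n - e * (p * expSeries ϖ n)
      ≈⟨ +-cong (trans (sym (expSeries-* a (- ϖ) n)) (expSeries-cong (solve 2 (λ a b → a :* (:- b) := :- (a :* b)) refl a ϖ) n))
           (-‿cong (*-congˡ (sym (expSeries-* a ϖ n)))) ⟩
    expSeries (- (a * ϖ)) n - e * expSeries (a * ϖ) n ∎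
    where
    e = E (2ℚ *ℚ x)
    p = a ^ n

  finiteProduct : Carrier → ℕ → Series
  finiteProduct a M = ΠS.⨁ (suc (M ℕ.+ M)) (λ i → linear (a * factor M i))

  finiteProduct-⟶ : ∀ a → finiteProduct a ⟶S limitSeries a
  finiteProduct-⟶ a n = ⟶-cong (λ M → sym (coefficient M)) refl
    (⟶-* {l = a ^ n} {m = w * (expSeries (- ϖ) n - e * expSeries ϖ n)} (⟶-constant (a ^ n))
      (⟶-* {l = w} {m = expSeries (- ϖ) n - e * expSeries ϖ n} (⟶-constant w)
      (⟶-cong {l = expSeries (- ϖ) n + (- e) * expSeries ϖ n} (λ M → refl) (+-congˡ (solve 2 (λ e f → (:- e) :* f := :- (e :* f)) refl e _))
        (⟶-+ {l = expSeries (- ϖ) n} {m = (- e) * expSeries ϖ n}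
          (⟶-cong (λ M → ^S-congˡ (suc (M ℕ.+ M)) (linear-cong (solve 2 (λ p i → (:- p) :* i := :- (p :* i)) refl ϖ _)) n) refl (power-limit (- ϖ) n))
          (⟶-* {l = - e} {m = expSeries ϖ n} (⟶-constant (- e)) (power-limit ϖ n))))))
    where
    e = E (2ℚ *ℚ x)
    coefficient : ∀ M → finiteProduct a M n ≈ a ^ n * (w * ((linear (- (ϖ * inverse (M ℕ.+ M))) ^S suc (M ℕ.+ M)) n +
                    (- e) * (linear (ϖ * inverse (M ℕ.+ M)) ^S suc (M ℕ.+ M)) n))
    coefficient M = begin
      finiteProduct a M n
        ≈⟨ scale-∏-linear a (suc (M ℕ.+ M)) (factor M) n ⟨
      a ^ n * f
        ≈⟨ *-congˡ (trans (sym (*-identityˡ f)) (*-congʳ (trans (sym 2x-unit) (*-comm _ _)))) ⟩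
      a ^ n * (w * (1# - e) * f)
        ≈⟨ *-congˡ (trans (*-assoc _ _ _) (*-congˡ (trans (sym (constant-⊛ _ (ΠS.⨁ (suc (M ℕ.+ M)) (linear ∘ factor M)) n)) (FiniteProduct.factored M n)))) ⟩
      a ^ n * (w * (Bⁿ n - (constant e ⊛ Aⁿ) n))
        ≈⟨ *-congˡ (*-congˡ (+-congˡ (trans (-‿cong (constant-⊛ e Aⁿ n)) (solve 2 (λ e f → :- (e :* f) := (:- e) :* f) refl e _)))) ⟩
      a ^ n * (w * (Bⁿ n + (- e) * Aⁿ n)) ∎
      where
      f = ΠS.⨁ (suc (M ℕ.+ M)) (linear ∘ factor M) n
      Aⁿ = linear (ϖ * inverse (M ℕ.+ M)) ^S suc (M ℕ.+ M)
      Bⁿ = linear (- (ϖ * inverse (M ℕ.+ M))) ^S suc (M ℕ.+ M)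

  finiteProduct-LogDerivative : ∀ a M → LogDerivative (finiteProduct a M) (ΣS.⨁ (suc (M ℕ.+ M)) (λ i → geometric (a * factor M i)))
  finiteProduct-LogDerivative a M = LogDerivative-∏ (suc (M ℕ.+ M)) _ _ (λ i _ → linear-geometric (a * factor M i))

  finiteProduct-head : ∀ a M → finiteProduct a M 0 ≈ 1#
  finiteProduct-head a M = ∏-linear-head (suc (M ℕ.+ M)) (λ i → a * factor M i)

-- Residues coprime to q.

module CoprimeResidues where
  open import Algebra.Bundles using (CommutativeMonoid)
  open import Data.List.Base using (List; []; _∷_; map; filter; upTo; length)
  open import Data.List.Relation.Unary.All using (All; []; _∷_)
  open import Data.Nat.Base as ℕ using (ℕ; zero; suc; _+_; _*_; _∸_; _<_; _≤_; s≤s; z≤n; NonZero; _^_)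
  open import Data.Nat.Coprimality as Coprimality using (Coprime; coprime?; coprime-divisor)
  open import Data.Nat.DivMod using (_%_; m≡m%n+[m/n]*n; m%n<n)
  open import Data.Nat.Divisibility using (_∣_; divides; _∣?_; ∣-trans; ∣-refl; ∣m∣n⇒∣m+n; ∣m+n∣m⇒∣n; n∣m*n; m∣m*n; ∣1⇒≡1; ∣m⇒∣m*n; ∣n⇒∣m*n; _∣0; >⇒∤)
  open import Data.Nat.Induction using (<-rec)
  open import Data.Nat.Primality using (Prime; prime⇒irreducible; prime⇒nonZero; prime⇒nonTrivial)
  open import Data.Nat.Primality.Factorisation using (PrimeFactorisation; factorise)
  import Data.Nat.Properties as ℕₚ
  open import Data.Nat.Solver using (module +-*-Solver)
  open import Data.Product using (∃; _×_; _,_; proj₁; proj₂)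
  open import Data.Sum.Base using (_⊎_; inj₁; inj₂)
  open import Defs using (IsPrimePower; Φ; ℓ; φ)
  open import Function.Base using (_∘_; id)
  open import Relation.Binary.PropositionalEquality as ≡ using (_≡_; _≢_; refl; sym; trans; cong; subst)
  import Relation.Binary.Reasoning.Setoid as SetoidReasoning
  open import Relation.Nullary using (Dec; yes; no; ¬_; contradiction)
  open import Relation.Nullary.Decidable using (_×-dec_; ¬?)

  coprime-* : ∀ {a m n} → Coprime a m → Coprime a n → Coprime a (m * n)
  coprime-* a⊥m a⊥n {d} (d∣a , d∣mn) =
    a⊥n (d∣a , coprime-divisor (λ (i∣d , i∣m) → a⊥m (∣-trans i∣d d∣a , i∣m)) d∣mn)

  coprime-^ : ∀ {a p} k → Coprime a p → Coprime a (p ^ k)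
  coprime-^ zero    a⊥p (_ , d∣1) = ∣1⇒≡1 d∣1
  coprime-^ (suc k) a⊥p = coprime-* a⊥p (coprime-^ k a⊥p)

  prime∤⇒coprime : ∀ {a p} → Prime p → ¬ p ∣ a → Coprime a p
  prime∤⇒coprime pr p∤a (d∣a , d∣p) with prime⇒irreducible pr d∣p
  ... | inj₁ d≡1  = d≡1
  ... | inj₂ refl = contradiction d∣a p∤a

  coprime⇒∤ : ∀ {a p q} → Prime p → p ∣ q → Coprime a q → ¬ p ∣ a
  coprime⇒∤ pr p∣q a⊥q p∣a with refl ← a⊥q (p∣a , p∣q) = contradiction (ℕ.nonTrivial⇒n>1 1 {{prime⇒nonTrivial pr}}) (λ { (s≤s ()) })

  coprime-∣ : ∀ {a m q} → m ∣ q → Coprime a q → Coprime a m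
  coprime-∣ m∣q a⊥q (d∣a , d∣m) = a⊥q (d∣a , ∣-trans d∣m m∣q)

  coprime-periodic⁺ : ∀ t {m r} → Coprime (t * m + r) m → Coprime r m
  coprime-periodic⁺ t c (d∣r , d∣m) = c (∣m∣n⇒∣m+n (∣n⇒∣m*n t d∣m) d∣r , d∣m)

  coprime-periodic⁻ : ∀ t {m r} → Coprime r m → Coprime (t * m + r) m
  coprime-periodic⁻ t c (d∣tm+r , d∣m) = c (∣m+n∣m⇒∣n d∣tm+r (∣n⇒∣m*n t d∣m) , d∣m)

  coprime-∸ : ∀ {j q} → j ≤ q → Coprime j q → Coprime (q ∸ j) q
  coprime-∸ {j} {q} j≤q c {d} (d∣q-j , d∣q) =
    c (∣m+n∣m⇒∣n (subst (d ∣_) (sym (ℕₚ.m∸n+n≡m j≤q)) d∣q) d∣q-j , d∣q)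

  ¬coprime-self : ∀ {q} → 2 ≤ q → ¬ Coprime q q
  ¬coprime-self 2≤q c with refl ← c (∣-refl , ∣-refl) = contradiction 2≤q λ { (s≤s ()) }

  ¬coprime-0 : ∀ {q} → 2 ≤ q → ¬ Coprime 0 q
  ¬coprime-0 {q} 2≤q c with refl ← c (q ∣0 , ∣-refl) = contradiction 2≤q λ { (s≤s ()) }

  factor-out : ∀ {p} → Prime p → ∀ q → 0 < q → ∃ λ k → ∃ λ m → q ≡ p ^ k * m × ¬ p ∣ m
  factor-out {p} pr = <-rec _ λ q rec 0<q → step q rec 0<q (p ∣? q)
    where
    instance
      p≢0 : NonZero p
      p≢0 = prime⇒nonZero pr
    Goal : ℕ → Set
    Goal q = 0 < q → ∃ λ k → ∃ λ m → q ≡ p ^ k * m × ¬ p ∣ m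
    step : ∀ q → (∀ {r} → r < q → Goal r) → 0 < q → Dec (p ∣ q) → ∃ λ k → ∃ λ m → q ≡ p ^ k * m × ¬ p ∣ m
    step q rec 0<q (no p∤q)  = 0 , q , sym (ℕₚ.*-identityˡ q) , p∤q
    step q rec 0<q (yes (divides zero    refl)) = contradiction 0<q λ ()
    step q rec 0<q (yes (divides (suc r) refl)) =
      let (k , m , eq , p∤m) = rec (ℕₚ.m<m*n (suc r) p (ℕ.nonTrivial⇒n>1 p {{prime⇒nonTrivial pr}})) (s≤s z≤n)
      in suc k , m , trans (ℕₚ.*-comm (suc r) p) (trans (cong (p *_) eq) (sym (ℕₚ.*-assoc p (p ^ k) m))) , p∤m

  prime-divisor : ∀ q → 2 ≤ q → ∃ λ p → Prime p × p ∣ q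
  prime-divisor (suc q) 2≤q = go (PrimeFactorisation.factors f) (PrimeFactorisation.isFactorisation f) (PrimeFactorisation.factorsPrime f)
    where
    f = factorise (suc q)
    go : ∀ ps → suc q ≡ Data.List.Base.foldr _*_ 1 ps → All Prime ps → ∃ λ p → Prime p × p ∣ suc q
    go []       refl []        = contradiction 2≤q λ { (s≤s ()) }
    go (p ∷ ps) eq   (pr ∷ _)  = p , pr , subst (p ∣_) (sym eq) (m∣m*n _)

  -- The full power of any prime divisor is split off; a cofactor 1 would make q a prime power.
  ¬primePower-factor : ∀ q → 2 ≤ q → ¬ IsPrimePower q →
                       ∃ λ p → ∃ λ k → ∃ λ m → Prime p × q ≡ p ^ suc k * m × ¬ p ∣ m × 2 ≤ m
  ¬primePower-factor q 2≤q ¬pp with p , pr , p∣q ← prime-divisor q 2≤q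
    with factor-out pr q (ℕₚ.<-trans (s≤s z≤n) 2≤q)
  ... | zero  , m , eq , p∤m = contradiction (subst (p ∣_) (trans eq (ℕₚ.*-identityˡ m)) p∣q) p∤m
  ... | suc k , zero , eq , p∤m = contradiction (p ∣0) p∤m
  ... | suc k , suc zero , eq , p∤m = contradiction (p , suc k , pr , s≤s z≤n , trans eq (ℕₚ.*-identityʳ _)) ¬pp
  ... | suc k , suc (suc m) , eq , p∤m = p , k , suc (suc m) , pr , eq , p∤m , s≤s (s≤s z≤n)

  module CoprimeFolds {c ℓ′} (M : CommutativeMonoid c ℓ′) where
    open CommutativeMonoid M renaming (refl to ≈-refl; sym to ≈-sym; trans to ≈-trans)
    open Fold M
    open SetoidReasoning setoid

    when-∙ : ∀ {p} {P : Set p} (d : Dec P) x y → when d (x ∙ y) ≈ when d x ∙ when d y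
    when-∙ (yes _) x y = ≈-refl
    when-∙ (no _)  x y = ≈-sym (identityˡ ε)

    ⨁-when : ∀ {p} {P : Set p} (d : Dec P) n f → ⨁ n (λ i → when d (f i)) ≈ when d (⨁ n f)
    ⨁-when (yes _) n f = ≈-refl
    ⨁-when (no _)  n f = ⨁-ε n

    module _ (n : ℕ) (2≤n : 2 ≤ n) where
      private
        q h e : ℕ
        q = suc n
        h = n ℕ./ 2
        e = n % 2

        n≡ : n ≡ h + (e + h)
        n≡ = trans (m≡m%n+[m/n]*n n 2) (trans (cong (e ℕ.+_) (ℕₚ.*-comm h 2)) (trans (cong (λ t → e + (h + t)) (ℕₚ.+-identityʳ h))
          (trans (sym (ℕₚ.+-assoc e h h)) (trans (cong (_+ h) (ℕₚ.+-comm e h)) (ℕₚ.+-assoc h e h)))))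

      open +-*-Solver using (solve; _:=_; _:+_; _:*_; con)

      -- The reflection j ↦ q - j pairs off the residues coprime to q.
      coprime-half : ∀ g → ⨁ᴸ g (filter (λ a → coprime? a q) (map suc (upTo q))) ≈ ⨁ᴸ (λ j → g j ∙ g (q ∸ j)) (Φ q)
      coprime-half g = begin
        ⨁ᴸ g (filter (λ a → coprime? a q) (map suc (upTo q)))
          ≈⟨ ⨁ᴸ-filter-range (λ a → coprime? a q) g q ⟩
        ⨁ n G ∙ G n
          ≈⟨ ≈-trans (∙-congˡ (when-no (coprime? q q) (¬coprime-self (ℕₚ.m≤n⇒m≤1+n 2≤n)))) (identityʳ _) ⟩
        ⨁ n G
          ≈⟨ ≈-trans (⨁-≡ G n≡) (⨁-split h (e + h) G) ⟩
        ⨁ h G ∙ ⨁ (e + h) (λ i → G (h + i))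
          ≈⟨ ∙-congˡ (≈-trans (⨁-split e h _) (≈-trans (∙-congʳ (middle e refl)) (identityˡ _))) ⟩
        ⨁ h G ∙ ⨁ h (λ i → G (h + (e + i)))
          ≈⟨ ∙-congˡ (≈-trans (≈-sym (⨁-reverse h _)) (⨁-cong h reflect)) ⟩
        ⨁ h G ∙ ⨁ h (λ i → when (coprime? (suc i) q) (g (q ∸ suc i)))
          ≈⟨ ⨁-∙ h _ _ ⟨
        ⨁ h (λ i → when (coprime? (suc i) q) (g (suc i)) ∙ when (coprime? (suc i) q) (g (q ∸ suc i)))
          ≈⟨ ⨁-cong h (λ i _ → when-∙ (coprime? (suc i) q) _ _) ⟨
        ⨁ h (λ i → when (coprime? (suc i) q) (g (suc i) ∙ g (q ∸ suc i)))
          ≈⟨ ⨁ᴸ-filter-range (λ a → coprime? a q) (λ j → g j ∙ g (q ∸ j)) h ⟨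
        ⨁ᴸ (λ j → g j ∙ g (q ∸ j)) (Φ q) ∎
        where
        G : ℕ → Carrier
        G i = when (coprime? (suc i) q) (g (suc i))

        -- For even q the reflection fixes q / 2, which divides q and differs from 1 as q ≥ 3, so it
        -- is not coprime to q.
        middle : ∀ e′ → e′ ≡ e → ⨁ e′ (λ i → G (h + i)) ≈ ε
        middle zero          _    = ≈-refl
        middle (suc zero)    1≡e = ≈-trans (identityˡ _) (when-no (coprime? (suc (h + 0)) q) λ c → ¬1 (c (∣-refl , divides 2 q≡)))
          where
          q≡ : q ≡ 2 * suc (h + 0)
          q≡ = trans (cong suc (trans n≡ (cong (λ t → h + (t + h)) (sym 1≡e))))
            (solve 1 (λ h → con 1 :+ (h :+ (con 1 :+ h)) := con 2 :* (con 1 :+ (h :+ con 0))) refl h)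
          ¬1 : suc (h + 0) ≢ 1
          ¬1 eq with h≡0 ← trans (sym (ℕₚ.+-identityʳ h)) (ℕₚ.suc-injective eq) =
            contradiction 2≤n (subst (λ t → ¬ 2 ≤ t) (sym (trans n≡ (trans (cong (λ t → h + (t + h)) (sym 1≡e)) (cong (λ t → t + (1 + t)) h≡0)))) λ { (s≤s ()) })
        middle (suc (suc k)) eq = contradiction (m%n<n n 2) (subst (λ t → ¬ t < 2) eq λ { (s≤s (s≤s ())) })

        reflect : ∀ i → i < h → G (h + (e + (h ∸ suc i))) ≈ when (coprime? (suc i) q) (g (q ∸ suc i))
        reflect i i<h = ≈-trans (reflexive (cong (λ a → when (coprime? a q) (g a)) index))
          (when-cong (coprime? (q ∸ suc i) q) (coprime? (suc i) q)
            (λ c → subst (λ t → Coprime t q) (ℕₚ.m∸[m∸n]≡n i<q) (coprime-∸ (ℕₚ.m∸n≤m q (suc i)) c))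
            (coprime-∸ i<q) (λ _ → ≈-refl))
          where
          h≤n : h ≤ n
          h≤n = subst (h ≤_) (sym n≡) (ℕₚ.m≤m+n h (e + h))
          i<q : suc i ≤ q
          i<q = ℕₚ.m≤n⇒m≤1+n (ℕₚ.≤-trans i<h h≤n)
          index : suc (h + (e + (h ∸ suc i))) ≡ q ∸ suc i
          index = trans (cong suc (trans (cong (h ℕ.+_) (sym (ℕₚ.+-∸-assoc e i<h))) (sym (ℕₚ.+-∸-assoc h (ℕₚ.≤-trans i<h (ℕₚ.m≤n+m h e))))))
            (trans (cong (λ t → suc (t ∸ suc i)) (sym n≡)) (sym (ℕₚ.+-∸-assoc 1 (ℕₚ.≤-trans i<h h≤n))))

    module _ (p-1 : ℕ) where
      private
        p = suc p-1

      -- In each block of p consecutive numbers starting at a multiple of p, only the first is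
      -- divisible by p.
      ⨁-sift : ∀ {G : ℕ → Set} (G? : ∀ a → Dec (G a)) (f : ℕ → Carrier) n → ⨁ (n * p) (λ a → when (G? a) (f a)) ≈
               ⨁ (n * p) (λ a → when (G? a ×-dec ¬? (p ∣? a)) (f a)) ∙ ⨁ n (λ b → when (G? (b * p)) (f (b * p)))
      ⨁-sift {G} G? f n = begin
        ⨁ (n * p) (λ a → when (G? a) (f a))
          ≈⟨ ⨁-blocks n p _ ⟩
        ⨁ n (λ b → ⨁ p (λ r → when (G? (b * p + r)) (f (b * p + r))))
          ≈⟨ ⨁-cong n (λ b _ → block b) ⟩
        ⨁ n (λ b → ⨁ p (λ r → H (b * p + r)) ∙ when (G? (b * p)) (f (b * p)))
          ≈⟨ ⨁-∙ n _ _ ⟩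
        ⨁ n (λ b → ⨁ p (λ r → H (b * p + r))) ∙ ⨁ n (λ b → when (G? (b * p)) (f (b * p)))
          ≈⟨ ∙-congʳ (⨁-blocks n p H) ⟨
        ⨁ (n * p) H ∙ ⨁ n (λ b → when (G? (b * p)) (f (b * p))) ∎
        where
        H : ℕ → Carrier
        H a = when (G? a ×-dec ¬? (p ∣? a)) (f a)
        ∤ : ∀ b r → r < p-1 → ¬ p ∣ b * p + suc r
        ∤ b r r<p-1 p∣ = >⇒∤ (s≤s r<p-1) (∣m+n∣m⇒∣n p∣ (n∣m*n b))
        block : ∀ b → ⨁ p (λ r → when (G? (b * p + r)) (f (b * p + r))) ≈ ⨁ p (λ r → H (b * p + r)) ∙ when (G? (b * p)) (f (b * p))
        block b = begin
          ⨁ p (λ r → when (G? (b * p + r)) (f (b * p + r)))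
            ≈⟨ ⨁-head p-1 _ ⟩
          when (G? (b * p + 0)) (f (b * p + 0)) ∙ ⨁ p-1 (λ r → when (G? (b * p + suc r)) (f (b * p + suc r)))
            ≈⟨ ∙-cong (reflexive (cong (λ a → when (G? a) (f a)) (ℕₚ.+-identityʳ (b * p))))
                 (⨁-cong p-1 (λ r r<p-1 → when-cong (G? _) (G? _ ×-dec ¬? (p ∣? _)) (λ g → g , ∤ b r r<p-1) proj₁ (λ _ → ≈-refl))) ⟩
          when (G? (b * p)) (f (b * p)) ∙ ⨁ p-1 (λ r → H (b * p + suc r))
            ≈⟨ comm _ _ ⟩
          ⨁ p-1 (λ r → H (b * p + suc r)) ∙ when (G? (b * p)) (f (b * p))
            ≈⟨ ∙-congʳ (≈-trans (∙-congʳ (when-no (G? _ ×-dec ¬? (p ∣? _)) (λ (_ , p∤) → p∤ (subst (p ∣_) (sym (ℕₚ.+-identityʳ (b * p))) (n∣m*n b))))) (identityˡ _)) ⟨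
          (H (b * p + 0) ∙ ⨁ p-1 (λ r → H (b * p + suc r))) ∙ when (G? (b * p)) (f (b * p))
            ≈⟨ ∙-congʳ (⨁-head p-1 (λ r → H (b * p + r))) ⟨
          ⨁ p (λ r → H (b * p + r)) ∙ when (G? (b * p)) (f (b * p)) ∎

  -- Counting is the fold of the constant 1 in the additive monoid, so the pairing of residues in
  -- `coprime-half` applies.
  2ℓ≡φ : ∀ q → 3 ≤ q → 2 * ℓ q ≡ φ q
  2ℓ≡φ (suc n) (s≤s 2≤n) = sym (begin
    φ (suc n)                                                   ≡⟨ count (filter (λ a → coprime? a (suc n)) (map suc (upTo (suc n)))) ⟨
    ⨁ᴸ (λ _ → 1) (filter (λ a → coprime? a (suc n)) (map suc (upTo (suc n)))) ≡⟨ coprime-half n 2≤n (λ _ → 1) ⟩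
    ⨁ᴸ (λ _ → 2) (Φ (suc n))                                    ≡⟨ double (Φ (suc n)) ⟩
    2 * ℓ (suc n)                                               ∎)
    where
    open Fold ℕₚ.+-0-commutativeMonoid
    open CoprimeFolds ℕₚ.+-0-commutativeMonoid
    open ≡.≡-Reasoning
    count : (xs : List ℕ) → ⨁ᴸ (λ _ → 1) xs ≡ length xs
    count []       = refl
    count (x ∷ xs) = cong suc (count xs)
    double : (xs : List ℕ) → ⨁ᴸ (λ _ → 2) xs ≡ 2 * length xs
    double []       = refl
    double (x ∷ xs) = trans (cong (2 ℕ.+_) (double xs)) (sym (ℕₚ.*-suc 2 (length xs)))

open CoprimeResidues

-- The value at 1 of cyclotomic polynomials.

module CyclotomicValue {V : NormedAlgebra} (Rot : Rotations V) where
  open RotationEstimates Rot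
  open SetoidReasoning setoid
  open Π using (⨁-cong; ⨁-≡; ⨁-blocks; ⨁-swap; ⨁-head; when; when-cong; when-yes; when-no; ⨁ᴸ-filter-range; ⨁ᴸ-cong)
  open CoprimeFolds *-commutativeMonoid

  e : ℚ → Carrier
  e t = 1# - E (2ℚ *ℚ t)

  e-≡ : ∀ {s t} → s ≡ t → e s ≈ e t
  e-≡ ≡.refl = refl

  cyclotomic : ℕ → Carrier
  cyclotomic n-1 = ∏ (suc n-1) (λ a → when (coprime? a (suc n-1)) (e (ν a *ℚ 1/[1+ n-1 ])))

  ν*1/ : ∀ n → ν (suc n) *ℚ 1/[1+ n ] ≡ 1ℚ
  ν*1/ n = ≡.trans (Q.*-comm _ _) (1/[1+n]*ν n)

  1/-unique : ∀ n r → r *ℚ ν (suc n) ≡ 1ℚ → r ≡ 1/[1+ n ]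
  1/-unique n r eq = *-cancelʳ-≡ 0<ν[1+ n ] (≡.trans eq (≡.sym (1/[1+n]*ν n)))

  -- Writing n and m for the two successors and a = t m + r, a step in t multiplies the exponential
  -- by an n-th root of unity ω. The product over t is ∏ (1 - ωᵗ Y) = 1 - Yⁿ, which is the factor of
  -- r modulo m.
  periodic-product : ∀ n m {G : ℕ → Set} (G? : ∀ a → Dec (G a)) →
    (∀ t r → G (t ℕ.* suc m ℕ.+ r) → G r) → (∀ t r → G r → G (t ℕ.* suc m ℕ.+ r)) →
    ∏ (suc n ℕ.* suc m) (λ a → when (G? a) (e (ν a *ℚ (1/[1+ n ] *ℚ 1/[1+ m ])))) ≈
    ∏ (suc m) (λ r → when (G? r) (e (ν r *ℚ 1/[1+ m ])))
  periodic-product n m G? G⇒ G⇐ = begin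
    ∏ (suc n ℕ.* suc m) (λ a → when (G? a) (e (ν a *ℚ (u *ℚ v))))
      ≈⟨ ⨁-blocks (suc n) (suc m) _ ⟩
    ∏ (suc n) (λ t → ∏ (suc m) (λ r → when (G? (t ℕ.* suc m ℕ.+ r)) (e (ν (t ℕ.* suc m ℕ.+ r) *ℚ (u *ℚ v)))))
      ≈⟨ ⨁-swap (suc n) (suc m) _ ⟩
    ∏ (suc m) (λ r → ∏ (suc n) (λ t → when (G? (t ℕ.* suc m ℕ.+ r)) (e (ν (t ℕ.* suc m ℕ.+ r) *ℚ (u *ℚ v)))))
      ≈⟨ ⨁-cong (suc m) (λ r _ → ⨁-cong (suc n) (λ t _ → when-cong (G? _) (G? r) (G⇒ t r) (G⇐ t r) (λ _ → refl))) ⟩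
    ∏ (suc m) (λ r → ∏ (suc n) (λ t → when (G? r) (e (ν (t ℕ.* suc m ℕ.+ r) *ℚ (u *ℚ v)))))
      ≈⟨ ⨁-cong (suc m) (λ r _ → ⨁-when (G? r) (suc n) _) ⟩
    ∏ (suc m) (λ r → when (G? r) (∏ (suc n) (λ t → e (ν (t ℕ.* suc m ℕ.+ r) *ℚ (u *ℚ v)))))
      ≈⟨ ⨁-cong (suc m) (λ r _ → when-cong (G? r) (G? r) id id (λ _ → residue r)) ⟩
    ∏ (suc m) (λ r → when (G? r) (e (ν r *ℚ v))) ∎
    where
    u = 1/[1+ n ]
    v = 1/[1+ m ]
    open PrimitiveRoot n using (ω^N≈1; ω^k-fixed)
    module Roots = RootsOfUnity (E (2ℚ *ℚ u)) n ω^N≈1 ω^k-fixed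
    residue : ∀ r → ∏ (suc n) (λ t → e (ν (t ℕ.* suc m ℕ.+ r) *ℚ (u *ℚ v))) ≈ e (ν r *ℚ v)
    residue r = begin
      ∏ (suc n) (λ t → e (ν (t ℕ.* suc m ℕ.+ r) *ℚ (u *ℚ v)))
        ≈⟨ ⨁-cong (suc n) (λ t _ → +-congˡ (-‿cong (trans (E-≡ (split t)) (trans (E-+ _ _) (*-congʳ (sym (E-^ _ t))))))) ⟩
      ∏ (suc n) (λ t → 1# - E (2ℚ *ℚ u) ^ t * Y)
        ≈⟨ Roots.∏-factors Y 1# ⟩
      1# ^ suc n - Y ^ suc n
        ≈⟨ +-cong (1^ (suc n)) (-‿cong (trans (E-^ _ (suc n)) (E-≡ (≡.trans
             (ℚS.solve 5 (λ n t r u v → n ℚS.:* (t ℚS.:* (r ℚS.:* (u ℚS.:* v))) ℚS.:= n ℚS.:* u ℚS.:* (t ℚS.:* (r ℚS.:* v))) ≡.refl (ν (suc n)) 2ℚ (ν r) u v)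
             (≡.trans (≡.cong (_*ℚ (2ℚ *ℚ (ν r *ℚ v))) (ν*1/ n)) (Q.*-identityˡ _)))))) ⟩
      e (ν r *ℚ v) ∎
      where
      Y = E (2ℚ *ℚ (ν r *ℚ (u *ℚ v)))
      split : ∀ t → 2ℚ *ℚ (ν (t ℕ.* suc m ℕ.+ r) *ℚ (u *ℚ v)) ≡ ν t *ℚ (2ℚ *ℚ u) +ℚ 2ℚ *ℚ (ν r *ℚ (u *ℚ v))
      split t = ≡.trans (≡.cong (λ z → 2ℚ *ℚ (z *ℚ (u *ℚ v))) (≡.trans (ν-+ (t ℕ.* suc m) r) (≡.cong (_+ℚ ν r) (ν-* t (suc m)))))
        (≡.trans (ℚS.solve 6 (λ c t m r u v → c ℚS.:* ((t ℚS.:* m ℚS.:+ r) ℚS.:* (u ℚS.:* v)) ℚS.:= m ℚS.:* v ℚS.:* (t ℚS.:* (c ℚS.:* u)) ℚS.:+ c ℚS.:* (r ℚS.:* (u ℚS.:* v))) ≡.refl 2ℚ (ν t) (ν (suc m)) (ν r) u v)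
          (≡.cong (_+ℚ 2ℚ *ℚ (ν r *ℚ (u *ℚ v))) (≡.trans (≡.cong (_*ℚ (ν t *ℚ (2ℚ *ℚ u))) (ν*1/ m)) (Q.*-identityˡ _))))

  nonzero? : ∀ a → Dec (¬ a ≡ 0)
  nonzero? a = ¬? (a ℕₚ.≟ 0)

  nontrivial-product : ∀ n → ∏ (suc n) (λ a → when (nonzero? a) (e (ν a *ℚ 1/[1+ n ]))) ≈ natural (suc n)
  nontrivial-product n = begin
    ∏ (suc n) (λ a → when (nonzero? a) (e (ν a *ℚ u)))
      ≈⟨ trans (⨁-head n _) (*-identityˡ _) ⟩
    ∏ n (λ i → e (ν (suc i) *ℚ u))
      ≈⟨ ⨁-cong n (λ i _ → +-congˡ (-‿cong (trans (E-≡ (ℚS.solve 3 (λ t i u → t ℚS.:* (i ℚS.:* u) ℚS.:= i ℚS.:* (t ℚS.:* u)) ≡.refl 2ℚ (ν (suc i)) u)) (sym (E-^ _ (suc i)))))) ⟩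
    ∏ n (λ i → 1# - E (2ℚ *ℚ u) ^ suc i)
      ≈⟨ Roots.∏-nontrivial ⟩
    ∑ (suc n) (λ _ → 1#)
      ≈⟨ count (suc n) ⟩
    natural (suc n) ∎
    where
    u = 1/[1+ n ]
    open PrimitiveRoot n using (ω^N≈1; ω^k-fixed)
    module Roots = RootsOfUnity (E (2ℚ *ℚ u)) n ω^N≈1 ω^k-fixed
    count : ∀ k → ∑ k (λ _ → 1#) ≈ natural k
    count zero    = refl
    count (suc k) = trans (+-congʳ (count k)) (+-comm _ _)

  e-cancel : ∀ n a → 0 ℕ.< a → a ℕ.< suc n → ∀ z → e (ν a *ℚ 1/[1+ n ]) * z ≈ 0# → z ≈ 0#
  e-cancel n a 0<a a<n z ez≈0 = PrimitiveRoot.ω^k-fixed n a 0<a a<n z (begin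
    E (2ℚ *ℚ 1/[1+ n ]) ^ a * z
      ≈⟨ *-congʳ (trans (E-^ _ a) (E-≡ (ℚS.solve 3 (λ t i u → i ℚS.:* (t ℚS.:* u) ℚS.:= t ℚS.:* (i ℚS.:* u)) ≡.refl 2ℚ (ν a) 1/[1+ n ]))) ⟩
    E (2ℚ *ℚ (ν a *ℚ 1/[1+ n ])) * z
      ≈⟨ solve 2 (λ e z → e :* z := z :- (con (+ 1) :- e) :* z) refl _ z ⟩
    z - e (ν a *ℚ 1/[1+ n ]) * z
      ≈⟨ trans (+-congˡ (-‿cong ez≈0)) (solve 1 (λ z → z :- con (+ 0) := z) refl z) ⟩
    z ∎)

  -- Each factor with 0 < a < `suc m` can be cancelled by itself, and a = 0 is not coprime to a
  -- modulus that is at least 2.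
  cyclotomic-cancel : ∀ m → 2 ℕ.≤ suc m → ∀ z → cyclotomic m * z ≈ 0# → z ≈ 0#
  cyclotomic-cancel m 2≤m = go (suc m) ℕₚ.≤-refl
    where
    f : ℕ → Carrier
    f a = when (coprime? a (suc m)) (e (ν a *ℚ 1/[1+ m ]))
    one : ∀ a → a ℕ.< suc m → ∀ z → f a * z ≈ 0# → z ≈ 0#
    one a a<m z with coprime? a (suc m)
    one zero    a<m z | yes c = ⊥-elim (¬coprime-0 2≤m c)
    one (suc a) a<m z | yes c = e-cancel m (suc a) (ℕ.s≤s ℕ.z≤n) a<m z
    ... | no _ = trans (sym (*-identityˡ z))
    go : ∀ k → k ℕ.≤ suc m → ∀ z → ∏ k f * z ≈ 0# → z ≈ 0#
    go zero    _   z eq = trans (sym (*-identityˡ z)) eq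
    go (suc k) k<m z eq = one k k<m z (go k (ℕₚ.<⇒≤ k<m) _ (trans (sym (*-assoc _ _ _)) eq))

  module _ (p-1 k q-1 : ℕ) (pr : Prime (suc p-1)) where
    private
      p q : ℕ
      p = suc p-1
      q = suc q-1

      instance
        p^k≢0 : NonZero (p ℕ.^ k)
        p^k≢0 = ℕₚ.m^n≢0 p k

      n : ℕ
      n = ℕ.pred (p ℕ.^ k)

      suc-n : suc n ≡ p ℕ.^ k
      suc-n = ℕₚ.suc-pred (p ℕ.^ k)

    -- The product over all nonzero residues modulo q is q. The multiples of p among them give the
    -- same product modulo q / p, that is q / p, and the remaining residues are exactly those
    -- coprime to q.
    cyclotomic-primePower : q ≡ p ℕ.^ suc k → cyclotomic q-1 ≈ natural p
    cyclotomic-primePower q≡ = begin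
      cyclotomic q-1                                    ≈⟨ *-identityʳ _ ⟨
      cyclotomic q-1 * 1#                               ≈⟨ *-congˡ (trans (*-comm _ _) (inverse-natural n)) ⟨
      cyclotomic q-1 * (natural (suc n) * inverse n)    ≈⟨ *-assoc _ _ _ ⟨
      cyclotomic q-1 * natural (suc n) * inverse n      ≈⟨ *-congʳ total ⟨
      natural q * inverse n                             ≈⟨ *-congʳ (trans (sym (ι-ν q)) (trans (reflexive (≡.cong ι (≡.trans (≡.cong ν q≡np) (≡.trans (≡.cong ν (ℕₚ.*-comm (suc n) p)) (ν-* p (suc n)))))) (trans (ι-* _ _) (*-cong (ι-ν p) (ι-ν (suc n)))))) ⟩
      natural p * natural (suc n) * inverse n           ≈⟨ trans (*-assoc _ _ _) (*-congˡ (trans (*-comm _ _) (inverse-natural n))) ⟩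
      natural p * 1#                                    ≈⟨ *-identityʳ _ ⟩
      natural p                                         ∎
      where
      q≡np : q ≡ suc n ℕ.* p
      q≡np = ≡.trans q≡ (≡.trans (ℕₚ.*-comm p (p ℕ.^ k)) (≡.cong (ℕ._* p) (≡.sym suc-n)))
      1/q : 1/[1+ q-1 ] *ℚ ν p ≡ 1/[1+ n ]
      1/q = 1/-unique n _ (≡.trans (Q.*-assoc _ _ _) (≡.trans (≡.cong (1/[1+ q-1 ] *ℚ_) (≡.trans (≡.sym (ν-* p (suc n))) (≡.cong ν (≡.trans (ℕₚ.*-comm p (suc n)) (≡.sym q≡np))))) (1/[1+n]*ν q-1)))
      total : natural q ≈ cyclotomic q-1 * natural (suc n)
      total = begin
        natural q
          ≈⟨ nontrivial-product q-1 ⟨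
        ∏ q (λ a → when (nonzero? a) (e (ν a *ℚ 1/[1+ q-1 ])))
          ≈⟨ trans (⨁-≡ _ q≡np) (⨁-sift p-1 nonzero? _ (suc n)) ⟩
        ∏ (suc n ℕ.* p) (λ a → when (nonzero? a ×-dec ¬? (p ∣? a)) (e (ν a *ℚ 1/[1+ q-1 ]))) *
        ∏ (suc n) (λ b → when (nonzero? (b ℕ.* p)) (e (ν (b ℕ.* p) *ℚ 1/[1+ q-1 ])))
          ≈⟨ *-cong
               (trans (⨁-≡ _ (≡.sym q≡np)) (⨁-cong q (λ a _ → when-cong (nonzero? a ×-dec ¬? (p ∣? a)) (coprime? a q)
                 (λ (_ , p∤a) → subst (Coprime a) (≡.sym q≡) (coprime-^ (suc k) (prime∤⇒coprime pr p∤a)))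
                 (λ c → (λ { ≡.refl → coprime⇒∤ pr p∣q c (p ∣0) }) , coprime⇒∤ pr p∣q c) (λ _ → refl))))
               (⨁-cong (suc n) (λ b _ → when-cong (nonzero? (b ℕ.* p)) (nonzero? b) (λ bp≢0 → λ { ≡.refl → bp≢0 ≡.refl })
                 (λ b≢0 bp≡0 → b≢0 (ℕₚ.m*n≡0⇒m≡0 b p bp≡0))
                 (λ _ → e-≡ (≡.trans (≡.cong (_*ℚ 1/[1+ q-1 ]) (ν-* b p)) (≡.trans (ℚS.solve 3 (λ b p u → b ℚS.:* p ℚS.:* u ℚS.:= b ℚS.:* (u ℚS.:* p)) ≡.refl (ν b) (ν p) 1/[1+ q-1 ]) (≡.cong (ν b *ℚ_) 1/q)))))) ⟩
        cyclotomic q-1 * ∏ (suc n) (λ b → when (nonzero? b) (e (ν b *ℚ 1/[1+ n ])))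
          ≈⟨ *-congˡ (nontrivial-product n) ⟩
        cyclotomic q-1 * natural (suc n) ∎
        where
        p∣q : p ∣ q
        p∣q = subst (p ∣_) (≡.sym q≡) (m∣m*n (p ℕ.^ k))

    -- The product over all a < q coprime to m collapses by periodicity to the value for m. The
    -- multiples of p among these a are the b p with b coprime to m and collapse to the same value;
    -- the others are coprime to q. So the value for m equals itself times the value for q, and it
    -- can be cancelled as m ≥ 2.
    cyclotomic-composite : ∀ m-1 → q ≡ p ℕ.^ suc k ℕ.* suc m-1 → ¬ p ∣ suc m-1 → 2 ℕ.≤ suc m-1 → cyclotomic q-1 ≈ 1#
    cyclotomic-composite m-1 q≡ p∤m 2≤m = begin
      cyclotomic q-1                ≈⟨ solve 1 (λ c → c := (c :- con (+ 1)) :+ con (+ 1)) refl _ ⟩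
      (cyclotomic q-1 - 1#) + 1#    ≈⟨ +-congʳ (cyclotomic-cancel m-1 2≤m _ vanishing) ⟩
      0# + 1#                       ≈⟨ +-identityˡ 1# ⟩
      1#                            ∎
      where
      m = suc m-1
      n₁ = ℕ.pred (p ℕ.^ suc k)
      instance
        p^1+k≢0 : NonZero (p ℕ.^ suc k)
        p^1+k≢0 = ℕₚ.m^n≢0 p (suc k)
      suc-n₁ : suc n₁ ≡ p ℕ.^ suc k
      suc-n₁ = ℕₚ.suc-pred (p ℕ.^ suc k)
      good? : ∀ a → Dec (Coprime a m)
      good? a = coprime? a m
      q≡nmp : q ≡ suc n ℕ.* m ℕ.* p
      q≡nmp = ≡.trans q≡ (≡.trans (ℕₚ.*-assoc p (p ℕ.^ k) m) (≡.trans (ℕₚ.*-comm p _) (≡.cong (λ t → t ℕ.* m ℕ.* p) (≡.sym suc-n))))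
      q≡n₁m : q ≡ suc n₁ ℕ.* m
      q≡n₁m = ≡.trans q≡ (≡.cong (ℕ._* m) (≡.sym suc-n₁))
      p∣q : p ∣ q
      p∣q = subst (p ∣_) (≡.sym q≡nmp) (n∣m*n (suc n ℕ.* m))
      m∣q : m ∣ q
      m∣q = subst (m ∣_) (≡.sym q≡) (n∣m*n (p ℕ.^ suc k))
      1/q₁ : 1/[1+ n₁ ] *ℚ 1/[1+ m-1 ] ≡ 1/[1+ q-1 ]
      1/q₁ = 1/-unique q-1 _ (≡.trans (≡.cong (1/[1+ n₁ ] *ℚ 1/[1+ m-1 ] *ℚ_) (≡.trans (≡.cong ν q≡n₁m) (ν-* (suc n₁) m)))
        (≡.trans (ℚS.solve 4 (λ a b c d → a ℚS.:* b ℚS.:* (c ℚS.:* d) ℚS.:= a ℚS.:* c ℚS.:* (b ℚS.:* d)) ≡.refl _ _ _ _)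
          (≡.trans (≡.cong₂ _*ℚ_ (1/[1+n]*ν n₁) (1/[1+n]*ν m-1)) (Q.*-identityˡ 1ℚ))))
      1/q₂ : 1/[1+ q-1 ] *ℚ ν p ≡ 1/[1+ n ] *ℚ 1/[1+ m-1 ]
      1/q₂ = *-cancelʳ-≡ (0<* 0<ν[1+ n ] 0<ν[1+ m-1 ]) (≡.trans
        (≡.trans (Q.*-assoc _ _ _) (≡.trans (≡.cong (1/[1+ q-1 ] *ℚ_) (≡.trans (≡.cong (ν p *ℚ_) (≡.sym (ν-* (suc n) m))) (≡.trans (≡.sym (ν-* p (suc n ℕ.* m))) (≡.cong ν (≡.trans (ℕₚ.*-comm p (suc n ℕ.* m)) (≡.sym q≡nmp)))))) (1/[1+n]*ν q-1)))
        (≡.sym (≡.trans (ℚS.solve 4 (λ a b c d → a ℚS.:* b ℚS.:* (c ℚS.:* d) ℚS.:= a ℚS.:* c ℚS.:* (b ℚS.:* d)) ≡.refl _ _ _ _)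
          (≡.trans (≡.cong₂ _*ℚ_ (1/[1+n]*ν n) (1/[1+n]*ν m-1)) (Q.*-identityˡ 1ℚ)))))

      p⊥m : Coprime p m
      p⊥m = Coprimality.sym (prime∤⇒coprime pr p∤m)

      whole : ∏ q (λ a → when (good? a) (e (ν a *ℚ 1/[1+ q-1 ]))) ≈ cyclotomic m-1
      whole = trans (trans (⨁-≡ _ q≡n₁m) (⨁-cong (suc n₁ ℕ.* m) (λ a _ → when-cong (good? a) (good? a) id id (λ _ → e-≡ (≡.cong (ν a *ℚ_) (≡.sym 1/q₁))))))
        (periodic-product n₁ m-1 good? (λ t r → coprime-periodic⁺ t) (λ t r → coprime-periodic⁻ t))

      total : cyclotomic m-1 ≈ cyclotomic q-1 * cyclotomic m-1
      total = begin
        cyclotomic m-1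
          ≈⟨ whole ⟨
        ∏ q (λ a → when (good? a) (e (ν a *ℚ 1/[1+ q-1 ])))
          ≈⟨ trans (⨁-≡ _ q≡nmp) (⨁-sift p-1 good? _ (suc n ℕ.* m)) ⟩
        ∏ (suc n ℕ.* m ℕ.* p) (λ a → when (good? a ×-dec ¬? (p ∣? a)) (e (ν a *ℚ 1/[1+ q-1 ]))) *
        ∏ (suc n ℕ.* m) (λ b → when (good? (b ℕ.* p)) (e (ν (b ℕ.* p) *ℚ 1/[1+ q-1 ])))
          ≈⟨ *-cong
               (trans (⨁-≡ _ (≡.sym q≡nmp)) (⨁-cong q (λ a _ → when-cong (good? a ×-dec ¬? (p ∣? a)) (coprime? a q)
                 (λ (a⊥m , p∤a) → subst (Coprime a) (≡.sym q≡) (coprime-* (coprime-^ (suc k) (prime∤⇒coprime pr p∤a)) a⊥m))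
                 (λ c → coprime-∣ m∣q c , coprime⇒∤ pr p∣q c) (λ _ → refl))))
               (⨁-cong (suc n ℕ.* m) (λ b _ → when-cong (good? (b ℕ.* p)) (good? b)
                 (λ c (d∣b , d∣m) → c (∣m⇒∣m*n p d∣b , d∣m))
                 (λ c → Coprimality.sym (coprime-* (Coprimality.sym c) (Coprimality.sym p⊥m)))
                 (λ _ → e-≡ (≡.trans (≡.cong (_*ℚ 1/[1+ q-1 ]) (ν-* b p)) (≡.trans (ℚS.solve 3 (λ b p u → b ℚS.:* p ℚS.:* u ℚS.:= b ℚS.:* (u ℚS.:* p)) ≡.refl (ν b) (ν p) 1/[1+ q-1 ]) (≡.cong (ν b *ℚ_) 1/q₂)))))) ⟩
        cyclotomic q-1 * ∏ (suc n ℕ.* m) (λ b → when (good? b) (e (ν b *ℚ (1/[1+ n ] *ℚ 1/[1+ m-1 ]))))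
          ≈⟨ *-congˡ (periodic-product n m-1 good? (λ t r → coprime-periodic⁺ t) (λ t r → coprime-periodic⁻ t)) ⟩
        cyclotomic q-1 * cyclotomic m-1 ∎

      vanishing : cyclotomic m-1 * (cyclotomic q-1 - 1#) ≈ 0#
      vanishing = trans (solve 2 (λ c d → c :* (d :- con (+ 1)) := d :* c :- c) refl _ _)
        (trans (+-congʳ (sym total)) (-‿inverseʳ _))

  -- 2 i sin (π t).
  sine : ℚ → Carrier
  sine t = E t - E (Q.- t)

  -- The product of (2 sin (π j / q))² over the coprime j < q / 2.
  sine-product : ∀ n → 2 ℕ.≤ n → ∏ᴸ (λ j → - (sine (ν j *ℚ 1/[1+ n ]) * sine (ν j *ℚ 1/[1+ n ]))) (Φ (suc n)) ≈ cyclotomic n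
  sine-product n 2≤n = begin
    ∏ᴸ (λ j → - (sine (t j) * sine (t j))) (Φ q)
      ≈⟨ ⨁ᴸ-filter-range (λ j → coprime? j q) (λ j → - (sine (t j) * sine (t j))) h ⟩
    ∏ h (λ i → when (coprime? (suc i) q) (- (sine (t (suc i)) * sine (t (suc i)))))
      ≈⟨ ⨁-cong h (λ i i<h → when-cong (coprime? (suc i) q) (coprime? (suc i) q) id id (λ _ → pair (suc i) i<h)) ⟩
    ∏ h (λ i → when (coprime? (suc i) q) (e (t (suc i)) * e (t (q ℕ.∸ suc i))))
      ≈⟨ ⨁ᴸ-filter-range (λ j → coprime? j q) (λ j → e (t j) * e (t (q ℕ.∸ j))) h ⟨
    ∏ᴸ (λ j → e (t j) * e (t (q ℕ.∸ j))) (Φ q)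
      ≈⟨ coprime-half n 2≤n (e ∘ t) ⟨
    ∏ᴸ (e ∘ t) (filter (λ a → coprime? a q) (map suc (upTo q)))
      ≈⟨ ⨁ᴸ-filter-range (λ a → coprime? a q) (e ∘ t) q ⟩
    ∏ q (λ i → f (suc i))
      ≈⟨ trans (sym (*-identityˡ _)) (*-congʳ (sym (when-no (coprime? 0 q) (¬coprime-0 2≤q)))) ⟩
    f 0 * ∏ q (λ i → f (suc i))
      ≈⟨ ⨁-head q f ⟨
    ∏ q f * f q
      ≈⟨ trans (*-congˡ (when-no (coprime? q q) (¬coprime-self 2≤q))) (*-identityʳ _) ⟩
    cyclotomic n ∎
    where
    q = suc n
    h = n ℕ./ 2
    2≤q = ℕₚ.m≤n⇒m≤1+n 2≤n
    t : ℕ → ℚ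
    t j = ν j *ℚ 1/[1+ n ]
    f : ℕ → Carrier
    f a = when (coprime? a q) (e (t a))
    -- With y = E (j / q) and z = y⁻¹ the two factors are 1 - y² and 1 - z², and their product is 2
    -- - y² - z² = -(y - z)².
    pair : ∀ j → j ℕ.≤ n ℕ./ 2 → - (sine (t j) * sine (t j)) ≈ e (t j) * e (t (q ℕ.∸ j))
    pair j j≤h = sym (begin
      e (t j) * e (t (q ℕ.∸ j))
        ≈⟨ *-cong (+-congˡ (-‿cong (trans (E-≡ (ℚS.solve 1 (λ t → ℚS.con (+ 2) ℚS.:* t ℚS.:= t ℚS.:+ t) ≡.refl (t j))) (E-+ _ _))))
             (+-congˡ (-‿cong (trans (E-≡ reflected) (trans (E-+ _ _) (trans (*-congʳ E-2) (trans (*-identityˡ _) (E-+ _ _))))))) ⟩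
      (1# - y * y) * (1# - z * z)
        ≈⟨ solve 2 (λ y z → (con (+ 1) :- y :* y) :* (con (+ 1) :- z :* z) := con (+ 1) :+ z :* y :* (z :* y) :- y :* y :- z :* z) refl y z ⟩
      1# + z * y * (z * y) - y * y - z * z
        ≈⟨ +-congʳ (+-congʳ (+-congˡ (trans (*-cong (E-neg (t j)) refl) (*-identityˡ _)))) ⟩
      1# + z * y - y * y - z * z
        ≈⟨ +-congʳ (+-congʳ (+-congʳ (sym (E-neg (t j))))) ⟩
      z * y + z * y - y * y - z * z
        ≈⟨ solve 2 (λ y z → z :* y :+ z :* y :- y :* y :- z :* z := :- ((y :- z) :* (y :- z))) refl y z ⟩
      - (sine (t j) * sine (t j)) ∎)
      where
      y = E (t j)
      z = E (Q.- t j)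
      j≤q : j ℕ.≤ q
      j≤q = ℕₚ.≤-trans j≤h (ℕₚ.≤-trans (ℕ.m/n≤m n 2) (ℕₚ.n≤1+n n))
      reflected : 2ℚ *ℚ t (q ℕ.∸ j) ≡ 2ℚ +ℚ (Q.- t j +ℚ Q.- t j)
      reflected = ≡.trans (ℚS.solve 4 (λ c a j u → c ℚS.:* (a ℚS.:* u) ℚS.:= c ℚS.:* ((a ℚS.:+ j) ℚS.:* u) ℚS.:- c ℚS.:* (j ℚS.:* u)) ≡.refl 2ℚ (ν (q ℕ.∸ j)) (ν j) 1/[1+ n ])
        (≡.trans (≡.cong₂ (λ a b → 2ℚ *ℚ a Q.- b) (≡.trans (≡.cong (_*ℚ 1/[1+ n ]) (≡.trans (≡.sym (ν-+ (q ℕ.∸ j) j)) (≡.cong ν (ℕₚ.m∸n+n≡m j≤q)))) (ν*1/ n)) ≡.refl)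
          (ℚS.solve 1 (λ t → ℚS.con (+ 2) ℚS.:* ℚS.con (+ 1) ℚS.:- ℚS.con (+ 2) ℚS.:* t ℚS.:= ℚS.con (+ 2) ℚS.:+ (ℚS.:- t ℚS.:+ ℚS.:- t)) ≡.refl (t j)))

-- Products of sine series and their expansion over signs.

module Assembly {V : NormedAlgebra} (Rot : Rotations V) where
  open RotationEstimates Rot
  open SetoidReasoning setoid

  sgn : Sign → Carrier
  sgn Sign.+ = 1#
  sgn Sign.- = - 1#

  signed : Sign → ℚ → ℚ
  signed Sign.+ t = t
  signed Sign.- t = Q.- t

  sgnProduct : ∀ {n} → Vec Sign n → Carrier
  sgnProduct []      = 1#
  sgnProduct (s ∷ δ) = sgn s * sgnProduct δ

  module _ {A : Set} (x : A → ℚ) (a : A → Carrier) where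

    angleSum : (js : List A) → Vec Sign (length js) → ℚ
    angleSum []       []      = 0ℚ
    angleSum (j ∷ js) (s ∷ δ) = signed s (x j) +ℚ angleSum js δ

    argumentSum : (js : List A) → Vec Sign (length js) → Carrier
    argumentSum []       []      = 0#
    argumentSum (j ∷ js) (s ∷ δ) = sgn s * a j + argumentSum js δ

    -- The expansion of 2 i sin (π (x + a z)).
    sineSeries : A → Series
    sineSeries j n = E (x j) * expSeries (a j * ϖ) n - E (Q.- x j) * expSeries (- (a j * ϖ)) n

    term : (js : List A) → Vec Sign (length js) → Series
    term js δ n = sgnProduct δ * E (angleSum js δ) * expSeries (argumentSum js δ * ϖ) n

    private
      half : Sign → A → Series
      half s j n = sgn s * E (signed s (x j)) * expSeries (sgn s * a j * ϖ) n

      halves : ∀ j → sineSeries j ≋ half Sign.+ j ⊞ half Sign.- j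
      halves j n = +-cong
        (*-cong (sym (*-identityˡ _)) (expSeries-cong (solve 2 (λ a p → a :* p := con (+ 1) :* a :* p) refl (a j) ϖ) n))
        (trans (solve 2 (λ e f → :- (e :* f) := (:- con (+ 1)) :* e :* f) refl _ _)
          (*-congˡ (expSeries-cong (solve 2 (λ a p → :- (a :* p) := (:- con (+ 1)) :* a :* p) refl (a j) ϖ) n)))

      half-⊛ : ∀ s j (js : List A) (δ : Vec Sign (length js)) → half s j ⊛ term js δ ≋ term (j ∷ js) (s ∷ δ)
      half-⊛ s j js δ n = begin
        (half s j ⊛ term js δ) n
          ≈⟨ *-⊛ b (expSeries (sgn s * a j * ϖ)) (term js δ) n ⟩
        b * (expSeries (sgn s * a j * ϖ) ⊛ term js δ) n
          ≈⟨ *-congˡ (trans (⊛-comm (expSeries (sgn s * a j * ϖ)) (term js δ) n)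
               (trans (*-⊛ c (expSeries (argumentSum js δ * ϖ)) (expSeries (sgn s * a j * ϖ)) n) (*-congˡ (trans (⊛-comm (expSeries (argumentSum js δ * ϖ)) (expSeries (sgn s * a j * ϖ)) n) (expSeries-+ _ _ n))))) ⟩
        b * (c * expSeries (sgn s * a j * ϖ + argumentSum js δ * ϖ) n)
          ≈⟨ solve 5 (λ g e p f y → g :* e :* (p :* f :* y) := g :* p :* (e :* f) :* y) refl (sgn s) (E (signed s (x j))) (sgnProduct δ) (E (angleSum js δ)) _ ⟩
        sgn s * sgnProduct δ * (E (signed s (x j)) * E (angleSum js δ)) * expSeries (sgn s * a j * ϖ + argumentSum js δ * ϖ) n
          ≈⟨ *-cong (*-congˡ (sym (E-+ _ _))) (expSeries-cong (sym (distribʳ _ _ _)) n) ⟩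
        term (j ∷ js) (s ∷ δ) n ∎
        where
        b = sgn s * E (signed s (x j))
        c = sgnProduct δ * E (angleSum js δ)

      ∑ᴸ-++ : ∀ {B : Set} (f : B → Carrier) xs ys → ∑ᴸ f (xs ++ ys) ≈ ∑ᴸ f xs + ∑ᴸ f ys
      ∑ᴸ-++ f []       ys = sym (+-identityˡ _)
      ∑ᴸ-++ f (x ∷ xs) ys = trans (+-congˡ (∑ᴸ-++ f xs ys)) (sym (+-assoc _ _ _))

      ⊛-∑ᴸ : ∀ {B : Set} f (g : B → Series) xs n → (f ⊛ (λ n → ∑ᴸ (λ x → g x n) xs)) n ≈ ∑ᴸ (λ x → (f ⊛ g x) n) xs
      ⊛-∑ᴸ f g []       n = trans (⊛-comm f (λ _ → 0#) n) (⊛-zeroˡ f n)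
      ⊛-∑ᴸ f g (x ∷ xs) n = trans (𝕊.distribˡ f (g x) (λ n → ∑ᴸ (λ x → g x n) xs) n) (+-congˡ (⊛-∑ᴸ f g xs n))

    -- A choice of one exponential in every factor is a sign vector; the arguments add up by `E-+`
    -- and `expSeries-+`.
    sign-expansion : ∀ js n → ΠS.⨁ᴸ sineSeries js n ≈ ∑ᴸ (λ δ → term js δ n) (signVectors (length js))
    sign-expansion []       n = sym (trans (+-identityʳ _) (trans (*-congʳ (trans (*-identityˡ _) E-0)) (trans (*-identityˡ _) (expSeries-0 n))))
      where
      expSeries-0 : ∀ n → expSeries (0# * ϖ) n ≈ constant 1# n
      expSeries-0 zero    = refl
      expSeries-0 (suc n) = solve 3 (λ i p e → i :* (con (+ 0) :* p :* e) := con (+ 0)) refl (inverse n) ϖ _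
    sign-expansion (j ∷ js) n = begin
      (sineSeries j ⊛ ΠS.⨁ᴸ sineSeries js) n
        ≈⟨ ⊛-cong (halves j) (sign-expansion js) n ⟩
      ((half Sign.+ j ⊞ half Sign.- j) ⊛ S) n
        ≈⟨ ⊛-distribʳ (half Sign.+ j) (half Sign.- j) S n ⟩
      (half Sign.+ j ⊛ S) n + (half Sign.- j ⊛ S) n
        ≈⟨ +-cong (part Sign.+) (part Sign.-) ⟩
      ∑ᴸ T (map (Sign.+ ∷_) Δ) + ∑ᴸ T (map (Sign.- ∷_) Δ)
        ≈⟨ ∑ᴸ-++ T (map (Sign.+ ∷_) Δ) (map (Sign.- ∷_) Δ) ⟨
      ∑ᴸ T (signVectors (suc (length js))) ∎
      where
      Δ = signVectors (length js)
      T : Vec Sign (suc (length js)) → Carrier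
      T δ = term (j ∷ js) δ n
      S : Series
      S n = ∑ᴸ (λ δ → term js δ n) Δ
      part : ∀ s → (half s j ⊛ S) n ≈ ∑ᴸ T (map (s ∷_) Δ)
      part s = trans (⊛-∑ᴸ (half s j) (term js) Δ n)
        (trans (Σ.⨁ᴸ-cong (λ δ → half-⊛ s j js δ n) Δ) (sym (Σ.⨁ᴸ-map T (s ∷_) Δ)))

  module _ {A : Set} (x : A → ℚ) (0<x : ∀ j → 0ℚ <ℚ x j) (x<½ : ∀ j → x j <ℚ ½) (a : A → Carrier) where
    module At (j : A) = Cotangent Rot (x j) (0<x j) (x<½ j)

    limit : A → Series
    limit j = At.limitSeries j (a j)

    -- `F` and `p` stay abstract: any products with constant term 1 whose power sums approach the
    -- symmetric ones with cutoff `M N` share the limit of the cotangent products. The cutoff may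
    -- lag far behind N as long as it tends to infinity.
    product-⟶ : ∀ js (M : ℕ → ℕ) → (∀ K → ∃ λ N → ∀ n → N ℕ.≤ n → K ℕ.≤ M n) →
      (F p : ℕ → Series) → (∀ N → F N 0 ≈ 1#) → (∀ N → LogDerivative (F N) (p N)) →
      (∀ n → Null (λ N → p N n - ∑ᴸ (λ j → At.limitSum j (a j) (M N) n) js)) →
      F ⟶S ΠS.⨁ᴸ limit js
    product-⟶ js M M→∞ F p F₀ F′ near = LogDerivative-⟶ {h = ΠS.⨁ᴸ limit js} F₀ (λ N → head js (M N)) F′
      (λ N → LogDerivative-∏ᴸ _ _ (λ j → At.finiteProduct-LogDerivative j (a j) (M N)) js)
      (λ n → Null-cong (λ N → sym (rearrange n N)) (Null-+ (near n) (Null-neg (Null-∑ᴸ (λ j → Null-compose M M→∞ (At.factor-sum j (a j) n)) js))))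
      (⟶S-∏ᴸ {h = limit} (λ j n → Null-compose M M→∞ (At.finiteProduct-⟶ j (a j) n)) js)
      where
      head : ∀ js M → ΠS.⨁ᴸ (λ j → At.finiteProduct j (a j) M) js 0 ≈ 1#
      head []       M = refl
      head (j ∷ js) M = trans (*-cong (At.finiteProduct-head j (a j) M) (head js M)) (*-identityˡ 1#)

      q : A → ℕ → Series
      q j M = ΣS.⨁ (suc (M ℕ.+ M)) (λ i → geometric (a j * At.factor j M i))

      ∑ᴸ-- : ∀ (f g : A → Carrier) js → ∑ᴸ (λ j → f j - g j) js ≈ ∑ᴸ f js - ∑ᴸ g js
      ∑ᴸ-- f g []       = sym (-‿inverseʳ 0#)
      ∑ᴸ-- f g (j ∷ js) = trans (+-congˡ (∑ᴸ-- f g js)) (solve 4 (λ a b c d → (a :- b) :+ (c :- d) := (a :+ c) :- (b :+ d)) refl _ _ _ _)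

      rearrange : ∀ n N → p N n - ΣS.⨁ᴸ (λ j → q j (M N)) js n ≈
        (p N n - ∑ᴸ (λ j → At.limitSum j (a j) (M N) n) js) -
        ∑ᴸ (λ j → ∑ (suc (M N ℕ.+ M N)) (λ i → geometric (a j * At.factor j (M N) i) n) - At.limitSum j (a j) (M N) n) js
      rearrange n N = begin
        p N n - ΣS.⨁ᴸ (λ j → q j (M N)) js n
          ≈⟨ +-congˡ (-‿cong (trans (∑ᴸS (λ j → q j (M N)) js n) (Σ.⨁ᴸ-cong (λ j → ∑S (suc (M N ℕ.+ M N)) _ n) js))) ⟩
        p N n - G
          ≈⟨ solve 3 (λ p g l → p :- g := (p :- l) :- (g :- l)) refl (p N n) G L ⟩
        (p N n - L) - (G - L)
          ≈⟨ +-congˡ (-‿cong (∑ᴸ-- _ _ js)) ⟨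
        _ ∎
        where
        G = ∑ᴸ (λ j → ∑ (suc (M N ℕ.+ M N)) (λ i → geometric (a j * At.factor j (M N) i) n)) js
        L = ∑ᴸ (λ j → At.limitSum j (a j) (M N) n) js

    -- Each `limit j` is a quotient of sines; multiplying by the denominators leaves differences of
    -- exponentials that can be expanded.
    limit-sines : ∀ js n → ∏ᴸ (λ j → E (x j) - E (Q.- x j)) js * ΠS.⨁ᴸ limit js n ≈ ΠS.⨁ᴸ (sineSeries x a) js n
    limit-sines = collect
      where
      sine : A → Carrier
      sine j = E (x j) - E (Q.- x j)

      single : ∀ j n → sine j * limit j n ≈ sineSeries x a j n
      single j n = begin
        sine j * limit j n
          ≈⟨ *-congʳ (trans (+-congʳ E[x]) (solve 2 (λ e f → f :* e :- f := (:- f) :* (con (+ 1) :- e)) refl e₂ f)) ⟩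
        (- f) * (1# - e₂) * limit j n
          ≈⟨ trans (*-assoc _ _ _) (*-congˡ (At.limitSeries-≈ j (a j) n)) ⟩
        (- f) * (u - e₂ * v)
          ≈⟨ solve 4 (λ f e u v → (:- f) :* (u :- e :* v) := f :* e :* v :- f :* u) refl f e₂ u v ⟩
        f * e₂ * v - f * u
          ≈⟨ +-congʳ (*-congʳ (sym E[x])) ⟩
        sineSeries x a j n ∎
        where
        f = E (Q.- x j)
        e₂ = E (2ℚ *ℚ x j)
        u = expSeries (- (a j * ϖ)) n
        v = expSeries (a j * ϖ) n
        E[x] : E (x j) ≈ f * e₂
        E[x] = trans (E-≡ (ℚS.solve 1 (λ x → x ℚS.:= ℚS.:- x ℚS.:+ ℚS.con (+ 2) ℚS.:* x) ≡.refl (x j))) (E-+ _ _)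

      collect : ∀ js n → ∏ᴸ sine js * ΠS.⨁ᴸ limit js n ≈ ΠS.⨁ᴸ (sineSeries x a) js n
      collect []       n = *-identityˡ _
      collect (j ∷ js) n = begin
        sine j * ∏ᴸ sine js * (limit j ⊛ ΠS.⨁ᴸ limit js) n
          ≈⟨ *-congʳ (*-comm _ _) ⟩
        ∏ᴸ sine js * sine j * (limit j ⊛ ΠS.⨁ᴸ limit js) n
          ≈⟨ trans (*-assoc _ _ _) (*-congˡ (sym (*-⊛ (sine j) (limit j) (ΠS.⨁ᴸ limit js) n))) ⟩
        ∏ᴸ sine js * ((λ k → sine j * limit j k) ⊛ ΠS.⨁ᴸ limit js) n
          ≈⟨ *-congˡ (⊛-cong (single j) 𝕊.refl n) ⟩
        ∏ᴸ sine js * (sineSeries x a j ⊛ ΠS.⨁ᴸ limit js) n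
          ≈⟨ *-congˡ (⊛-comm (sineSeries x a j) _ n) ⟩
        ∏ᴸ sine js * (ΠS.⨁ᴸ limit js ⊛ sineSeries x a j) n
          ≈⟨ *-⊛ (∏ᴸ sine js) (ΠS.⨁ᴸ limit js) (sineSeries x a j) n ⟨
        ((λ k → ∏ᴸ sine js * ΠS.⨁ᴸ limit js k) ⊛ sineSeries x a j) n
          ≈⟨ ⊛-cong (collect js) 𝕊.refl n ⟩
        (ΠS.⨁ᴸ (sineSeries x a) js ⊛ sineSeries x a j) n
          ≈⟨ ⊛-comm _ (sineSeries x a j) n ⟩
        (sineSeries x a j ⊛ ΠS.⨁ᴸ (sineSeries x a) js) n ∎

-- The complex numbers as a normed algebra.

module ComplexAlgebra where
  open import Algebra.Bundles using (CommutativeRing)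
  open import Algebra.Structures using (IsCommutativeRing)
  open import Data.Integer.Base as ℤ using (ℤ; +_; -[1+_])
  open import Data.Nat.Base as ℕ using (ℕ; zero; suc)
  import Data.Nat.Properties as ℕₚ
  open import Data.Product using (∃; _×_; _,_; proj₁; proj₂)
  open import Data.Rational.Base as ℚ using (ℚ; 0ℚ; 1ℚ; ½; _+_; _*_; -_; _-_; ∣_∣; _≤_; _<_)
  import Data.Rational.Properties as ℚₚ
  open import Data.Rational.Solver using (module +-*-Solver)
  open import Data.Sum.Base using (inj₁; inj₂)
  import Defs
  open import Defs hiding (0<*; 0≤*; 0<½*; half+half; *-inv; 0<inv; 0<1/; 1/-antimono; archimedean)
  open import Level using (0ℓ)
  open import Relation.Binary.PropositionalEquality

  open ExpCauchy using (at; ‖_‖; ‖⊕‖; ‖⊗‖; 0≤‖‖; ∣x∣≤‖‖; ∣y∣≤‖‖; _⊕_; _⊗_; _,,_)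
  open +-*-Solver using (solve; _:=_; _:+_; _:*_; :-_; _:-_; con)
  open ℚₚ.≤-Reasoning

  infix 4 _≲_
  -- The norm ∣re z∣ + ∣im z∣ is at most r.
  record _≲_ (z : ℂ) (r : ℚ) : Set where
    constructor by
    field eventually : ∀ ε → 0ℚ < ε → ∃ λ K → ∀ k → K ℕ.≤ k → ‖ at z k ‖ ≤ r + ε

  open _≲_

  ≲-exact : ∀ {z w r} → (∀ k → at z k ≡ at w k) → z ≲ r → w ≲ r
  ≲-exact {r = r} eq z≲r = by λ ε 0<ε → let (K , b) = eventually z≲r ε 0<ε in K , λ k K≤k → subst (λ g → ‖ g ‖ ≤ r + ε) (eq k) (b k K≤k)

  ≲-mono : ∀ {z r s} → r ≤ s → z ≲ r → z ≲ s
  ≲-mono r≤s z≲r = by λ ε 0<ε → let (K , b) = eventually z≲r ε 0<ε in K , λ k K≤k → ℚₚ.≤-trans (b k K≤k) (ℚₚ.+-monoˡ-≤ ε r≤s)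

  ≲-closed : ∀ {z r} → (∀ ε → 0ℚ < ε → z ≲ r + ε) → z ≲ r
  ≲-closed {z} {r} z≲ = by λ ε 0<ε → let (K , b) = eventually (z≲ (ε * ½) (Defs.0<½* 0<ε)) (ε * ½) (Defs.0<½* 0<ε) in K , λ k K≤k →
    ℚₚ.≤-trans (b k K≤k) (ℚₚ.≤-reflexive (trans (ℚₚ.+-assoc r (ε * ½) (ε * ½)) (cong (λ t → r + t) (Defs.half+half ε))))

  ≲-+ : ∀ {z w r s} → z ≲ r → w ≲ s → z +ᶜ w ≲ r + s
  ≲-+ {z} {w} {r} {s} z≲r w≲s = by λ ε 0<ε →
    let (K , b) = eventually z≲r (ε * ½) (Defs.0<½* 0<ε) ; (L , c) = eventually w≲s (ε * ½) (Defs.0<½* 0<ε)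
    in K ℕ.⊔ L , λ k le → begin
      ‖ at z k ⊕ at w k ‖            ≤⟨ ‖⊕‖ (at z k) (at w k) ⟩
      ‖ at z k ‖ + ‖ at w k ‖        ≤⟨ ℚₚ.+-mono-≤ (b k (ℕₚ.m⊔n≤o⇒m≤o K L le)) (c k (ℕₚ.m⊔n≤o⇒n≤o K L le)) ⟩
      (r + ε * ½) + (s + ε * ½)      ≡⟨ solve 3 (λ r s e → (r :+ e) :+ (s :+ e) := (r :+ s) :+ (e :+ e)) refl r s (ε * ½) ⟩
      (r + s) + (ε * ½ + ε * ½)      ≡⟨ cong (λ t → r + s + t) (Defs.half+half ε) ⟩
      (r + s) + ε                    ∎

  ≲-neg : ∀ {z r} → z ≲ r → -ᶜ z ≲ r
  ≲-neg {z} {r} z≲r = by λ ε 0<ε → let (K , b) = eventually z≲r ε 0<ε in K , λ k K≤k →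
    subst (_≤ r + ε) (sym (cong₂ _+_ (ℚₚ.∣-p∣≡∣p∣ (seq (re z) k)) (ℚₚ.∣-p∣≡∣p∣ (seq (im z) k)))) (b k K≤k)

  private
    -- δ is the minimum of 1 and ε / (r + s + 1): the first bounds r + s + δ by r + s + 1, the
    -- second then bounds δ (r + s + δ) by ε.
    margin : ∀ r s ε → 0ℚ ≤ r → 0ℚ ≤ s → 0ℚ < ε → ∃ λ δ → 0ℚ < δ × (r + δ) * (s + δ) ≤ r * s + ε
    margin r s ε 0≤r 0≤s 0<ε = δ , 0<δ , (begin
      (r + δ) * (s + δ)             ≡⟨ solve 3 (λ r s d → (r :+ d) :* (s :+ d) := r :* s :+ d :* (r :+ s :+ d)) refl r s δ ⟩
      r * s + δ * (r + s + δ)       ≤⟨ ℚₚ.+-monoʳ-≤ (r * s) δ[r+s+δ]≤ ⟩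
      r * s + ε * inv B * B         ≡⟨ cong (λ t → r * s + t) (trans (ℚₚ.*-assoc ε (inv B) B) (trans (cong (ε *_) (trans (ℚₚ.*-comm (inv B) B) (Defs.*-inv B 0<B))) (ℚₚ.*-identityʳ ε))) ⟩
      r * s + ε                     ∎)
      where
      B = r + s + 1ℚ
      0<B : 0ℚ < B
      0<B = ℚₚ.+-mono-≤-< (ℚₚ.+-mono-≤ 0≤r 0≤s) (ℚₚ.positive⁻¹ 1ℚ)
      δ = 1ℚ ℚ.⊓ (ε * inv B)
      δ≤1 : δ ≤ 1ℚ
      δ≤1 = ℚₚ.p⊓q≤p 1ℚ (ε * inv B)
      δ≤ε/B : δ ≤ ε * inv B
      δ≤ε/B = ℚₚ.p⊓q≤q 1ℚ (ε * inv B)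
      0<δ : 0ℚ < δ
      0<δ with ℚₚ.⊓-sel 1ℚ (ε * inv B)
      ... | inj₁ eq = subst (0ℚ <_) (sym eq) (ℚₚ.positive⁻¹ 1ℚ)
      ... | inj₂ eq = subst (0ℚ <_) (sym eq) (Defs.0<* 0<ε (Defs.0<inv B 0<B))
      δ[r+s+δ]≤ : δ * (r + s + δ) ≤ ε * inv B * B
      δ[r+s+δ]≤ = begin
        δ * (r + s + δ)  ≤⟨ ℚₚ.*-monoˡ-≤-nonNeg δ {{ℚ.nonNegative (ℚₚ.<⇒≤ 0<δ)}} (ℚₚ.+-monoʳ-≤ (r + s) δ≤1) ⟩
        δ * B            ≤⟨ ℚₚ.*-monoʳ-≤-nonNeg B {{ℚ.nonNegative (ℚₚ.<⇒≤ 0<B)}} δ≤ε/B ⟩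
        ε * inv B * B    ∎

  ≲-* : ∀ {z w r s} → 0ℚ ≤ r → 0ℚ ≤ s → z ≲ r → w ≲ s → z *ᶜ w ≲ r * s
  ≲-* {z} {w} {r} {s} 0≤r 0≤s z≲r w≲s = by λ ε 0<ε →
    let (δ , 0<δ , rs≤) = margin r s ε 0≤r 0≤s 0<ε
        (K , b) = eventually z≲r δ 0<δ ; (L , c) = eventually w≲s δ 0<δ
    in K ℕ.⊔ L , λ k le → begin
      ‖ at z k ⊗ at w k ‖            ≤⟨ ‖⊗‖ (at z k) (at w k) ⟩
      ‖ at z k ‖ * ‖ at w k ‖        ≤⟨ Defs.*-mono-≤ (ℚₚ.+-mono-≤ 0≤r (ℚₚ.<⇒≤ 0<δ)) (0≤‖‖ (at w k))
                                         (b k (ℕₚ.m⊔n≤o⇒m≤o K L le)) (c k (ℕₚ.m⊔n≤o⇒n≤o K L le)) ⟩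
      (r + δ) * (s + δ)              ≤⟨ rs≤ ⟩
      r * s + ε                      ∎

  bound : ∀ z → ∃ λ B → 0ℚ ≤ B × z ≲ B
  bound z = let (B , 0<B , K , b) = ExpCauchy.bounded z in B , ℚₚ.<⇒≤ 0<B , by λ ε 0<ε → K , λ k K≤k →
    ℚₚ.≤-trans (b k K≤k) (subst (_≤ B + ε) (ℚₚ.+-identityʳ B) (ℚₚ.+-monoʳ-≤ B (ℚₚ.<⇒≤ 0<ε)))

  fromℚᶜ-≲ : ∀ p → fromℚᶜ p ≲ ∣ p ∣
  fromℚᶜ-≲ p = by λ ε 0<ε → 0 , λ _ _ → ℚₚ.+-monoʳ-≤ ∣ p ∣ (ℚₚ.<⇒≤ 0<ε)

  -- The ring laws hold already between the rational approximations at each index, where the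
  -- rational solver proves them.
  exact : ∀ {z w} → (∀ k → at z k ≡ at w k) → z ≈ᶜ w
  exact {z} {w} eq = part {re z} {re w} (λ k → cong ExpCauchy.ℚ[i].x (eq k)) , part {im z} {im w} (λ k → cong ExpCauchy.ℚ[i].y (eq k))
    where
    part : ∀ {x y} → (∀ k → seq x k ≡ seq y k) → x ≈ʳ y
    part {x} {y} eq ε 0<ε = 0 , λ k _ → subst (_≤ ε)
      (sym (trans (cong (λ t → ∣ t - seq y k ∣) (eq k)) (cong ∣_∣ (ℚₚ.+-inverseʳ (seq y k))))) (ℚₚ.<⇒≤ 0<ε)

  ≈⇒≲0 : ∀ {z w} → z ≈ᶜ w → z +ᶜ -ᶜ w ≲ 0ℚ
  ≈⇒≲0 {z} {w} (p , q) = by λ ε 0<ε →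
    let (K , b) = p (ε * ½) (Defs.0<½* 0<ε) ; (L , c) = q (ε * ½) (Defs.0<½* 0<ε)
    in K ℕ.⊔ L , λ k le → ℚₚ.≤-trans (ℚₚ.+-mono-≤ (b k (ℕₚ.m⊔n≤o⇒m≤o K L le)) (c k (ℕₚ.m⊔n≤o⇒n≤o K L le)))
      (ℚₚ.≤-reflexive (trans (Defs.half+half ε) (sym (ℚₚ.+-identityˡ ε))))

  ≲0⇒≈ : ∀ {z w} → z +ᶜ -ᶜ w ≲ 0ℚ → z ≈ᶜ w
  ≲0⇒≈ {z} {w} z-w≲0 = part ∣x∣≤‖‖ , part ∣y∣≤‖‖
    where
    part : ∀ {f : ExpCauchy.ℚ[i] → ℚ} → (∀ g → f g ≤ ‖ g ‖) → ∀ ε → 0ℚ < ε → ∃ λ K → ∀ k → K ℕ.≤ k → f (at (z +ᶜ -ᶜ w) k) ≤ ε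
    part f≤ ε 0<ε = let (K , b) = eventually z-w≲0 ε 0<ε in K , λ k K≤k →
      ℚₚ.≤-trans (f≤ _) (ℚₚ.≤-trans (b k K≤k) (ℚₚ.≤-reflexive (ℚₚ.+-identityˡ ε)))

  private
    pair : ∀ {a b c d : ℚ} → a ≡ c → b ≡ d → a ,, b ≡ c ,, d
    pair = cong₂ _,,_

  ≈-refl : ∀ {z} → z ≈ᶜ z
  ≈-refl {z} = exact {z} {z} (λ _ → refl)

  ≈-sym : ∀ {z w} → z ≈ᶜ w → w ≈ᶜ z
  ≈-sym {z} {w} z≈w = ≲0⇒≈ {w} {z} (≲-exact { -ᶜ (z +ᶜ -ᶜ w)} {w +ᶜ -ᶜ z}
    (λ k → pair (swap (seq (re z) k) (seq (re w) k)) (swap (seq (im z) k) (seq (im w) k))) (≲-neg {z +ᶜ -ᶜ w} (≈⇒≲0 {z} {w} z≈w)))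
    where
    swap : ∀ a b → - (a + - b) ≡ b + - a
    swap = solve 2 (λ a b → :- (a :+ :- b) := b :+ :- a) refl

  0+0 : 0ℚ + 0ℚ ≤ 0ℚ
  0+0 = ℚₚ.≤-reflexive (ℚₚ.+-identityˡ 0ℚ)

  ≈-trans : ∀ {z w v} → z ≈ᶜ w → w ≈ᶜ v → z ≈ᶜ v
  ≈-trans {z} {w} {v} z≈w w≈v = ≲0⇒≈ {z} {v} (≲-exact {(z +ᶜ -ᶜ w) +ᶜ (w +ᶜ -ᶜ v)} {z +ᶜ -ᶜ v}
    (λ k → pair (tele (seq (re z) k) (seq (re w) k) (seq (re v) k)) (tele (seq (im z) k) (seq (im w) k) (seq (im v) k))) (≲-mono {(z +ᶜ -ᶜ w) +ᶜ (w +ᶜ -ᶜ v)} 0+0 (≲-+ {z +ᶜ -ᶜ w} {w +ᶜ -ᶜ v} (≈⇒≲0 {z} {w} z≈w) (≈⇒≲0 {w} {v} w≈v))))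
    where
    tele : ∀ a b c → (a + - b) + (b + - c) ≡ a + - c
    tele = solve 3 (λ a b c → (a :+ :- b) :+ (b :+ :- c) := a :+ :- c) refl

  +-cong : ∀ {z w z′ w′} → z ≈ᶜ w → z′ ≈ᶜ w′ → z +ᶜ z′ ≈ᶜ w +ᶜ w′
  +-cong {z} {w} {z′} {w′} p q = ≲0⇒≈ {z +ᶜ z′} {w +ᶜ w′} (≲-exact {(z +ᶜ -ᶜ w) +ᶜ (z′ +ᶜ -ᶜ w′)} {(z +ᶜ z′) +ᶜ -ᶜ (w +ᶜ w′)}
    (λ k → pair (inter (seq (re z) k) (seq (re w) k) (seq (re z′) k) (seq (re w′) k)) (inter (seq (im z) k) (seq (im w) k) (seq (im z′) k) (seq (im w′) k))) (≲-mono {(z +ᶜ -ᶜ w) +ᶜ (z′ +ᶜ -ᶜ w′)} 0+0 (≲-+ {z +ᶜ -ᶜ w} {z′ +ᶜ -ᶜ w′} (≈⇒≲0 {z} {w} p) (≈⇒≲0 {z′} {w′} q))))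
    where
    inter : ∀ a b c d → (a + - b) + (c + - d) ≡ (a + c) + - (b + d)
    inter = solve 4 (λ a b c d → (a :+ :- b) :+ (c :+ :- d) := (a :+ c) :+ :- (b :+ d)) refl

  neg-cong : ∀ {z w} → z ≈ᶜ w → -ᶜ z ≈ᶜ -ᶜ w
  neg-cong {z} {w} p = ≲0⇒≈ { -ᶜ z} { -ᶜ w} (≲-exact { -ᶜ (z +ᶜ -ᶜ w)} {(-ᶜ z) +ᶜ -ᶜ (-ᶜ w)}
    (λ k → pair (ℚₚ.neg-distrib-+ (seq (re z) k) (seq (re (-ᶜ w)) k)) (ℚₚ.neg-distrib-+ (seq (im z) k) (seq (im (-ᶜ w)) k))) (≲-neg {z +ᶜ -ᶜ w} (≈⇒≲0 {z} {w} p)))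

  -- z z′ - w w′ = z (z′ - w′) + (z - w) w′, where the differences have norm 0 and `z` and `w′` are
  -- bounded.
  *-cong : ∀ {z w z′ w′} → z ≈ᶜ w → z′ ≈ᶜ w′ → z *ᶜ z′ ≈ᶜ w *ᶜ w′
  *-cong {z} {w} {z′} {w′} p q =
    let (A , 0≤A , z≲A) = bound z ; (B , 0≤B , w′≲B) = bound w′
        d = z +ᶜ -ᶜ w ; d′ = z′ +ᶜ -ᶜ w′
    in ≲0⇒≈ {z *ᶜ z′} {w *ᶜ w′} (≲-exact {z *ᶜ d′ +ᶜ d *ᶜ w′} {(z *ᶜ z′) +ᶜ -ᶜ (w *ᶜ w′)}
      (λ k → pair (real (seq (re z) k) (seq (im z) k) (seq (re w) k) (seq (im w) k) (seq (re z′) k) (seq (im z′) k) (seq (re w′) k) (seq (im w′) k))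
                  (imag (seq (re z) k) (seq (im z) k) (seq (re w) k) (seq (im w) k) (seq (re z′) k) (seq (im z′) k) (seq (re w′) k) (seq (im w′) k)))
      (≲-mono {z *ᶜ d′ +ᶜ d *ᶜ w′} (ℚₚ.≤-reflexive (cong₂ _+_ (ℚₚ.*-zeroʳ A) (ℚₚ.*-zeroˡ B)))
        (≲-+ {z *ᶜ d′} {d *ᶜ w′} (≲-* {z} {d′} 0≤A ℚₚ.≤-refl z≲A (≈⇒≲0 {z′} {w′} q)) (≲-* {d} {w′} ℚₚ.≤-refl 0≤B (≈⇒≲0 {z} {w} p) w′≲B))))
    where
    real : ∀ a b c d a′ b′ c′ d′ → (a * (a′ + - c′) - b * (b′ + - d′)) + ((a + - c) * c′ - (b + - d) * d′) ≡ (a * a′ - b * b′) + - (c * c′ - d * d′)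
    real = solve 8 (λ a b c d a′ b′ c′ d′ → (a :* (a′ :+ :- c′) :- b :* (b′ :+ :- d′)) :+ ((a :+ :- c) :* c′ :- (b :+ :- d) :* d′) := (a :* a′ :- b :* b′) :+ :- (c :* c′ :- d :* d′)) refl
    imag : ∀ a b c d a′ b′ c′ d′ → (a * (b′ + - d′) + b * (a′ + - c′)) + ((a + - c) * d′ + (b + - d) * c′) ≡ (a * b′ + b * a′) + - (c * d′ + d * c′)
    imag = solve 8 (λ a b c d a′ b′ c′ d′ → (a :* (b′ :+ :- d′) :+ b :* (a′ :+ :- c′)) :+ ((a :+ :- c) :* d′ :+ (b :+ :- d) :* c′) := (a :* b′ :+ b :* a′) :+ :- (c :* d′ :+ d :* c′)) refl

  *-assoc : ∀ z w v → (z *ᶜ w) *ᶜ v ≈ᶜ z *ᶜ (w *ᶜ v)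
  *-assoc z w v = exact {(z *ᶜ w) *ᶜ v} {z *ᶜ (w *ᶜ v)} λ k → pair
    (solve 6 (λ a b c d e f → (a :* c :- b :* d) :* e :- (a :* d :+ b :* c) :* f := a :* (c :* e :- d :* f) :- b :* (c :* f :+ d :* e)) refl
      (seq (re z) k) (seq (im z) k) (seq (re w) k) (seq (im w) k) (seq (re v) k) (seq (im v) k))
    (solve 6 (λ a b c d e f → (a :* c :- b :* d) :* f :+ (a :* d :+ b :* c) :* e := a :* (c :* f :+ d :* e) :+ b :* (c :* e :- d :* f)) refl
      (seq (re z) k) (seq (im z) k) (seq (re w) k) (seq (im w) k) (seq (re v) k) (seq (im v) k))

  *-comm : ∀ z w → z *ᶜ w ≈ᶜ w *ᶜ z
  *-comm z w = exact {z *ᶜ w} {w *ᶜ z} λ k → pair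
    (solve 4 (λ a b c d → a :* c :- b :* d := c :* a :- d :* b) refl (seq (re z) k) (seq (im z) k) (seq (re w) k) (seq (im w) k))
    (solve 4 (λ a b c d → a :* d :+ b :* c := c :* b :+ d :* a) refl (seq (re z) k) (seq (im z) k) (seq (re w) k) (seq (im w) k))

  *-identityˡ : ∀ z → 1ᶜ *ᶜ z ≈ᶜ z
  *-identityˡ z = exact {1ᶜ *ᶜ z} {z} λ k → pair
    (solve 2 (λ a b → con 1ℚ :* a :- con 0ℚ :* b := a) refl (seq (re z) k) (seq (im z) k))
    (solve 2 (λ a b → con 1ℚ :* b :+ con 0ℚ :* a := b) refl (seq (re z) k) (seq (im z) k))

  distribˡ : ∀ z w v → z *ᶜ (w +ᶜ v) ≈ᶜ z *ᶜ w +ᶜ z *ᶜ v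
  distribˡ z w v = exact {z *ᶜ (w +ᶜ v)} {z *ᶜ w +ᶜ z *ᶜ v} λ k → pair
    (solve 6 (λ a b c d e f → a :* (c :+ e) :- b :* (d :+ f) := (a :* c :- b :* d) :+ (a :* e :- b :* f)) refl
      (seq (re z) k) (seq (im z) k) (seq (re w) k) (seq (im w) k) (seq (re v) k) (seq (im v) k))
    (solve 6 (λ a b c d e f → a :* (d :+ f) :+ b :* (c :+ e) := (a :* d :+ b :* c) :+ (a :* f :+ b :* e)) refl
      (seq (re z) k) (seq (im z) k) (seq (re w) k) (seq (im w) k) (seq (re v) k) (seq (im v) k))

  opaque
    ℂ-isCommutativeRing : IsCommutativeRing _≈ᶜ_ _+ᶜ_ _*ᶜ_ -ᶜ_ 0ᶜ 1ᶜ
    ℂ-isCommutativeRing = record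
      { isRing = record
        { +-isAbelianGroup = record
          { isGroup = record
            { isMonoid = record
              { isSemigroup = record
                { isMagma = record
                  { isEquivalence = record
                    { refl = λ {z} → ≈-refl {z} ; sym = λ {z} {w} → ≈-sym {z} {w} ; trans = λ {z} {w} {v} → ≈-trans {z} {w} {v} }
                  ; ∙-cong = λ {z} {w} {z′} {w′} → +-cong {z} {w} {z′} {w′} }
                ; assoc = λ z w v → exact {z +ᶜ w +ᶜ v} {z +ᶜ (w +ᶜ v)} λ k → pair (ℚₚ.+-assoc (seq (re z) k) (seq (re w) k) (seq (re v) k)) (ℚₚ.+-assoc (seq (im z) k) (seq (im w) k) (seq (im v) k)) }
              ; identity = (λ z → exact {0ᶜ +ᶜ z} {z} λ k → pair (ℚₚ.+-identityˡ (seq (re z) k)) (ℚₚ.+-identityˡ (seq (im z) k)))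
                         , (λ z → exact {z +ᶜ 0ᶜ} {z} λ k → pair (ℚₚ.+-identityʳ (seq (re z) k)) (ℚₚ.+-identityʳ (seq (im z) k))) }
            ; inverse = (λ z → exact {(-ᶜ z) +ᶜ z} {0ᶜ} λ k → pair (ℚₚ.+-inverseˡ (seq (re z) k)) (ℚₚ.+-inverseˡ (seq (im z) k)))
                      , (λ z → exact {z +ᶜ (-ᶜ z)} {0ᶜ} λ k → pair (ℚₚ.+-inverseʳ (seq (re z) k)) (ℚₚ.+-inverseʳ (seq (im z) k)))
            ; ⁻¹-cong = λ {z} {w} → neg-cong {z} {w} }
          ; comm = λ z w → exact {z +ᶜ w} {w +ᶜ z} λ k → pair (ℚₚ.+-comm (seq (re z) k) (seq (re w) k)) (ℚₚ.+-comm (seq (im z) k) (seq (im w) k)) }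
        ; *-cong = λ {z} {w} {z′} {w′} → *-cong {z} {w} {z′} {w′}
        ; *-assoc = *-assoc
        ; *-identity = *-identityˡ , (λ z → ≈-trans {z *ᶜ 1ᶜ} {1ᶜ *ᶜ z} {z} (*-comm z 1ᶜ) (*-identityˡ z))
        ; distrib = distribˡ , (λ v z w → ≈-trans {(z +ᶜ w) *ᶜ v} {v *ᶜ (z +ᶜ w)} {z *ᶜ v +ᶜ w *ᶜ v} (*-comm (z +ᶜ w) v)
            (≈-trans {v *ᶜ (z +ᶜ w)} {v *ᶜ z +ᶜ v *ᶜ w} {z *ᶜ v +ᶜ w *ᶜ v} (distribˡ v z w)
              (+-cong {v *ᶜ z} {z *ᶜ v} {v *ᶜ w} {w *ᶜ v} (*-comm v z) (*-comm v w)))) }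
      ; *-comm = *-comm }

  ℂ-ring : CommutativeRing 0ℓ 0ℓ
  ℂ-ring = record { isCommutativeRing = ℂ-isCommutativeRing }

  ≲-resp : ∀ {z w r} → z ≈ᶜ w → z ≲ r → w ≲ r
  ≲-resp {z} {w} {r} z≈w z≲r = ≲-mono {w} (ℚₚ.≤-reflexive (ℚₚ.+-identityˡ r)) (≲-exact {(w +ᶜ -ᶜ z) +ᶜ z} {w}
    (λ k → pair (cancel (seq (re w) k) (seq (re z) k)) (cancel (seq (im w) k) (seq (im z) k))) (≲-+ {w +ᶜ -ᶜ z} {z} (≈⇒≲0 {w} {z} (≈-sym {z} {w} z≈w)) z≲r))
    where
    cancel : ∀ a b → (a + - b) + b ≡ a
    cancel = solve 2 (λ a b → (a :+ :- b) :+ b := a) refl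

  ≲-0 : ∀ {z} → (∀ ε → 0ℚ < ε → z ≲ ε) → z ≈ᶜ 0ᶜ
  ≲-0 {z} z≲ = ≲0⇒≈ {z} {0ᶜ} (≲-exact {z} {z +ᶜ -ᶜ 0ᶜ} (λ k → pair (sym (ℚₚ.+-identityʳ (seq (re z) k))) (sym (ℚₚ.+-identityʳ (seq (im z) k))))
    (≲-closed {z} λ ε 0<ε → ≲-mono {z} (ℚₚ.≤-reflexive (sym (ℚₚ.+-identityˡ ε))) (z≲ ε 0<ε)))

  fromℚᶜ-* : ∀ p q → fromℚᶜ (p * q) ≈ᶜ fromℚᶜ p *ᶜ fromℚᶜ q
  fromℚᶜ-* p q = exact {fromℚᶜ (p * q)} {fromℚᶜ p *ᶜ fromℚᶜ q} λ k → pair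
    (solve 2 (λ p q → p :* q := p :* q :- con 0ℚ :* con 0ℚ) refl p q)
    (solve 2 (λ p q → con 0ℚ := p :* con 0ℚ :+ con 0ℚ :* q) refl p q)

  opaque
    unfolding Q._+_ Q._*_ Q.∣_∣

    ℂ-≲-+ : ∀ {z w r s} → z ≲ r → w ≲ s → z +ᶜ w ≲ r Q.+ s
    ℂ-≲-+ {z} {w} = ≲-+ {z} {w}
    ℂ-≲-* : ∀ {z w r s} → 0ℚ ≤ r → 0ℚ ≤ s → z ≲ r → w ≲ s → z *ᶜ w ≲ r Q.* s
    ℂ-≲-* {z} {w} = ≲-* {z} {w}
    ℂ-≲-closed : ∀ {z r} → (∀ ε → 0ℚ < ε → z ≲ r Q.+ ε) → z ≲ r
    ℂ-≲-closed {z} = ≲-closed {z}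
    ℂ-ι-+ : ∀ p q → fromℚᶜ (p Q.+ q) ≈ᶜ fromℚᶜ p +ᶜ fromℚᶜ q
    ℂ-ι-+ p q = exact {fromℚᶜ (p + q)} {fromℚᶜ p +ᶜ fromℚᶜ q} λ k → refl
    ℂ-ι-* : ∀ p q → fromℚᶜ (p Q.* q) ≈ᶜ fromℚᶜ p *ᶜ fromℚᶜ q
    ℂ-ι-* = fromℚᶜ-*
    ℂ-ι-≲ : ∀ p → fromℚᶜ p ≲ Q.∣ p ∣
    ℂ-ι-≲ = fromℚᶜ-≲

  ℂ-algebra : NormedAlgebra
  ℂ-algebra = record
    { commutativeRing = ℂ-ring
    ; _≲_ = _≲_
    ; ≲-resp = λ {z} {w} → ≲-resp {z} {w}
    ; ≲-mono = λ {z} → ≲-mono {z}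
    ; ≲-+ = λ {z} {w} → ℂ-≲-+ {z} {w}
    ; ≲-neg = λ {z} → ≲-neg {z}
    ; ≲-* = λ {z} {w} → ℂ-≲-* {z} {w}
    ; ≲-0 = λ {z} → ≲-0 {z}
    ; ≲-closed = λ {z} → ℂ-≲-closed {z}
    ; bound = bound
    ; ι = fromℚᶜ
    ; ι-+ = ℂ-ι-+
    ; ι-* = ℂ-ι-*
    ; ι-1 = ≈-refl {1ᶜ}
    ; ι-0 = ≈-refl {0ᶜ}
    ; ι-≲ = ℂ-ι-≲
    }

open import Defs hiding (0<*; 0≤*; 0<½*; half+half; *-inv; 0<inv; 0<1/; 1/-antimono; archimedean)

-- The interface to ℂ that the rest of the argument uses. Working over an abstract instance
-- keeps the operations from being unfolded to sequences of rationals.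
record Complexes : Set₁ where
  field
    algebra : NormedAlgebra
  open Limits algebra public
  field
    𝕛         : Carrier
    𝕛²≈-1     : 𝕛 * 𝕛 ≈ - 1#
    conj      : Carrier → Carrier
    conj-+    : ∀ z w → conj (z + w) ≈ conj z + conj w
    conj-*    : ∀ z w → conj (z * w) ≈ conj z * conj w
    conj-neg  : ∀ z → conj (- z) ≈ - conj z
    conj-ι    : ∀ p → conj (ι p) ≈ ι p
    conj-𝕛    : conj 𝕛 ≈ - 𝕛
    conj-≲    : ∀ {z r} → z ≲ r → conj z ≲ r
    real      : ℝ → Carrier
    conj-real : ∀ x → conj (real x) ≈ real x
    real-+    : ∀ x y → real (x +ʳ y) ≈ real x + real y
    real-*    : ∀ x y → real (x *ʳ y) ≈ real x * real y
    real-ι    : ∀ p → real (fromℚ p) ≈ ι p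
    real-cong : ∀ {x y} → x ≈ʳ y → real x ≈ real y
    recip-inverse : ∀ x (0<x : 0ʳ <ʳ x) → real x * real (recip x 0<x) ≈ 1#
    recip-≲   : ∀ x (0<x : 0ʳ <ʳ x) → (∃ λ K → ∀ k → K ℕ.≤ k → 1ℚ ℚ.≤ seq x k) → real (recip x 0<x) ≲ 1ℚ
    Re Im     : Carrier → ℝ
    cartesian      : ∀ z → z ≈ real (Re z) + 𝕛 * real (Im z)
    conj-cartesian : ∀ z → conj z ≈ real (Re z) - 𝕛 * real (Im z)
    pow       : Carrier → ℕ → Carrier
    pow-0     : ∀ z → pow z 0 ≈ 1#
    pow-suc   : ∀ z n → pow z (suc n) ≈ z * pow z n
    ipow      : ℤ → Carrier
    ipow-pos  : ∀ n → ipow (+ n) ≈ pow 𝕛 n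
    ipow-neg  : ∀ n → ipow -[1+ n ] ≈ pow (- 𝕛) (suc n)
    sign      : Sign → Carrier
    sign-+    : sign Sign.+ ≈ 1#
    sign--    : sign Sign.- ≈ - 1#
    partialExp      : Carrier → ℕ → Carrier
    partialExp-0    : ∀ z → partialExp z 0 ≈ 0#
    partialExp-suc  : ∀ z n → partialExp z (suc n) ≈ partialExp z n + ι (invFact n) * pow z n
    Exp       : Carrier → Carrier
    Exp-⟶     : ∀ z → partialExp z ⟶ Exp z

-- The concrete complex numbers and their two notions of convergence.

module ComplexInstance where
  open ComplexAlgebra
  open ComplexAlgebra._≲_ using (eventually)
  open ExpCauchy using (at; ‖_‖; _,,_)
  open ℚ-Solver using (solve; _:=_; _:+_; _:*_; :-_; _:-_; con)
  open Limits ℂ-algebra using (_⟶_)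

  ⟶⇒⟶ᶜ : ∀ {s l} → s ⟶ l → s ⟶ᶜ l
  ⟶⇒⟶ᶜ {s} {l} s→l = part (ExpCauchy.∣x∣≤‖‖) , part (ExpCauchy.∣y∣≤‖‖)
    where
    part : ∀ {f : ExpCauchy.ℚ[i] → ℚ} → (∀ g → f g ℚ.≤ ‖ g ‖) → ∀ ε → 0ℚ ℚ.< ε → ∃ λ N → ∀ n → N ℕ.≤ n →
           ∃ λ δ → 0ℚ ℚ.< δ × ∃ λ K → ∀ k → K ℕ.≤ k → f (at (s n +ᶜ -ᶜ l) k) ℚ.+ δ ℚ.≤ ε
    part {f} f≤ ε 0<ε =
      -- `η` is the strict margin required by `_<ʳ_`; the other half of ε is shared between the
      -- bound `δ` and an equal slack inside `_≲_`.
      let η = ε ℚ.* ½ ; 0<η = Defs.0<½* 0<ε ; δ = η ℚ.* ½ ; 0<δ = Defs.0<½* 0<η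
          (N , near) = s→l δ 0<δ
      in N , λ n N≤n → let (K , b) = eventually (near n N≤n) δ 0<δ in
        η , 0<η , K , λ k K≤k → ℚₚ.≤-trans (ℚₚ.+-monoˡ-≤ η (ℚₚ.≤-trans (f≤ (at (s n +ᶜ -ᶜ l) k)) (b k K≤k)))
          (ℚₚ.≤-reflexive (≡.trans (≡.cong (λ t → t ℚ.+ η) (Defs.half+half η)) (Defs.half+half ε)))

  ⟶ᶜ⇒⟶ : ∀ {s l} → s ⟶ᶜ l → s ⟶ l
  ⟶ᶜ⇒⟶ {s} {l} (p , q) ε 0<ε =
    let η = ε ℚ.* ½ ; 0<η = Defs.0<½* 0<ε
        (M , near) = p η 0<η ; (N , near′) = q η 0<η
    in M ℕ.⊔ N , λ n le →
      let (δ , 0<δ , K , b) = near n (ℕₚ.m⊔n≤o⇒m≤o M N le) ; (δ′ , 0<δ′ , L , c) = near′ n (ℕₚ.m⊔n≤o⇒n≤o M N le)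
      in by λ κ 0<κ → K ℕ.⊔ L , λ k le′ →
        let B = drop {∣ re (s n) -ʳ re l ∣ʳ} 0<δ (b k (ℕₚ.m⊔n≤o⇒m≤o K L le′)) ; C = drop {∣ im (s n) -ʳ im l ∣ʳ} 0<δ′ (c k (ℕₚ.m⊔n≤o⇒n≤o K L le′))
        in ℚₚ.≤-trans (ℚₚ.+-mono-≤ B C) (ℚₚ.≤-trans (ℚₚ.≤-reflexive (Defs.half+half ε)) (drop′ ε 0<κ))
    where
    drop′ : ∀ a {δ} → 0ℚ ℚ.< δ → a ℚ.≤ a ℚ.+ δ
    drop′ a {δ} 0<δ = subst (λ t → t ℚ.≤ a ℚ.+ δ) (ℚₚ.+-identityʳ a) (ℚₚ.+-monoʳ-≤ a (ℚₚ.<⇒≤ 0<δ))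
    drop : ∀ {x δ b k} → 0ℚ ℚ.< δ → seq x k ℚ.+ δ ℚ.≤ b → seq x k ℚ.≤ b
    drop {x} {k = k} 0<δ = ℚₚ.≤-trans (drop′ (seq x k) 0<δ)

  private
    pair : ∀ {a b c d : ℚ} → a ≡ c → b ≡ d → a ,, b ≡ c ,, d
    pair = ≡.cong₂ _,,_

    conjᶜ : ℂ → ℂ
    conjᶜ z = re z +𝕚 (-ʳ im z)

    conjᶜ-≲ : ∀ {z r} → z ≲ r → conjᶜ z ≲ r
    conjᶜ-≲ {z} {r} z≲r = by λ ε 0<ε → let (K , b) = eventually z≲r ε 0<ε in K , λ k K≤k →
      subst (λ t → ℚ.∣ seq (re z) k ∣ ℚ.+ t ℚ.≤ r ℚ.+ ε) (≡.sym (ℚₚ.∣-p∣≡∣p∣ (seq (im z) k))) (b k K≤k)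

    conjᶜ-* : ∀ z w → conjᶜ (z *ᶜ w) ≈ᶜ conjᶜ z *ᶜ conjᶜ w
    conjᶜ-* z w = exact {conjᶜ (z *ᶜ w)} {conjᶜ z *ᶜ conjᶜ w} λ k → pair
      (solve 4 (λ a b c d → a :* c :- b :* d := a :* c :- (:- b) :* (:- d)) ≡.refl (seq (re z) k) (seq (im z) k) (seq (re w) k) (seq (im w) k))
      (solve 4 (λ a b c d → :- (a :* d :+ b :* c) := a :* (:- d) :+ (:- b) :* c) ≡.refl (seq (re z) k) (seq (im z) k) (seq (re w) k) (seq (im w) k))

    cartesianᶜ : ∀ z → z ≈ᶜ fromℝ (re z) +ᶜ 𝕚 *ᶜ fromℝ (im z)
    cartesianᶜ z = exact {z} {fromℝ (re z) +ᶜ 𝕚 *ᶜ fromℝ (im z)} λ k → pair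
      (solve 2 (λ a b → a := a :+ (con 0ℚ :* b :- con 1ℚ :* con 0ℚ)) ≡.refl (seq (re z) k) (seq (im z) k))
      (solve 2 (λ a b → b := con 0ℚ :+ (con 0ℚ :* con 0ℚ :+ con 1ℚ :* b)) ≡.refl (seq (re z) k) (seq (im z) k))

    conjᶜ-cartesian : ∀ z → conjᶜ z ≈ᶜ fromℝ (re z) +ᶜ -ᶜ (𝕚 *ᶜ fromℝ (im z))
    conjᶜ-cartesian z = exact {conjᶜ z} {fromℝ (re z) +ᶜ -ᶜ (𝕚 *ᶜ fromℝ (im z))} λ k → pair
      (solve 2 (λ a b → a := a :- (con 0ℚ :* b :- con 1ℚ :* con 0ℚ)) ≡.refl (seq (re z) k) (seq (im z) k))
      (solve 2 (λ a b → :- b := con 0ℚ :- (con 0ℚ :* con 0ℚ :+ con 1ℚ :* b)) ≡.refl (seq (re z) k) (seq (im z) k))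

    fromℝ-* : ∀ x y → fromℝ (x *ʳ y) ≈ᶜ fromℝ x *ᶜ fromℝ y
    fromℝ-* x y = exact {fromℝ (x *ʳ y)} {fromℝ x *ᶜ fromℝ y} λ k → pair
      (solve 2 (λ a b → a :* b := a :* b :- con 0ℚ :* con 0ℚ) ≡.refl (seq x k) (seq y k))
      (solve 2 (λ a b → con 0ℚ := a :* con 0ℚ :+ con 0ℚ :* b) ≡.refl (seq x k) (seq y k))

    fromℝ-cong : ∀ {x y} → x ≈ʳ y → fromℝ x ≈ᶜ fromℝ y
    fromℝ-cong x≈y = x≈y , proj₂ (≈-refl {0ᶜ})

    fromℝ-recip : ∀ x (0<x : 0ʳ <ʳ x) → fromℝ x *ᶜ fromℝ (recip x 0<x) ≈ᶜ 1ᶜ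
    fromℝ-recip x 0<x@(d , 0<d , K , 0+d≤x) = ≈-trans {fromℝ x *ᶜ fromℝ x⁻¹} {fromℝ (x *ʳ x⁻¹)} {1ᶜ}
      (≈-sym {fromℝ (x *ʳ x⁻¹)} {fromℝ x *ᶜ fromℝ x⁻¹} (fromℝ-* x x⁻¹))
      (fromℝ-cong {x *ʳ x⁻¹} {1ʳ} λ ε 0<ε → K , λ k K≤k → subst (λ t → ℚ.∣ t ℚ.- 1ℚ ∣ ℚ.≤ ε)
        (≡.sym (Defs.*-inv (seq x k) (ℚₚ.<-≤-trans 0<d (subst (λ t → t ℚ.≤ seq x k) (ℚₚ.+-identityˡ d) (0+d≤x k K≤k))))) (ℚₚ.<⇒≤ 0<ε))
      where x⁻¹ = recip x 0<x

    fromℝ-recip-≲ : ∀ x (0<x : 0ʳ <ʳ x) → (∃ λ K → ∀ k → K ℕ.≤ k → 1ℚ ℚ.≤ seq x k) → fromℝ (recip x 0<x) ≲ 1ℚ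
    fromℝ-recip-≲ x 0<x (K , 1≤x) = by λ ε 0<ε → K , λ k K≤k → ℚₚ.≤-trans
      (ℚₚ.≤-trans (ℚₚ.≤-reflexive (≡.trans (ℚₚ.+-identityʳ ℚ.∣ inv (seq x k) ∣) (ℚₚ.0≤p⇒∣p∣≡p (ℚₚ.<⇒≤ (Defs.0<inv (seq x k) (ℚₚ.<-≤-trans (ℚₚ.positive⁻¹ 1ℚ) (1≤x k K≤k)))))))
        (inv-antimono {1ℚ} {seq x k} (ℚₚ.positive⁻¹ 1ℚ) (1≤x k K≤k)))
      (subst (λ t → t ℚ.≤ 1ℚ ℚ.+ ε) (ℚₚ.+-identityʳ 1ℚ) (ℚₚ.+-monoʳ-≤ 1ℚ (ℚₚ.<⇒≤ 0<ε)))

  complexes : Complexes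
  complexes = record
    { algebra = ℂ-algebra
    ; 𝕛 = 𝕚
    ; 𝕛²≈-1 = exact {𝕚 *ᶜ 𝕚} { -ᶜ 1ᶜ} λ k → ≡.refl
    ; conj = conjᶜ
    ; conj-+ = λ z w → exact {conjᶜ (z +ᶜ w)} {conjᶜ z +ᶜ conjᶜ w} λ k → pair ≡.refl (ℚₚ.neg-distrib-+ (seq (im z) k) (seq (im w) k))
    ; conj-* = conjᶜ-*
    ; conj-neg = λ z → ≈-refl {conjᶜ (-ᶜ z)}
    ; conj-ι = λ p → exact {conjᶜ (fromℚᶜ p)} {fromℚᶜ p} λ k → ≡.refl
    ; conj-𝕛 = exact {conjᶜ 𝕚} { -ᶜ 𝕚} λ k → ≡.refl
    ; conj-real = λ x → exact {conjᶜ (fromℝ x)} {fromℝ x} λ k → ≡.refl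
    ; conj-≲ = λ {z} → conjᶜ-≲ {z}
    ; real = fromℝ
    ; real-+ = λ x y → exact {fromℝ (x +ʳ y)} {fromℝ x +ᶜ fromℝ y} λ k → ≡.refl
    ; real-* = fromℝ-*
    ; real-ι = λ p → ≈-refl {fromℚᶜ p}
    ; real-cong = λ {x} {y} → fromℝ-cong {x} {y}
    ; recip-inverse = fromℝ-recip
    ; recip-≲ = fromℝ-recip-≲
    ; Re = re
    ; Im = im
    ; cartesian = cartesianᶜ
    ; conj-cartesian = conjᶜ-cartesian
    ; pow = _^ᶜ_
    ; pow-0 = λ z → ≈-refl {1ᶜ}
    ; pow-suc = λ z n → ≈-refl {z *ᶜ z ^ᶜ n}
    ; ipow = 𝕚^_
    ; ipow-pos = λ n → ≈-refl {𝕚 ^ᶜ n}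
    ; ipow-neg = λ n → ≈-refl {(-ᶜ 𝕚) ^ᶜ suc n}
    ; sign = signᶜ
    ; sign-+ = ≈-refl {1ᶜ}
    ; sign-- = ≈-refl { -ᶜ 1ᶜ}
    ; partialExp = expSum
    ; partialExp-0 = λ z → ≈-refl {0ᶜ}
    ; partialExp-suc = λ z n → ≈-refl {expSum z (suc n)}
    ; Exp = exp
    ; Exp-⟶ = λ z → ⟶ᶜ⇒⟶ {expSum z} {exp z} (expSum-⟶ z)
    }

-- Positive reals.

module RealPositivity where
  positive-* : ∀ {x y} → 0ʳ <ʳ x → 0ʳ <ʳ y → 0ʳ <ʳ x *ʳ y
  positive-* {x} {y} (a , 0<a , K , a≤x) (b , 0<b , L , b≤y) = a ℚ.* b , Defs.0<* 0<a 0<b , K ℕ.⊔ L , λ k le →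
    subst (λ t → t ℚ.≤ seq x k ℚ.* seq y k) (≡.sym (ℚₚ.+-identityˡ (a ℚ.* b)))
      (*-mono-≤ (ℚₚ.≤-trans (ℚₚ.<⇒≤ 0<a) (a≤ k le)) (ℚₚ.<⇒≤ 0<b) (a≤ k le) (b≤ k le))
    where
    a≤ : ∀ k → K ℕ.⊔ L ℕ.≤ k → a ℚ.≤ seq x k
    a≤ k le = subst (λ t → t ℚ.≤ seq x k) (ℚₚ.+-identityˡ a) (a≤x k (ℕₚ.m⊔n≤o⇒m≤o K L le))
    b≤ : ∀ k → K ℕ.⊔ L ℕ.≤ k → b ℚ.≤ seq y k
    b≤ k le = subst (λ t → t ℚ.≤ seq y k) (ℚₚ.+-identityˡ b) (b≤y k (ℕₚ.m⊔n≤o⇒n≤o K L le))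

  positive-+ : ∀ {x y} → 0ʳ <ʳ x → 0ʳ <ʳ y → 0ʳ <ʳ x +ʳ y
  positive-+ {x} {y} (a , 0<a , K , a≤x) (b , 0<b , L , b≤y) = a ℚ.+ b , ℚₚ.+-mono-< 0<a 0<b , K ℕ.⊔ L , λ k le →
    subst (λ t → t ℚ.≤ seq x k ℚ.+ seq y k) (solve′ 2 (λ a b → con′ 0ℚ :+′ a :+′ (con′ 0ℚ :+′ b) :=′ con′ 0ℚ :+′ (a :+′ b)) ≡.refl a b)
      (ℚₚ.+-mono-≤ (a≤x k (ℕₚ.m⊔n≤o⇒m≤o K L le)) (b≤y k (ℕₚ.m⊔n≤o⇒n≤o K L le)))
    where open ℚ-Solver using () renaming (solve to solve′; _:=_ to _:=′_; _:+_ to _:+′_; con to con′)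

  private
    lower : ∀ {x} d {K} → (∀ k → K ℕ.≤ k → 0ℚ ℚ.+ d ℚ.≤ seq x k) → ∀ k → K ℕ.≤ k → d ℚ.≤ seq x k
    lower {x} d le k K≤k = subst (λ t → t ℚ.≤ seq x k) (ℚₚ.+-identityˡ d) (le k K≤k)

  positive-scaled : ∀ {x p} → 0ʳ <ʳ x → 0ℚ ℚ.< p → 0ʳ <ʳ x *ʳ fromℚ p
  positive-scaled {x} {p} (d , 0<d , K , d≤x) 0<p = d ℚ.* p , Defs.0<* 0<d 0<p , K , λ k K≤k →
    subst (λ t → t ℚ.≤ seq x k ℚ.* p) (≡.sym (ℚₚ.+-identityˡ (d ℚ.* p)))
      (ℚₚ.*-monoʳ-≤-nonNeg p {{ℚ.nonNegative (ℚₚ.<⇒≤ 0<p)}} (lower {x} d d≤x k K≤k))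

  scaled-<ʳ : ∀ {x p} → 0ʳ <ʳ x → 0ℚ ℚ.< 1ℚ ℚ.- p → x *ʳ fromℚ p <ʳ x
  scaled-<ʳ {x} {p} (d , 0<d , K , d≤x) 0<1-p = d ℚ.* (1ℚ ℚ.- p) , Defs.0<* 0<d 0<1-p , K , λ k K≤k →
    ℚₚ.≤-trans (ℚₚ.+-monoʳ-≤ (seq x k ℚ.* p) (ℚₚ.*-monoʳ-≤-nonNeg (1ℚ ℚ.- p) {{ℚ.nonNegative (ℚₚ.<⇒≤ 0<1-p)}} (lower {x} d d≤x k K≤k)))
      (ℚₚ.≤-reflexive (solve′ 2 (λ s p → s :*′ p :+′ s :*′ (con′ 1ℚ :-′ p) :=′ s) ≡.refl (seq x k) p))
    where open ℚ-Solver using () renaming (solve to solve′; _:=_ to _:=′_; _:+_ to _:+′_; _:*_ to _:*′_; _:-_ to _:-′_; con to con′)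

  1+-≥1 : ∀ {x} → 0ʳ <ʳ x → ∃ λ K → ∀ k → K ℕ.≤ k → 1ℚ ℚ.≤ seq (1ʳ +ʳ x) k
  1+-≥1 {x} (d , 0<d , K , d≤x) = K , λ k K≤k → subst (λ t → t ℚ.≤ 1ℚ ℚ.+ seq x k) (ℚₚ.+-identityʳ 1ℚ)
    (ℚₚ.+-monoʳ-≤ 1ℚ (ℚₚ.≤-trans (ℚₚ.<⇒≤ 0<d) (lower {x} d d≤x k K≤k)))

  positive-fromℚ : ∀ {p} → 0ℚ ℚ.< p → 0ʳ <ʳ fromℚ p
  positive-fromℚ {p} 0<p = p , 0<p , 0 , λ _ _ → ℚₚ.≤-reflexive (ℚₚ.+-identityˡ p)


-- The exponential function and conjugation.

module ComplexExponential (C : Complexes) where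
  open Complexes C public
  open Exponentials algebra public
  open SetoidReasoning setoid

  pow-≈ : ∀ z n → pow z n ≈ z ^ n
  pow-≈ z zero    = pow-0 z
  pow-≈ z (suc n) = trans (pow-suc z n) (*-congˡ (pow-≈ z n))

  partialExp-≈ : ∀ z N → partialExp z N ≈ ∑ N (expSeries z)
  partialExp-≈ z zero    = partialExp-0 z
  partialExp-≈ z (suc N) = trans (partialExp-suc z N) (+-cong (partialExp-≈ z N)
    (trans (*-congˡ (pow-≈ z N)) (sym (expSeries-closed z N))))

  exp-⟶ : ∀ z → (λ N → ∑ N (expSeries z)) ⟶ Exp z
  exp-⟶ z = ⟶-cong (partialExp-≈ z) refl (Exp-⟶ z)

  exp-cong : ∀ {z w} → z ≈ w → Exp z ≈ Exp w
  exp-cong {z} {w} z≈w = ⟶-unique (exp-⟶ z)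
    (⟶-cong (λ N → Σ.⨁-cong N (λ n _ → expSeries-cong (sym z≈w) n)) refl (exp-⟶ w))

  exp-+ : ∀ z w → Exp (z + w) ≈ Exp z * Exp w
  exp-+ z w = expSeries-+-limit (exp-⟶ z) (exp-⟶ w) (exp-⟶ (z + w))

  exp-0 : Exp 0# ≈ 1#
  exp-0 = ⟶-unique (exp-⟶ 0#) λ ε 0<ε → 1 , λ { (suc N) _ →
    ≲-resp (sym (trans (+-congʳ (sum N)) (-‿inverseʳ 1#))) (0≲ (ℚₚ.<⇒≤ 0<ε)) }
    where
    sum : ∀ N → ∑ (suc N) (expSeries 0#) ≈ 1#
    sum zero    = +-identityˡ 1#
    sum (suc N) = trans (+-cong (sum N) (trans (*-congˡ (zeroˡ _)) (zeroʳ _))) (+-identityʳ 1#)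

  -- A difference of norm 0 keeps norm 0 under conjugation, by `conj-≲`.
  conj-cong : ∀ {z w} → z ≈ w → conj z ≈ conj w
  conj-cong {z} {w} z≈w = begin
    conj z                             ≈⟨ solve 2 (λ a b → a := (a :- b) :+ b) refl (conj z) (conj w) ⟩
    (conj z - conj w) + conj w         ≈⟨ +-congʳ (≲-0 λ ε 0<ε → ≲-resp (trans (conj-+ z (- w)) (+-congˡ (conj-neg w)))
                                            (conj-≲ (≲-resp (sym (trans (+-congʳ z≈w) (-‿inverseʳ w))) (0≲ (ℚₚ.<⇒≤ 0<ε))))) ⟩
    0# + conj w                        ≈⟨ +-identityˡ _ ⟩
    conj w                             ∎

  conj-1 : conj 1# ≈ 1#
  conj-1 = trans (conj-cong (sym ι-1)) (trans (conj-ι 1ℚ) ι-1)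

  conj-0 : conj 0# ≈ 0#
  conj-0 = trans (conj-cong (sym ι-0)) (trans (conj-ι 0ℚ) ι-0)

  conj-expSeries : ∀ z n → conj (expSeries z n) ≈ expSeries (conj z) n
  conj-expSeries z zero    = conj-1
  conj-expSeries z (suc n) = trans (conj-* _ _) (*-cong (conj-ι _) (trans (conj-* _ _) (*-congˡ (conj-expSeries z n))))

  conj-∑ : ∀ N f → conj (∑ N f) ≈ ∑ N (λ n → conj (f n))
  conj-∑ zero    f = conj-0
  conj-∑ (suc N) f = trans (conj-+ _ _) (+-congʳ (conj-∑ N f))

  conj-exp : ∀ z → conj (Exp z) ≈ Exp (conj z)
  conj-exp z = ⟶-unique {l = conj (Exp z)}
    (λ ε 0<ε → let (N , near) = exp-⟶ z ε 0<ε in N , λ n N≤n → ≲-resp (conjugate n) (conj-≲ (near n N≤n)))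
    (exp-⟶ (conj z))
    where
    conjugate : ∀ n → conj (∑ n (expSeries z) - Exp z) ≈ ∑ n (expSeries (conj z)) - conj (Exp z)
    conjugate n = trans (conj-+ _ _) (+-cong (trans (conj-∑ n _) (Σ.⨁-cong n (λ i _ → conj-expSeries z i))) (conj-neg _))

-- The number π and rotations by its rational multiples.

record SineZero (C : Complexes) : Set where
  open Complexes C
  field
    π         : ℝ
    0<π       : 0ʳ <ʳ π
    sin[π]≈0  : Im (Exp (𝕛 * real π)) ≈ʳ 0ʳ
    0<sin     : ∀ x → 0ʳ <ʳ x → x <ʳ π → 0ʳ <ʳ Im (Exp (𝕛 * real x))

module Trigonometry (C : Complexes) (sineZero : SineZero C) where
  open SineZero sineZero
  open ComplexExponential C
  open RealPositivity
  open SetoidReasoning setoid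

  ϖ : Carrier
  ϖ = 𝕛 * real π

  E : ℚ → Carrier
  E t = Exp (𝕛 * real (π *ʳ fromℚ t))

  angle-≈ : ∀ t → 𝕛 * real (π *ʳ fromℚ t) ≈ ι t * ϖ
  angle-≈ t = trans (*-congˡ (trans (real-* π (fromℚ t)) (*-congˡ (real-ι t))))
    (solve 3 (λ i p t → i :* (p :* t) := t :* (i :* p)) refl 𝕛 (real π) (ι t))

  E-≈ : ∀ t → E t ≈ Exp (ι t * ϖ)
  E-≈ t = exp-cong (angle-≈ t)

  E-+ : ∀ s t → E (s +ℚ t) ≈ E s * E t
  E-+ s t = begin
    E (s +ℚ t)                          ≈⟨ E-≈ (s +ℚ t) ⟩
    Exp (ι (s +ℚ t) * ϖ)                ≈⟨ exp-cong (trans (*-congʳ (ι-+ s t)) (distribʳ _ _ _)) ⟩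
    Exp (ι s * ϖ + ι t * ϖ)             ≈⟨ exp-+ _ _ ⟩
    Exp (ι s * ϖ) * Exp (ι t * ϖ)       ≈⟨ *-cong (E-≈ s) (E-≈ t) ⟨
    E s * E t                           ∎

  E-0 : E 0ℚ ≈ 1#
  E-0 = trans (E-≈ 0ℚ) (trans (exp-cong (trans (*-congʳ ι-0) (zeroˡ _))) exp-0)

  E-⟶ : ∀ t → (λ N → ∑ N (expSeries (ι t * ϖ))) ⟶ E t
  E-⟶ t = ⟶-cong (λ _ → refl) (sym (E-≈ t)) (exp-⟶ (ι t * ϖ))

  E-≡ : ∀ {s t} → s ≡ t → E s ≈ E t
  E-≡ ≡.refl = refl

  conj-E : ∀ t → conj (E t) ≈ E (Q.- t)
  conj-E t = begin
    conj (E t)                          ≈⟨ conj-exp _ ⟩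
    Exp (conj (𝕛 * real (π *ʳ fromℚ t)))  ≈⟨ exp-cong (trans (conj-* _ _) (*-cong conj-𝕛 (conj-real _))) ⟩
    Exp (- 𝕛 * real (π *ʳ fromℚ t))     ≈⟨ exp-cong (trans (solve 2 (λ i a → :- i :* a := :- (i :* a)) refl 𝕛 _) (-‿cong (angle-≈ t))) ⟩
    Exp (- (ι t * ϖ))                   ≈⟨ exp-cong (trans (solve 2 (λ a b → :- (a :* b) := :- a :* b) refl (ι t) ϖ) (*-congʳ (sym (ι-neg t)))) ⟩
    Exp (ι (Q.- t) * ϖ)                 ≈⟨ E-≈ (Q.- t) ⟨
    E (Q.- t)                           ∎

  cos sin′ : ℚ → ℝ
  cos t  = Re (E t)
  sin′ t = Im (E t)

  E-cartesian : ∀ t → E t ≈ real (cos t) + 𝕛 * real (sin′ t)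
  E-cartesian t = cartesian (E t)

  E-cartesian⁻ : ∀ t → E (Q.- t) ≈ real (cos t) - 𝕛 * real (sin′ t)
  E-cartesian⁻ t = trans (sym (conj-E t)) (conj-cartesian (E t))

  E-inverse : ∀ t → E t * E (Q.- t) ≈ 1#
  E-inverse t = trans (sym (E-+ t (Q.- t))) (trans (E-≡ (Q.+-inverseʳ t)) E-0)

  opaque
    unfolding Q._+_ Q.-_
    0<sin′ : ∀ {t} → 0ℚ <ℚ t → 0ℚ <ℚ 1ℚ Q.- t → 0ʳ <ʳ sin′ t
    0<sin′ {t} 0<t 0<1-t = 0<sin (π *ʳ fromℚ t) (positive-scaled {π} 0<π 0<t) (scaled-<ʳ {π} 0<π 0<1-t)

  sin′[½] : 0ʳ <ʳ sin′ ½
  sin′[½] = 0<sin′ (ℚₚ.positive⁻¹ ½) (subst (0ℚ <ℚ_) (≡.sym 1-½) (ℚₚ.positive⁻¹ ½))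
    where
    1-½ : 1ℚ Q.- ½ ≡ ½
    1-½ = ≡.trans (≡.cong (Q._- ½) (≡.sym ½+½))
      (ℚS.solve 1 (λ h → h ℚS.:+ h ℚS.:- h ℚS.:= h) ≡.refl ½)

  private
    X Y Y⁻¹ : Carrier
    X = real (cos ½)
    Y = real (sin′ ½)
    Y⁻¹ = real (recip (sin′ ½) sin′[½])

    Y*Y⁻¹ : Y * Y⁻¹ ≈ 1#
    Y*Y⁻¹ = recip-inverse (sin′ ½) sin′[½]

    E[1] : E 1ℚ ≈ (X + 𝕛 * Y) * (X + 𝕛 * Y)
    E[1] = trans (E-≡ (≡.sym ½+½)) (trans (E-+ ½ ½) (*-cong (E-cartesian ½) (E-cartesian ½)))

    E[-1] : E (Q.- 1ℚ) ≈ (X - 𝕛 * Y) * (X - 𝕛 * Y)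
    E[-1] = trans (E-≡ (≡.trans (≡.cong Q.-_ (≡.sym ½+½)) (ℚS.solve 1 (λ h → ℚS.:- (h ℚS.:+ h) ℚS.:= ℚS.:- h ℚS.:+ ℚS.:- h) ≡.refl ½)))
      (trans (E-+ _ _) (*-cong (E-cartesian⁻ ½) (E-cartesian⁻ ½)))

    -- As sin π = 0, `E 1ℚ` equals its conjugate, and conjugation negates the angle.
    E[1]-real : E 1ℚ ≈ E (Q.- 1ℚ)
    E[1]-real = begin
      E 1ℚ                              ≈⟨ E[1]-π ⟩
      Z                                 ≈⟨ cartesian Z ⟩
      real (Re Z) + 𝕛 * real (Im Z)     ≈⟨ +-congˡ (*-congˡ sin≈0) ⟩
      real (Re Z) + 𝕛 * 0#              ≈⟨ solve 2 (λ a i → a :+ i :* con (+ 0) := a :- i :* con (+ 0)) refl _ 𝕛 ⟩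
      real (Re Z) - 𝕛 * 0#              ≈⟨ +-congˡ (-‿cong (*-congˡ sin≈0)) ⟨
      real (Re Z) - 𝕛 * real (Im Z)     ≈⟨ conj-cartesian Z ⟨
      conj Z                            ≈⟨ conj-cong E[1]-π ⟨
      conj (E 1ℚ)                       ≈⟨ conj-E 1ℚ ⟩
      E (Q.- 1ℚ)                        ∎
      where
      Z = Exp (𝕛 * real π)
      E[1]-π : E 1ℚ ≈ Z
      E[1]-π = trans (E-≈ 1ℚ) (exp-cong (trans (*-congʳ ι-1) (*-identityˡ _)))
      sin≈0 : real (Im Z) ≈ 0#
      sin≈0 = trans (real-cong sin[π]≈0) (trans (real-ι 0ℚ) ι-0)

    η : Carrier
    η = ι ½

    η*2 : η * (1# + 1#) ≈ 1#
    η*2 = trans (*-congˡ (trans (+-cong (sym ι-1) (sym ι-1)) (sym (ι-+ 1ℚ 1ℚ)))) (ι-inverse ½*2)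

    -- `E ½` is X + i Y, and E 1 = E (-1) says (X + i Y)² = (X - i Y)², that is 4 i X Y = 0. `Y` is
    -- invertible because sin (π / 2) is positive; the two factors `η` divide by 4.
    X≈0 : X ≈ 0#
    X≈0 = begin
      X                                 ≈⟨ solve 1 (λ x → x := con (+ 1) :* con (+ 1) :* x :* con (+ 1)) refl X ⟩
      1# * 1# * X * 1#                  ≈⟨ *-congˡ Y*Y⁻¹ ⟨
      1# * 1# * X * (Y * Y⁻¹)           ≈⟨ *-congʳ (*-congʳ (*-cong η*2 η*2)) ⟨
      η * (1# + 1#) * (η * (1# + 1#)) * X * (Y * Y⁻¹)
        ≈⟨ solve 4 (λ h x y z → h :* con (+ 2) :* (h :* con (+ 2)) :* x :* (y :* z) := (:- con (+ 1)) :* (con (ℤ.- (+ 4)) :* (x :* y) :* (h :* h :* z))) refl η X Y Y⁻¹ ⟩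
      - 1# * (con-4 * (X * Y) * (η * η * Y⁻¹))
        ≈⟨ *-congʳ 𝕛²≈-1 ⟨
      𝕛 * 𝕛 * (con-4 * (X * Y) * (η * η * Y⁻¹))
        ≈⟨ solve 5 (λ i x y h z → i :* i :* (con (ℤ.- (+ 4)) :* (x :* y) :* (h :* h :* z))
             := ((x :- i :* y) :* (x :- i :* y) :- (x :+ i :* y) :* (x :+ i :* y)) :* (i :* (h :* h :* z))) refl 𝕛 X Y η Y⁻¹ ⟩
      ((X - 𝕛 * Y) * (X - 𝕛 * Y) - (X + 𝕛 * Y) * (X + 𝕛 * Y)) * (𝕛 * (η * η * Y⁻¹))
        ≈⟨ *-congʳ (trans (+-cong (trans (sym E[-1]) (sym E[1]-real)) (-‿cong (sym E[1]))) (-‿inverseʳ _)) ⟩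
      0# * (𝕛 * (η * η * Y⁻¹))          ≈⟨ zeroˡ _ ⟩
      0#                                ∎
      where con-4 = - (1# + 1# + 1# + 1#)

    Y²≈1 : Y * Y ≈ 1#
    Y²≈1 = begin
      Y * Y                             ≈⟨ solve 1 (λ y → y :* y := con (+ 0) :* con (+ 0) :- (:- con (+ 1)) :* (y :* y)) refl Y ⟩
      0# * 0# - - 1# * (Y * Y)          ≈⟨ +-cong (*-cong X≈0 X≈0) (-‿cong (*-congʳ 𝕛²≈-1)) ⟨
      X * X - 𝕛 * 𝕛 * (Y * Y)           ≈⟨ solve 3 (λ i x y → x :* x :- i :* i :* (y :* y) := (x :+ i :* y) :* (x :- i :* y)) refl 𝕛 X Y ⟩
      (X + 𝕛 * Y) * (X - 𝕛 * Y)         ≈⟨ *-cong (E-cartesian ½) (E-cartesian⁻ ½) ⟨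
      E ½ * E (Q.- ½)                   ≈⟨ E-inverse ½ ⟩
      1#                                ∎

  -- Since cos (π / 2) = 0, `E ½` is i Y with Y² = 1, and its square is -1.
  E-1 : E 1ℚ ≈ - 1#
  E-1 = begin
    E 1ℚ                              ≈⟨ E[1] ⟩
    (X + 𝕛 * Y) * (X + 𝕛 * Y)         ≈⟨ *-cong (+-congʳ X≈0) (+-congʳ X≈0) ⟩
    (0# + 𝕛 * Y) * (0# + 𝕛 * Y)       ≈⟨ solve 2 (λ i y → (con (+ 0) :+ i :* y) :* (con (+ 0) :+ i :* y) := i :* i :* (y :* y)) refl 𝕛 Y ⟩
    𝕛 * 𝕛 * (Y * Y)                   ≈⟨ *-cong 𝕛²≈-1 Y²≈1 ⟩
    - 1# * 1#                         ≈⟨ *-identityʳ _ ⟩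
    - 1#                              ∎

  E-2 : E 2ℚ ≈ 1#
  E-2 = trans (E-+ 1ℚ 1ℚ) (trans (*-cong E-1 E-1) (solve 0 ((:- con (+ 1)) :* (:- con (+ 1)) := con (+ 1)) refl))

  private
    approx = exp-linear-approximation ϖ
    ϖ-bound′ = bound ϖ

  -- For 1/2 < s ≤ 1 the real part of E s is negative, so ∣E s - 1∣² ≥ 2.
  E-left : ∃ λ D → 0ℚ ≤ℚ D × (∀ s → ½ <ℚ s → s ≤ℚ 1ℚ → ∃ λ w → (E s - 1#) * w ≈ 1# × w ≲ D)
  E-left = proj₁ ϖ-bound′ +ℚ proj₁ approx , 0≤D , λ s ½<s s≤1 →
    (E (Q.- s) - 1#) * real (recip (ρ s) (0<ρ s ½<s s≤1)) ,
    trans (sym (*-assoc _ _ _)) (trans (*-congʳ (modulus s)) (recip-inverse (ρ s) (0<ρ s ½<s s≤1))) ,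
    ≲-≡ (Q.*-identityʳ _) (≲-* 0≤D 0≤1 (near s ½<s s≤1) (recip-≲ (ρ s) (0<ρ s ½<s s≤1) (1+-≥1 {ρ′ s} (0<ρ′ s ½<s s≤1))))
    where
    0≤D : 0ℚ ≤ℚ proj₁ ϖ-bound′ +ℚ proj₁ approx
    0≤D = 0≤+ (proj₁ (proj₂ ϖ-bound′)) (proj₁ (proj₂ approx))
    v : ℚ → ℝ
    v s = sin′ (s Q.- ½)
    -- cos (π s) = -sin (π / 2) sin (π (s - 1/2)), so `ρ` is 2 - 2 cos (π s) = |E s - 1|². It is
    -- split as 1 + `ρ′` with `ρ′` positive, since `recip-≲` asks for the lower bound 1.
    p ρ ρ′ : ℚ → ℝ
    p s = sin′ ½ *ʳ v s
    ρ′ s = 1ʳ +ʳ (p s +ʳ p s)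
    ρ s = 1ʳ +ʳ ρ′ s
    0<v : ∀ s → ½ <ℚ s → s ≤ℚ 1ℚ → 0ʳ <ʳ v s
    0<v s ½<s s≤1 = 0<sin′ (Q.p<q⇒0<q-p ½<s) (Q.p<q⇒0<q-p (Q.≤-<-trans (Q.+-monoˡ-≤ (Q.- ½) s≤1)
      (subst (1ℚ Q.- ½ <ℚ_) (Q.+-identityʳ 1ℚ) (Q.+-monoʳ-< 1ℚ -½<0))))
      where
      -½<0 : Q.- ½ <ℚ 0ℚ
      -½<0 = subst (_<ℚ 0ℚ) (≡.sym (Q.neg-≡ ½)) (ℚₚ.negative⁻¹ (ℚ.- ½))
    0<p : ∀ s → ½ <ℚ s → s ≤ℚ 1ℚ → 0ʳ <ʳ p s
    0<p s ½<s s≤1 = positive-* {sin′ ½} {v s} sin′[½] (0<v s ½<s s≤1)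
    0<ρ′ : ∀ s → ½ <ℚ s → s ≤ℚ 1ℚ → 0ʳ <ʳ ρ′ s
    0<ρ′ s ½<s s≤1 = positive-+ {1ʳ} {p s +ʳ p s} (positive-fromℚ 0<1) (positive-+ {p s} {p s} (0<p s ½<s s≤1) (0<p s ½<s s≤1))
    0<ρ : ∀ s → ½ <ℚ s → s ≤ℚ 1ℚ → 0ʳ <ʳ ρ s
    0<ρ s ½<s s≤1 = positive-+ {1ʳ} {ρ′ s} (positive-fromℚ 0<1) (0<ρ′ s ½<s s≤1)

    real-1 : real 1ʳ ≈ 1#
    real-1 = trans (real-ι 1ℚ) ι-1

    modulus : ∀ s → (E s - 1#) * (E (Q.- s) - 1#) ≈ real (ρ s)
    modulus s = begin
      (E s - 1#) * (E (Q.- s) - 1#)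
        ≈⟨ solve 2 (λ a b → (a :- con (+ 1)) :* (b :- con (+ 1)) := a :* b :+ con (+ 1) :- (a :+ b)) refl (E s) (E (Q.- s)) ⟩
      E s * E (Q.- s) + 1# - (E s + E (Q.- s))
        ≈⟨ +-cong (+-congʳ (E-inverse s)) (-‿cong (+-cong E[s] E[-s])) ⟩
      1# + 1# - ((X + 𝕛 * Y) * (c + 𝕛 * V) + (X - 𝕛 * Y) * (c - 𝕛 * V))
        ≈⟨ solve 5 (λ i x y c v → con (+ 1) :+ con (+ 1) :- ((x :+ i :* y) :* (c :+ i :* v) :+ (x :- i :* y) :* (c :- i :* v))
             := con (+ 1) :+ (con (+ 1) :- (i :* i :* (y :* v) :+ i :* i :* (y :* v))) :- x :* (c :+ c)) refl 𝕛 X Y c V ⟩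
      1# + (1# - (𝕛 * 𝕛 * (Y * V) + 𝕛 * 𝕛 * (Y * V))) - X * (c + c)
        ≈⟨ +-cong (+-congˡ (+-congˡ (-‿cong (+-cong (*-congʳ 𝕛²≈-1) (*-congʳ 𝕛²≈-1))))) (-‿cong (*-congʳ X≈0)) ⟩
      1# + (1# - (- 1# * (Y * V) + - 1# * (Y * V))) - 0# * (c + c)
        ≈⟨ solve 2 (λ p c → con (+ 1) :+ (con (+ 1) :- ((:- con (+ 1)) :* p :+ (:- con (+ 1)) :* p)) :- con (+ 0) :* c := con (+ 1) :+ (con (+ 1) :+ (p :+ p))) refl (Y * V) (c + c) ⟩
      1# + (1# + (Y * V + Y * V))
        ≈⟨ trans (real-+ 1ʳ (ρ′ s)) (+-cong real-1 (trans (real-+ 1ʳ (p s +ʳ p s)) (+-cong real-1 (trans (real-+ (p s) (p s)) (+-cong (real-* (sin′ ½) (v s)) (real-* (sin′ ½) (v s))))))) ⟨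
      real (ρ s) ∎
      where
      c = real (cos (s Q.- ½))
      V = real (v s)
      E[s] : E s ≈ (X + 𝕛 * Y) * (c + 𝕛 * V)
      E[s] = trans (E-≡ (ℚS.solve 2 (λ s h → s ℚS.:= h ℚS.:+ (s ℚS.:- h)) ≡.refl s ½)) (trans (E-+ _ _) (*-cong (E-cartesian ½) (E-cartesian _)))
      E[-s] : E (Q.- s) ≈ (X - 𝕛 * Y) * (c - 𝕛 * V)
      E[-s] = trans (E-≡ (ℚS.solve 2 (λ s h → ℚS.:- s ℚS.:= ℚS.:- h ℚS.:+ ℚS.:- (s ℚS.:- h)) ≡.refl s ½)) (trans (E-+ _ _) (*-cong (E-cartesian⁻ ½) (E-cartesian⁻ _)))

    near : ∀ s → ½ <ℚ s → s ≤ℚ 1ℚ → E (Q.- s) - 1# ≲ proj₁ ϖ-bound′ +ℚ proj₁ approx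
    near s ½<s s≤1 = ≲-resp (solve 2 (λ e z → z :+ (e :- con (+ 1) :- z) := e :- con (+ 1)) refl (E (Q.- s)) (ι (Q.- s) * ϖ))
      (≲-mono (Q.≤-trans (Q.+-mono-≤ (*-monoʳ (proj₁ (proj₂ ϖ-bound′)) ∣-s∣≤1) (*-monoˡ (proj₁ (proj₂ approx)) (Q.≤-trans (*-monoˡ (Q.0≤∣p∣ _) ∣-s∣≤1) (*-monoʳ 0≤1 ∣-s∣≤1))))
          (Q.≤-reflexive (ℚS.solve 2 (λ a b → ℚS.con (+ 1) ℚS.:* a ℚS.:+ b ℚS.:* (ℚS.con (+ 1) ℚS.:* ℚS.con (+ 1)) ℚS.:= a ℚS.:+ b) ≡.refl (proj₁ ϖ-bound′) (proj₁ approx))))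
        (≲-+ (≲-* (Q.0≤∣p∣ _) (proj₁ (proj₂ ϖ-bound′)) (ι-≲ (Q.- s)) (proj₂ (proj₂ ϖ-bound′)))
          (proj₂ (proj₂ approx) (Q.- s) (E (Q.- s)) ∣-s∣≤1 (E-⟶ (Q.- s)))))
      where
      ∣-s∣≤1 : Q.∣ Q.- s ∣ ≤ℚ 1ℚ
      ∣-s∣≤1 = subst (_≤ℚ 1ℚ) (≡.sym (≡.trans (Q.∣-p∣≡∣p∣ s) (Q.0≤p⇒∣p∣≡p (Q.<⇒≤ (Q.≤-<-trans (Q.<⇒≤ (ℚₚ.positive⁻¹ ½)) ½<s))))) s≤1

  rotations : Rotations algebra
  rotations = record
    { E = E
    ; ϖ = ϖ
    ; ϖ⁻¹ = - 𝕛 * real (recip π 0<π)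
    ; ϖ⁻¹-ϖ = trans (solve 3 (λ i p r → :- i :* r :* (i :* p) := :- (i :* i) :* (p :* r)) refl 𝕛 (real π) _)
        (trans (*-cong (-‿cong 𝕛²≈-1) (recip-inverse π 0<π)) (solve 0 (:- (:- con (+ 1)) :* con (+ 1) := con (+ 1)) refl))
    ; E-+ = E-+
    ; E-0 = E-0
    ; E-2 = E-2
    ; E-⟶ = E-⟶
    ; E-left = E-left
    }

-- Odd characters and elementary symmetric sums.

record OddCharacter (C : Complexes) (q : ℕ) : Set where
  open Complexes C
  field
    χ         : ℤ → Carrier
    periodic  : ∀ a b → + q ℤ.∣ a ℤ.- b → χ a ≈ χ b
    homo-*    : ∀ a b → χ (a ℤ.* b) ≈ χ a * χ b
    χ≈0       : ∀ a → ¬ ℤ.Coprime a (+ q) → χ a ≈ 0#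
    odd       : χ (ℤ.- + 1) ≈ - 1#

module ElementarySymmetric (V : NormedAlgebra) where
  open Limits V
  open SetoidReasoning setoid

  sumᴸ prodᴸ : List Carrier → Carrier
  sumᴸ  = foldr _+_ 0#
  prodᴸ = foldr _*_ 1#

  elementary : (ℕ → Carrier) → ℕ → List ℕ → Carrier
  elementary f n xs = sumᴸ (map (λ is → prodᴸ (map f (Vec.toList is))) (sublists n xs))

  sumᴸ-map : ∀ {A : Set} (f : A → Carrier) xs → sumᴸ (map f xs) ≈ ∑ᴸ f xs
  sumᴸ-map f []       = refl
  sumᴸ-map f (x ∷ xs) = +-congˡ (sumᴸ-map f xs)

  -- Subsequences that contain the head correspond to the term f(x) z of the first factor, the
  -- others to its 1.
  elementary-≈ : ∀ f n xs → elementary f n xs ≈ ΠS.⨁ᴸ (linear ∘ f) xs n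
  elementary-≈ f zero    []       = +-identityʳ _
  elementary-≈ f zero    (x ∷ xs) = trans (+-identityʳ _) (sym (trans (*-identityˡ _) (trans (sym (elementary-≈ f 0 xs)) (+-identityʳ _))))
  elementary-≈ f (suc n) []       = refl
  elementary-≈ f (suc n) (x ∷ xs) = begin
    sumᴸ (map g (map (x ∷_) (sublists n xs) ++ sublists (suc n) xs))
      ≈⟨ split (sublists n xs) ⟩
    f x * elementary f n xs + elementary f (suc n) xs
      ≈⟨ trans (+-comm _ _) (+-cong (elementary-≈ f (suc n) xs) (*-congˡ (elementary-≈ f n xs))) ⟩
    ΠS.⨁ᴸ (linear ∘ f) xs (suc n) + f x * ΠS.⨁ᴸ (linear ∘ f) xs n
      ≈⟨ linear-⊛ (f x) _ n ⟨
    (linear (f x) ⊛ ΠS.⨁ᴸ (linear ∘ f) xs) (suc n) ∎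
    where
    g : ∀ {n} → Vec ℕ n → Carrier
    g is = prodᴸ (map f (Vec.toList is))
    split : ∀ ys → sumᴸ (map g (map (x ∷_) ys ++ sublists (suc n) xs)) ≈ f x * sumᴸ (map g ys) + elementary f (suc n) xs
    split []       = sym (trans (+-congʳ (zeroʳ _)) (+-identityˡ _))
    split (y ∷ ys) = trans (+-congˡ (split ys)) (solve 4 (λ a b c d → a :* b :+ (a :* c :+ d) := a :* (b :+ c) :+ d) refl _ _ _ _)

-- The L-sums as limits of products over residue classes.

module LSums (C : Complexes) (sineZero : SineZero C) (n-1 : ℕ) (2≤n : 2 ℕ.≤ n-1)
  (X : OddCharacter C (suc n-1)) where
  open Trigonometry C sineZero using (rotations)
  open CyclotomicValue rotations using (1/-unique)
  open Assembly rotations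
  open ElementarySymmetric (Complexes.algebra C)
  open Limits (Complexes.algebra C)
  open OddCharacter X
  open SetoidReasoning setoid
  open Σ using (⨁-cong; ⨁-≡; ⨁-split; ⨁-blocks; ⨁-head; ⨁-∙; when; when-yes; when-no; ⨁ᴸ-filter-range; ⨁ᴸ-cong; ⨁ᴸ-∙)
  open CoprimeFolds +-commutativeMonoid using (coprime-half)

  private
    q : ℕ
    q = suc n-1

    u : ℚ
    u = 1/[1+ n-1 ]

  summand : ℕ → Carrier
  summand i = χ (+ suc i) * ι 1/[1+ i ]

  x : ℕ → ℚ
  x j = ν j *ℚ u

  a : ℕ → Carrier
  a j = χ (+ j) * ι u

  χ-shift : ∀ t r → χ (+ (t ℕ.* q ℕ.+ r)) ≈ χ (+ r)
  χ-shift t r = periodic _ _ (subst (λ d → q ℕ.∣ ℤ.∣ d ∣) (≡.sym difference) (ℕ.n∣m*n t))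
    where
    difference : + (t ℕ.* q ℕ.+ r) ℤ.- + r ≡ + (t ℕ.* q)
    difference = ≡.trans (ℤₚ.+-assoc (+ (t ℕ.* q)) (+ r) (ℤ.- + r)) (≡.trans (≡.cong (λ d → + (t ℕ.* q) ℤ.+ d) (ℤₚ.+-inverseʳ (+ r))) (ℤₚ.+-identityʳ _))

  -- Oddness turns the class of -j into the continuation of the class of j to negative integers:
  -- with x = j / q, χ(m q - j) / (m q - j) becomes (χ(j) / q) / (x - m).
  χ-reflect : ∀ t j → j ℕ.≤ q → χ (+ (t ℕ.* q ℕ.+ (q ℕ.∸ j))) ≈ - χ (+ j)
  χ-reflect t j j≤q = begin
    χ (+ (t ℕ.* q ℕ.+ (q ℕ.∸ j)))    ≈⟨ χ-shift t (q ℕ.∸ j) ⟩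
    χ (+ (q ℕ.∸ j))                  ≈⟨ periodic _ _ (subst (λ d → q ℕ.∣ ℤ.∣ d ∣) (≡.sym difference) ℕ.∣-refl) ⟩
    χ (ℤ.- + 1 ℤ.* + j)              ≈⟨ homo-* (ℤ.- + 1) (+ j) ⟩
    χ (ℤ.- + 1) * χ (+ j)            ≈⟨ *-congʳ odd ⟩
    - 1# * χ (+ j)                   ≈⟨ solve 1 (λ c → (:- con (+ 1)) :* c := :- c) refl _ ⟩
    - χ (+ j)                        ∎
    where
    difference : + (q ℕ.∸ j) ℤ.- (ℤ.- + 1 ℤ.* + j) ≡ + q
    difference = ≡.trans (≡.cong (λ d → + (q ℕ.∸ j) ℤ.- d) (ℤₚ.-1*i≡-i (+ j)))
      (≡.trans (≡.cong (λ d → + (q ℕ.∸ j) ℤ.+ d) (ℤₚ.neg-involutive (+ j))) (≡.cong +_ (ℕₚ.m∸n+n≡m j≤q)))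

  χ-vanishes : ∀ r → ¬ Coprime r q → χ (+ r) ≈ 0#
  χ-vanishes r ¬c = χ≈0 (+ r) ¬c

  -- Periodicity leaves finitely many residues, and their bounds are added up.
  χ-bounded : ∃ λ B → 0ℚ ≤ℚ B × (∀ r → χ (+ r) ≲ B)
  χ-bounded = let (B , 0≤B , χ≲) = residues q in B , 0≤B , λ r → ≲-resp
    (trans (sym (χ-shift (r ℕ./ q) (r ℕ.% q))) (reflexive (≡.cong (λ k → χ (+ k)) (≡.trans (ℕₚ.+-comm (r ℕ./ q ℕ.* q) _) (≡.sym (ℕ.m≡m%n+[m/n]*n r q))))))
    (χ≲ (r ℕ.% q) (ℕ.m%n<n r q))
    where
    residues : ∀ m → ∃ λ B → 0ℚ ≤ℚ B × (∀ r → r ℕ.< m → χ (+ r) ≲ B)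
    residues zero    = 0ℚ , Q.≤-refl , λ _ ()
    residues (suc m) = let (A , 0≤A , χ≲) = residues m ; (B , 0≤B , χm≲) = bound (χ (+ m)) in A +ℚ B , 0≤+ 0≤A 0≤B , λ r r<1+m →
      extend A 0≤A χ≲ B 0≤B χm≲ r (r ℕₚ.≟ m) r<1+m
      where
      extend : ∀ A → 0ℚ ≤ℚ A → (∀ r → r ℕ.< m → χ (+ r) ≲ A) → ∀ B → 0ℚ ≤ℚ B → χ (+ m) ≲ B → ∀ r → Dec (r ≡ m) → r ℕ.< suc m → χ (+ r) ≲ A +ℚ B
      extend A 0≤A χ≲ B 0≤B χm≲ r (yes ≡.refl) _   = ≲-mono (Q.≤-trans (≤-steps 0≤A Q.≤-refl) (Q.≤-reflexive (Q.+-comm B A))) χm≲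
      extend A 0≤A χ≲ B 0≤B χm≲ r (no r≢m)     r<m = ≲-mono (≤-steps 0≤B Q.≤-refl) (χ≲ r (ℕₚ.≤∧≢⇒< (ℕₚ.≤-pred r<m) r≢m))

  F : ℕ → Series
  F N = ΠS.⨁ᴸ (linear ∘ summand) (upTo N)

  F-elementary : ∀ n N → elementary summand n (upTo N) ≈ F N n
  F-elementary n N = elementary-≈ summand n (upTo N)

  p : ℕ → Series
  p N = ΣS.⨁ᴸ (geometric ∘ summand) (upTo N)

  F-head : ∀ N → F N 0 ≈ 1#
  F-head N = go (upTo N)
    where
    go : ∀ xs → ΠS.⨁ᴸ (linear ∘ summand) xs 0 ≈ 1#
    go []       = refl
    go (x ∷ xs) = trans (*-identityˡ _) (go xs)

  InRange : ℕ → Set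
  InRange j = 1 ℕ.≤ j × j ℕ.+ j ℕ.< q

  -- The bounds travel with j, so that 0 < j / q < 1/2 holds for every element of the type, as
  -- `Assembly` demands; `indices` is `Φ q` with these proofs attached.
  Index : Set
  Index = ∃ InRange

  inRange : All InRange (Φ q)
  inRange = All.filter⁺ (λ j → coprime? j q) (All.map⁺ (All.applyUpTo⁺₁ id (n-1 ℕ./ 2) λ {i} i<h → ℕ.s≤s ℕ.z≤n ,
    ℕ.s≤s (ℕₚ.≤-trans (ℕₚ.≤-trans (ℕₚ.+-mono-≤ i<h i<h) (ℕₚ.≤-reflexive (double (n-1 ℕ./ 2)))) (ℕ.m/n*n≤m n-1 2))))
    where
    double : ∀ h → h ℕ.+ h ≡ h ℕ.* 2
    double h = ≡.trans (≡.cong (h ℕ.+_) (≡.sym (ℕₚ.+-identityʳ h))) (ℕₚ.*-comm 2 h)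

  indices : List Index
  indices = All.toList inRange

  indices-Φ : map proj₁ indices ≡ Φ q
  indices-Φ = go inRange
    where
    go : ∀ {xs} (pxs : All InRange xs) → map proj₁ (All.toList pxs) ≡ xs
    go []         = ≡.refl
    go (px ∷ pxs) = ≡.cong (_ ∷_) (go pxs)

  0<u : 0ℚ <ℚ u
  0<u = 0<1/ n-1

  q*u : ν q *ℚ u ≡ 1ℚ
  q*u = ≡.trans (Q.*-comm _ _) (1/[1+n]*ν n-1)

  X₀ : Index → ℚ
  X₀ (j , _) = x j

  A₀ : Index → Carrier
  A₀ (j , _) = a j

  0<X : ∀ j → 0ℚ <ℚ X₀ j
  0<X (suc j , _) = 0<* 0<ν[1+ j ] 0<u

  X<½ : ∀ j → X₀ j <ℚ ½
  X<½ (j , _ , 2j<q) = Q.*-cancelʳ-< 0<2 (subst₂ _<ℚ_ (≡.sym double) (≡.trans q*u (≡.sym ½*2)) (Q.*-monoʳ-< 0<u (Q.<-≤-trans (ν-<-suc (j ℕ.+ j)) (ν-mono 2j<q))))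
    where
    open ≡ using (subst₂)
    double : ν j *ℚ u *ℚ 2ℚ ≡ ν (j ℕ.+ j) *ℚ u
    double = ≡.trans (ℚS.solve 2 (λ j u → j ℚS.:* u ℚS.:* ℚS.con (+ 2) ℚS.:= (j ℚS.:+ j) ℚS.:* u) ≡.refl (ν j) u) (≡.cong (_*ℚ u) (≡.sym (ν-+ j j)))

  module Sums (m : ℕ) where

    G : ℕ → Carrier
    G i = geometric (summand i) m

    G-Null : Null G
    G-Null = Null-cong (λ i → *-comm _ _) (Null-* (Bounded-^ (Null⇒Bounded (Null-neg summand-Null)) m) summand-Null)
      where
      summand-Null : Null summand
      summand-Null = Null-* χ-Bounded Null-inverse
        where
        χ-Bounded : Bounded (λ i → χ (+ suc i))
        χ-Bounded = proj₁ χ-bounded , proj₁ (proj₂ χ-bounded) , 0 , λ i _ → proj₂ (proj₂ χ-bounded) (suc i)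

    -- The terms j + b q and (b + 1) q - j.
    up down : ℕ → ℕ → Carrier
    up   j b = G (b ℕ.* q ℕ.+ ℕ.pred j)
    down j b = G (b ℕ.* q ℕ.+ ℕ.pred (q ℕ.∸ j))

    -- Terms at numbers not coprime to q vanish with χ, and the reflection j ↦ q - j pairs the
    -- others.
    block : ∀ b → ∑ q (λ i → G (b ℕ.* q ℕ.+ i)) ≈ ∑ᴸ (λ j → up j b + down j b) (Φ q)
    block b = begin
      ∑ q (λ i → G (b ℕ.* q ℕ.+ i))
        ≈⟨ ⨁-cong q (λ i _ → only-coprime i (coprime? (suc i) q)) ⟩
      ∑ q (λ i → when (coprime? (suc i) q) (g (suc i)))
        ≈⟨ ⨁ᴸ-filter-range (λ j → coprime? j q) g q ⟨
      ∑ᴸ g (filter (λ j → coprime? j q) (map suc (upTo q)))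
        ≈⟨ coprime-half n-1 2≤n g ⟩
      ∑ᴸ (λ j → up j b + down j b) (Φ q) ∎
      where
      g : ℕ → Carrier
      g j = G (b ℕ.* q ℕ.+ ℕ.pred j)
      only-coprime : ∀ i (d : Dec (Coprime (suc i) q)) → G (b ℕ.* q ℕ.+ i) ≈ when d (g (suc i))
      only-coprime i (yes _) = refl
      only-coprime i (no ¬c) = trans (*-congʳ (trans (*-congʳ (trans (reflexive (≡.cong (λ k → χ (+ k)) (≡.sym (ℕₚ.+-suc (b ℕ.* q) i)))) (trans (χ-shift b (suc i)) (χ-vanishes (suc i) ¬c)))) (zeroˡ _))) (zeroˡ _)

    module Term (j : Index) where
      module K = At X₀ 0<X X<½ A₀ j

      private
        j₀ = proj₁ j
        1≤j = proj₁ (proj₂ j)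
        j<q : j₀ ℕ.< q
        j<q = ℕₚ.≤-<-trans (ℕₚ.m≤m+n j₀ j₀) (proj₂ (proj₂ j))

        reciprocal : ∀ k y → 0ℚ <ℚ y → y ≡ ν (suc k) *ℚ u → u *ℚ inv y ≡ 1/[1+ k ]
        reciprocal k y 0<y y≡ = 1/-unique k _ (≡.trans (ℚS.solve 3 (λ u i n → u ℚS.:* i ℚS.:* n ℚS.:= n ℚS.:* u ℚS.:* i) ≡.refl u (inv y) (ν (suc k)))
          (≡.trans (≡.cong (_*ℚ inv y) (≡.sym y≡)) (*-inv y 0<y)))

        index⁺ : ∀ b → suc (b ℕ.* q ℕ.+ ℕ.pred j₀) ≡ b ℕ.* q ℕ.+ j₀
        index⁺ b = ≡.trans (≡.sym (ℕₚ.+-suc (b ℕ.* q) (ℕ.pred j₀))) (≡.cong (b ℕ.* q ℕ.+_) (ℕₚ.suc-pred j₀ {{ℕ.>-nonZero 1≤j}}))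

        index⁻ : ∀ b → suc (b ℕ.* q ℕ.+ ℕ.pred (q ℕ.∸ j₀)) ≡ b ℕ.* q ℕ.+ (q ℕ.∸ j₀)
        index⁻ b = ≡.trans (≡.sym (ℕₚ.+-suc (b ℕ.* q) (ℕ.pred (q ℕ.∸ j₀)))) (≡.cong (b ℕ.* q ℕ.+_) (ℕₚ.suc-pred (q ℕ.∸ j₀) {{ℕ.>-nonZero (ℕₚ.m<n⇒0<n∸m j<q)}}))

        position⁺ : ∀ b → ν (b ℕ.* q ℕ.+ j₀) *ℚ u ≡ x j₀ +ℚ ν b
        position⁺ b = ≡.trans (≡.cong (_*ℚ u) (≡.trans (ν-+ (b ℕ.* q) j₀) (≡.cong (_+ℚ ν j₀) (ν-* b q))))
          (≡.trans (ℚS.solve 4 (λ b q j u → (b ℚS.:* q ℚS.:+ j) ℚS.:* u ℚS.:= j ℚS.:* u ℚS.:+ b ℚS.:* (q ℚS.:* u)) ≡.refl (ν b) (ν q) (ν j₀) u)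
            (≡.cong (x j₀ +ℚ_) (≡.trans (≡.cong (ν b *ℚ_) q*u) (Q.*-identityʳ (ν b)))))

        position⁻ : ∀ b → ν (b ℕ.* q ℕ.+ (q ℕ.∸ j₀)) *ℚ u ≡ ν (suc b) Q.- x j₀
        position⁻ b = ≡.trans (ℚS.solve 3 (λ a j u → a ℚS.:* u ℚS.:= (a ℚS.:+ j) ℚS.:* u ℚS.:- j ℚS.:* u) ≡.refl (ν (b ℕ.* q ℕ.+ (q ℕ.∸ j₀))) (ν j₀) u)
          (≡.cong (Q._- x j₀) (≡.trans (≡.cong (_*ℚ u) (≡.trans (≡.sym (ν-+ (b ℕ.* q ℕ.+ (q ℕ.∸ j₀)) j₀)) (≡.trans (≡.cong ν total) (ν-* (suc b) q))))
            (≡.trans (Q.*-assoc _ _ _) (≡.trans (≡.cong (ν (suc b) *ℚ_) q*u) (Q.*-identityʳ _)))))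
          where
          total : b ℕ.* q ℕ.+ (q ℕ.∸ j₀) ℕ.+ j₀ ≡ suc b ℕ.* q
          total = ≡.trans (ℕₚ.+-assoc (b ℕ.* q) _ j₀) (≡.trans (≡.cong (b ℕ.* q ℕ.+_) (ℕₚ.m∸n+n≡m (ℕₚ.<⇒≤ j<q))) (ℕₚ.+-comm (b ℕ.* q) q))

        term⁺ : ∀ b y → 0ℚ <ℚ y → y ≡ x j₀ +ℚ ν b → a j₀ * ι (inv y) ≈ summand (b ℕ.* q ℕ.+ ℕ.pred j₀)
        term⁺ b y 0<y y≡ = trans (*-assoc _ _ _) (*-cong
          (trans (sym (χ-shift b j₀)) (reflexive (≡.cong (λ k → χ (+ k)) (≡.sym (index⁺ b)))))
          (trans (sym (ι-* u (inv y))) (reflexive (≡.cong ι (reciprocal _ y 0<y (≡.trans y≡ (≡.trans (≡.sym (position⁺ b)) (≡.cong (λ k → ν k *ℚ u) (≡.sym (index⁺ b))))))))))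

      geometric-cong : ∀ {y z} n → y ≈ z → geometric y n ≈ geometric z n
      geometric-cong n y≈z = *-cong y≈z (^-congˡ n (-‿cong y≈z))

      up-zeroth : geometric (a j₀ * K.d⁰) m ≈ up j₀ 0
      up-zeroth = geometric-cong m (term⁺ 0 (x j₀) (0<X j) (≡.sym (≡.trans (≡.cong (x j₀ +ℚ_) ν-0) (Q.+-identityʳ _))))

      up-suc : ∀ k → geometric (a j₀ * K.d⁺ k) m ≈ up j₀ (suc k)
      up-suc k = geometric-cong m (term⁺ (suc k) (K.above k) (K.0<above k) ≡.refl)

      down-≈ : ∀ k → geometric (a j₀ * K.d⁻ k) m ≈ down j₀ k
      down-≈ k = geometric-cong m (begin
        a j₀ * - ι (inv (K.below k))
          ≈⟨ solve 3 (λ c u i → c :* u :* (:- i) := :- c :* (u :* i)) refl (χ (+ j₀)) (ι u) _ ⟩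
        - χ (+ j₀) * (ι u * ι (inv (K.below k)))
          ≈⟨ *-cong (trans (sym (χ-reflect k j₀ (ℕₚ.<⇒≤ j<q))) (reflexive (≡.cong (λ t → χ (+ t)) (≡.sym (index⁻ k)))))
               (trans (sym (ι-* u _)) (reflexive (≡.cong ι (reciprocal _ (K.below k) (K.0<below k) (≡.trans (≡.sym (position⁻ k)) (≡.cong (λ t → ν t *ℚ u) (≡.sym (index⁻ k)))))))) ⟩
        summand (k ℕ.* q ℕ.+ ℕ.pred (q ℕ.∸ j₀)) ∎)

      -- The range |m| ≤ M has one more nonnegative than negative member, so the term m = M is left
      -- without a partner.
      limitSum-≈ : ∀ M → K.limitSum (a j₀) M m ≈ ∑ M (λ b → up j₀ b + down j₀ b) + up j₀ M
      limitSum-≈ M = begin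
        geometric (a j₀ * K.d⁰) m + ∑ M (λ k → geometric (a j₀ * K.d⁺ k) m + geometric (a j₀ * K.d⁻ k) m)
          ≈⟨ +-cong up-zeroth (trans (⨁-cong M (λ k _ → +-cong (up-suc k) (down-≈ k))) (⨁-∙ M _ _)) ⟩
        up j₀ 0 + (∑ M (up j₀ ∘ suc) + ∑ M (down j₀))
          ≈⟨ sym (+-assoc _ _ _) ⟩
        up j₀ 0 + ∑ M (up j₀ ∘ suc) + ∑ M (down j₀)
          ≈⟨ +-congʳ (⨁-head M (up j₀)) ⟨
        ∑ M (up j₀) + up j₀ M + ∑ M (down j₀)
          ≈⟨ solve 3 (λ a b c → a :+ b :+ c := a :+ c :+ b) refl _ _ _ ⟩
        ∑ M (up j₀) + ∑ M (down j₀) + up j₀ M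
          ≈⟨ +-congʳ (⨁-∙ M _ _) ⟨
        ∑ M (λ b → up j₀ b + down j₀ b) + up j₀ M ∎

    quotient→∞ : ∀ K → ∃ λ N → ∀ n → N ℕ.≤ n → K ℕ.≤ n ℕ./ q
    quotient→∞ K = K ℕ.* q , λ n Kq≤n → subst (ℕ._≤ n ℕ./ q) (ℕ.m*n/n≡m K q) (ℕ./-monoˡ-≤ q Kq≤n)

    shifted→∞ : ∀ r K → ∃ λ N → ∀ n → N ℕ.≤ n → K ℕ.≤ n ℕ./ q ℕ.* q ℕ.+ r
    shifted→∞ r K = let (N , large) = quotient→∞ K in N , λ n N≤n →
      ℕₚ.≤-trans (large n N≤n) (ℕₚ.≤-trans (ℕₚ.m≤m*n (n ℕ./ q) q) (ℕₚ.m≤m+n _ r))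

    -- The number of terms varies with N; padding by zeros up to q terms makes this a fixed number
    -- of null sequences.
    remainder-Null : Null (λ N → ∑ (N ℕ.% q) (λ i → G (N ℕ./ q ℕ.* q ℕ.+ i)))
    remainder-Null = Null-cong (λ N → truncate (N ℕ.% q) q (λ i → G (N ℕ./ q ℕ.* q ℕ.+ i)) (ℕₚ.<⇒≤ (ℕ.m%n<n N q)))
      (Null-∑ q (λ i → Null-when (λ N → i ℕₚ.<? N ℕ.% q) (Null-compose (λ N → N ℕ./ q ℕ.* q ℕ.+ i) (shifted→∞ i) G-Null)))
      where
      Null-∑ : ∀ k {f : ℕ → ℕ → Carrier} → (∀ i → Null (f i)) → Null (λ N → ∑ k (λ i → f i N))
      Null-∑ zero    f→0 = Null-0
      Null-∑ (suc k) f→0 = Null-+ (Null-∑ k f→0) (f→0 k)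
      Null-when : ∀ {P : ℕ → Set} (d : ∀ N → Dec (P N)) {s} → Null s → Null (λ N → when (d N) (s N))
      Null-when d {s} s→0 ε 0<ε = let (N , s≲) = s→0 ε 0<ε in N , λ n N≤n → by-cases (d n) (s≲ n N≤n)
        where
        by-cases : ∀ {P : Set} (d : Dec P) {z} → z ≲ ε → when d z ≲ ε
        by-cases (yes _) z≲ = z≲
        by-cases (no _)  _  = 0≲ (Q.<⇒≤ 0<ε)
      truncate : ∀ r k f → r ℕ.≤ k → ∑ k (λ i → when (i ℕₚ.<? r) (f i)) ≈ ∑ r f
      truncate r k f r≤k = begin
        ∑ k h                                             ≈⟨ ⨁-≡ h (≡.sym (ℕₚ.m+[n∸m]≡n r≤k)) ⟩
        ∑ (r ℕ.+ (k ℕ.∸ r)) h                             ≈⟨ ⨁-split r (k ℕ.∸ r) h ⟩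
        ∑ r h + ∑ (k ℕ.∸ r) (λ i → h (r ℕ.+ i))           ≈⟨ +-cong (⨁-cong r (λ i i<r → when-yes (i ℕₚ.<? r) i<r))
                                                              (trans (⨁-cong (k ℕ.∸ r) (λ i _ → when-no (r ℕ.+ i ℕₚ.<? r) (ℕₚ.≤⇒≯ (ℕₚ.m≤m+n r i)))) (Σ.⨁-ε (k ℕ.∸ r))) ⟩
        ∑ r f + 0#                                        ≈⟨ +-identityʳ _ ⟩
        ∑ r f                                             ∎
        where
        h : ℕ → Carrier
        h i = when (i ℕₚ.<? r) (f i)

    p-≈ : ∀ N → p N m ≈ ∑ N G
    p-≈ N = trans (∑ᴸS (geometric ∘ summand) (upTo N) m) (Σ.⨁ᴸ-applyUpTo G id N)

    -- Both sums run over the same numbers coprime to q, up to boundary terms.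
    p-limitSum : Null (λ N → p N m - ∑ᴸ (λ j → At.limitSum X₀ 0<X X<½ A₀ j (A₀ j) (N ℕ./ q) m) indices)
    p-limitSum = Null-cong (λ N → sym (compare N)) (Null-+ remainder-Null
      (Null-neg (Null-∑ᴸ (λ (j , _) → Null-compose (λ N → N ℕ./ q ℕ.* q ℕ.+ ℕ.pred j) (shifted→∞ (ℕ.pred j)) G-Null) indices)))
      where
      compare : ∀ N → p N m - ∑ᴸ (λ j → At.limitSum X₀ 0<X X<½ A₀ j (A₀ j) (N ℕ./ q) m) indices ≈
                ∑ (N ℕ.% q) (λ i → G (N ℕ./ q ℕ.* q ℕ.+ i)) + - ∑ᴸ (λ (j , _) → up j (N ℕ./ q)) indices
      compare N = begin
        p N m - ∑ᴸ (λ j → At.limitSum X₀ 0<X X<½ A₀ j (A₀ j) M m) indices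
          ≈⟨ +-cong (trans (p-≈ N) (trans (⨁-≡ G (≡.trans (ℕ.m≡m%n+[m/n]*n N q) (ℕₚ.+-comm r (M ℕ.* q)))) (⨁-split (M ℕ.* q) r G)))
               (-‿cong (trans (⨁ᴸ-cong (λ j → Term.limitSum-≈ j M) indices) (⨁ᴸ-∙ _ _ indices))) ⟩
        ∑ (M ℕ.* q) G + R - (∑ᴸ (λ (j , _) → ∑ M (λ b → up j b + down j b)) indices + U)
          ≈⟨ +-congʳ (+-congʳ (trans (⨁-blocks M q G) (trans (⨁-cong M (λ b _ → block b)) (trans (Σ.⨁-⨁ᴸ-swap M _ (Φ q)) convert)))) ⟩
        S + R - (S + U)
          ≈⟨ solve 3 (λ s r u → s :+ r :- (s :+ u) := r :+ :- u) refl S R U ⟩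
        R + - U ∎
        where
        M = N ℕ./ q
        r = N ℕ.% q
        R = ∑ r (λ i → G (M ℕ.* q ℕ.+ i))
        U = ∑ᴸ (λ (j , _) → up j M) indices
        S = ∑ᴸ (λ (j , _) → ∑ M (λ b → up j b + down j b)) indices
        convert : ∑ᴸ (λ j → ∑ M (λ b → up j b + down j b)) (Φ q) ≈ S
        convert = trans (reflexive (≡.cong (∑ᴸ (λ j → ∑ M (λ b → up j b + down j b))) (≡.sym indices-Φ))) (Σ.⨁ᴸ-map _ proj₁ indices)

  limitProduct : Series
  limitProduct = ΠS.⨁ᴸ (limit X₀ 0<X X<½ A₀) indices

  -- With cutoff ⌊N / q⌋ the symmetric ranges cover the complete blocks of q consecutive k ≤ N.
  elementary-⟶ : ∀ n → (λ N → elementary summand n (upTo N)) ⟶ limitProduct n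
  elementary-⟶ n = ⟶-cong (λ N → sym (F-elementary n N)) refl
    (product-⟶ X₀ 0<X X<½ A₀ indices (λ N → N ℕ./ q) (Sums.quotient→∞ 0) F p F-head
      (λ N → LogDerivative-∏ᴸ (linear ∘ summand) (geometric ∘ summand) (linear-geometric ∘ summand) (upTo N))
      Sums.p-limitSum n)

-- Fractions with denominator q.

module CommonDenominator (n-1 : ℕ) where
  private
    _/q : ℤ → ℚ
    i /q = i / suc n-1

  opaque
    unfolding Q._+_ Q._*_ Q.-_ ν 1/[1+_]

    /q-+ : ∀ i j → (i ℤ.+ j) /q ≡ i /q Q.+ j /q
    /q-+ i j = ≡.trans (ℚₚ.fromℚᵘ-cong {ℚᵘ.mkℚᵘ (i ℤ.+ j) n-1} {ℚᵘ.mkℚᵘ i n-1 ℚᵘ.+ ℚᵘ.mkℚᵘ j n-1}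
        (ℚᵘ.*≡* (≡.trans (≡.cong ((i ℤ.+ j) ℤ.*_) (ℤₚ.pos-* (suc n-1) (suc n-1)))
          (solve 3 (λ i j d → (i :+ j) :* (d :* d) := (i :* d :+ j :* d) :* d) ≡.refl i j (+ suc n-1)))))
      (fromℚᵘ-homo-+ (ℚᵘ.mkℚᵘ i n-1) (ℚᵘ.mkℚᵘ j n-1))
      where open ℤ-Solver using (solve; _:=_; _:+_; _:*_)

    /q-0 : (+ 0) /q ≡ 0ℚ
    /q-0 = ℚₚ.fromℚᵘ-cong {ℚᵘ.mkℚᵘ (+ 0) n-1} {ℚᵘ.mkℚᵘ (+ 0) 0} (ℚᵘ.*≡* ≡.refl)

    /q-ν : ∀ j → (+ j) /q ≡ ν j Q.* 1/[1+ n-1 ]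
    /q-ν j = ≡.trans (ℚₚ.fromℚᵘ-cong {ℚᵘ.mkℚᵘ (+ j) n-1} {ℚᵘ.mkℚᵘ (+ j) 0 ℚᵘ.* ℚᵘ.mkℚᵘ (+ 1) n-1}
        (ℚᵘ.*≡* (≡.cong₂ ℤ._*_ (≡.sym (ℤₚ.*-identityʳ (+ j))) (≡.cong +_ (ℕₚ.*-identityˡ (suc n-1))))))
      (fromℚᵘ-homo-* (ℚᵘ.mkℚᵘ (+ j) 0) (ℚᵘ.mkℚᵘ (+ 1) n-1))

  /q-neg : ∀ i → (ℤ.- i) /q ≡ Q.- (i /q)
  /q-neg i = ≡.trans (ℚS.solve 2 (λ a b → a ℚS.:= (a ℚS.:+ b) ℚS.:- b) ≡.refl ((ℤ.- i) /q) (i /q))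
    (≡.trans (≡.cong (Q._- (i /q)) (≡.trans (≡.sym (/q-+ (ℤ.- i) i)) (≡.trans (≡.cong _/q (ℤₚ.+-inverseˡ i)) /q-0))) (Q.+-identityˡ _))

-- The closed form of the limit.

module Formula (C : Complexes) (sineZero : SineZero C) (n-1 : ℕ) (2≤n : 2 ℕ.≤ n-1)
  (X : OddCharacter C (suc n-1)) where
  open Complexes C
  open Trigonometry C sineZero using (rotations; ϖ; E; sin′; E-cartesian; E-cartesian⁻; 0<sin′)
  open SineZero sineZero using (π)
  open ComplexExponential C using (pow-≈; expSeries-closed)
  open CyclotomicValue rotations using (sine; sine-product; cyclotomic; cyclotomic-primePower; cyclotomic-composite)
  open Assembly rotations
  open ElementarySymmetric algebra
  open LSums C sineZero n-1 2≤n X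
  open OddCharacter X
  open RealPositivity
  open CommonDenominator n-1
  open SetoidReasoning setoid

  private
    q : ℕ
    q = suc n-1

    -- 2 sin (π j / q)
    weight : Index → ℝ
    weight j = sin′ (X₀ j) +ʳ sin′ (X₀ j)

    weights : List Index → ℝ
    weights []       = 1ʳ
    weights (j ∷ js) = weight j *ʳ weights js

    0<weights : ∀ js → 0ʳ <ʳ weights js
    0<weights []       = positive-fromℚ 0<1
    0<weights (j ∷ js) = positive-* {weight j} {weights js} (positive-+ {sin′ (X₀ j)} {sin′ (X₀ j)} 0<s 0<s) (0<weights js)
      where
      0<s : 0ʳ <ʳ sin′ (X₀ j)
      0<s = 0<sin′ (0<X j) (Q.p<q⇒0<q-p (Q.<-≤-trans (X<½ j) ½≤1))

    W : Carrier
    W = real (weights indices)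

    real-1 : real 1ʳ ≈ 1#
    real-1 = trans (real-ι 1ℚ) ι-1

    sine-≈ : ∀ j → sine (X₀ j) ≈ 𝕛 * real (weight j)
    sine-≈ j = trans (+-cong (E-cartesian (X₀ j)) (-‿cong (E-cartesian⁻ (X₀ j))))
      (trans (solve 3 (λ c i s → (c :+ i :* s) :- (c :- i :* s) := i :* (s :+ s)) refl _ 𝕛 _) (*-congˡ (sym (real-+ _ _))))

    sines : ∀ js → ∏ᴸ (sine ∘ X₀) js ≈ 𝕛 ^ length js * real (weights js)
    sines []       = sym (trans (*-identityˡ _) real-1)
    sines (j ∷ js) = trans (*-cong (sine-≈ j) (sines js))
      (trans (solve 4 (λ i s p w → i :* s :* (p :* w) := i :* p :* (s :* w)) refl 𝕛 _ _ _) (*-congˡ (sym (real-* _ _))))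

    squares : ∀ js → ∏ᴸ (λ j → - (sine (X₀ j) * sine (X₀ j))) js ≈ real (weights js) * real (weights js)
    squares []       = sym (trans (*-cong real-1 real-1) (*-identityˡ 1#))
    squares (j ∷ js) = trans (*-cong (-‿cong (*-cong (sine-≈ j) (sine-≈ j))) (squares js))
      (trans (solve 3 (λ i s w → :- (i :* s :* (i :* s)) :* (w :* w) := (:- (i :* i)) :* (s :* w :* (s :* w))) refl 𝕛 _ _)
        (trans (*-congʳ (trans (-‿cong 𝕛²≈-1) (solve 0 (:- (:- con (+ 1)) := con (+ 1)) refl)))
          (trans (*-identityˡ _) (*-cong (sym (real-* _ _)) (sym (real-* _ _))))))

    length-indices : length indices ≡ ℓ q
    length-indices = ≡.trans (go indices) (≡.cong length indices-Φ)
      where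
      go : ∀ js → length js ≡ length (map proj₁ js)
      go []       = ≡.refl
      go (j ∷ js) = ≡.cong suc (go js)

    over-Φ : ∀ f → ∏ᴸ f (Φ q) ≈ ∏ᴸ (f ∘ proj₁) indices
    over-Φ f = trans (reflexive (≡.cong (∏ᴸ f) (≡.sym indices-Φ))) (Π.⨁ᴸ-map f proj₁ indices)

    W² : W * W ≈ cyclotomic n-1
    W² = trans (sym (squares indices)) (trans (sym (over-Φ _)) (sine-product n-1 2≤n))

  -- All that the formula uses of ε(q) besides positivity is its square, so the construction of the
  -- square root stays out of sight.
  IsEpsilon : ℝ → Set
  IsEpsilon e = (∃ λ p → ∃ λ k → Prime p × 1 ℕ.≤ k × q ≡ p ℕ.^ k × e *ʳ e ≈ʳ fromℚ (ν p)) ⊎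
                (¬ IsPrimePower q × e *ʳ e ≈ʳ 1ʳ)

  module _ (e : ℝ) (0<e : 0ʳ <ʳ e) (isEpsilon : IsEpsilon e) where
    private
      e² : real e * real e ≈ cyclotomic n-1
      e² = trans (sym (real-* e e)) (by-cases isEpsilon)
        where
        by-cases : IsEpsilon e → real (e *ʳ e) ≈ cyclotomic n-1
        by-cases (inj₁ (zero , _ , pr , _)) = contradiction (prime⇒nonZero pr) λ ()
        by-cases (inj₁ (suc p-1 , suc k , pr , 1≤k , eq , e²≈p)) = trans (real-cong e²≈p)
          (trans (real-ι _) (trans (ι-ν (suc p-1)) (sym (cyclotomic-primePower p-1 k n-1 pr eq))))
        by-cases (inj₂ (¬pp , e²≈1)) with ¬primePower-factor q (ℕₚ.m≤n⇒m≤1+n 2≤n) ¬pp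
        ... | zero , k , m , pr , _ = contradiction (prime⇒nonZero pr) λ ()
        ... | suc p-1 , k , suc m-1 , pr , eq , p∤m , 2≤m = trans (trans (real-cong e²≈1) real-1)
          (sym (cyclotomic-composite p-1 k n-1 pr m-1 eq p∤m 2≤m))

      -- W - e = (W² - e²) / (W + e), where W + e is positive and hence invertible; the squares
      -- agree by `W²` and `e²`.
      W≈e : W ≈ real e
      W≈e = begin
        W
          ≈⟨ solve 2 (λ w e → w := e :+ (w :- e) :* con (+ 1)) refl W (real e) ⟩
        real e + (W - real e) * 1#
          ≈⟨ +-congˡ (*-congˡ (trans (*-congʳ (sym (real-+ _ _))) (recip-inverse (weights indices +ʳ e) positive))) ⟨
        real e + (W - real e) * ((W + real e) * i)
          ≈⟨ solve 3 (λ w e i → e :+ (w :- e) :* ((w :+ e) :* i) := e :+ (w :* w :- e :* e) :* i) refl W (real e) i ⟩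
        real e + (W * W - real e * real e) * i
          ≈⟨ +-congˡ (*-congʳ (trans (+-cong W² (-‿cong e²)) (-‿inverseʳ _))) ⟩
        real e + 0# * i
          ≈⟨ solve 2 (λ e i → e :+ con (+ 0) :* i := e) refl (real e) i ⟩
        real e ∎
        where
        positive = positive-+ {weights indices} {e} (0<weights indices) 0<e
        i = real (recip (weights indices +ʳ e) positive)

      e⁻¹ : Carrier
      e⁻¹ = real (recip e 0<e)

      W*e⁻¹ : W * e⁻¹ ≈ 1#
      W*e⁻¹ = trans (*-congʳ W≈e) (recip-inverse e 0<e)

      𝕛̄*𝕛 : - 𝕛 * 𝕛 ≈ 1#
      𝕛̄*𝕛 = trans (solve 1 (λ i → (:- i) :* i := :- (i :* i)) refl 𝕛) (trans (-‿cong 𝕛²≈-1) (solve 0 (:- (:- con (+ 1)) := con (+ 1)) refl))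

      𝕛̄^*𝕛^ : ∀ k → (- 𝕛) ^ k * 𝕛 ^ k ≈ 1#
      𝕛̄^*𝕛^ zero    = *-identityˡ 1#
      𝕛̄^*𝕛^ (suc k) = trans (solve 4 (λ a b p r → a :* p :* (b :* r) := a :* b :* (p :* r)) refl (- 𝕛) 𝕛 _ _)
        (trans (*-cong 𝕛̄*𝕛 (𝕛̄^*𝕛^ k)) (*-identityˡ 1#))

      -- One factor (-i) i = 1 is removed at a time.
      ipow-⊖ : ∀ m l → ipow (m ℤ.⊖ l) ≈ (- 𝕛) ^ l * 𝕛 ^ m
      ipow-⊖ m       zero    = trans (ipow-pos m) (trans (pow-≈ 𝕛 m) (sym (*-identityˡ _)))
      ipow-⊖ zero    (suc l) = trans (ipow-neg l) (trans (pow-≈ (- 𝕛) (suc l)) (sym (*-identityʳ _)))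
      ipow-⊖ (suc m) (suc l) = trans (reflexive (≡.cong ipow (ℤₚ.[1+m]⊖[1+n]≡m⊖n m l))) (trans (ipow-⊖ m l)
        (sym (trans (solve 4 (λ a b p r → a :* p :* (b :* r) := a :* b :* (p :* r)) refl (- 𝕛) 𝕛 _ _) (trans (*-congʳ 𝕛̄*𝕛) (*-identityˡ _)))))

      S : Vec Sign (ℓ q) → Carrier
      S δ = sumᴸ (zipWith (λ s j → sign s * χ (+ j)) (Vec.toList δ) (Φ q))

      sign-≈ : ∀ s → sign s ≈ sgn s
      sign-≈ Sign.+ = sign-+
      sign-≈ Sign.- = sign--

      sgnProduct-≈ : ∀ {k} (δ : Vec Sign k) → prodᴸ (map sign (Vec.toList δ)) ≈ sgnProduct δ
      sgnProduct-≈ []      = refl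
      sgnProduct-≈ (s ∷ δ) = *-cong (sign-≈ s) (sgnProduct-≈ δ)

      argumentSum-≈ : ∀ js (δ : Vec Sign (length js)) →
        argumentSum x a js δ ≈ sumᴸ (zipWith (λ s j → sign s * χ (+ j)) (Vec.toList δ) js) * ι 1/[1+ n-1 ]
      argumentSum-≈ []       []      = sym (zeroˡ _)
      argumentSum-≈ (j ∷ js) (s ∷ δ) = trans (+-cong (trans (sym (*-assoc _ _ _)) (*-congʳ (*-congʳ (sym (sign-≈ s))))) (argumentSum-≈ js δ))
        (sym (distribʳ _ _ _))

      angleSum-≈ : ∀ js (δ : Vec Sign (length js)) →
        angleSum x a js δ ≡ foldr ℤ._+_ (+ 0) (zipWith ℤ._◃_ (Vec.toList δ) js) / q
      angleSum-≈ []       []      = ≡.sym /q-0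
      angleSum-≈ (j ∷ js) (s ∷ δ) = ≡.trans (≡.cong₂ _+ℚ_ (single s) (angleSum-≈ js δ)) (≡.sym (/q-+ (s ℤ.◃ j) _))
        where
        single : ∀ s → signed s (x j) ≡ (s ℤ.◃ j) / q
        single Sign.+ = ≡.sym (≡.trans (≡.cong (_/ q) (ℤₚ.+◃n≡+n j)) (/q-ν j))
        single Sign.- = ≡.sym (≡.trans (≡.cong (_/ q) (ℤₚ.-◃n≡-n j)) (≡.trans (/q-neg (+ j)) (≡.cong Q.-_ (/q-ν j))))

    value : ℕ → Carrier
    value n = ipow (+ n ℤ.- + ℓ q) * (real (recip e 0<e) * ι (invFact n)) * pow (real (π *ʳ fromℚ (+ 1 / q))) n *
      sumᴸ (map (λ δ → prodᴸ (map sign (Vec.toList δ)) * Exp (𝕛 * real (π *ʳ fromℚ (j[_] {q} δ / q))) *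
                       pow (sumᴸ (zipWith (λ s j → sign s * χ (+ j)) (Vec.toList δ) (Φ q))) n)
                (signVectors (ℓ q)))

    -- The factor (-i)^ℓ i^ℓ (W / e) = 1 is inserted. Here i^ℓ W is the product of the 2 i sin (π j
    -- / q), which clears the denominators in `limit-sines`; the remaining (-i)^ℓ combines with the
    -- iⁿ from the n-th power of `ϖ` to i^(n - ℓ).
    formula : ∀ n → limitProduct n ≈ value n
    formula n = begin
      limitProduct n
        ≈⟨ trans (sym (*-identityˡ _)) (*-congʳ (trans (sym (*-identityˡ 1#)) (sym (*-cong (𝕛̄^*𝕛^ (ℓ q)) W*e⁻¹)))) ⟩
      (- 𝕛) ^ ℓ q * 𝕛 ^ ℓ q * (W * e⁻¹) * limitProduct n
        ≈⟨ solve 5 (λ a b w i r → a :* b :* (w :* i) :* r := a :* i :* (b :* w :* r)) refl _ _ W e⁻¹ _ ⟩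
      (- 𝕛) ^ ℓ q * e⁻¹ * (𝕛 ^ ℓ q * W * limitProduct n)
        ≈⟨ *-congˡ (trans (*-congʳ (sym (trans (sines indices) (*-congʳ (reflexive (≡.cong (𝕛 ^_) length-indices))))))
             (trans (limit-sines X₀ 0<X X<½ A₀ indices n) over-naturals)) ⟩
      (- 𝕛) ^ ℓ q * e⁻¹ * ∑ᴸ (λ δ → term x a (Φ q) δ n) (signVectors (ℓ q))
        ≈⟨ *-congˡ (trans (Σ.⨁ᴸ-cong term-≈ (signVectors (ℓ q))) (sym (∑ᴸ-* K T (signVectors (ℓ q))))) ⟩
      (- 𝕛) ^ ℓ q * e⁻¹ * (ι (invFact n) * (𝕛 ^ n * r ^ n) * ∑ᴸ T (signVectors (ℓ q)))
        ≈⟨ solve 6 (λ a i f j r t → a :* i :* (f :* (j :* r) :* t) := a :* j :* (i :* f) :* r :* t) refl _ e⁻¹ _ _ _ _ ⟩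
      (- 𝕛) ^ ℓ q * 𝕛 ^ n * (e⁻¹ * ι (invFact n)) * r ^ n * ∑ᴸ T (signVectors (ℓ q))
        ≈⟨ *-cong (*-cong (*-congʳ (trans (sym (ipow-⊖ n (ℓ q))) (reflexive (≡.cong ipow (≡.sym (ℤₚ.m-n≡m⊖n n (ℓ q)))))))
             (sym (pow-≈ r n))) (sym (sumᴸ-map T (signVectors (ℓ q)))) ⟩
      _ ∎
      where
      r K : Carrier
      r = real (π *ʳ fromℚ (+ 1 / q))
      K = ι (invFact n) * (𝕛 ^ n * r ^ n)

      T : Vec Sign (ℓ q) → Carrier
      T δ = prodᴸ (map sign (Vec.toList δ)) * Exp (𝕛 * real (π *ʳ fromℚ (j[_] {q} δ / q))) * pow (S δ) n

      over-naturals : ΠS.⨁ᴸ (sineSeries X₀ A₀) indices n ≈ ∑ᴸ (λ δ → term x a (Φ q) δ n) (signVectors (ℓ q))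
      over-naturals = trans (sym (trans (reflexive (≡.cong (λ js → ΠS.⨁ᴸ (sineSeries x a) js n) (≡.sym indices-Φ))) (ΠS.⨁ᴸ-map (sineSeries x a) proj₁ indices n)))
        (sign-expansion x a (Φ q) n)

      r-≈ : ι 1/[1+ n-1 ] * ϖ ≈ 𝕛 * r
      r-≈ = trans (solve 3 (λ u i p → u :* (i :* p) := i :* (p :* u)) refl _ 𝕛 (real π))
        (*-congˡ (sym (trans (real-* π _) (*-congˡ (trans (real-ι _) (reflexive (≡.cong ι (≡.sym (1/[1+]-≡ n-1)))))))))

      term-≈ : ∀ δ → term x a (Φ q) δ n ≈ K * T δ
      term-≈ δ = begin
        sgnProduct δ * E (angleSum x a (Φ q) δ) * expSeries (argumentSum x a (Φ q) δ * ϖ) n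
          ≈⟨ *-cong (*-cong (sym (sgnProduct-≈ δ)) (reflexive (≡.cong E (angleSum-≈ (Φ q) δ)))) (expSeries-closed _ n) ⟩
        P′ * E′ * (ι (invFact n) * (argumentSum x a (Φ q) δ * ϖ) ^ n)
          ≈⟨ *-congˡ (*-congˡ (trans (^-congˡ n (trans (*-congʳ (argumentSum-≈ (Φ q) δ)) (trans (*-assoc _ _ _) (*-congˡ r-≈))))
               (trans (^-distrib-* (S δ) (𝕛 * r) n) (*-congˡ (^-distrib-* 𝕛 r n))))) ⟩
        P′ * E′ * (ι (invFact n) * (S δ ^ n * (𝕛 ^ n * r ^ n)))
          ≈⟨ solve 5 (λ p e f s k → p :* e :* (f :* (s :* k)) := f :* k :* (p :* e :* s)) refl P′ E′ _ _ _ ⟩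
        K * (P′ * E′ * S δ ^ n)
          ≈⟨ *-congˡ (*-congˡ (sym (pow-≈ (S δ) n))) ⟩
        K * T δ ∎
        where
        P′ = prodᴸ (map sign (Vec.toList δ))
        E′ = E (j[_] {q} δ / q)

    -- The opaque reciprocals `1/[1+ i ]` are exchanged for the fractions that occur in `L-partial`.
    elementary-value : ∀ n → (λ N → elementary (λ i → χ (+ suc i) * ι (+ 1 / suc i)) n (upTo N)) ⟶ value n
    elementary-value n = ⟶-cong {m = value n} (λ N → trans (elementary-≈ summand n (upTo N))
      (trans (ΠS.⨁ᴸ-cong (λ i → linear-cong (*-congˡ (reflexive (≡.cong ι (1/[1+]-≡ i))))) (upTo N) n)
        (sym (elementary-≈ _ n (upTo N))))) (formula n) (elementary-⟶ n)

open import Data.List.Base using (map)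
open import Data.Nat.Base as ℕ using (ℕ; zero; suc; NonZero)
open import Data.Nat.Divisibility as ℕ using ()
open import Data.Nat.Primality using (Prime; prime⇒nonZero)
open import Data.Product using (∃; _×_; _,_; proj₁; proj₂)
import Data.Rational.Base as ℚ
open import Data.Rational.Base using (ℚ; 0ℚ; 1ℚ; _/_)
import Defs
open import Defs hiding (0<*; 0≤*; 0<½*; half+half; *-inv; 0<inv; 0<1/; 1/-antimono; archimedean)
open import Relation.Binary.PropositionalEquality using (_≡_; refl; sym; trans; cong; subst)
open import Relation.Nullary using (¬_; Dec; yes; no; contradiction)
open import Relation.Nullary.Decidable using (from-no)

-- The square of ε(q).

module SquareRoot (p : ℕ) (1≤p : 1 ℕ.≤ p) where
  open Sqrt p using (root; approx)

  private
    module _ (n : ℕ) where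
      r N : ℕ
      r = root n
      N = suc n

      h : ℚ
      h = 1/[1+ n ]

      r²≤ : r ℕ.* r ℕ.≤ p ℕ.* (N ℕ.* N)
      r²≤ = ⌊√⌋²≤ (p ℕ.* (N ℕ.* N))

      <[1+r]² : p ℕ.* (N ℕ.* N) ℕ.< suc r ℕ.* suc r
      <[1+r]² = <[1+⌊√⌋]² (p ℕ.* (N ℕ.* N))

      -- A crude bound from r² ≤ p N² ≤ (p N)², used for the linear term in `p≤`.
      r≤pN : r ℕ.≤ p ℕ.* N
      r≤pN = ℕₚ.≤-pred (²-cancel-< r (suc (p ℕ.* N)) (ℕₚ.≤-<-trans (ℕₚ.≤-trans r²≤ pN²≤)
        (ℕₚ.*-mono-< (ℕₚ.n<1+n (p ℕ.* N)) (ℕₚ.n<1+n (p ℕ.* N)))))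
        where
        pN²≤ : p ℕ.* (N ℕ.* N) ℕ.≤ (p ℕ.* N) ℕ.* (p ℕ.* N)
        pN²≤ = ℕₚ.≤-trans (ℕₚ.*-monoˡ-≤ (N ℕ.* N) (ℕₚ.m≤m*n p p {{ℕ.>-nonZero 1≤p}}))
          (ℕₚ.≤-reflexive (ℕₚ.[m*n]*[o*p]≡[m*o]*[n*p] p p N N))

      a : ℚ
      a = ν r *ℚ h

      h*N : h *ℚ ν N ≡ 1ℚ
      h*N = 1/[1+n]*ν n

      0≤h² : 0ℚ ≤ℚ h *ℚ h
      0≤h² = 0≤* (0≤1/ n) (0≤1/ n)

      scaled : ν (p ℕ.* (N ℕ.* N)) *ℚ (h *ℚ h) ≡ ν p
      scaled = trans (cong (_*ℚ (h *ℚ h)) (trans (ν-* p (N ℕ.* N)) (cong (ν p *ℚ_) (ν-* N N))))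
        (trans (ℚS.solve 3 (λ p n h → p ℚS.:* (n ℚS.:* n) ℚS.:* (h ℚS.:* h) ℚS.:= p ℚS.:* (h ℚS.:* n ℚS.:* (h ℚS.:* n))) refl (ν p) (ν N) h)
          (trans (cong (λ t → ν p *ℚ (t *ℚ t)) h*N) (trans (cong (ν p *ℚ_) (Q.*-identityˡ 1ℚ)) (Q.*-identityʳ (ν p)))))

      a² : a *ℚ a ≤ℚ ν p
      a² = Q.≤-trans (Q.≤-reflexive (trans (ℚS.solve 2 (λ r h → r ℚS.:* h ℚS.:* (r ℚS.:* h) ℚS.:= r ℚS.:* r ℚS.:* (h ℚS.:* h)) refl (ν r) h) (cong (_*ℚ (h *ℚ h)) (sym (ν-* r r)))))
        (Q.≤-trans (*-monoʳ 0≤h² (ν-mono r²≤)) (Q.≤-reflexive scaled))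

      a≤p : a ≤ℚ ν p
      a≤p = Q.≤-trans (*-monoʳ (0≤1/ n) (ν-mono r≤pN)) (Q.≤-reflexive (trans (cong (_*ℚ h) (ν-* p N))
        (trans (ℚS.solve 3 (λ p n h → p ℚS.:* n ℚS.:* h ℚS.:= p ℚS.:* (h ℚS.:* n)) refl (ν p) (ν N) h) (trans (cong (ν p *ℚ_) h*N) (Q.*-identityʳ (ν p))))))

      -- p < ((r + 1) h)² = a² + (2 a + h) h with a ≤ p and h ≤ 1, so the error of a² is O(1 / N).
      p≤ : ν p ≤ℚ a *ℚ a +ℚ (2ℚ *ℚ ν p +ℚ 1ℚ) *ℚ h
      p≤ = Q.≤-trans (Q.≤-reflexive (sym scaled)) (Q.≤-trans (*-monoʳ 0≤h² (ν-mono (ℕₚ.<⇒≤ <[1+r]²)))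
        (Q.≤-trans (Q.≤-reflexive (trans (cong (_*ℚ (h *ℚ h)) (trans (ν-* (suc r) (suc r)) (cong (λ t → t *ℚ t) (ν-suc r))))
            (ℚS.solve 2 (λ r h → (ℚS.con (+ 1) ℚS.:+ r) ℚS.:* (ℚS.con (+ 1) ℚS.:+ r) ℚS.:* (h ℚS.:* h)
              ℚS.:= r ℚS.:* h ℚS.:* (r ℚS.:* h) ℚS.:+ (ℚS.con (+ 2) ℚS.:* (r ℚS.:* h) ℚS.:+ h) ℚS.:* h) refl (ν r) h)))
          (Q.+-monoʳ-≤ (a *ℚ a) (*-monoʳ (0≤1/ n) (Q.+-mono-≤ (*-monoˡ 0≤2 a≤p) (1/≤1 n))))))

  opaque
    unfolding Q._+_ Q._*_ Q.-_ Q.∣_∣ ν 1/[1+_]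

    √²≈ : √ p *ʳ √ p ≈ʳ fromℚ (ν p)
    √²≈ ε 0<ε =
      let (N , small) = 1/-small (2ℚ *ℚ ν p +ℚ 1ℚ) (0≤+ (0≤* 0≤2 (0≤ν p)) 0≤1) ε 0<ε
      in N , λ n N≤n → subst (λ t → ℚ.∣ t ℚ.* t ℚ.- ν p ∣ ℚ.≤ ε) (sym (approx≡ n)) (∣∣-lub
        (ℚₚ.≤-trans (below (a n *ℚ a n) (ν p) (a² n)) (ℚₚ.<⇒≤ 0<ε))
        (ℚₚ.≤-trans (above (a n *ℚ a n) (ν p) _ (p≤ n)) (small n N≤n)))
      where
      approx≡ : ∀ n → approx n ≡ a n
      approx≡ n = CommonDenominator./q-ν n (root n)
      below : ∀ s t → s ℚ.≤ t → s ℚ.- t ℚ.≤ 0ℚ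
      below s t s≤t = subst (s ℚ.- t ℚ.≤_) (ℚₚ.+-inverseʳ t) (ℚₚ.+-monoˡ-≤ (ℚ.- t) s≤t)
      above : ∀ s t d → t ℚ.≤ s ℚ.+ d → ℚ.- (s ℚ.- t) ℚ.≤ d
      above s t d t≤s+d = ℚₚ.≤-trans (ℚₚ.≤-reflexive (ℚ-Solver.solve 2 (λ s t → ℚ-Solver.:- (s ℚ-Solver.:- t) ℚ-Solver.:= t ℚ-Solver.:- s) refl s t))
        (ℚₚ.≤-trans (ℚₚ.+-monoˡ-≤ (ℚ.- s) t≤s+d) (ℚₚ.≤-reflexive (ℚ-Solver.solve 2 (λ s d → s ℚ-Solver.:+ d ℚ-Solver.:- s ℚ-Solver.:= d) refl s d)))

ϵ²-≈ : ∀ q → (∃ λ p → ∃ λ k → Prime p × 1 ℕ.≤ k × q ≡ p ℕ.^ k × ϵ q *ʳ ϵ q ≈ʳ fromℚ (ν p)) ⊎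
             (¬ IsPrimePower q × ϵ q *ʳ ϵ q ≈ʳ 1ʳ)
ϵ²-≈ q with primePower? q
... | yes (p , k , pr , 1≤k , eq) = inj₁ (p , k , pr , 1≤k , eq , SquareRoot.√²≈ p (ℕ.>-nonZero⁻¹ p {{prime⇒nonZero pr}}))
... | no ¬pp = inj₂ (¬pp , λ ε 0<ε → 0 , λ _ _ → ℚₚ.<⇒≤ 0<ε)

-- Small moduli, and the theorem.

1≉-1 : ¬ 1ᶜ ≈ᶜ -ᶜ 1ᶜ
1≉-1 (1≈-1 , _) = let (N , b) = 1≈-1 1ℚ (ℚₚ.positive⁻¹ 1ℚ) in
  contradiction (b N ℕₚ.≤-refl) (from-no (ℚ.∣ 1ℚ ℚ.- (ℚ.- 1ℚ) ∣ ℚₚ.≤? 1ℚ))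

-- 1 and -1 are congruent modulo every divisor of 2, so χ(-1) = χ(1) = 1. This excludes the moduli 1
-- and 2.
odd⇒χ[1]≈-1 : ∀ q (X : DirichletCharacter q) → q ℕ.∣ 2 → Odd X → 1ᶜ ≈ᶜ -ᶜ 1ᶜ
odd⇒χ[1]≈-1 q X q∣2 odd = ComplexAlgebra.≈-trans {1ᶜ} {χ (+ 1)} { -ᶜ 1ᶜ}
  (ComplexAlgebra.≈-sym {χ (+ 1)} {1ᶜ} χ[1]≈1)
  (ComplexAlgebra.≈-trans {χ (+ 1)} {χ (ℤ.- + 1)} { -ᶜ 1ᶜ} (periodic (+ 1) (ℤ.- + 1) q∣2) odd)
  where open DirichletCharacter X

module Conclusion (π : ℝ) (isPi : IsPi π) (m : ℕ) (X : DirichletCharacter (suc (suc (suc m)))) (odd : Odd X) where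
  open ComplexInstance using (complexes; ⟶⇒⟶ᶜ)

  private
    q : ℕ
    q = suc (suc (suc m))

  sineZero : SineZero complexes
  sineZero = record
    { π = π ; 0<π = IsPi.0<π isPi ; sin[π]≈0 = IsPi.sin[π]≈0 isPi ; 0<sin = IsPi.0<sin isPi }

  character : OddCharacter complexes q
  character = record
    { χ = χ ; periodic = periodic ; homo-* = homo-* ; χ≈0 = χ≈0 ; odd = odd }
    where open DirichletCharacter X

  open Formula complexes sineZero (suc (suc m)) (ℕ.s≤s (ℕ.s≤s ℕ.z≤n)) character

  L-value : ∀ n → L-partial X n ⟶ᶜ value (ϵ q) (0<ϵ q) (ϵ²-≈ q) n
  L-value n = ⟶⇒⟶ᶜ {L-partial X n} {value (ϵ q) (0<ϵ q) (ϵ²-≈ q) n} (elementary-value (ϵ q) (0<ϵ q) (ϵ²-≈ q) n)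

theorem4 :
    (π : ℝ) → IsPi π →
    (q : ℕ) .{{_ : NonZero q}} (X : DirichletCharacter q) →
    Primitive X → ¬ Principal X → Odd X →
    (2 ℕ.* ℓ q ≡ φ q) ×
    ((n : ℕ) → 1 ℕ.≤ n →
      L-partial X n ⟶ᶜ
        𝕚^ (+ n ℤ.- + ℓ q)
        *ᶜ (fromℝ (1/ϵ q) *ᶜ fromℚᶜ (invFact n))
        *ᶜ fromℝ (π *ʳ fromℚ (+ 1 / q)) ^ᶜ n
        *ᶜ sumᶜ (map (λ δ → P δ
                         *ᶜ exp (𝕚 *ᶜ fromℝ (π *ʳ fromℚ (j[_] {q} δ / q)))
                         *ᶜ signedSum X δ ^ᶜ n)
                     (signVectors (ℓ q))))
theorem4 π isPi zero X _ _ odd = contradiction refl (ℕ.≢-nonZero⁻¹ 0)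
theorem4 π isPi (suc zero) X _ _ odd = contradiction (odd⇒χ[1]≈-1 1 X (ℕ.1∣ 2) odd) 1≉-1
theorem4 π isPi (suc (suc zero)) X _ _ odd = contradiction (odd⇒χ[1]≈-1 2 X ℕ.∣-refl odd) 1≉-1
-- For q ≥ 3 the reflection j ↦ q - j fixes no residue coprime to q.
theorem4 π isPi (suc (suc (suc m))) X _ _ odd =
  2ℓ≡φ (suc (suc (suc m))) (ℕ.s≤s (ℕ.s≤s (ℕ.s≤s ℕ.z≤n))) , λ n _ → Conclusion.L-value π isPi m X odd n
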